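{- Suppose there is an algorithm which, given any integer linear recurrence sequence $\langle u_n\rangle_{n=0}^\infty$ of order $6$, decides whether $u_n\ge 0$ for all $n\ge 0$ (i.e. the Positivity Problem is decidable for integer LRS of order $6$). Then for every $t\in\mathcal{T}$, the type $L(t)$ is a computable real number.
   Context: An integer linear recurrence sequence (LRS) of order $k$ is a sequence $\langle u_n\rangle_{n=0}^\infty$ of integers for which there are integers $a_1,\ldots,a_k$ with $a_k\ne 0$ such that $u_{n+k}=a_1u_{n+k-1}+\cdots+a_ku_n$ for all $n\ge0$; it is given as input by the $2k$-tuple $(a_1,\ldots,a_k,u_0,\ldots,u_{k-1})$. For a real number $x$, the (homogeneous Diophantine approximation) type is $L(x)=\inf\{c\in\mathbb{R}: |x-\frac{n}{m}|<\frac{c}{m^2} \text{ for some } n,m\in\mathbb{Z},\ m\neq 0\}$. Let $\mathcal{A}=\{p+qi\in\mathbb{C}: p,q\in\mathbb{Q},\ p^2+q^2=1,\ p\neq 0,\ q\neq 0\}$, and let $\mathcal{T}=\{\frac{\arg\alpha}{2\pi}:\alpha\in\mathcal{A}\}$, where $\arg$ denotes the principal argument with values in $(-\pi,\pi]$. A real number $x$ is computable if there is an algorithm which, given any rational $\varepsilon>0$, returns a rational $q$ with $|q-x|<\varepsilon$. -}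

module Defs where

open import Algebra.Properties.Monoid.Sum using (sum)
open import Data.Bool.Base using (Bool; true; false; if_then_else_)
open import Data.Fin.Base using (Fin; toℕ; opposite)
open import Data.Integer.Base as ℤ using (ℤ; +_; -[1+_]; 0ℤ; 1ℤ; -1ℤ)
import Data.Integer.Properties as ℤ
open import Data.Nat.Base as ℕ using (ℕ; zero; suc; _!)
import Data.Nat.Properties as ℕ
open import Data.Product.Base using (Σ; ∃; _×_; _,_)
open import Data.Rational.Unnormalised.Base as ℚ using (ℚᵘ; mkℚᵘ; 0ℚᵘ; 1ℚᵘ; ½)
import Data.Rational.Unnormalised.Properties as ℚ
open import Data.Rational.Unnormalised.Solver using (module +-*-Solver)
open import Data.Sum.Base using (inj₁; inj₂)
open import Data.Vec.Base using (Vec; []; _∷_; _++_; lookup; tabulate)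
open import Relation.Binary.PropositionalEquality using (_≡_; _≢_; refl; sym; cong; subst)
open import Relation.Nullary using (¬_; Reflects)

-- An algorithm is a program for a partial recursive function.  Agda's
-- own function space is deliberately not used for this purpose, since
-- an Agda function given as a hypothesis need not be computable.

data Rec : ℕ → Set where
  zer  : ∀ {n} → Rec n
  succ : Rec 1
  proj : ∀ {n} → Fin n → Rec n
  comp : ∀ {m n} → Rec m → Vec (Rec n) m → Rec n
  prec : ∀ {n} → Rec n → Rec (2 ℕ.+ n) → Rec (1 ℕ.+ n)
  mini : ∀ {n} → Rec (1 ℕ.+ n) → Rec n

infix 4 _[_]⇓_ _[_]⇓*_

-- f [ xs ]⇓ y : the program f halts on the input xs with output y.

mutual
  data _[_]⇓_ : ∀ {n} → Rec n → Vec ℕ n → ℕ → Set where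
    ⇓zer  : ∀ {n} {xs : Vec ℕ n} → zer [ xs ]⇓ 0
    ⇓succ : ∀ {x} → succ [ x ∷ [] ]⇓ suc x
    ⇓proj : ∀ {n} {xs : Vec ℕ n} (i : Fin n) → proj i [ xs ]⇓ lookup xs i
    ⇓comp : ∀ {m n} {f : Rec m} {gs : Vec (Rec n) m} {xs ys z} →
            gs [ xs ]⇓* ys → f [ ys ]⇓ z → comp f gs [ xs ]⇓ z
    ⇓prec-zero : ∀ {n} {f : Rec n} {g : Rec (2 ℕ.+ n)} {xs y} →
                 f [ xs ]⇓ y → prec f g [ 0 ∷ xs ]⇓ y
    ⇓prec-suc  : ∀ {n} {f : Rec n} {g : Rec (2 ℕ.+ n)} {k xs y z} →
                 prec f g [ k ∷ xs ]⇓ y → g [ k ∷ y ∷ xs ]⇓ z →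
                 prec f g [ suc k ∷ xs ]⇓ z
    ⇓mini : ∀ {n} {f : Rec (1 ℕ.+ n)} {xs y} →
            (∀ x → x ℕ.< y → ∃ λ v → f [ x ∷ xs ]⇓ suc v) →
            f [ y ∷ xs ]⇓ 0 → mini f [ xs ]⇓ y

  data _[_]⇓*_ {n} : ∀ {m} → Vec (Rec n) m → Vec ℕ n → Vec ℕ m → Set where
    []  : ∀ {xs} → [] [ xs ]⇓* []
    _∷_ : ∀ {m f xs y} {fs : Vec (Rec n) m} {ys} →
          f [ xs ]⇓ y → fs [ xs ]⇓* ys → f ∷ fs [ xs ]⇓* y ∷ ys

encodeℤ : ℤ → ℕ
encodeℤ (+ n)    = 2 ℕ.* n
encodeℤ -[1+ n ] = suc (2 ℕ.* n)

encodeℚ : ℚᵘ → Vec ℕ 2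
encodeℚ q = encodeℤ (ℚ.↥ q) ∷ ℚᵘ.denominator-1 q ∷ []

encodeBool : Bool → ℕ
encodeBool b = if b then 1 else 0

-- The coefficient a_{i+1} is  coeff i  for i = 0, …, k-1, and it
-- multiplies u_{n+k-1-i}; here  toℕ (opposite i) = k-1-i.

record LRS (k : ℕ) : Set where
  field
    coeff      : Fin k → ℤ
    term       : ℕ → ℤ
    last≢0     : ∀ i → suc (toℕ i) ≡ k → coeff i ≢ 0ℤ
    recurrence : ∀ n → term (n ℕ.+ k) ≡
                   sum ℤ.+-0-monoid (λ i → coeff i ℤ.* term (n ℕ.+ toℕ (opposite i)))

open LRS

encodeLRS : ∀ {k} → LRS k → Vec ℕ (k ℕ.+ k)
encodeLRS u = tabulate (λ i → encodeℤ (coeff u i)) ++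
              tabulate (λ i → encodeℤ (term u (toℕ i)))

Positive : ∀ {k} → LRS k → Set
Positive u = ∀ n → 0ℤ ℤ.≤ term u n

PositivityDecidable : ℕ → Set
PositivityDecidable k =
  Σ (Rec (k ℕ.+ k)) λ f → ∀ (u : LRS k) →
    Σ Bool λ b → f [ encodeLRS u ]⇓ encodeBool b × Reflects (Positive u) b

IsCauchy : (ℕ → ℚᵘ) → Set
IsCauchy s = ∀ ε → 0ℚᵘ ℚ.< ε →
  ∃ λ N → ∀ m n → N ℕ.≤ m → N ℕ.≤ n → ℚ.∣ s m ℚ.- s n ∣ ℚ.< ε

-- Equality of reals is _≈_ below; since the modulus of convergence is
-- an Agda function and not a program, a real need not be Computable.

record ℝ : Set where
  constructor mkℝ
  field
    seq    : ℕ → ℚᵘ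
    cauchy : IsCauchy seq

open ℝ

private
  open ℚ.≤-Reasoning
  open +-*-Solver

  half-pos : ∀ ε → 0ℚᵘ ℚ.< ε → 0ℚᵘ ℚ.< ½ ℚ.* ε
  half-pos ε 0<ε = ℚ.positive⁻¹ (½ ℚ.* ε) {{ℚ.pos*pos⇒pos ½ ε {{ℚ.positive 0<ε}}}}

  half+half : ∀ ε → ½ ℚ.* ε ℚ.+ ½ ℚ.* ε ℚ.≃ ε
  half+half ε = begin-equality
    ½ ℚ.* ε ℚ.+ ½ ℚ.* ε   ≃⟨ ℚ.*-distribʳ-+ ε ½ ½ ⟨
    (½ ℚ.+ ½) ℚ.* ε       ≃⟨ ℚ.*-congʳ {ε} {½ ℚ.+ ½} {1ℚᵘ} (ℚ.*≡* refl) ⟩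
    1ℚᵘ ℚ.* ε             ≃⟨ ℚ.*-identityˡ ε ⟩
    ε                     ∎

  ∣a∣≤∣a-b∣+∣b∣ : ∀ a b → ℚ.∣ a ∣ ℚ.≤ ℚ.∣ a ℚ.- b ∣ ℚ.+ ℚ.∣ b ∣
  ∣a∣≤∣a-b∣+∣b∣ a b = begin
    ℚ.∣ a ∣                       ≃⟨ ℚ.∣-∣-cong (solve 2 (λ x y → x := (x :- y) :+ y) ℚ.≃-refl a b) ⟩
    ℚ.∣ (a ℚ.- b) ℚ.+ b ∣         ≤⟨ ℚ.∣p+q∣≤∣p∣+∣q∣ (a ℚ.- b) b ⟩
    ℚ.∣ a ℚ.- b ∣ ℚ.+ ℚ.∣ b ∣     ∎

  ∣a-b∣≃∣b-a∣ : ∀ a b → ℚ.∣ a ℚ.- b ∣ ℚ.≃ ℚ.∣ b ℚ.- a ∣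
  ∣a-b∣≃∣b-a∣ a b = begin-equality
    ℚ.∣ a ℚ.- b ∣          ≃⟨ ℚ.∣-p∣≃∣p∣ (a ℚ.- b) ⟨
    ℚ.∣ ℚ.- (a ℚ.- b) ∣    ≃⟨ ℚ.∣-∣-cong (solve 2 (λ x y → :- (x :- y) := y :- x) ℚ.≃-refl a b) ⟩
    ℚ.∣ b ℚ.- a ∣          ∎

  ∣a∣-∣b∣≤∣a-b∣ : ∀ a b → ℚ.∣ a ∣ ℚ.- ℚ.∣ b ∣ ℚ.≤ ℚ.∣ a ℚ.- b ∣
  ∣a∣-∣b∣≤∣a-b∣ a b = begin
    ℚ.∣ a ∣ ℚ.- ℚ.∣ b ∣
      ≤⟨ ℚ.+-monoˡ-≤ (ℚ.- ℚ.∣ b ∣) (∣a∣≤∣a-b∣+∣b∣ a b) ⟩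
    (ℚ.∣ a ℚ.- b ∣ ℚ.+ ℚ.∣ b ∣) ℚ.- ℚ.∣ b ∣
      ≃⟨ solve 2 (λ x y → (x :+ y) :- y := x) ℚ.≃-refl ℚ.∣ a ℚ.- b ∣ ℚ.∣ b ∣ ⟩
    ℚ.∣ a ℚ.- b ∣ ∎

  ∣∣a∣-∣b∣∣≤∣a-b∣ : ∀ a b → ℚ.∣ ℚ.∣ a ∣ ℚ.- ℚ.∣ b ∣ ∣ ℚ.≤ ℚ.∣ a ℚ.- b ∣
  ∣∣a∣-∣b∣∣≤∣a-b∣ a b with ℚ.∣p∣≡p∨∣p∣≡-p (ℚ.∣ a ∣ ℚ.- ℚ.∣ b ∣)
  ... | inj₁ eq = subst (ℚ._≤ ℚ.∣ a ℚ.- b ∣) (sym eq) (∣a∣-∣b∣≤∣a-b∣ a b)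
  ... | inj₂ eq = subst (ℚ._≤ ℚ.∣ a ℚ.- b ∣) (sym eq) (begin
    ℚ.- (ℚ.∣ a ∣ ℚ.- ℚ.∣ b ∣)
      ≃⟨ solve 2 (λ x y → :- (x :- y) := y :- x) ℚ.≃-refl ℚ.∣ a ∣ ℚ.∣ b ∣ ⟩
    ℚ.∣ b ∣ ℚ.- ℚ.∣ a ∣    ≤⟨ ∣a∣-∣b∣≤∣a-b∣ b a ⟩
    ℚ.∣ b ℚ.- a ∣          ≃⟨ ∣a-b∣≃∣b-a∣ b a ⟩
    ℚ.∣ a ℚ.- b ∣          ∎)

  eventually-bounded : ∀ {s} → IsCauchy s →
    Σ ℚᵘ λ B → ℚ.Positive B × ∃ λ N → ∀ n → N ℕ.≤ n → ℚ.∣ s n ∣ ℚ.≤ B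
  eventually-bounded {s} c with c 1ℚᵘ (ℚ.positive⁻¹ 1ℚᵘ)
  ... | N , h = 1ℚᵘ ℚ.+ ℚ.∣ s N ∣
              , ℚ.positive (ℚ.<-≤-trans (ℚ.positive⁻¹ 1ℚᵘ)
                  (ℚ.p≤p+q 1ℚᵘ ℚ.∣ s N ∣ {{ℚ.∣-∣-nonNeg (s N)}}))
              , N , λ n N≤n → begin
    ℚ.∣ s n ∣                            ≤⟨ ∣a∣≤∣a-b∣+∣b∣ (s n) (s N) ⟩
    ℚ.∣ s n ℚ.- s N ∣ ℚ.+ ℚ.∣ s N ∣      ≤⟨ ℚ.+-monoˡ-≤ ℚ.∣ s N ∣ (ℚ.<⇒≤ (h n N N≤n ℕ.≤-refl)) ⟩
    1ℚᵘ ℚ.+ ℚ.∣ s N ∣                    ∎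

  cauchy-* : ∀ s t → IsCauchy s → IsCauchy t → IsCauchy (λ n → s n ℚ.* t n)
  cauchy-* s t cs ct ε 0<ε
    with eventually-bounded cs | eventually-bounded ct
  ... | A , A>0 , N₁ , hA | B , B>0 , N₂ , hB
    with cs (δ B B>0) (δ-pos B B>0) | ct (δ A A>0) (δ-pos A A>0)
    where
    δ : ∀ C → ℚ.Positive C → ℚᵘ
    δ C C>0 = (½ ℚ.* ε) ℚ.* (ℚ.1/ C) {{ℚ.pos⇒nonZero C {{C>0}}}}
    δ-pos : ∀ C (C>0 : ℚ.Positive C) → 0ℚᵘ ℚ.< δ C C>0
    δ-pos C C>0 = ℚ.positive⁻¹ (δ C C>0)
      {{ℚ.pos*pos⇒pos (½ ℚ.* ε) {{ℚ.positive (half-pos ε 0<ε)}}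
                      ((ℚ.1/ C) {{ℚ.pos⇒nonZero C {{C>0}}}}) {{ℚ.1/pos⇒pos C {{C>0}}}}}}
  ... | N₃ , hs | N₄ , ht = (N₁ ℕ.⊔ N₂) ℕ.⊔ (N₃ ℕ.⊔ N₄) , λ m n N≤m N≤n →
    let N₁≤m = ℕ.≤-trans (ℕ.≤-trans (ℕ.m≤m⊔n N₁ N₂) (ℕ.m≤m⊔n (N₁ ℕ.⊔ N₂) (N₃ ℕ.⊔ N₄))) N≤m
        N₂≤n = ℕ.≤-trans (ℕ.≤-trans (ℕ.m≤n⊔m N₁ N₂) (ℕ.m≤m⊔n (N₁ ℕ.⊔ N₂) (N₃ ℕ.⊔ N₄))) N≤n
        N₃≤  = ℕ.≤-trans (ℕ.m≤m⊔n N₃ N₄) (ℕ.m≤n⊔m (N₁ ℕ.⊔ N₂) (N₃ ℕ.⊔ N₄))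
        N₄≤  = ℕ.≤-trans (ℕ.m≤n⊔m N₃ N₄) (ℕ.m≤n⊔m (N₁ ℕ.⊔ N₂) (N₃ ℕ.⊔ N₄))
    in begin-strict
    ℚ.∣ s m ℚ.* t m ℚ.- s n ℚ.* t n ∣
      ≃⟨ ℚ.∣-∣-cong (solve 4 (λ a b c d →
           a :* b :- c :* d := a :* (b :- d) :+ d :* (a :- c)) ℚ.≃-refl (s m) (t m) (s n) (t n)) ⟩
    ℚ.∣ s m ℚ.* (t m ℚ.- t n) ℚ.+ t n ℚ.* (s m ℚ.- s n) ∣
      ≤⟨ ℚ.∣p+q∣≤∣p∣+∣q∣ (s m ℚ.* (t m ℚ.- t n)) (t n ℚ.* (s m ℚ.- s n)) ⟩
    ℚ.∣ s m ℚ.* (t m ℚ.- t n) ∣ ℚ.+ ℚ.∣ t n ℚ.* (s m ℚ.- s n) ∣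
      <⟨ ℚ.+-mono-< (small A A>0 (s m) (t m ℚ.- t n) (hA m N₁≤m)
                       (ht m n (ℕ.≤-trans N₄≤ N≤m) (ℕ.≤-trans N₄≤ N≤n)))
                     (small B B>0 (t n) (s m ℚ.- s n) (hB n N₂≤n)
                       (hs m n (ℕ.≤-trans N₃≤ N≤m) (ℕ.≤-trans N₃≤ N≤n))) ⟩
    ½ ℚ.* ε ℚ.+ ½ ℚ.* ε
      ≃⟨ half+half ε ⟩
    ε ∎
    where
    small : ∀ C (C>0 : ℚ.Positive C) x y → ℚ.∣ x ∣ ℚ.≤ C →
            ℚ.∣ y ∣ ℚ.< (½ ℚ.* ε) ℚ.* (ℚ.1/ C) {{ℚ.pos⇒nonZero C {{C>0}}}} →
            ℚ.∣ x ℚ.* y ∣ ℚ.< ½ ℚ.* ε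
    small C C>0 x y x≤C y<δ = let instance _ = C>0; _ = ℚ.pos⇒nonZero C in begin-strict
      ℚ.∣ x ℚ.* y ∣                      ≃⟨ ℚ.∣p*q∣≃∣p∣*∣q∣ x y ⟩
      ℚ.∣ x ∣ ℚ.* ℚ.∣ y ∣                ≤⟨ ℚ.*-monoˡ-≤-nonNeg ℚ.∣ y ∣ {{ℚ.∣-∣-nonNeg y}} x≤C ⟩
      C ℚ.* ℚ.∣ y ∣                      <⟨ ℚ.*-monoʳ-<-pos C y<δ ⟩
      C ℚ.* ((½ ℚ.* ε) ℚ.* ℚ.1/ C)       ≃⟨ solve 3 (λ c e i → c :* (e :* i) := e :* (c :* i)) ℚ.≃-refl C (½ ℚ.* ε) (ℚ.1/ C) ⟩
      (½ ℚ.* ε) ℚ.* (C ℚ.* ℚ.1/ C)       ≃⟨ ℚ.*-congˡ {½ ℚ.* ε} (ℚ.*-inverseʳ C) ⟩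
      (½ ℚ.* ε) ℚ.* 1ℚᵘ                  ≃⟨ ℚ.*-identityʳ (½ ℚ.* ε) ⟩
      ½ ℚ.* ε                            ∎

infixl 6 _+_ _-_
infixl 7 _*_
infix  8 -_
infixr 8 _^_
infix  4 _<_ _≤_ _≈_

fromℚ : ℚᵘ → ℝ
fromℚ q = mkℝ (λ _ → q) λ ε 0<ε → 0 , λ _ _ _ _ → begin-strict
  ℚ.∣ q ℚ.- q ∣   ≃⟨ ℚ.∣-∣-cong (ℚ.+-inverseʳ q) ⟩
  0ℚᵘ             <⟨ 0<ε ⟩
  ε               ∎

_+_ : ℝ → ℝ → ℝ
x + y = mkℝ (λ n → seq x n ℚ.+ seq y n) λ ε 0<ε →
  let (N₁ , h₁) = cauchy x (½ ℚ.* ε) (half-pos ε 0<ε)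
      (N₂ , h₂) = cauchy y (½ ℚ.* ε) (half-pos ε 0<ε)
      N₁≤ = ℕ.m≤m⊔n N₁ N₂
      N₂≤ = ℕ.m≤n⊔m N₁ N₂
  in N₁ ℕ.⊔ N₂ , λ m n N≤m N≤n → begin-strict
  ℚ.∣ (seq x m ℚ.+ seq y m) ℚ.- (seq x n ℚ.+ seq y n) ∣
    ≃⟨ ℚ.∣-∣-cong (solve 4 (λ a b c d → (a :+ b) :- (c :+ d) := (a :- c) :+ (b :- d))
                   ℚ.≃-refl (seq x m) (seq y m) (seq x n) (seq y n)) ⟩
  ℚ.∣ (seq x m ℚ.- seq x n) ℚ.+ (seq y m ℚ.- seq y n) ∣
    ≤⟨ ℚ.∣p+q∣≤∣p∣+∣q∣ (seq x m ℚ.- seq x n) (seq y m ℚ.- seq y n) ⟩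
  ℚ.∣ seq x m ℚ.- seq x n ∣ ℚ.+ ℚ.∣ seq y m ℚ.- seq y n ∣
    <⟨ ℚ.+-mono-< (h₁ m n (ℕ.≤-trans N₁≤ N≤m) (ℕ.≤-trans N₁≤ N≤n))
                   (h₂ m n (ℕ.≤-trans N₂≤ N≤m) (ℕ.≤-trans N₂≤ N≤n)) ⟩
  ½ ℚ.* ε ℚ.+ ½ ℚ.* ε
    ≃⟨ half+half ε ⟩
  ε ∎

-_ : ℝ → ℝ
- x = mkℝ (λ n → ℚ.- seq x n) λ ε 0<ε →
  let (N , h) = cauchy x ε 0<ε
  in N , λ m n N≤m N≤n → begin-strict
  ℚ.∣ ℚ.- seq x m ℚ.- ℚ.- seq x n ∣
    ≃⟨ ℚ.∣-∣-cong (solve 2 (λ a b → :- a :- :- b := b :- a) ℚ.≃-refl (seq x m) (seq x n)) ⟩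
  ℚ.∣ seq x n ℚ.- seq x m ∣   <⟨ h n m N≤n N≤m ⟩
  ε                           ∎

_-_ : ℝ → ℝ → ℝ
x - y = x + - y

_*_ : ℝ → ℝ → ℝ
x * y = mkℝ (λ n → seq x n ℚ.* seq y n) (cauchy-* (seq x) (seq y) (cauchy x) (cauchy y))

_^_ : ℝ → ℕ → ℝ
x ^ zero  = fromℚ 1ℚᵘ
x ^ suc n = x * x ^ n

∣_∣ : ℝ → ℝ
∣ x ∣ = mkℝ (λ n → ℚ.∣ seq x n ∣) λ ε 0<ε →
  let (N , h) = cauchy x ε 0<ε
  in N , λ m n N≤m N≤n →
    ℚ.≤-<-trans (∣∣a∣-∣b∣∣≤∣a-b∣ (seq x m) (seq x n)) (h m n N≤m N≤n)

_<_ : ℝ → ℝ → Set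
x < y = Σ ℚᵘ λ ε → 0ℚᵘ ℚ.< ε ×
        ∃ λ N → ∀ n → N ℕ.≤ n → seq x n ℚ.+ ε ℚ.≤ seq y n

_≤_ : ℝ → ℝ → Set
x ≤ y = ¬ (y < x)

_≈_ : ℝ → ℝ → Set
x ≈ y = x ≤ y × y ≤ x

IsInfimum : (ℝ → Set) → ℝ → Set
IsInfimum S l = (∀ c → S c → l ≤ c) × (∀ b → (∀ c → S c → b ≤ c) → b ≤ l)

partialSum : (ℕ → ℝ) → ℕ → ℝ
partialSum f zero    = fromℚ 0ℚᵘ
partialSum f (suc n) = partialSum f n + f n

HasSum : (ℕ → ℝ) → ℝ → Set
HasSum f s = ∀ ε → 0ℚᵘ ℚ.< ε →
  ∃ λ N → ∀ n → N ℕ.≤ n → ∣ partialSum f n - s ∣ < fromℚ ε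

altInvFact : ℕ → ℕ → ℚᵘ
altInvFact k j = ((-1ℤ ℤ.^ k) ℚ./ (j !)) {{j ℕ.!≢0}}

-- IsCos x y and IsSin x y say cos x = y and sin x = y, the functions
-- being given by their power series at 0.

IsCos : ℝ → ℝ → Set
IsCos x = HasSum (λ k → fromℚ (altInvFact k (2 ℕ.* k)) * x ^ (2 ℕ.* k))

IsSin : ℝ → ℝ → Set
IsSin x = HasSum (λ k → fromℚ (altInvFact k (suc (2 ℕ.* k))) * x ^ suc (2 ℕ.* k))

IsPi : ℝ → Set
IsPi π = fromℚ 0ℚᵘ < π × IsSin π (fromℚ 0ℚᵘ) ×
         (∀ x → fromℚ 0ℚᵘ < x → x < π → ¬ IsSin x (fromℚ 0ℚᵘ))

-- θ is the principal argument of the complex number p + qi, which is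
-- assumed to have modulus 1.

IsArg : ℚᵘ → ℚᵘ → (π θ : ℝ) → Set
IsArg p q π θ = (- π < θ) × (θ ≤ π) × IsCos θ (fromℚ p) × IsSin θ (fromℚ q)

𝒜 : ℚᵘ → ℚᵘ → Set
𝒜 p q = (p ℚ.* p ℚ.+ q ℚ.* q ℚ.≃ 1ℚᵘ) × ¬ (p ℚ.≃ 0ℚᵘ) × ¬ (q ℚ.≃ 0ℚᵘ)

-- The equation t = θ / 2π is stated as 2π t = θ.

𝒯 : ℝ → Set
𝒯 t = Σ ℚᵘ λ p → Σ ℚᵘ λ q → 𝒜 p q ×
      Σ ℝ λ π → IsPi π × Σ ℝ λ θ → IsArg p q π θ ×
      (fromℚ (+ 2 ℚ./ 1) * π * t ≈ θ)

infixl 7 _÷_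

_÷_ : (n m : ℤ) .{{_ : ℤ.NonZero m}} → ℚᵘ
n ÷ m = (n ℚ./ 1) ℚ.÷ (m ℚ./ 1)

-- IsType x l says L(x) = l; a relation, because the infimum of a set of
-- reals is not a total operation constructively.

IsType : ℝ → ℝ → Set
IsType x = IsInfimum λ c →
  Σ ℤ λ n → Σ ℤ λ m → Σ (ℤ.NonZero m) λ m≢0 →
    let instance _ = m≢0; _ = ℤ.i*j≢0 m m
    in ∣ x - fromℚ (n ÷ m) ∣ < c * fromℚ (1ℤ ÷ (m ℤ.* m))

-- The two programs compute the numerator and the denominator of the
-- approximation.

Computable : ℝ → Set
Computable x =
  Σ (Vec (Rec 2) 2) λ fs → ∀ ε → 0ℚᵘ ℚ.< ε →
    Σ ℚᵘ λ q → fs [ encodeℚ ε ]⇓* encodeℚ q × ∣ fromℚ q - x ∣ < fromℚ ε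

{-# OPTIONS --safe #-}
-- Let w = e^{2πit} = p + qi; replacing t by -t we may assume q > 0.  The type of t is the infimum
-- of m |m t - i| over m ≥ 1 and all integers i.  As (1 - cos x) / |sin x| ~ |x| / 2 near 0, the
-- inequality r |Im wᵐ| ≤ m (1 - Re wᵐ) says for large m, up to an explicit error, that
-- r / π ≤ m |m t - i| for all i; here Im wᵐ ≠ 0 since w is not a root of unity.  Multiplied by the
-- m-th power of a common denominator d of p and q, it splits into m (1 - Re wᵐ) ± r Im wᵐ ≥ 0, the
-- positivity of two integer recurrences of order 6 with double roots d, d w and d w̄, so the oracle
-- decides it for all m ≥ O(K) at once.  The remaining finitely many m are tested on a rational
-- approximation of t.  A multiple r of 1/K that passes both tests while r + 1/K fails determines
-- L(t) up to O(1/K).  The numbers t and 1/π are approximated by counting how often the multiples of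
-- the arguments of w and of (K + i)² pass a full turn, which depends only on signs of integers.

module Submission where

-- The obstacle is that π, t and the argument are Cauchy sequences whose moduli are not programs, so
-- the algorithm may read only the integers behind p and q; the given reals enter the correctness
-- proof alone. There the n-th rational approximation of an angle is put into the n-th Taylor
-- polynomial of e^{iy}, and every statement about reals becomes one about all sufficiently late
-- indices, where comparisons are decidable. The tests are inexact: success at r only yields that
-- r/π - O(1/K) is a lower bound for the quantities m |m t - i|, failure only that r/π + O(1/K) is
-- not one. This suffices, because a lower bound for one K and a non-bound for another compare the
-- two outputs; hence the outputs form a Cauchy sequence, and the infimum exists constructively as
-- its limit. That w is not a root of unity supplies the strictly positive amount |Im wᵐ| / K, which
-- absorbs the errors of the approximations when a bound is derived from a successful test. The
-- search for r may stop at 2, since after the reflection 0 ≤ t ≤ 1/2, so that the fraction 0/1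
-- bounds the type by 1/2 < 2/π.

-- Rational arithmetic, certificates for inequalities, eventual statements

module Basics where

  open import Data.Integer.Base as ℤ using (ℤ; +_)
  import Data.Integer.Properties as ℤ
  open import Data.List.Base using ([]; _∷_)
  open import Data.Nat.Base as ℕ using (ℕ; zero; suc)
  import Data.Nat.Properties as ℕ
  open import Data.Product.Base using (Σ; ∃; _×_; _,_)
  open import Data.Rational.Base as ℚ using (ℚ; 0ℚ; 1ℚ; _+_; _*_; _-_; -_; _/_; _≤_; _<_; ∣_∣; toℚᵘ; fromℚᵘ)
  import Data.Rational.Properties as ℚ
  open import Data.Rational.Unnormalised.Base as ℚᵘ using (ℚᵘ; mkℚᵘ)
  import Data.Rational.Unnormalised.Properties as ℚᵘ
  open import Data.Sum.Base using (_⊎_; inj₁; inj₂; [_,_]′)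
  open import Data.Empty using (⊥-elim)
  open import Relation.Binary.PropositionalEquality using (_≡_; refl; sym; trans; cong; cong₂; subst; subst₂)
  open import Relation.Nullary using (yes; no)
  open import Relation.Nullary.Decidable.Core using (dec⇒maybe; True; toWitness)
  open import Tactic.RingSolver using (solve; solve-∀)
  open import Tactic.RingSolver.Core.AlmostCommutativeRing using (AlmostCommutativeRing; fromCommutativeRing)

  ring : AlmostCommutativeRing _ _
  ring = fromCommutativeRing ℚ.+-*-commutativeRing (λ x → dec⇒maybe (0ℚ ℚ.≟ x))

  infixl 7 _//_
  _//_ : ℕ → ℕ → ℚ
  n // zero  = 0ℚ
  n // suc d = + n / suc d

  # : ∀ c {_ : True (0ℚ ℚ.≤? c)} → 0ℚ ≤ c
  # c {h} = toWitness h

  #≤ : ∀ a b {_ : True (a ℚ.≤? b)} → a ≤ b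
  #≤ a b {h} = toWitness h

  #< : ∀ c {_ : True (0ℚ ℚ.<? c)} → 0ℚ < c
  #< c {h} = toWitness h

  δ : ∀ {a b} → a ≤ b → 0ℚ ≤ b - a
  δ {a} {b} p = subst (_≤ b - a) (ℚ.+-inverseʳ a) (ℚ.+-monoˡ-≤ (- a) p)

  δ< : ∀ {a b} → a < b → 0ℚ < b - a
  δ< {a} {b} p = subst (_< b - a) (ℚ.+-inverseʳ a) (ℚ.+-monoˡ-< (- a) p)

  -- The shape of nearly every inequality proof below: `d` is a certificate, a sum of products of
  -- slacks of the hypotheses, nonnegative by its form (through `δ`, `⊞`, `⊠`), and the ring solver
  -- checks that it equals `b - a`. The numerals in such certificates are what remains after
  -- eliminating the hypotheses.
  by≤ : ∀ {a b d} → 0ℚ ≤ d → b - a ≡ d → a ≤ b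
  by≤ {a} {b} p refl = subst₂ _≤_ (ℚ.+-identityˡ a) (b-a+a a b) (ℚ.+-monoˡ-≤ a p)
    where
    b-a+a : ∀ a b → b - a + a ≡ b
    b-a+a = solve-∀ ring

  by< : ∀ {a b d} → 0ℚ < d → b - a ≡ d → a < b
  by< {a} {b} p refl = subst₂ _<_ (ℚ.+-identityˡ a) (b-a+a a b) (ℚ.+-monoˡ-< a p)
    where
    b-a+a : ∀ a b → b - a + a ≡ b
    b-a+a = solve-∀ ring

  infixr 6 _⊞_ _<⊞_ _⊞<_
  infixr 7 _⊠_ _<⊠_

  _⊞_ : ∀ {a b} → 0ℚ ≤ a → 0ℚ ≤ b → 0ℚ ≤ a + b
  _⊞_ = ℚ.+-mono-≤

  _<⊞_ : ∀ {a b} → 0ℚ < a → 0ℚ ≤ b → 0ℚ < a + b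
  _<⊞_ = ℚ.+-mono-<-≤

  _⊞<_ : ∀ {a b} → 0ℚ ≤ a → 0ℚ < b → 0ℚ < a + b
  _⊞<_ = ℚ.+-mono-≤-<

  _⊠_ : ∀ {a b} → 0ℚ ≤ a → 0ℚ ≤ b → 0ℚ ≤ a * b
  _⊠_ {a} {b} p q = subst (_≤ a * b) (ℚ.*-zeroʳ a) (ℚ.*-monoˡ-≤-nonNeg a {{ℚ.nonNegative p}} q)

  _<⊠_ : ∀ {a b} → 0ℚ < a → 0ℚ < b → 0ℚ < a * b
  _<⊠_ {a} {b} p q = subst (_< a * b) (ℚ.*-zeroʳ a) (ℚ.*-monoʳ-<-pos a {{ℚ.positive p}} q)

  <⇒≤ : ∀ {a b} → a < b → a ≤ b
  <⇒≤ = ℚ.<⇒≤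

  ≡⇒≤ : ∀ {a b} → a ≡ b → a ≤ b
  ≡⇒≤ = ℚ.≤-reflexive

  0≤sq : ∀ x → 0ℚ ≤ x * x
  0≤sq x with ℚ.≤-total 0ℚ x
  ... | inj₁ p = p ⊠ p
  ... | inj₂ p = by≤ (δ p ⊠ δ p) (solve (x ∷ []) ring)

  infix 4 _≤⊎<_
  _≤⊎<_ : ∀ a b → a ≤ b ⊎ b < a
  a ≤⊎< b with a ℚ.≤? b
  ... | yes p = inj₁ p
  ... | no p = inj₂ (ℚ.≰⇒> p)

  x≤∣x∣ : ∀ x → x ≤ ∣ x ∣
  x≤∣x∣ x with ℚ.≤-total 0ℚ x
  ... | inj₁ p = ≡⇒≤ (sym (ℚ.0≤p⇒∣p∣≡p p))
  ... | inj₂ p = ℚ.≤-trans p (ℚ.0≤∣p∣ x)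

  -x≤∣x∣ : ∀ x → - x ≤ ∣ x ∣
  -x≤∣x∣ x = subst (- x ≤_) (ℚ.∣-p∣≡∣p∣ x) (x≤∣x∣ (- x))

  ∣x∣≤ : ∀ {x b} → x ≤ b → - x ≤ b → ∣ x ∣ ≤ b
  ∣x∣≤ {x} {b} p q with ℚ.∣p∣≡p∨∣p∣≡-p x
  ... | inj₁ e = subst (_≤ b) (sym e) p
  ... | inj₂ e = subst (_≤ b) (sym e) q

  ∣x∣≤⇒ : ∀ {x b} → ∣ x ∣ ≤ b → x ≤ b × - b ≤ x
  ∣x∣≤⇒ {x} {b} p = ℚ.≤-trans (x≤∣x∣ x) p , by≤ (δ (ℚ.≤-trans (-x≤∣x∣ x) p)) (solve (x ∷ b ∷ []) ring)

  *-cancel-≤ : ∀ {a b c} → 0ℚ < c → a * c ≤ b * c → a ≤ b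
  *-cancel-≤ {a} {b} {c} p = ℚ.*-cancelʳ-≤-pos c {{ℚ.positive p}}

  -- Recursion makes `nat (suc n)` the ring expression `1ℚ + nat n`, to which the solver applies
  -- directly.
  nat : ℕ → ℚ
  nat zero    = 0ℚ
  nat (suc n) = 1ℚ + nat n

  nat-+ : ∀ m n → nat (m ℕ.+ n) ≡ nat m + nat n
  nat-+ zero n = sym (ℚ.+-identityˡ (nat n))
  nat-+ (suc m) n = trans (cong (λ v → 1ℚ + v) (nat-+ m n)) (sym (ℚ.+-assoc 1ℚ (nat m) (nat n)))

  nat-* : ∀ m n → nat (m ℕ.* n) ≡ nat m * nat n
  nat-* zero n = sym (ℚ.*-zeroˡ (nat n))
  nat-* (suc m) n = trans (nat-+ n (m ℕ.* n)) (trans (cong (λ v → nat n + v) (nat-* m n)) (lem (nat m) (nat n)))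
    where
    lem : ∀ x y → y + x * y ≡ (1ℚ + x) * y
    lem = solve-∀ ring

  0≤nat : ∀ n → 0ℚ ≤ nat n
  0≤nat zero = ℚ.≤-refl
  0≤nat (suc n) = # 1ℚ ⊞ 0≤nat n

  0<nat : ∀ n → 0ℚ < nat (suc n)
  0<nat n = #< 1ℚ <⊞ 0≤nat n

  nat-mono : ∀ {m n} → m ℕ.≤ n → nat m ≤ nat n
  nat-mono {n = n} ℕ.z≤n = 0≤nat n
  nat-mono (ℕ.s≤s p) = ℚ.+-monoʳ-≤ 1ℚ (nat-mono p)

  int : ℤ → ℚ
  int i = i / 1

  toℚᵘ-int : ∀ i → toℚᵘ (int i) ℚᵘ.≃ mkℚᵘ i 0
  toℚᵘ-int i = ℚ.toℚᵘ-fromℚᵘ (mkℚᵘ i 0)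

  int-+ : ∀ i j → int (i ℤ.+ j) ≡ int i + int j
  int-+ i j = ℚ.toℚᵘ-injective (ℚᵘ.≃-trans (toℚᵘ-int (i ℤ.+ j)) (ℚᵘ.≃-sym
    (ℚᵘ.≃-trans (ℚ.toℚᵘ-homo-+ (int i) (int j)) (ℚᵘ.≃-trans (ℚᵘ.+-cong (toℚᵘ-int i) (toℚᵘ-int j))
    (ℚᵘ.*≡* (cong (ℤ._* + 1) (cong₂ ℤ._+_ (ℤ.*-identityʳ i) (ℤ.*-identityʳ j))))))))

  int-* : ∀ i j → int (i ℤ.* j) ≡ int i * int j
  int-* i j = ℚ.toℚᵘ-injective (ℚᵘ.≃-trans (toℚᵘ-int (i ℤ.* j)) (ℚᵘ.≃-sym
    (ℚᵘ.≃-trans (ℚ.toℚᵘ-homo-* (int i) (int j)) (ℚᵘ.≃-trans (ℚᵘ.*-cong (toℚᵘ-int i) (toℚᵘ-int j))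
    (ℚᵘ.*≡* refl)))))

  int-neg : ∀ i → int (ℤ.- i) ≡ - int i
  int-neg i = ℚ.toℚᵘ-injective (ℚᵘ.≃-trans (toℚᵘ-int (ℤ.- i)) (ℚᵘ.≃-sym
    (ℚᵘ.≃-trans (ℚ.toℚᵘ-homo‿- (int i)) (ℚᵘ.-‿cong (toℚᵘ-int i)))))

  int-nat : ∀ n → int (+ n) ≡ nat n
  int-nat zero = refl
  int-nat (suc n) = trans (int-+ (+ 1) (+ n)) (cong (λ v → 1ℚ + v) (int-nat n))

  int-mono : ∀ {i j} → i ℤ.≤ j → int i ≤ int j
  int-mono {i} {j} p = ℚ.toℚᵘ-cancel-≤ (ℚᵘ.≤-respʳ-≃ (ℚᵘ.≃-sym (toℚᵘ-int j)) (ℚᵘ.≤-respˡ-≃ (ℚᵘ.≃-sym (toℚᵘ-int i))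
    (ℚᵘ.*≤* (ℤ.*-monoʳ-≤-nonNeg (+ 1) p))))

  int-cancel : ∀ {i j} → int i ≤ int j → i ℤ.≤ j
  int-cancel {i} {j} p with ℚᵘ.≤-respʳ-≃ (toℚᵘ-int j) (ℚᵘ.≤-respˡ-≃ (toℚᵘ-int i) (ℚ.toℚᵘ-mono-≤ p))
  ... | ℚᵘ.*≤* q = subst₂ ℤ._≤_ (ℤ.*-identityʳ i) (ℤ.*-identityʳ j) q

  int-inj : ∀ {i j} → int i ≡ int j → i ≡ j
  int-inj p = ℤ.≤-antisym (int-cancel (≡⇒≤ p)) (int-cancel (≡⇒≤ (sym p)))

  nat-cancel : ∀ {m n} → nat m ≤ nat n → m ℕ.≤ n
  nat-cancel {m} {n} p = ℤ.drop‿+≤+ (int-cancel (subst₂ _≤_ (sym (int-nat m)) (sym (int-nat n)) p))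

  opaque
    inv : ℕ → ℚ
    inv n = 1 // suc n

  fromℚᵘ-scale : ∀ p → int (+ suc (ℚᵘ.denominator-1 p)) * fromℚᵘ p ≡ int (ℚᵘ.numerator p)
  fromℚᵘ-scale p@(mkℚᵘ n d) = ℚ.toℚᵘ-injective (ℚᵘ.≃-trans (ℚ.toℚᵘ-homo-* (int (+ suc d)) (fromℚᵘ p))
    (ℚᵘ.≃-trans (ℚᵘ.*-cong (toℚᵘ-int (+ suc d)) (ℚ.toℚᵘ-fromℚᵘ p)) (ℚᵘ.≃-trans
      (ℚᵘ.*≡* (trans (ℤ.*-identityʳ (+ suc d ℤ.* n)) (trans (ℤ.*-comm (+ suc d) n) (cong (λ v → n ℤ.* + suc v) (sym (ℕ.+-identityʳ d))))))
      (ℚᵘ.≃-sym (toℚᵘ-int n)))))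

  opaque
    unfolding inv

    nat*inv : ∀ n → nat (suc n) * inv n ≡ 1ℚ
    nat*inv n = trans (cong (_* inv n) (sym (int-nat (suc n)))) (fromℚᵘ-scale (mkℚᵘ (+ 1) n))

    0<inv : ∀ n → 0ℚ < inv n
    0<inv n = ℚ.positive⁻¹ (inv n) {{ℚ.normalize-pos 1 (suc n)}}

  0≤inv : ∀ n → 0ℚ ≤ inv n
  0≤inv n = <⇒≤ (0<inv n)

  archimedean : ∀ x → Σ ℕ λ n → x ≤ nat n
  archimedean x@record{} = ℤ.∣ ℚ.↥ x ∣ , subst (x ≤_) (int-nat ℤ.∣ ℚ.↥ x ∣) (ℚ.toℚᵘ-cancel-≤
    (ℚᵘ.≤-respʳ-≃ (ℚᵘ.≃-sym (toℚᵘ-int (+ ℤ.∣ ℚ.↥ x ∣))) (ℚᵘ.*≤* (lem (ℚ.↥ x) (ℚ.denominator-1 x)))))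
    where
    lem : ∀ i d → i ℤ.* + 1 ℤ.≤ + ℤ.∣ i ∣ ℤ.* + suc d
    lem (+ n) d = subst₂ ℤ._≤_ (ℤ.pos-* n 1) (ℤ.pos-* n (suc d)) (ℤ.+≤+ (ℕ.*-monoʳ-≤ n (ℕ.s≤s ℕ.z≤n)))
    lem ℤ.-[1+ n ] d = subst (ℤ._≤ + suc n ℤ.* + suc d) (sym (ℤ.*-identityʳ ℤ.-[1+ n ])) ℤ.-≤+

  Ev : (ℕ → Set) → Set
  Ev P = Σ ℕ λ N → ∀ n → N ℕ.≤ n → P n

  infixr 4 _&_
  _&_ : ∀ {P Q : ℕ → Set} → Ev P → Ev Q → Ev (λ n → P n × Q n)
  (M , p) & (N , q) = M ℕ.⊔ N , λ n h → p n (ℕ.≤-trans (ℕ.m≤m⊔n M N) h) , q n (ℕ.≤-trans (ℕ.m≤n⊔m M N) h)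

  Ev-map : ∀ {P Q : ℕ → Set} → (∀ n → P n → Q n) → Ev P → Ev Q
  Ev-map f (N , p) = N , λ n h → f n (p n h)

  Ev-suc : ∀ {P : ℕ → Set} → Ev (λ n → P (suc n)) → Ev P
  Ev-suc (N , p) = suc N , λ { (suc n) (ℕ.s≤s h) → p n h }

  Ev⇒∃ : ∀ {P : ℕ → Set} → Ev P → ∃ P
  Ev⇒∃ (N , p) = N , p N ℕ.≤-refl

  _÷_by_ : ∀ a b → 0ℚ < b → ℚ
  a ÷ b by p = a * (ℚ.1/ b) {{ℚ.pos⇒nonZero b {{ℚ.positive p}}}}

  ÷-law : ∀ a b (p : 0ℚ < b) → (a ÷ b by p) * b ≡ a
  ÷-law a b p = trans (ℚ.*-assoc a _ b) (trans (cong (λ v → a * v) (ℚ.*-inverseˡ b {{ℚ.pos⇒nonZero b {{ℚ.positive p}}}})) (ℚ.*-identityʳ a))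

  ÷-pos : ∀ {a b} → 0ℚ < a → (p : 0ℚ < b) → 0ℚ < a ÷ b by p
  ÷-pos {a} {b} q p = q <⊠ ℚ.positive⁻¹ _ {{ℚ.1/pos⇒pos b {{ℚ.positive p}}}}

  small-inv : ∀ C {ε} → 0ℚ < ε → Ev (λ n → C * inv n ≤ ε)
  small-inv C {ε} p with archimedean (C ÷ ε by p)
  ... | N , h = N , λ n N≤n → lem (nat (suc n)) (nat N) (C ÷ ε by p) (÷-law C ε p) (nat-mono (ℕ.m≤n⇒m≤1+n N≤n)) h (nat*inv n) (0≤inv n)
    where
    lem : ∀ {i} m N q → q * ε ≡ C → N ≤ m → q ≤ N → m * i ≡ 1ℚ → 0ℚ ≤ i → C * i ≤ ε
    lem {i} m N q refl h g e 0≤i = by≤ (((δ h ⊞ δ g) ⊠ (<⇒≤ p ⊠ 0≤i)) ⊞ <⇒≤ p ⊠ δ (≡⇒≤ e)) (solve (m ∷ i ∷ N ∷ q ∷ ε ∷ []) ring)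

  -- A positive η below 1 and below ε / M.
  small : ∀ {ε M} → 0ℚ < ε → 0ℚ ≤ M → Σ ℚ λ η → 0ℚ < η × η ≤ 1ℚ × η * M ≤ ε
  small {ε} {M} 0<ε 0≤M = η , 0<η , *-cancel-≤ q (lem₁ η (÷-law ε (M + ε) q) 0≤M) , lem₂ η (÷-law ε (M + ε) q) (<⇒≤ 0<η)
    where
    q : 0ℚ < M + ε
    q = 0≤M ⊞< 0<ε
    η = ε ÷ (M + ε) by q
    0<η = ÷-pos 0<ε q
    lem₁ : ∀ η → η * (M + ε) ≡ ε → 0ℚ ≤ M → η * (M + ε) ≤ 1ℚ * (M + ε)
    lem₁ η e p = by≤ (p ⊞ δ (≡⇒≤ e)) (solve (η ∷ M ∷ ε ∷ []) ring)
    lem₂ : ∀ η → η * (M + ε) ≡ ε → 0ℚ ≤ η → η * M ≤ ε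
    lem₂ η e p = by≤ (δ (≡⇒≤ e) ⊞ p ⊠ <⇒≤ 0<ε) (solve (η ∷ M ∷ ε ∷ []) ring)

  min₂ : ∀ {a b} → 0ℚ < a → 0ℚ < b → Σ ℚ λ η → 0ℚ < η × η ≤ a × η ≤ b
  min₂ {a} {b} p q = [ (λ h → a , p , ℚ.≤-refl , h) , (λ h → b , q , <⇒≤ h , ℚ.≤-refl) ]′ (a ≤⊎< b)

  absurd : ∀ {a b} {A : Set} → a < b → b ≤ a → A
  absurd p q = ⊥-elim (ℚ.<-irrefl refl (ℚ.<-≤-trans p q))

-- Complex numbers with rational coordinates

module Complex where

  open Basics
  open import Algebra.Structures using (IsCommutativeRing)
  open import Data.List.Base using ([]; _∷_)
  open import Data.Product.Base using (_,_)
  open import Data.Rational.Base as ℚ using (ℚ; 0ℚ; 1ℚ; _+_; _*_; _-_; -_; _≤_; ∣_∣)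
  import Data.Rational.Properties as ℚ
  open import Relation.Binary.PropositionalEquality using (_≡_; refl; sym; trans; cong; cong₂; subst; subst₂; isEquivalence)
  open import Relation.Nullary using (yes)
  open import Data.Maybe.Base using (Maybe; just; nothing)
  open import Tactic.RingSolver using (solve; solve-∀)
  open import Tactic.RingSolver.Core.AlmostCommutativeRing using (AlmostCommutativeRing; fromCommutativeRing)

  infixl 6 _+ᶜ_ _-ᶜ_
  infixl 7 _*ᶜ_
  infix  8 -ᶜ_

  record ℂ : Set where
    no-eta-equality
    pattern
    constructor cx
    field
      re im : ℚ

  open ℂ public

  _+ᶜ_ _-ᶜ_ _*ᶜ_ : ℂ → ℂ → ℂ
  cx a b +ᶜ cx c d = cx (a + c) (b + d)
  cx a b -ᶜ cx c d = cx (a - c) (b - d)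
  cx a b *ᶜ cx c d = cx (a * c - b * d) (a * d + b * c)

  -ᶜ_ conj : ℂ → ℂ
  -ᶜ cx a b = cx (- a) (- b)
  conj (cx a b) = cx a (- b)

  real : ℚ → ℂ
  real x = cx x 0ℚ

  0ᶜ 1ᶜ iᶜ : ℂ
  0ᶜ = real 0ℚ
  1ᶜ = real 1ℚ
  iᶜ = cx 0ℚ 1ℚ

  -- The sum norm keeps all values rational, is submultiplicative and dominates both coordinates.
  norm : ℂ → ℚ
  norm u = ∣ re u ∣ + ∣ im u ∣

  ℂ-isCommutativeRing : IsCommutativeRing _≡_ _+ᶜ_ _*ᶜ_ -ᶜ_ 0ᶜ 1ᶜ
  ℂ-isCommutativeRing = record
    { isRing = record
      { +-isAbelianGroup = record
        { isGroup = record
          { isMonoid = record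
            { isSemigroup = record
              { isMagma = record { isEquivalence = isEquivalence ; ∙-cong = cong₂ _+ᶜ_ }
              ; assoc = λ { (cx a b) (cx c d) (cx e f) → cong₂ cx (ℚ.+-assoc a c e) (ℚ.+-assoc b d f) } }
            ; identity = (λ { (cx a b) → cong₂ cx (ℚ.+-identityˡ a) (ℚ.+-identityˡ b) })
                       , (λ { (cx a b) → cong₂ cx (ℚ.+-identityʳ a) (ℚ.+-identityʳ b) }) }
          ; inverse = (λ { (cx a b) → cong₂ cx (ℚ.+-inverseˡ a) (ℚ.+-inverseˡ b) })
                    , (λ { (cx a b) → cong₂ cx (ℚ.+-inverseʳ a) (ℚ.+-inverseʳ b) })
          ; ⁻¹-cong = cong (λ u → -ᶜ u) }
        ; comm = λ { (cx a b) (cx c d) → cong₂ cx (ℚ.+-comm a c) (ℚ.+-comm b d) } }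
      ; *-cong = cong₂ _*ᶜ_
      ; *-assoc = λ { (cx a b) (cx c d) (cx e f) → cong₂ cx (assoc-re a b c d e f) (assoc-im a b c d e f) }
      ; *-identity = (λ { (cx a b) → cong₂ cx (1*-re a b) (1*-im a b) }) , (λ { (cx a b) → cong₂ cx (*1-re a b) (*1-im a b) })
      ; distrib = (λ { (cx a b) (cx c d) (cx e f) → cong₂ cx (distˡ-re a b c d e f) (distˡ-im a b c d e f) })
                , (λ { (cx a b) (cx c d) (cx e f) → cong₂ cx (distʳ-re a b c d e f) (distʳ-im a b c d e f) }) }
    ; *-comm = λ { (cx a b) (cx c d) → cong₂ cx (comm-re a b c d) (comm-im a b c d) } }
    where
    assoc-re : ∀ a b c d e f → (a * c - b * d) * e - (a * d + b * c) * f ≡ a * (c * e - d * f) - b * (c * f + d * e)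
    assoc-re = solve-∀ ring
    assoc-im : ∀ a b c d e f → (a * c - b * d) * f + (a * d + b * c) * e ≡ a * (c * f + d * e) + b * (c * e - d * f)
    assoc-im = solve-∀ ring
    1*-re : ∀ a b → 1ℚ * a - 0ℚ * b ≡ a
    1*-re = solve-∀ ring
    1*-im : ∀ a b → 1ℚ * b + 0ℚ * a ≡ b
    1*-im = solve-∀ ring
    *1-re : ∀ a b → a * 1ℚ - b * 0ℚ ≡ a
    *1-re = solve-∀ ring
    *1-im : ∀ a b → a * 0ℚ + b * 1ℚ ≡ b
    *1-im = solve-∀ ring
    distˡ-re : ∀ a b c d e f → a * (c + e) - b * (d + f) ≡ (a * c - b * d) + (a * e - b * f)
    distˡ-re = solve-∀ ring
    distˡ-im : ∀ a b c d e f → a * (d + f) + b * (c + e) ≡ (a * d + b * c) + (a * f + b * e)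
    distˡ-im = solve-∀ ring
    distʳ-re : ∀ a b c d e f → (c + e) * a - (d + f) * b ≡ (c * a - d * b) + (e * a - f * b)
    distʳ-re = solve-∀ ring
    distʳ-im : ∀ a b c d e f → (c + e) * b + (d + f) * a ≡ (c * b + d * a) + (e * b + f * a)
    distʳ-im = solve-∀ ring
    comm-re : ∀ a b c d → a * c - b * d ≡ c * a - d * b
    comm-re = solve-∀ ring
    comm-im : ∀ a b c d → a * d + b * c ≡ c * b + d * a
    comm-im = solve-∀ ring

  0ᶜ≟ : ∀ u → Maybe (0ᶜ ≡ u)
  0ᶜ≟ (cx a b) with 0ℚ ℚ.≟ a | 0ℚ ℚ.≟ b
  ... | yes refl | yes refl = just refl
  ... | _ | _ = nothing

  ℂ-ring : AlmostCommutativeRing _ _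
  ℂ-ring = fromCommutativeRing (record { isCommutativeRing = ℂ-isCommutativeRing }) 0ᶜ≟

  norm-+ : ∀ u v → norm (u +ᶜ v) ≤ norm u + norm v
  norm-+ (cx a b) (cx c d) = lem (∣ a + c ∣) (∣ a ∣) (∣ c ∣) (∣ b + d ∣) (∣ b ∣) (∣ d ∣) (ℚ.∣p+q∣≤∣p∣+∣q∣ a c) (ℚ.∣p+q∣≤∣p∣+∣q∣ b d)
    where
    lem : ∀ a b c d e f → a ≤ b + c → d ≤ e + f → a + d ≤ b + e + (c + f)
    lem a b c d e f p q = by≤ (δ p ⊞ δ q) (solve (a ∷ b ∷ c ∷ d ∷ e ∷ f ∷ []) ring)

  norm-neg : ∀ u → norm (-ᶜ u) ≡ norm u
  norm-neg (cx a b) = cong₂ _+_ (ℚ.∣-p∣≡∣p∣ a) (ℚ.∣-p∣≡∣p∣ b)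

  norm-conj : ∀ u → norm (conj u) ≡ norm u
  norm-conj (cx a b) = cong (λ v → ∣ a ∣ + v) (ℚ.∣-p∣≡∣p∣ b)

  -ᶜ-def : ∀ u v → u -ᶜ v ≡ u +ᶜ -ᶜ v
  -ᶜ-def (cx a b) (cx c d) = refl

  norm-swap : ∀ u v → norm (u -ᶜ v) ≡ norm (v -ᶜ u)
  norm-swap u v = trans (sym (norm-neg (u -ᶜ v))) (cong norm (trans (cong (λ w → -ᶜ w) (-ᶜ-def u v)) (trans (lem u v) (sym (-ᶜ-def v u)))))
    where
    lem : ∀ u v → -ᶜ (u +ᶜ -ᶜ v) ≡ v +ᶜ -ᶜ u
    lem = solve-∀ ℂ-ring

  norm-* : ∀ u v → norm (u *ᶜ v) ≤ norm u * norm v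
  norm-* (cx a b) (cx c d) = lem (∣ a * c - b * d ∣) (∣ a * d + b * c ∣) (∣ a ∣) (∣ b ∣) (∣ c ∣) (∣ d ∣)
    (subst₂ (λ x y → ∣ a * c - b * d ∣ ≤ x + y) (ℚ.∣p*q∣≡∣p∣*∣q∣ a c) (ℚ.∣p*q∣≡∣p∣*∣q∣ b d) (ℚ.∣p-q∣≤∣p∣+∣q∣ (a * c) (b * d)))
    (subst₂ (λ x y → ∣ a * d + b * c ∣ ≤ x + y) (ℚ.∣p*q∣≡∣p∣*∣q∣ a d) (ℚ.∣p*q∣≡∣p∣*∣q∣ b c) (ℚ.∣p+q∣≤∣p∣+∣q∣ (a * d) (b * c)))
    where
    lem : ∀ x y a b c d → x ≤ a * c + b * d → y ≤ a * d + b * c → x + y ≤ (a + b) * (c + d)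
    lem x y a b c d p q = by≤ (δ p ⊞ δ q) (solve (x ∷ y ∷ a ∷ b ∷ c ∷ d ∷ []) ring)

  0≤norm : ∀ u → 0ℚ ≤ norm u
  0≤norm u = ℚ.0≤∣p∣ (re u) ⊞ ℚ.0≤∣p∣ (im u)

  norm-real : ∀ {x} → 0ℚ ≤ x → norm (real x) ≡ x
  norm-real {x} p = trans (cong (_+ 0ℚ) (ℚ.0≤p⇒∣p∣≡p p)) (ℚ.+-identityʳ x)

  norm-tri : ∀ u v w → norm (u -ᶜ w) ≤ norm (u -ᶜ v) + norm (v -ᶜ w)
  norm-tri u v w = subst (λ z → norm z ≤ norm (u -ᶜ v) + norm (v -ᶜ w))
    (trans (cong₂ _+ᶜ_ (-ᶜ-def u v) (-ᶜ-def v w)) (trans (lem u v w) (sym (-ᶜ-def u w)))) (norm-+ (u -ᶜ v) (v -ᶜ w))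
    where
    lem : ∀ a b c → (a +ᶜ -ᶜ b) +ᶜ (b +ᶜ -ᶜ c) ≡ a +ᶜ -ᶜ c
    lem = solve-∀ ℂ-ring

  re≤norm : ∀ u → ∣ re u ∣ ≤ norm u
  re≤norm u = lem (∣ re u ∣) (∣ im u ∣) (ℚ.0≤∣p∣ (im u))
    where
    lem : ∀ a b → 0ℚ ≤ b → a ≤ a + b
    lem a b p = by≤ p (solve (a ∷ b ∷ []) ring)

  im≤norm : ∀ u → ∣ im u ∣ ≤ norm u
  im≤norm u = lem (∣ re u ∣) (∣ im u ∣) (ℚ.0≤∣p∣ (re u))
    where
    lem : ∀ b a → 0ℚ ≤ b → a ≤ b + a
    lem b a p = by≤ p (solve (b ∷ a ∷ []) ring)

-- Cauchy products and the addition law of the exponential coefficients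

module Series where

  import Algebra.Solver.Ring.NaturalCoefficients.Default as Solver
  open import Algebra.Core using (Op₁; Op₂)
  open import Algebra.Structures using (IsCommutativeRing)
  open import Algebra.Bundles using (CommutativeRing)
  open import Data.Nat.Base using (ℕ; zero; suc)
  import Data.Nat.Base as ℕ
  open import Function.Base using (_∘_)
  open import Relation.Binary.PropositionalEquality using (_≡_; refl; sym; trans; cong; cong₂)

  module _ {A : Set} {add mul : Op₂ A} {neg : Op₁ A} {0# 1# : A}
           (isCR : IsCommutativeRing _≡_ add mul neg 0# 1#) where

    private
      R : CommutativeRing _ _
      R = record { isCommutativeRing = isCR }

    open CommutativeRing R using (_+_; _*_)
    open Solver (CommutativeRing.commutativeSemiring R) using (solve; _:+_; _:*_; _:=_)
    open IsCommutativeRing isCR using (+-identityˡ; +-identityʳ; *-identityˡ; +-comm; *-identityʳ; distribʳ)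

    sumTo : (ℕ → A) → ℕ → A
    sumTo a zero    = 0#
    sumTo a (suc n) = a 0 + sumTo (a ∘ suc) n

    conv : (ℕ → A) → (ℕ → A) → ℕ → A
    conv a b zero    = a 0 * b 0
    conv a b (suc n) = a 0 * b (suc n) + conv (a ∘ suc) b n

    sumTo-cong : ∀ {a b} → (∀ k → a k ≡ b k) → ∀ n → sumTo a n ≡ sumTo b n
    sumTo-cong h zero    = refl
    sumTo-cong h (suc n) = cong₂ _+_ (h 0) (sumTo-cong (h ∘ suc) n)

    sumTo-suc : ∀ a n → sumTo a (suc n) ≡ sumTo a n + a n
    sumTo-suc a zero = +-comm (a 0) 0#
    sumTo-suc a (suc n) = trans (cong (a 0 +_) (sumTo-suc (a ∘ suc) n)) (lem _ _ _)
      where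
      lem : ∀ x y z → x + (y + z) ≡ x + y + z
      lem = solve 3 (λ x y z → x :+ (y :+ z) := x :+ y :+ z) refl

    sumTo-+ : ∀ a m n → sumTo a (m ℕ.+ n) ≡ sumTo a m + sumTo (λ k → a (m ℕ.+ k)) n
    sumTo-+ a zero n = sym (+-identityˡ _)
    sumTo-+ a (suc m) n = trans (cong (a 0 +_) (sumTo-+ (a ∘ suc) m n)) (lem _ _ _)
      where
      lem : ∀ x y z → x + (y + z) ≡ x + y + z
      lem = solve 3 (λ x y z → x :+ (y :+ z) := x :+ y :+ z) refl

    conv-cong : ∀ {a a′ b} → (∀ k → a k ≡ a′ k) → ∀ n → conv a b n ≡ conv a′ b n
    conv-cong h zero    = cong (_* _) (h 0)
    conv-cong h (suc n) = cong₂ _+_ (cong (_* _) (h 0)) (conv-cong (h ∘ suc) n)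

    conv-congʳ : ∀ {a b b′} → (∀ k → b k ≡ b′ k) → ∀ n → conv a b n ≡ conv a b′ n
    conv-congʳ {a} h zero    = cong (a 0 *_) (h 0)
    conv-congʳ {a} h (suc n) = cong₂ _+_ (cong (a 0 *_) (h (suc n))) (conv-congʳ h n)

    conv-+ : ∀ a a′ b n → conv (λ k → a k + a′ k) b n ≡ conv a b n + conv a′ b n
    conv-+ a a′ b zero = lem _ _ _
      where
      lem : ∀ x y z → (x + y) * z ≡ x * z + y * z
      lem = solve 3 (λ x y z → (x :+ y) :* z := x :* z :+ y :* z) refl
    conv-+ a a′ b (suc n) = trans (cong ((a 0 + a′ 0) * b (suc n) +_) (conv-+ (a ∘ suc) (a′ ∘ suc) b n)) (lem _ _ _ _ _)
      where
      lem : ∀ x y z u v → (x + y) * z + (u + v) ≡ x * z + u + (y * z + v)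
      lem = solve 5 (λ x y z u v → (x :+ y) :* z :+ (u :+ v) := x :* z :+ u :+ (y :* z :+ v)) refl

    conv-*ˡ : ∀ x a b n → conv (λ k → x * a k) b n ≡ x * conv a b n
    conv-*ˡ x a b zero = lem _ _ _
      where
      lem : ∀ x y z → x * y * z ≡ x * (y * z)
      lem = solve 3 (λ x y z → x :* y :* z := x :* (y :* z)) refl
    conv-*ˡ x a b (suc n) = trans (cong (x * a 0 * b (suc n) +_) (conv-*ˡ x (a ∘ suc) b n)) (lem _ _ _ _)
      where
      lem : ∀ x y z u → x * y * z + x * u ≡ x * (y * z + u)
      lem = solve 4 (λ x y z u → x :* y :* z :+ x :* u := x :* (y :* z :+ u)) refl

    conv-*ʳ : ∀ x a b n → conv a (λ k → x * b k) n ≡ x * conv a b n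
    conv-*ʳ x a b zero = lem _ _ _
      where
      lem : ∀ x y z → y * (x * z) ≡ x * (y * z)
      lem = solve 3 (λ x y z → y :* (x :* z) := x :* (y :* z)) refl
    conv-*ʳ x a b (suc n) = trans (cong (a 0 * (x * b (suc n)) +_) (conv-*ʳ x (a ∘ suc) b n)) (lem _ _ _ _)
      where
      lem : ∀ x y z u → y * (x * z) + x * u ≡ x * (y * z + u)
      lem = solve 4 (λ x y z u → y :* (x :* z) :+ x :* u := x :* (y :* z :+ u)) refl

    -- A partial sum of a Cauchy product runs over a triangle of index pairs; its first column is
    -- split off, and what remains is the triangle of the shifted sequence.
    sumTo-conv : ∀ a b n → sumTo (conv a b) (suc n) ≡ a 0 * sumTo b (suc n) + sumTo (conv (a ∘ suc) b) n
    sumTo-conv a b zero = cong (_+ 0#) (cong (a 0 *_) (sym (+-identityʳ (b 0))))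
    sumTo-conv a b (suc n) = trans (sumTo-suc (conv a b) (suc n)) (trans (cong (_+ conv a b (suc n)) (sumTo-conv a b n))
      (trans (lem _ _ _ _ _) (sym (cong₂ _+_ (cong (a 0 *_) (sumTo-suc b (suc n))) (sumTo-suc (conv (a ∘ suc) b) n)))))
      where
      lem : ∀ x y z u v → x * y + z + (x * u + v) ≡ x * (y + u) + (z + v)
      lem = solve 5 (λ x y z u v → x :* y :+ z :+ (x :* u :+ v) := x :* (y :+ u) :+ (z :+ v)) refl

    module _ (ν ι : ℕ → A) (ν-0 : ν 0 ≡ 0#) (ν-suc : ∀ n → ν (suc n) ≡ 1# + ν n) (ν*ι : ∀ n → ν (suc n) * ι n ≡ 1#) where

      deriv : (ℕ → A) → ℕ → A
      deriv a n = ν (suc n) * a (suc n)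

      -- The convolution of coefficient sequences is the product of power series, deriv is differentiation.
      leibniz : ∀ a b n → ν (suc n) * conv a b (suc n) ≡ conv (deriv a) b n + conv a (deriv b) n
      leibniz a b zero = lem _ _ _ _ _
        where
        lem : ∀ a₀ a₁ b₀ b₁ ν → ν * (a₀ * b₁ + a₁ * b₀) ≡ ν * a₁ * b₀ + a₀ * (ν * b₁)
        lem = solve 5 (λ a₀ a₁ b₀ b₁ ν → ν :* (a₀ :* b₁ :+ a₁ :* b₀) := ν :* a₁ :* b₀ :+ a₀ :* (ν :* b₁)) refl
      leibniz a b (suc n) = trans (cong (_* (a 0 * b (2 ℕ.+ n) + conv (a ∘ suc) b (suc n))) (ν-suc (suc n)))
        (lem (ν 1) (ν (suc n)) _ _ _ _ _ _ _ _ _ ν-1 (leibniz (a ∘ suc) b n)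
          (trans (conv-cong sderiv n) (conv-+ (a ∘ suc ∘ suc) (deriv (a ∘ suc)) b n)) (ν-suc (suc n)))
        where
        ν-1 : ν 1 ≡ 1#
        ν-1 = trans (ν-suc 0) (trans (cong (1# +_) ν-0) (+-identityʳ 1#))
        sderiv : ∀ k → deriv a (suc k) ≡ a (2 ℕ.+ k) + deriv (a ∘ suc) k
        sderiv k = trans (cong (_* a (2 ℕ.+ k)) (ν-suc (suc k)))
          (trans (distribʳ _ _ _) (cong (_+ ν (suc k) * a (2 ℕ.+ k)) (*-identityˡ _)))
        lem : ∀ ν₁ ν a₀ a₁ b₁ b₂ D₁ D₂ S₁ S₂ ν₂ → ν₁ ≡ 1# → ν * (a₁ * b₁ + S₁) ≡ D₁ + D₂ → S₂ ≡ S₁ + D₁ → ν₂ ≡ 1# + ν →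
              (1# + ν) * (a₀ * b₂ + (a₁ * b₁ + S₁)) ≡ ν₁ * a₁ * b₁ + S₂ + (a₀ * (ν₂ * b₂) + D₂)
        lem _ ν a₀ a₁ b₁ b₂ D₁ D₂ S₁ _ _ refl e refl refl = trans (l₁ 1# ν a₀ a₁ b₁ b₂ S₁)
          (trans (cong₂ (λ u v → (1# + ν) * (a₀ * b₂) + (1# * a₁ * b₁ + u) + v) (*-identityˡ S₁) e) (l₂ 1# ν a₀ a₁ b₁ b₂ D₁ D₂ S₁))
          where
          l₁ : ∀ o ν a₀ a₁ b₁ b₂ S₁ →
               (o + ν) * (a₀ * b₂ + (a₁ * b₁ + S₁)) ≡ (o + ν) * (a₀ * b₂) + (o * a₁ * b₁ + o * S₁) + ν * (a₁ * b₁ + S₁)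
          l₁ = solve 7 (λ o ν a₀ a₁ b₁ b₂ S₁ → (o :+ ν) :* (a₀ :* b₂ :+ (a₁ :* b₁ :+ S₁)) := (o :+ ν) :* (a₀ :* b₂) :+ (o :* a₁ :* b₁ :+ o :* S₁) :+ ν :* (a₁ :* b₁ :+ S₁)) refl
          l₂ : ∀ o ν a₀ a₁ b₁ b₂ D₁ D₂ S₁ →
               (o + ν) * (a₀ * b₂) + (o * a₁ * b₁ + S₁) + (D₁ + D₂) ≡ o * a₁ * b₁ + (S₁ + D₁) + (a₀ * ((o + ν) * b₂) + D₂)
          l₂ = solve 9 (λ o ν a₀ a₁ b₁ b₂ D₁ D₂ S₁ → (o :+ ν) :* (a₀ :* b₂) :+ (o :* a₁ :* b₁ :+ S₁) :+ (D₁ :+ D₂) := o :* a₁ :* b₁ :+ (S₁ :+ D₁) :+ (a₀ :* ((o :+ ν) :* b₂) :+ D₂)) refl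

      expTerm : A → ℕ → A
      expTerm x zero    = 1#
      expTerm x (suc n) = x * expTerm x n * ι n

      deriv-expTerm : ∀ x n → deriv (expTerm x) n ≡ x * expTerm x n
      deriv-expTerm x n = trans (lem _ _ _ _) (trans (cong (_* (x * expTerm x n)) (ν*ι n)) (*-identityˡ _))
        where
        lem : ∀ ν x t ι → ν * (x * t * ι) ≡ ν * ι * (x * t)
        lem = solve 4 (λ ν x t ι → ν :* (x :* t :* ι) := ν :* ι :* (x :* t)) refl

      -- Both sides have constant coefficient 1 and satisfy `f′ = (x + y) f`, the left one by
      -- `leibniz`. As `ν (suc n)` is invertible, that equation determines each coefficient from the
      -- preceding one, so no binomial coefficients appear.
      conv-expTerm : ∀ x y n → conv (expTerm x) (expTerm y) n ≡ expTerm (x + y) n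
      conv-expTerm x y zero = *-identityˡ 1#
      conv-expTerm x y (suc n) = trans (lem₁ _ _ _ (ν*ι n)) (trans (cong (_* ι n) (trans (leibniz (expTerm x) (expTerm y) n)
          (trans (cong₂ _+_ (trans (conv-cong (deriv-expTerm x) n) (conv-*ˡ x _ _ n)) (trans (conv-congʳ (deriv-expTerm y) n) (conv-*ʳ y _ _ n)))
          (trans (lem₂ _ _ _) (cong ((x + y) *_) (conv-expTerm x y n)))))) refl)
        where
        lem₁ : ∀ c ν ι → ν * ι ≡ 1# → c ≡ ν * c * ι
        lem₁ c ν ι e = trans (sym (*-identityˡ c)) (trans (cong (_* c) (sym e)) (l₂ c ν ι))
          where
          l₂ : ∀ c ν ι → ν * ι * c ≡ ν * c * ι
          l₂ = solve 3 (λ c ν ι → ν :* ι :* c := ν :* c :* ι) refl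
        lem₂ : ∀ x y z → x * z + y * z ≡ (x + y) * z
        lem₂ = solve 3 (λ x y z → x :* z :+ y :* z := (x :+ y) :* z) refl

-- Taylor polynomials of e^{iy} with errors uniform on bounded sets

module Exponential where

  open Basics
  open Complex
  open Series
  open import Data.List.Base using ([]; _∷_)
  open import Data.Nat.Base as ℕ using (ℕ; zero; suc)
  import Data.Nat.Properties as ℕ
  open import Data.Product.Base using (_×_; _,_)
  open import Data.Rational.Base as ℚ using (ℚ; 0ℚ; 1ℚ; ½; _+_; _*_; _-_; -_; _≤_; _<_; ∣_∣)
  import Data.Rational.Properties as ℚ
  open import Function.Base using (_∘_)
  open import Relation.Binary.PropositionalEquality using (_≡_; refl; sym; trans; cong; cong₂; subst; subst₂)
  open import Tactic.RingSolver using (solve; solve-∀)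

  sumℚ : (ℕ → ℚ) → ℕ → ℚ
  sumℚ = sumTo ℚ.+-*-isCommutativeRing

  sumᶜ : (ℕ → ℂ) → ℕ → ℂ
  sumᶜ = sumTo ℂ-isCommutativeRing

  convℚ : (ℕ → ℚ) → (ℕ → ℚ) → ℕ → ℚ
  convℚ = conv ℚ.+-*-isCommutativeRing

  convᶜ : (ℕ → ℂ) → (ℕ → ℂ) → ℕ → ℂ
  convᶜ = conv ℂ-isCommutativeRing

  τ : ℚ → ℕ → ℚ
  τ = expTerm ℚ.+-*-isCommutativeRing nat inv refl (λ _ → refl) nat*inv

  nat*invᶜ : ∀ n → real (nat (suc n)) *ᶜ real (inv n) ≡ 1ᶜ
  nat*invᶜ n = cong₂ cx (trans (lem (nat (suc n)) (inv n)) (nat*inv n)) (lem′ (nat (suc n)) (inv n))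
    where
    lem : ∀ x y → x * y - 0ℚ * 0ℚ ≡ x * y
    lem = solve-∀ ring
    lem′ : ∀ x y → x * 0ℚ + 0ℚ * y ≡ 0ℚ
    lem′ = solve-∀ ring

  T : ℂ → ℕ → ℂ
  T = expTerm ℂ-isCommutativeRing (λ n → real (nat n)) (λ n → real (inv n)) refl (λ _ → refl) nat*invᶜ

  conv-T : ∀ u v n → convᶜ (T u) (T v) n ≡ T (u +ᶜ v) n
  conv-T = conv-expTerm ℂ-isCommutativeRing (λ n → real (nat n)) (λ n → real (inv n)) refl (λ _ → refl) nat*invᶜ

  conv-τ : ∀ x y n → convℚ (τ x) (τ y) n ≡ τ (x + y) n
  conv-τ = conv-expTerm ℚ.+-*-isCommutativeRing nat inv refl (λ _ → refl) nat*inv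

  norm-sum : ∀ {a ā} → (∀ k → norm (a k) ≤ ā k) → ∀ n → norm (sumᶜ a n) ≤ sumℚ ā n
  norm-sum h zero = ℚ.≤-refl
  norm-sum {a} h (suc n) = ℚ.≤-trans (norm-+ (a 0) (sumᶜ (a ∘ suc) n)) (ℚ.+-mono-≤ (h 0) (norm-sum (h ∘ suc) n))

  sum-nonneg : ∀ {a} → (∀ k → 0ℚ ≤ a k) → ∀ n → 0ℚ ≤ sumℚ a n
  sum-nonneg h zero = ℚ.≤-refl
  sum-nonneg h (suc n) = h 0 ⊞ sum-nonneg (h ∘ suc) n

  sum-mono : ∀ {a} → (∀ k → 0ℚ ≤ a k) → ∀ m n → sumℚ a n ≤ sumℚ a (m ℕ.+ n)
  sum-mono h zero n = ℚ.≤-refl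
  sum-mono {a} h (suc m) n = ℚ.≤-trans (sum-mono h m n)
    (subst (sumℚ a (m ℕ.+ n) ≤_) (sym (sumTo-suc ℚ.+-*-isCommutativeRing a (m ℕ.+ n))) (lem (sumℚ a (m ℕ.+ n)) (a (m ℕ.+ n)) (h (m ℕ.+ n))))
    where
    lem : ∀ x y → 0ℚ ≤ y → x ≤ x + y
    lem x y p = by≤ p (solve (x ∷ y ∷ []) ring)

  -- The product of the partial sums runs over a square of index pairs, the partial sum of the
  -- convolution over a triangle in it. The defect is the sum over the rest of the square, where
  -- each term is bounded by the product of the majorants.
  conv-defect : ∀ {a b ā b̄} → (∀ k → norm (a k) ≤ ā k) → (∀ k → norm (b k) ≤ b̄ k) → ∀ n →
    norm (sumᶜ a n *ᶜ sumᶜ b n -ᶜ sumᶜ (convᶜ a b) n) ≤ sumℚ ā n * sumℚ b̄ n - sumℚ (convℚ ā b̄) n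
  conv-defect ha hb zero = # 0ℚ
  conv-defect {a} {b} {ā} {b̄} ha hb (suc n) =
    subst₂ _≤_ (cong norm (sym eqᶜ)) (sym eqℚ)
      (ℚ.≤-trans (norm-+ D (A *ᶜ b n)) (ℚ.+-mono-≤ (conv-defect (ha ∘ suc) hb n)
        (ℚ.≤-trans (norm-* A (b n)) (mono (norm A) Ā (norm (b n)) (b̄ n) (norm-sum (ha ∘ suc) n) (hb n) (0≤norm A) (ℚ.≤-trans (0≤norm (b n)) (hb n))))))
    where
    A = sumᶜ (a ∘ suc) n
    Ā = sumℚ (ā ∘ suc) n
    D = A *ᶜ sumᶜ b n -ᶜ sumᶜ (convᶜ (a ∘ suc) b) n
    idᶜ : ∀ a₀ A B b S → (a₀ +ᶜ A) *ᶜ (B +ᶜ b) +ᶜ -ᶜ (a₀ *ᶜ (B +ᶜ b) +ᶜ S) ≡ (A *ᶜ B +ᶜ -ᶜ S) +ᶜ A *ᶜ b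
    idᶜ = solve-∀ ℂ-ring
    idℚ : ∀ a₀ A B b S → (a₀ + A) * (B + b) - (a₀ * (B + b) + S) ≡ (A * B - S) + A * b
    idℚ = solve-∀ ring
    eqᶜ : sumᶜ a (suc n) *ᶜ sumᶜ b (suc n) -ᶜ sumᶜ (convᶜ a b) (suc n) ≡ D +ᶜ A *ᶜ b n
    eqᶜ = trans (cong₂ (λ u v → sumᶜ a (suc n) *ᶜ u -ᶜ v) (sumTo-suc ℂ-isCommutativeRing b n)
        (trans (sumTo-conv ℂ-isCommutativeRing a b n) (cong (λ u → a 0 *ᶜ u +ᶜ sumᶜ (convᶜ (a ∘ suc) b) n) (sumTo-suc ℂ-isCommutativeRing b n))))
      (trans (-ᶜ-def (sumᶜ a (suc n) *ᶜ (sumᶜ b n +ᶜ b n)) _) (trans (idᶜ (a 0) A (sumᶜ b n) (b n) (sumᶜ (convᶜ (a ∘ suc) b) n))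
        (cong (_+ᶜ A *ᶜ b n) (sym (-ᶜ-def (A *ᶜ sumᶜ b n) (sumᶜ (convᶜ (a ∘ suc) b) n))))))
    eqℚ : sumℚ ā (suc n) * sumℚ b̄ (suc n) - sumℚ (convℚ ā b̄) (suc n) ≡ (Ā * sumℚ b̄ n - sumℚ (convℚ (ā ∘ suc) b̄) n) + Ā * b̄ n
    eqℚ = trans (cong₂ (λ u v → sumℚ ā (suc n) * u - v) (sumTo-suc ℚ.+-*-isCommutativeRing b̄ n)
        (trans (sumTo-conv ℚ.+-*-isCommutativeRing ā b̄ n) (cong (λ u → ā 0 * u + sumℚ (convℚ (ā ∘ suc) b̄) n) (sumTo-suc ℚ.+-*-isCommutativeRing b̄ n))))
      (idℚ (ā 0) Ā (sumℚ b̄ n) (b̄ n) (sumℚ (convℚ (ā ∘ suc) b̄) n))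
    mono : ∀ x y u v → x ≤ y → u ≤ v → 0ℚ ≤ x → 0ℚ ≤ v → x * u ≤ y * v
    mono x y u v p q 0≤x 0≤v = by≤ (0≤x ⊠ δ q ⊞ δ p ⊠ 0≤v) (solve (x ∷ y ∷ u ∷ v ∷ []) ring)

  -- The terms are nonnegative, and the rectangle of index pairs is contained in the triangle of
  -- pairs with sum below `m + n`.
  sum-product≤ : ∀ {a b} → (∀ k → 0ℚ ≤ a k) → (∀ k → 0ℚ ≤ b k) → ∀ m n → sumℚ a m * sumℚ b n ≤ sumℚ (convℚ a b) (m ℕ.+ n)
  sum-product≤ {a} {b} ha hb zero n = ℚ.≤-trans (≡⇒≤ (ℚ.*-zeroˡ (sumℚ b n))) (sum-nonneg (conv-nonneg ha) n)
    where
    conv-nonneg : ∀ {a} → (∀ k → 0ℚ ≤ a k) → ∀ k → 0ℚ ≤ convℚ a b k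
    conv-nonneg ha zero = ha 0 ⊠ hb 0
    conv-nonneg ha (suc k) = ha 0 ⊠ hb (suc k) ⊞ conv-nonneg (ha ∘ suc) k
  sum-product≤ {a} {b} ha hb (suc m) n = subst (sumℚ a (suc m) * sumℚ b n ≤_) (sym (sumTo-conv ℚ.+-*-isCommutativeRing a b (m ℕ.+ n)))
    (lem (a 0) _ _ _ _ (ha 0) (sum-mono hb (suc m) n) (sum-product≤ (ha ∘ suc) hb m n))
    where
    lem : ∀ a₀ A B B′ S → 0ℚ ≤ a₀ → B ≤ B′ → A * B ≤ S → (a₀ + A) * B ≤ a₀ * B′ + S
    lem a₀ A B B′ S p q r = by≤ (p ⊠ δ q ⊞ δ r) (solve (a₀ ∷ A ∷ B ∷ B′ ∷ S ∷ []) ring)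

  τ-nonneg : ∀ {x} → 0ℚ ≤ x → ∀ k → 0ℚ ≤ τ x k
  τ-nonneg p zero = # 1ℚ
  τ-nonneg p (suc k) = (p ⊠ τ-nonneg p k) ⊠ 0≤inv k

  norm-T : ∀ {x} w → norm w ≤ x → ∀ k → norm (T w k) ≤ τ x k
  norm-T w p zero = ℚ.≤-refl
  norm-T {x} w p (suc k) = ℚ.≤-trans (norm-* (w *ᶜ T w k) (real (inv k)))
    (lem (norm (w *ᶜ T w k)) (norm w) x (norm (T w k)) (τ x k) (norm (real (inv k))) (inv k) (norm-* w (T w k)) p (norm-T w p k)
      (norm-real (0≤inv k)) (0≤inv k) (0≤norm (T w k)) (ℚ.≤-trans (0≤norm w) p))
    where
    lem : ∀ m w x t τ i′ i → m ≤ w * t → w ≤ x → t ≤ τ → i′ ≡ i → 0ℚ ≤ i → 0ℚ ≤ t → 0ℚ ≤ x → m * i′ ≤ x * τ * i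
    lem m w x t τ i _ p q r refl 0≤i 0≤t 0≤x = by≤ (0≤i ⊠ (δ p ⊞ δ q ⊠ 0≤t ⊞ 0≤x ⊠ δ r)) (solve (m ∷ w ∷ x ∷ t ∷ τ ∷ i ∷ []) ring)

  norm-imaginary : ∀ y → norm (cx 0ℚ y) ≡ ∣ y ∣
  norm-imaginary y = ℚ.+-identityˡ (∣ y ∣)

  tail : (ℕ → ℚ) → ℕ → ℕ → ℚ
  tail a n m = sumℚ (λ k → a (n ℕ.+ k)) m

  tail-suc : ∀ a n m → tail a n (suc m) ≡ a n + tail a (suc n) m
  tail-suc a n m = cong₂ _+_ (cong a (ℕ.+-identityʳ n)) (sumTo-cong ℚ.+-*-isCommutativeRing (λ k → cong a (ℕ.+-suc n k)) m)

  module _ (B : ℕ) where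

    private
      t : ℕ → ℚ
      t = τ (nat B)

    -- The ratio of successive terms is `B / (n + 1)`.
    τ-halves : ∀ n → B ℕ.+ B ℕ.≤ n → t (suc n) ≤ ½ * t n
    τ-halves n h = lem (nat (suc n)) (nat B) (inv n) (t n) (nat*inv n)
      (subst (_≤ nat (suc n)) (nat-+ B B) (nat-mono (ℕ.m≤n⇒m≤1+n h))) (0≤inv n) (τ-nonneg (0≤nat B) n)
      where
      lem : ∀ N B i τ → N * i ≡ 1ℚ → B + B ≤ N → 0ℚ ≤ i → 0ℚ ≤ τ → B * τ * i ≤ ½ * τ
      lem N B i τ e h 0≤i 0≤τ = by≤ (# ½ ⊠ (0≤τ ⊠ δ (≡⇒≤ e)) ⊞ # ½ ⊠ (0≤τ ⊠ (0≤i ⊠ δ h))) (solve (N ∷ B ∷ i ∷ τ ∷ []) ring)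

    τ-tail≤ : ∀ m n → B ℕ.+ B ℕ.≤ n → tail t n m ≤ (2 // 1) * t n
    τ-tail≤ zero n h = # (2 // 1) ⊠ τ-nonneg (0≤nat B) n
    τ-tail≤ (suc m) n h = subst (_≤ (2 // 1) * t n) (sym (tail-suc t n m))
      (lem (t n) (t (suc n)) (tail t (suc n) m) (τ-tail≤ m (suc n) (ℕ.m≤n⇒m≤1+n h)) (τ-halves n h))
      where
      lem : ∀ t t′ s → s ≤ (2 // 1) * t′ → t′ ≤ ½ * t → t + s ≤ (2 // 1) * t
      lem t t′ s p q = by≤ (δ p ⊞ # (2 // 1) ⊠ δ q) (solve (t ∷ t′ ∷ s ∷ []) ring)

    τ-bounded : ∀ k → t (k ℕ.+ (B ℕ.+ B)) ≤ t (B ℕ.+ B)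
    τ-bounded zero = ℚ.≤-refl
    τ-bounded (suc k) = ℚ.≤-trans (τ-halves (k ℕ.+ (B ℕ.+ B)) (ℕ.m≤n+m (B ℕ.+ B) k))
      (lem (t (k ℕ.+ (B ℕ.+ B))) (t (B ℕ.+ B)) (τ-nonneg (0≤nat B) (k ℕ.+ (B ℕ.+ B))) (τ-bounded k))
      where
      lem : ∀ x y → 0ℚ ≤ x → x ≤ y → ½ * x ≤ y
      lem x y p q = by≤ (# ½ ⊠ p ⊞ δ q) (solve (x ∷ y ∷ []) ring)

    -- A tail with ratio at most one half is at most twice its first term, and that term is a
    -- bounded one times `B · inv n`. This gives an explicit threshold from the Archimedean property
    -- alone.
    τ-tail-small : ∀ {ε} → 0ℚ < ε → Ev (λ n → ∀ m → tail t n m ≤ ε)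
    τ-tail-small {ε} 0<ε = Ev-suc (Ev-map step (small-inv ((2 // 1) * (nat B * t (B ℕ.+ B))) 0<ε & (B ℕ.+ B , λ n h → h)))
      where
      step : ∀ n → (2 // 1) * (nat B * t (B ℕ.+ B)) * inv n ≤ ε × B ℕ.+ B ℕ.≤ n → ∀ m → tail t (suc n) m ≤ ε
      step n (h , g) m = ℚ.≤-trans (τ-tail≤ m (suc n) (ℕ.m≤n⇒m≤1+n g))
        (lem (nat B) (t n) (t (B ℕ.+ B)) (inv n) ε (subst (λ v → t v ≤ t (B ℕ.+ B)) (ℕ.m∸n+n≡m g) (τ-bounded (n ℕ.∸ (B ℕ.+ B)))) h (0≤nat B) (0≤inv n))
        where
        lem : ∀ B t M i ε → t ≤ M → (2 // 1) * (B * M) * i ≤ ε → 0ℚ ≤ B → 0ℚ ≤ i → (2 // 1) * (B * t * i) ≤ ε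
        lem B t M i ε p q 0≤B 0≤i = by≤ (# (2 // 1) ⊠ (0≤B ⊠ (δ p ⊠ 0≤i)) ⊞ δ q) (solve (B ∷ t ∷ M ∷ i ∷ ε ∷ []) ring)

  dbl : ℕ → ℕ
  dbl zero    = zero
  dbl (suc n) = suc (suc (dbl n))

  dbl-≤ : ∀ {m n} → m ℕ.≤ n → dbl m ℕ.≤ dbl n
  dbl-≤ ℕ.z≤n = ℕ.z≤n
  dbl-≤ (ℕ.s≤s p) = ℕ.s≤s (ℕ.s≤s (dbl-≤ p))

  n≤dbl : ∀ n → n ℕ.≤ dbl n
  n≤dbl zero = ℕ.z≤n
  n≤dbl (suc n) = ℕ.s≤s (ℕ.m≤n⇒m≤1+n (n≤dbl n))

  opaque
    -- The Taylor polynomial of e^{iy} with n terms of the cosine and n terms of the sine.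
    E : ℕ → ℚ → ℂ
    E n y = sumᶜ (T (cx 0ℚ y)) (dbl n)

  opaque
    unfolding E

    -- Uniformity in `y` lets the argument vary with the degree; this is what permits evaluating
    -- `E n` at the `n`-th approximation of an angle.
    E-tail : ∀ B {ε} → 0ℚ < ε → Ev (λ n → ∀ m → n ℕ.≤ m → ∀ y → ∣ y ∣ ≤ nat B → norm (E m y -ᶜ E n y) ≤ ε)
    E-tail B {ε} 0<ε = let (N , h) = τ-tail-small B 0<ε in N , λ n N≤n m n≤m y y≤B → subst (λ j → norm (sumᶜ (T (cx 0ℚ y)) j -ᶜ E n y) ≤ ε) (ℕ.m+[n∸m]≡n (dbl-≤ n≤m))
        (ℚ.≤-trans (step n (dbl m ℕ.∸ dbl n) y y≤B) (h (dbl n) (ℕ.≤-trans N≤n (n≤dbl n)) (dbl m ℕ.∸ dbl n)))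
      where
      lem : ∀ u v → (u +ᶜ v) +ᶜ -ᶜ u ≡ v
      lem = solve-∀ ℂ-ring
      step : ∀ n k y → ∣ y ∣ ≤ nat B → norm (sumᶜ (T (cx 0ℚ y)) (dbl n ℕ.+ k) -ᶜ E n y) ≤ tail (τ (nat B)) (dbl n) k
      step n k y y≤B = subst (λ u → norm u ≤ tail (τ (nat B)) (dbl n) k)
        (sym (trans (cong (λ u → u -ᶜ E n y) (sumTo-+ ℂ-isCommutativeRing (T (cx 0ℚ y)) (dbl n) k))
          (trans (-ᶜ-def _ (E n y)) (lem (E n y) (sumᶜ (λ j → T (cx 0ℚ y) (dbl n ℕ.+ j)) k)))))
        (norm-sum (λ j → norm-T (cx 0ℚ y) (ℚ.≤-trans (≡⇒≤ (norm-imaginary y)) y≤B) (dbl n ℕ.+ j)) k)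

  opaque
    unfolding E

    -- The difference is the defect of a Cauchy product cut at `d = dbl n`. With the majorant
    -- `τ (nat B)` it is at most the sum of the convolution over the indices from `d` to below `2d`,
    -- and by `conv-τ` this is a piece of the tail of the exponential series at `2B`.
    E-+ : ∀ B {ε} → 0ℚ < ε → Ev (λ n → ∀ x y → ∣ x ∣ ≤ nat B → ∣ y ∣ ≤ nat B → norm (E n x *ᶜ E n y -ᶜ E n (x + y)) ≤ ε)
    E-+ B {ε} 0<ε = let (N , h) = τ-tail-small (B ℕ.+ B) 0<ε in N , λ n N≤n x y x≤B y≤B →
      let b = τ (nat B)
          0≤b = τ-nonneg (0≤nat B)
          d = dbl n
      in ℚ.≤-trans (subst (λ u → norm (E n x *ᶜ E n y -ᶜ u) ≤ sumℚ b d * sumℚ b d - sumℚ (convℚ b b) d)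
             (sumTo-cong ℂ-isCommutativeRing (conv-T (cx 0ℚ x) (cx 0ℚ y)) d)
             (conv-defect (norm-T (cx 0ℚ x) (ℚ.≤-trans (≡⇒≤ (norm-imaginary x)) x≤B)) (norm-T (cx 0ℚ y) (ℚ.≤-trans (≡⇒≤ (norm-imaginary y)) y≤B)) d))
         (ℚ.≤-trans (lem (sumℚ b d * sumℚ b d) (sumℚ (convℚ b b) d) (sumℚ (convℚ b b) (d ℕ.+ d)) (tail (convℚ b b) d d)
               (sum-product≤ 0≤b 0≤b d d) (sumTo-+ ℚ.+-*-isCommutativeRing (convℚ b b) d d))
           (subst (_≤ ε) (sumTo-cong ℚ.+-*-isCommutativeRing (λ k → sym (trans
                (conv-τ (nat B) (nat B) (d ℕ.+ k))
                (cong (λ v → τ v (d ℕ.+ k)) (sym (nat-+ B B))))) d)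
              (h d (ℕ.≤-trans N≤n (n≤dbl n)) d)))
      where
      lem : ∀ P S S′ t → P ≤ S′ → S′ ≡ S + t → P - S ≤ t
      lem P S _ t p refl = by≤ (δ p) (solve (P ∷ S ∷ t ∷ []) ring)

  conj-* : ∀ u v → conj (u *ᶜ v) ≡ conj u *ᶜ conj v
  conj-* (cx a b) (cx c d) = cong₂ cx (lem₁ a b c d) (lem₂ a b c d)
    where
    lem₁ : ∀ a b c d → a * c - b * d ≡ a * c - - b * - d
    lem₁ = solve-∀ ring
    lem₂ : ∀ a b c d → - (a * d + b * c) ≡ a * - d + - b * c
    lem₂ = solve-∀ ring

  conj-+ : ∀ u v → conj (u +ᶜ v) ≡ conj u +ᶜ conj v
  conj-+ (cx a b) (cx c d) = cong (cx (a + c)) (ℚ.neg-distrib-+ b d)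

  conj-sum : ∀ {a b} → (∀ k → conj (a k) ≡ b k) → ∀ n → conj (sumᶜ a n) ≡ sumᶜ b n
  conj-sum h zero = refl
  conj-sum {a} h (suc n) = trans (conj-+ (a 0) (sumᶜ (a ∘ suc) n)) (cong₂ _+ᶜ_ (h 0) (conj-sum (h ∘ suc) n))

  opaque
    unfolding E

    E-neg : ∀ n y → E n (- y) ≡ conj (E n y)
    E-neg n y = sym (conj-sum conj-T (dbl n))
      where
      conj-T : ∀ k → conj (T (cx 0ℚ y) k) ≡ T (cx 0ℚ (- y)) k
      conj-T zero = refl
      conj-T (suc k) = trans (conj-* (cx 0ℚ y *ᶜ T (cx 0ℚ y) k) (real (inv k)))
        (cong (_*ᶜ real (inv k)) (trans (conj-* (cx 0ℚ y) (T (cx 0ℚ y) k)) (cong (cx 0ℚ (- y) *ᶜ_) (conj-T k))))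

  opaque
    unfolding E

    E-0 : ∀ n → E (suc n) 0ℚ ≡ 1ᶜ
    E-0 n = cong (1ᶜ +ᶜ_) (sum-0 T-0 (suc (dbl n)))
      where
      zeroᶜ : ∀ u v → 0ᶜ *ᶜ u *ᶜ v ≡ 0ᶜ
      zeroᶜ = solve-∀ ℂ-ring
      T-0 : ∀ k → T 0ᶜ (suc k) ≡ 0ᶜ
      T-0 k = zeroᶜ (T 0ᶜ k) (real (inv k))
      sum-0 : ∀ {a} → (∀ k → a k ≡ 0ᶜ) → ∀ n → sumᶜ a n ≡ 0ᶜ
      sum-0 h zero = refl
      sum-0 h (suc n) = cong₂ _+ᶜ_ (h 0) (sum-0 (h ∘ suc) n)

  E-unit : ∀ B {ε} → 0ℚ < ε → Ev (λ n → ∀ y → ∣ y ∣ ≤ nat B → norm (E n y *ᶜ conj (E n y) -ᶜ 1ᶜ) ≤ ε)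
  E-unit B 0<ε = let (N , h) = E-+ B 0<ε in suc N , λ { (suc n) (ℕ.s≤s N≤n) y y≤B →
    subst₂ (λ u v → norm (E (suc n) y *ᶜ u -ᶜ v) ≤ _) (E-neg (suc n) y) (trans (cong (E (suc n)) (ℚ.+-inverseʳ y)) (E-0 n))
      (h (suc n) (ℕ.m≤n⇒m≤1+n N≤n) y (- y) y≤B (subst (_≤ nat B) (sym (ℚ.∣-p∣≡∣p∣ y)) y≤B)) }

-- Alternating series for cosine and sine

module Taylor where

  open Basics
  open Complex
  open Series
  open Exponential
  open import Data.List.Base using ([]; _∷_)
  open import Data.Nat.Base as ℕ using (ℕ; zero; suc)
  import Data.Nat.Properties as ℕ
  open import Data.Product.Base using (_×_; _,_; proj₁; proj₂)
  open import Data.Rational.Base as ℚ using (ℚ; 0ℚ; 1ℚ; ½; _+_; _*_; _-_; -_; _≤_)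
  import Data.Rational.Properties as ℚ
  open import Function.Base using (_∘_)
  open import Relation.Binary.PropositionalEquality using (_≡_; refl; sym; trans; cong; cong₂)
  open import Tactic.RingSolver using (solve; solve-∀)

  alt : (ℕ → ℚ) → ℕ → ℚ
  alt a zero    = 0ℚ
  alt a (suc n) = a 0 - alt (a ∘ suc) n

  alt-bounds : ∀ {a} → (∀ k → 0ℚ ≤ a k) → (∀ k → a (suc k) ≤ a k) → ∀ n → 0ℚ ≤ alt a n × alt a n ≤ a 0
  alt-bounds 0≤a dec zero = ℚ.≤-refl , 0≤a 0
  alt-bounds {a} 0≤a dec (suc n) =
    let (p , q) = alt-bounds (0≤a ∘ suc) (dec ∘ suc) n
    in δ (ℚ.≤-trans q (dec 0)) , lem (a 0) (alt (a ∘ suc) n) p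
    where
    lem : ∀ x y → 0ℚ ≤ y → x - y ≤ x
    lem x y p = by≤ p (solve (x ∷ y ∷ []) ring)

  private
    rot : ℕ → ℂ
    rot zero    = 1ᶜ
    rot (suc k) = iᶜ *ᶜ rot k

    real-* : ∀ x y → real x *ᶜ real y ≡ real (x * y)
    real-* x y = cong₂ cx (lem x y) (lem′ x y)
      where
      lem : ∀ x y → x * y - 0ℚ * 0ℚ ≡ x * y
      lem = solve-∀ ring
      lem′ : ∀ x y → x * 0ℚ + 0ℚ * y ≡ 0ℚ
      lem′ = solve-∀ ring

    i*real : ∀ y → iᶜ *ᶜ real y ≡ cx 0ℚ y
    i*real y = cong₂ cx (lem y) (lem′ y)
      where
      lem : ∀ y → 0ℚ * y - 1ℚ * 0ℚ ≡ 0ℚ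
      lem = solve-∀ ring
      lem′ : ∀ y → 0ℚ * 0ℚ + 1ℚ * y ≡ y
      lem′ = solve-∀ ring

    T-rot : ∀ y k → T (cx 0ℚ y) k ≡ rot k *ᶜ real (τ y k)
    T-rot y zero = refl
    T-rot y (suc k) = trans (cong₂ (λ u v → u *ᶜ v *ᶜ real (inv k)) (sym (i*real y)) (T-rot y k))
      (trans (lem iᶜ (real y) (rot k) (real (τ y k)) (real (inv k)))
        (cong (rot (suc k) *ᶜ_) (trans (cong (_*ᶜ real (inv k)) (real-* y (τ y k))) (real-* (y * τ y k) (inv k)))))
      where
      lem : ∀ i y r t n → i *ᶜ y *ᶜ (r *ᶜ t) *ᶜ n ≡ i *ᶜ r *ᶜ (y *ᶜ t *ᶜ n)
      lem = solve-∀ ℂ-ring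

    sum-neg : ∀ {a b} → (∀ k → a k ≡ -ᶜ b k) → ∀ n → sumᶜ a n ≡ -ᶜ sumᶜ b n
    sum-neg h zero = refl
    sum-neg {a} {b} h (suc n) = trans (cong₂ _+ᶜ_ (h 0) (sum-neg (h ∘ suc) n)) (lem (b 0) (sumᶜ (b ∘ suc) n))
      where
      lem : ∀ u v → -ᶜ u +ᶜ -ᶜ v ≡ -ᶜ (u +ᶜ v)
      lem = solve-∀ ℂ-ring

    sum-rot : ∀ f n → sumᶜ (λ k → rot k *ᶜ real (f k)) (dbl n) ≡ cx (alt (f ∘ dbl) n) (alt (f ∘ suc ∘ dbl) n)
    sum-rot f zero = refl
    sum-rot f (suc n) = trans
      (cong (λ u → rot 0 *ᶜ real (f 0) +ᶜ (rot 1 *ᶜ real (f 1) +ᶜ u))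
        (trans (sum-neg (λ k → i²≡-1 (rot k) (real (f (2 ℕ.+ k)))) (dbl n)) (cong (λ u → -ᶜ u) (sum-rot (f ∘ suc ∘ suc) n))))
      (cong₂ cx (lem (f 0) (f 1) _) (lem′ (f 0) (f 1) _))
      where
      i²≡-1 : ∀ r t → iᶜ *ᶜ (iᶜ *ᶜ r) *ᶜ t ≡ -ᶜ (r *ᶜ t)
      i²≡-1 = solve-∀ ℂ-ring
      lem : ∀ x y a → (1ℚ * x - 0ℚ * 0ℚ) + ((0ℚ * y - 1ℚ * 0ℚ) + - a) ≡ x - a
      lem = solve-∀ ring
      lem′ : ∀ x y b → (1ℚ * 0ℚ + 0ℚ * x) + ((0ℚ * 0ℚ + 1ℚ * y) + - b) ≡ y - b
      lem′ = solve-∀ ring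

  opaque
    unfolding E

    E-alt : ∀ n y → E n y ≡ cx (alt (τ y ∘ dbl) n) (alt (τ y ∘ suc ∘ dbl) n)
    E-alt n y = trans (sumTo-cong ℂ-isCommutativeRing (T-rot y) (dbl n)) (sum-rot (τ y) n)

  -- The ratio of terms two apart is `y² / ((k + 1) (k + 2))`, with denominator at least
  -- `3 · 4 = 12`. The root of 12 lies above 171/50, the largest angle estimated below.
  τ-decreasing : ∀ {y} → 0ℚ ≤ y → y * y ≤ 12 // 1 → ∀ k → 2 ℕ.≤ k → τ y (2 ℕ.+ k) ≤ τ y k
  τ-decreasing {y} 0≤y y²≤12 k 2≤k = lem (nat (suc k)) (nat (2 ℕ.+ k)) (inv k) (inv (suc k)) (τ y k)
    (nat-mono (ℕ.s≤s 2≤k)) (nat-mono (ℕ.s≤s (ℕ.s≤s 2≤k)))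
    (nat*inv k) (nat*inv (suc k)) (0≤inv k) (0≤inv (suc k)) (τ-nonneg 0≤y k)
    where
    lem : ∀ M N i j t → 3 // 1 ≤ M → 4 // 1 ≤ N → M * i ≡ 1ℚ → N * j ≡ 1ℚ → 0ℚ ≤ i → 0ℚ ≤ j → 0ℚ ≤ t → y * (y * t * i) * j ≤ t
    lem M N i j t p q e f 0≤i 0≤j 0≤t = by≤
      (0≤t ⊠ (0≤i ⊠ (0≤j ⊠ (δ y²≤12 ⊞ # (4 // 1) ⊠ δ p ⊞ ((# (3 // 1) ⊞ δ p) ⊠ δ q))) ⊞ (δ (≡⇒≤ e) ⊞ 0≤i ⊠ ((# (3 // 1) ⊞ δ p) ⊠ δ (≡⇒≤ f)))))
      (solve (M ∷ N ∷ i ∷ j ∷ t ∷ y ∷ []) ring)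

  record AltBounds (p₀ p₁ p₂ p₃ x : ℚ) : Set where
    field
      hi₀ : x ≤ p₀
      lo₁ : p₀ - p₁ ≤ x
      hi₂ : x ≤ p₀ - p₁ + p₂
      lo₃ : p₀ - p₁ + p₂ - p₃ ≤ x

  AltBounds-≡ : ∀ {p q r s x x′} → x ≡ x′ → AltBounds p q r s x′ → AltBounds p q r s x
  AltBounds-≡ refl b = b

  open AltBounds public

  -- Monotonicity is asked only from index 1 on: for the cosine the first term 1 is smaller than the
  -- second as soon as `y² > 2`.
  alt-expansion : ∀ {a} → (∀ k → 0ℚ ≤ a k) → (∀ k → a (2 ℕ.+ k) ≤ a (suc k)) → ∀ n → 4 ℕ.≤ n →
    ∀ {p₀ p₁ p₂ p₃} → a 0 ≡ p₀ → a 1 ≡ p₁ → a 2 ≡ p₂ → a 3 ≡ p₃ → AltBounds p₀ p₁ p₂ p₃ (alt a n)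
  alt-expansion {a} 0≤a dec (suc (suc (suc (suc n)))) (ℕ.s≤s (ℕ.s≤s (ℕ.s≤s (ℕ.s≤s _)))) {p₀} {p₁} {p₂} {p₃} refl refl refl refl = record
    { hi₀ = h₀ (a 0) _ (proj₁ B₁)
    ; lo₁ = h₁ (a 0) (a 1) _ (proj₂ B₁)
    ; hi₂ = h₂ (a 0) (a 1) (a 2) (alt (a ∘ suc ∘ suc) (2 ℕ.+ n)) (proj₂ B₂)
    ; lo₃ = h₃ (a 0) (a 1) (a 2) (a 3) (alt (a ∘ suc ∘ suc ∘ suc) (1 ℕ.+ n)) (proj₂ B₃) }
    where
    B₁ = alt-bounds {a ∘ suc} (λ k → 0≤a (suc k)) dec (3 ℕ.+ n)
    B₂ = alt-bounds {a ∘ suc ∘ suc} (λ k → 0≤a (2 ℕ.+ k)) (dec ∘ suc) (2 ℕ.+ n)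
    B₃ = alt-bounds {a ∘ suc ∘ suc ∘ suc} (λ k → 0≤a (3 ℕ.+ k)) (dec ∘ suc ∘ suc) (1 ℕ.+ n)
    h₀ : ∀ p A → 0ℚ ≤ A → p - A ≤ p
    h₀ p A h = by≤ h (solve (p ∷ A ∷ []) ring)
    h₁ : ∀ p q A → A ≤ q → p - q ≤ p - A
    h₁ p q A h = by≤ (δ h) (solve (p ∷ q ∷ A ∷ []) ring)
    h₂ : ∀ p q r A → A ≤ r → p - (q - A) ≤ p - q + r
    h₂ p q r A h = by≤ (δ h) (solve (p ∷ q ∷ r ∷ A ∷ []) ring)
    h₃ : ∀ p q r s A → A ≤ s → p - q + r - s ≤ p - (q - (r - A))
    h₃ p q r s A h = by≤ (δ h) (solve (p ∷ q ∷ r ∷ s ∷ A ∷ []) ring)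

  module _ {y} (0≤y : 0ℚ ≤ y) (y²≤12 : y * y ≤ 12 // 1) where

    private
      opaque
        unfolding inv

        τ₂ : τ y 2 ≡ ½ * (y * y)
        τ₂ = lem y
          where
          lem : ∀ y → y * (y * 1ℚ * (1 // 1)) * (1 // 2) ≡ ½ * (y * y)
          lem = solve-∀ ring
        τ-2+ : ∀ k c d → inv k * inv (suc k) * c ≡ d → ∀ p → τ y k ≡ c * p → τ y (2 ℕ.+ k) ≡ d * (p * (y * y))
        τ-2+ k c d e p h = trans (cong (λ t → y * (y * t * inv k) * inv (suc k)) h) (trans (lem (inv k) (inv (suc k)) c p y) (cong (_* (p * (y * y))) e))
          where
          lem : ∀ i j c p y → y * (y * (c * p) * i) * j ≡ i * j * c * (p * (y * y))
          lem = solve-∀ ring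
        τ₄ : τ y 4 ≡ (1 // 24) * (y * y * (y * y))
        τ₄ = τ-2+ 2 ½ (1 // 24) refl (y * y) τ₂
        τ₆ : τ y 6 ≡ (1 // 720) * (y * y * (y * y) * (y * y))
        τ₆ = τ-2+ 4 (1 // 24) (1 // 720) refl (y * y * (y * y)) τ₄
        τ₁ : τ y 1 ≡ 1ℚ * y
        τ₁ = lem y
          where
          lem : ∀ y → y * 1ℚ * (1 // 1) ≡ 1ℚ * y
          lem = solve-∀ ring
        τ₃ : τ y 3 ≡ (1 // 6) * (y * (y * y))
        τ₃ = τ-2+ 1 1ℚ (1 // 6) refl y τ₁
        τ₅ : τ y 5 ≡ (1 // 120) * (y * (y * y) * (y * y))
        τ₅ = τ-2+ 3 (1 // 6) (1 // 120) refl (y * (y * y)) τ₃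
        τ₇ : τ y 7 ≡ (1 // 5040) * (y * (y * y) * (y * y) * (y * y))
        τ₇ = τ-2+ 5 (1 // 120) (1 // 5040) refl (y * (y * y) * (y * y)) τ₅

    cos-bounds : ∀ n → 4 ℕ.≤ n → AltBounds 1ℚ (½ * (y * y)) ((1 // 24) * (y * y * (y * y)))
      ((1 // 720) * (y * y * (y * y) * (y * y))) (re (E n y))
    cos-bounds n h = AltBounds-≡ (cong re (E-alt n y)) (alt-expansion {λ k → τ y (dbl k)} (λ k → τ-nonneg 0≤y (dbl k))
      (λ k → τ-decreasing 0≤y y²≤12 (2 ℕ.+ dbl k) (ℕ.s≤s (ℕ.s≤s ℕ.z≤n))) n h refl τ₂ τ₄ τ₆)

    sin-bounds : ∀ n → 4 ℕ.≤ n → AltBounds (1ℚ * y) ((1 // 6) * (y * (y * y))) ((1 // 120) * (y * (y * y) * (y * y)))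
      ((1 // 5040) * (y * (y * y) * (y * y) * (y * y))) (im (E n y))
    sin-bounds n h = AltBounds-≡ (cong im (E-alt n y)) (alt-expansion {λ k → τ y (suc (dbl k))} (λ k → τ-nonneg 0≤y (suc (dbl k)))
      (λ k → τ-decreasing 0≤y y²≤12 (3 ℕ.+ dbl k) (ℕ.s≤s (ℕ.s≤s ℕ.z≤n))) n h τ₁ τ₃ τ₅ τ₇)

-- Numerical estimates for sine and cosine

module Estimates where

  open Basics
  open Complex
  open Exponential
  open Taylor
  open import Data.List.Base using ([]; _∷_)
  open import Data.Nat.Base as ℕ using (ℕ)
  import Data.Nat.Properties as ℕ
  open import Data.Product.Base using (_×_; _,_; proj₁; proj₂)
  open import Data.Rational.Base as ℚ using (ℚ; 0ℚ; 1ℚ; ½; _+_; _*_; _-_; -_; _≤_; ∣_∣)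
  import Data.Rational.Properties as ℚ
  open import Data.Sum.Base using ([_,_]′)
  open import Relation.Binary.PropositionalEquality using (_≡_; refl; sym; trans; cong; subst; subst₂)
  open import Tactic.RingSolver using (solve; solve-∀)

  CosBounds SinBounds : ℚ → ℚ → Set
  CosBounds y = AltBounds 1ℚ (½ * (y * y)) ((1 // 24) * (y * y * (y * y))) ((1 // 720) * (y * y * (y * y) * (y * y)))
  SinBounds y = AltBounds (1ℚ * y) ((1 // 6) * (y * (y * y))) ((1 // 120) * (y * (y * y) * (y * y))) ((1 // 5040) * (y * (y * y) * (y * y) * (y * y)))

  sq-mono : ∀ {x y} → 0ℚ ≤ x → x ≤ y → x * x ≤ y * y
  sq-mono {x} {y} 0≤x x≤y = by≤ (δ x≤y ⊠ (δ x≤y ⊞ # (2 // 1) ⊠ 0≤x)) (solve (x ∷ y ∷ []) ring)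

  sq≤ : ∀ {x} c → 0ℚ ≤ x → x ≤ c → c * c ≤ 12 // 1 → x * x ≤ 12 // 1
  sq≤ c 0≤x x≤c h = ℚ.≤-trans (sq-mono 0≤x x≤c) h

  module _ {y c s} (0≤y : 0ℚ ≤ y) (C : CosBounds y c) (S : SinBounds y s) where

    -- With the next bound this places `tan (y/2) = (1 - cos y) / sin y` between `y/2` and
    -- `(y/2) (1 + y²)`, in a form free of division.
    y*sin≤2-2cos : y ≤ ½ → y * s ≤ (2 // 1) * (1ℚ - c)
    y*sin≤2-2cos y≤½ = by≤
      (# (2 // 1) ⊠ δ (hi₂ C) ⊞ 0≤y ⊠ δ (hi₂ S) ⊞ # (1 // 120) ⊠ ((0≤sq y ⊠ 0≤sq y) ⊠ (# (39 // 4) ⊞ δ y≤½ ⊠ (# ½ ⊞ 0≤y))))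
      (solve (y ∷ c ∷ s ∷ []) ring)

    2-2cos≤ : y ≤ ½ → (2 // 1) * (1ℚ - c) ≤ s * (y * (1ℚ + y * y))
    2-2cos≤ y≤½ = by≤
      ((0≤y ⊠ (# 1ℚ ⊞ 0≤sq y)) ⊠ δ (lo₁ S) ⊞ # (2 // 1) ⊠ δ (lo₁ C) ⊞ # (1 // 6) ⊠ ((0≤sq y ⊠ 0≤sq y) ⊠ (# (19 // 4) ⊞ δ y≤½ ⊠ (# ½ ⊞ 0≤y))))
      (solve (y ∷ c ∷ s ∷ []) ring)

    -- The truncation is `y (1 - y²/6)`, and at 12/5 the second factor is exactly 1/25.
    sin-lower : y ≤ 12 // 5 → (1 // 25) * y ≤ s
    sin-lower h = by≤ (δ (lo₁ S) ⊞ # (1 // 6) ⊠ (0≤y ⊠ (δ h ⊠ (# (12 // 5) ⊞ 0≤y)))) (solve (y ∷ s ∷ []) ring)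

    -- The upper end is `17/5 + 1/50`: the bound for π plus the largest tolerance with which an
    -- angle is later reduced by full turns.
    1-cos≥ : ½ ≤ y → y ≤ 171 // 50 → 1 // 10 ≤ 1ℚ - c
    1-cos≥ p q = by≤
      (δ (hi₂ C) ⊞ (# (1 // 24) ⊠ (((δ p ⊠ (# ½ ⊞ 0≤y)) ⊠ (δ q ⊠ (# (171 // 50) ⊞ 0≤y))) ⊞ # (67 // 1250) ⊠ 0≤sq y ⊞ # (5241 // 10000))))
      (solve (y ∷ c ∷ []) ring)

    -- Crude, but enough to tell the cosine of π from 1 once its square is known to be 1.
    cos≤4/5 : 12 // 5 ≤ y → y ≤ 17 // 5 → c ≤ 4 // 5
    cos≤4/5 p q = by≤
      (δ (hi₂ C) ⊞ # (1 // 24) ⊠ (((δ p ⊠ (# (12 // 5) ⊞ 0≤y)) ⊠ (δ q ⊠ (# (17 // 5) ⊞ 0≤y)))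
        ⊞ # (133 // 25) ⊠ (δ q ⊠ (# (17 // 5) ⊞ 0≤y)) ⊞ # (2864 // 10000)))
      (solve (y ∷ c ∷ []) ring)

    near-tangent : y ≤ 1ℚ → ∣ c - 1ℚ ∣ ≤ ½ * (y * y) × ∣ s - y ∣ ≤ (1 // 6) * (y * (y * y))
    near-tangent h =
        ∣x∣≤ (by≤ (δ (hi₀ C) ⊞ # ½ ⊠ 0≤sq y) (solve (y ∷ c ∷ []) ring)) (by≤ (δ (lo₁ C)) (solve (y ∷ c ∷ []) ring))
      , ∣x∣≤ (by≤ (δ (hi₀ S) ⊞ # (1 // 6) ⊠ (0≤y ⊠ 0≤sq y)) (solve (y ∷ s ∷ []) ring)) (by≤ (δ (lo₁ S)) (solve (y ∷ s ∷ []) ring))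

  re-conj : ∀ u → re (conj u) ≡ re u
  re-conj (cx a b) = refl

  im-conj : ∀ u → im (conj u) ≡ - im u
  im-conj (cx a b) = refl

  re-E-abs : ∀ n y → re (E n (∣ y ∣)) ≡ re (E n y)
  re-E-abs n y = [ (λ e → cong (λ x → re (E n x)) e)
                 , (λ e → trans (cong (λ x → re (E n x)) e) (trans (cong re (E-neg n y)) (re-conj (E n y)))) ]′ (ℚ.∣p∣≡p∨∣p∣≡-p y)

  im-E-abs : ∀ n y → ∣ im (E n (∣ y ∣)) ∣ ≡ ∣ im (E n y) ∣
  im-E-abs n y = [ (λ e → cong (λ x → ∣ im (E n x) ∣) e)
                 , (λ e → trans (cong (λ x → ∣ im (E n x) ∣) e) (trans (cong (λ u → ∣ im u ∣) (E-neg n y))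
                     (trans (cong ∣_∣ (im-conj (E n y))) (ℚ.∣-p∣≡∣p∣ (im (E n y)))))) ]′ (ℚ.∣p∣≡p∨∣p∣≡-p y)

  module _ n (4≤n : 4 ℕ.≤ n) (y : ℚ) where

    private
      0≤∣y∣ = ℚ.0≤∣p∣ y

      bounds : ∀ c → ∣ y ∣ ≤ c → c * c ≤ 12 // 1 → CosBounds (∣ y ∣) (re (E n (∣ y ∣))) × SinBounds (∣ y ∣) (im (E n (∣ y ∣)))
      bounds c h g = let k = sq≤ c 0≤∣y∣ h g in cos-bounds 0≤∣y∣ k n 4≤n , sin-bounds 0≤∣y∣ k n 4≤n

    E-tan-bounds : ∣ y ∣ ≤ ½ → let c = re (E n y) ; s = ∣ im (E n y) ∣ in
      ∣ y ∣ * s ≤ (2 // 1) * (1ℚ - c) × (2 // 1) * (1ℚ - c) ≤ s * (∣ y ∣ * (1ℚ + ∣ y ∣ * ∣ y ∣))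
    E-tan-bounds h = subst₂ (λ c s → ∣ y ∣ * s ≤ (2 // 1) * (1ℚ - c) × (2 // 1) * (1ℚ - c) ≤ s * (∣ y ∣ * (1ℚ + ∣ y ∣ * ∣ y ∣)))
      (re-E-abs n y) (trans (sym (ℚ.0≤p⇒∣p∣≡p 0≤s)) (im-E-abs n y))
      (y*sin≤2-2cos 0≤∣y∣ (proj₁ b) (proj₂ b) h , 2-2cos≤ 0≤∣y∣ (proj₁ b) (proj₂ b) h)
      where
      b = bounds ½ h (#≤ (½ * ½) (12 // 1))
      0≤s : 0ℚ ≤ im (E n (∣ y ∣))
      0≤s = ℚ.≤-trans (# (1 // 25) ⊠ 0≤∣y∣) (sin-lower 0≤∣y∣ (proj₁ b) (proj₂ b) (ℚ.≤-trans h (#≤ ½ (12 // 5))))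

    E-1-cos≥ : ½ ≤ ∣ y ∣ → ∣ y ∣ ≤ 171 // 50 → 1 // 10 ≤ 1ℚ - re (E n y)
    E-1-cos≥ p q = subst (λ c → 1 // 10 ≤ 1ℚ - c) (re-E-abs n y) (1-cos≥ 0≤∣y∣ (proj₁ b) (proj₂ b) p q)
      where
      b = bounds (171 // 50) q (#≤ ((171 // 50) * (171 // 50)) (12 // 1))

    E-sin≤ : ∣ y ∣ ≤ 12 // 5 → ∣ im (E n y) ∣ ≤ ∣ y ∣
    E-sin≤ h = subst (_≤ ∣ y ∣) (im-E-abs n y) (∣x∣≤ (lem (im (E n (∣ y ∣))) (∣ y ∣) (hi₀ (proj₂ b))) (lem′ (im (E n (∣ y ∣))) (∣ y ∣) 0≤∣y∣ (sin-lower 0≤∣y∣ (proj₁ b) (proj₂ b) h)))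
      where
      b = bounds (12 // 5) h (#≤ ((12 // 5) * (12 // 5)) (12 // 1))
      lem : ∀ s y → s ≤ 1ℚ * y → s ≤ y
      lem s y p = by≤ (δ p) (solve (s ∷ y ∷ []) ring)
      lem′ : ∀ s y → 0ℚ ≤ y → (1 // 25) * y ≤ s → - s ≤ y
      lem′ s y p q = by≤ (# (26 // 25) ⊠ p ⊞ δ q) (solve (s ∷ y ∷ []) ring)

    E-sin-lower : 0ℚ ≤ y → y ≤ 12 // 5 → (1 // 25) * y ≤ im (E n y)
    E-sin-lower 0≤y h = sin-lower 0≤y (cos-bounds 0≤y k n 4≤n) (sin-bounds 0≤y k n 4≤n) h
      where
      k = sq≤ (12 // 5) 0≤y h (#≤ ((12 // 5) * (12 // 5)) (12 // 1))

    E-cos≤4/5 : 12 // 5 ≤ y → y ≤ 17 // 5 → re (E n y) ≤ 4 // 5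
    E-cos≤4/5 p h = cos≤4/5 0≤y (cos-bounds 0≤y k n 4≤n) (sin-bounds 0≤y k n 4≤n) p h
      where
      0≤y = ℚ.≤-trans (# (12 // 5)) p
      k = sq≤ (17 // 5) 0≤y h (#≤ ((17 // 5) * (17 // 5)) (12 // 1))

  E-tangent⁺ : ∀ n → 4 ℕ.≤ n → ∀ y → 0ℚ ≤ y → y ≤ 1ℚ → norm (E n y -ᶜ cx 1ℚ y) ≤ y * y
  E-tangent⁺ n 4≤n y 0≤y h = subst (λ u → norm u ≤ y * y) (sym (eq (E n y))) (lem (∣ re (E n y) - 1ℚ ∣) (∣ im (E n y) - y ∣) p q)
    where
    k = sq≤ 1ℚ 0≤y h (#≤ (1ℚ * 1ℚ) (12 // 1))
    pq = near-tangent 0≤y (cos-bounds 0≤y k n 4≤n) (sin-bounds 0≤y k n 4≤n) h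
    p = proj₁ pq
    q = proj₂ pq
    eq : ∀ u → u -ᶜ cx 1ℚ y ≡ cx (re u - 1ℚ) (im u - y)
    eq (cx a b) = refl
    lem : ∀ a b → a ≤ ½ * (y * y) → b ≤ (1 // 6) * (y * (y * y)) → a + b ≤ y * y
    lem a b p q = by≤ (δ p ⊞ δ q ⊞ # (1 // 6) ⊠ ((0≤sq y ⊠ δ h) ⊞ # (2 // 1) ⊠ 0≤sq y)) (solve (a ∷ b ∷ y ∷ []) ring)

  E-tangent : ∀ n → 4 ℕ.≤ n → ∀ y → ∣ y ∣ ≤ 1ℚ → norm (E n y -ᶜ cx 1ℚ y) ≤ y * y
  E-tangent n 4≤n y h = [ (λ 0≤y → E-tangent⁺ n 4≤n y 0≤y (ℚ.≤-trans (x≤∣x∣ y) h))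
    , (λ y≤0 → subst₂ _≤_ (trans (cong norm (trans (cong (_-ᶜ cx 1ℚ (- y)) (E-neg n y)) (eq (E n y)))) (norm-conj (E n y -ᶜ cx 1ℚ y))) (lem y)
      (E-tangent⁺ n 4≤n (- y) (ℚ.neg-antimono-≤ y≤0) (ℚ.≤-trans (-x≤∣x∣ y) h))) ]′ (ℚ.≤-total 0ℚ y)
    where
    lem : ∀ y → - y * - y ≡ y * y
    lem = solve-∀ ring
    eq : ∀ u → conj u -ᶜ cx 1ℚ (- y) ≡ conj (u -ᶜ cx 1ℚ y)
    eq (cx a b) = cong (cx (a - 1ℚ)) (lem′ b y)
      where
      lem′ : ∀ b y → - b - - y ≡ - (b - y)
      lem′ = solve-∀ ring

  -- 11/7 is half of 22/7, hence close to π/2; it starts the iteration that constructs a zero of the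
  -- sine.
  E-11/7 : ∀ n → 4 ℕ.≤ n → norm (E n (11 // 7) -ᶜ iᶜ) ≤ 1 // 40
  E-11/7 n 4≤n = subst (λ u → norm u ≤ 1 // 40) (sym (eq (E n (11 // 7))))
      (lem (∣ re (E n (11 // 7)) - 0ℚ ∣) (∣ im (E n (11 // 7)) - 1ℚ ∣) (num₁ (re (E n (11 // 7))) C) (num₂ (im (E n (11 // 7))) S))
    where
    0≤y = # (11 // 7)
    k = #≤ ((11 // 7) * (11 // 7)) (12 // 1)
    C = cos-bounds 0≤y k n 4≤n
    S = sin-bounds 0≤y k n 4≤n
    eq : ∀ u → u -ᶜ iᶜ ≡ cx (re u - 0ℚ) (im u - 1ℚ)
    eq (cx a b) = refl
    num₁ : ∀ c → CosBounds (11 // 7) c → ∣ c - 0ℚ ∣ ≤ 1 // 50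
    num₁ c C = ∣x∣≤ (by≤ (δ (hi₂ C) ⊞ # (1 // 50 - (1ℚ - ½ * ((11 // 7) * (11 // 7)) + (1 // 24) * ((11 // 7) * (11 // 7) * ((11 // 7) * (11 // 7)))))) (solve (c ∷ []) ring))
                    (by≤ (δ (lo₃ C) ⊞ # (1 // 50 + (1ℚ - ½ * ((11 // 7) * (11 // 7)) + (1 // 24) * ((11 // 7) * (11 // 7) * ((11 // 7) * (11 // 7))) - (1 // 720) * ((11 // 7) * (11 // 7) * ((11 // 7) * (11 // 7)) * ((11 // 7) * (11 // 7)))))) (solve (c ∷ []) ring))
    num₂ : ∀ s → SinBounds (11 // 7) s → ∣ s - 1ℚ ∣ ≤ 1 // 200
    num₂ s S = ∣x∣≤ (by≤ (δ (hi₂ S) ⊞ # (201 // 200 - (1ℚ * (11 // 7) - (1 // 6) * ((11 // 7) * ((11 // 7) * (11 // 7))) + (1 // 120) * ((11 // 7) * ((11 // 7) * (11 // 7)) * ((11 // 7) * (11 // 7)))))) (solve (s ∷ []) ring))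
                    (by≤ (δ (lo₃ S) ⊞ # ((1ℚ * (11 // 7) - (1 // 6) * ((11 // 7) * ((11 // 7) * (11 // 7))) + (1 // 120) * ((11 // 7) * ((11 // 7) * (11 // 7)) * ((11 // 7) * (11 // 7))) - (1 // 5040) * ((11 // 7) * ((11 // 7) * (11 // 7)) * ((11 // 7) * (11 // 7)) * ((11 // 7) * (11 // 7)))) - 199 // 200)) (solve (s ∷ []) ring))
    lem : ∀ a b → a ≤ 1 // 50 → b ≤ 1 // 200 → a + b ≤ 1 // 40
    lem a b p q = by≤ (δ p ⊞ δ q) (solve (a ∷ b ∷ []) ring)

-- Sequences converging to an angle, and the sign of the sine

module Angles where

  open Basics
  open Complex
  open Exponential
  open Estimates
  open import Data.List.Base using ([]; _∷_)
  open import Data.Nat.Base as ℕ using (ℕ; zero; suc)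
  import Data.Nat.Properties as ℕ
  open import Data.Product.Base using (_×_; _,_)
  open import Data.Rational.Base as ℚ using (ℚ; 0ℚ; 1ℚ; _+_; _*_; _-_; -_; _≤_; _<_; ∣_∣)
  import Data.Rational.Properties as ℚ
  open import Data.Sum.Base using ([_,_]′)
  open import Relation.Binary.PropositionalEquality using (_≡_; refl; sym; trans; cong; cong₂; subst)
  open import Tactic.RingSolver using (solve; solve-∀)

  -- The sequence z is bounded and converges to an angle whose complex exponential is w.
  record Angle (z : ℕ → ℚ) (w : ℂ) : Set where
    field
      bound   : ℕ
      bounded : Ev (λ n → ∣ z n ∣ ≤ nat bound)
      limit   : ∀ {ε} → 0ℚ < ε → Ev (λ n → norm (E n (z n) -ᶜ w) ≤ ε)

  open Angle public

  Angle-≡ : ∀ {z z′ w w′} → (∀ n → z n ≡ z′ n) → w ≡ w′ → Angle z w → Angle z′ w′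
  Angle-≡ {w = w} h refl a = record
    { bound   = bound a
    ; bounded = Ev-map (λ n p → subst (λ x → ∣ x ∣ ≤ nat (bound a)) (h n) p) (bounded a)
    ; limit   = λ 0<ε → Ev-map (λ n p → subst (λ x → norm (E n x -ᶜ w) ≤ _) (h n) p) (limit a 0<ε) }

  Angle-0 : Angle (λ _ → 0ℚ) 1ᶜ
  Angle-0 = record
    { bound   = 0
    ; bounded = 0 , λ _ _ → ℚ.≤-refl
    ; limit   = λ {ε} 0<ε → 1 , λ { (suc n) _ → subst (λ u → norm (u -ᶜ 1ᶜ) ≤ ε) (sym (E-0 n)) (<⇒≤ 0<ε) } }

  Angle-neg : ∀ {z w} → Angle z w → Angle (λ n → - z n) (conj w)
  Angle-neg {z} {w} a = record
    { bound   = bound a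
    ; bounded = Ev-map (λ n p → subst (_≤ nat (bound a)) (sym (ℚ.∣-p∣≡∣p∣ (z n))) p) (bounded a)
    ; limit   = λ 0<ε → Ev-map (λ n p → subst (_≤ _) (sym (trans (cong (λ u → norm (u -ᶜ conj w)) (E-neg n (z n)))
        (trans (cong norm (conj-- (E n (z n)) w)) (norm-conj (E n (z n) -ᶜ w))))) p) (limit a 0<ε) }
    where
    conj-- : ∀ u v → conj u -ᶜ conj v ≡ conj (u -ᶜ v)
    conj-- (cx a b) (cx c d) = cong (cx (a - c)) (lem b d)
      where
      lem : ∀ b d → - b - - d ≡ - (b - d)
      lem = solve-∀ ring

  Angle-+ : ∀ {x y u v} → Angle x u → Angle y v → Angle (λ n → x n + y n) (u *ᶜ v)
  Angle-+ {x} {y} {u} {v} a b = record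
    { bound   = bound a ℕ.+ bound b
    ; bounded = Ev-map (λ n (p , q) → ℚ.≤-trans (ℚ.∣p+q∣≤∣p∣+∣q∣ (x n) (y n))
        (subst (∣ x n ∣ + ∣ y n ∣ ≤_) (sym (nat-+ (bound a) (bound b))) (ℚ.+-mono-≤ p q))) (bounded a & bounded b)
    ; limit   = λ {ε} 0<ε →
        -- The errors add up to `η + η (η + norm v) + norm u · η`; this explains the factor and the
        -- demand `η ≤ 1`.
        let (η , 0<η , η≤1 , ηM≤ε) = small {ε} {(2 // 1) + norm u + norm v} 0<ε ((# (2 // 1) ⊞ 0≤norm u) ⊞ 0≤norm v)
        in Ev-map (λ n → step n ε η 0<η η≤1 ηM≤ε)
             (E-+ (bound a ℕ.+ bound b) 0<η & bounded a & bounded b & limit a 0<η & limit b 0<η) }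
    where
    B = bound a ℕ.+ bound b
    diff : ∀ p q u v → p *ᶜ q +ᶜ -ᶜ (u *ᶜ v) ≡ (p +ᶜ -ᶜ u) *ᶜ ((q +ᶜ -ᶜ v) +ᶜ v) +ᶜ u *ᶜ (q +ᶜ -ᶜ v)
    diff = solve-∀ ℂ-ring
    diff′ : ∀ p q u v → p *ᶜ q -ᶜ u *ᶜ v ≡ (p -ᶜ u) *ᶜ ((q -ᶜ v) +ᶜ v) +ᶜ u *ᶜ (q -ᶜ v)
    diff′ p q u v = trans (-ᶜ-def (p *ᶜ q) (u *ᶜ v)) (trans (diff p q u v)
      (sym (cong₂ (λ s t → s *ᶜ (t +ᶜ v) +ᶜ u *ᶜ t) (-ᶜ-def p u) (-ᶜ-def q v))))
    arith : ∀ {t t₁ t₂ t₃ t₄ m₁ m₂ U V η ε} → t ≤ t₁ + t₂ → t₁ ≤ η → t₂ ≤ m₁ + m₂ → m₁ ≤ t₃ * (t₄ + V) → m₂ ≤ U * t₄ →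
            t₃ ≤ η → t₄ ≤ η → 0ℚ ≤ t₄ → 0ℚ ≤ U → 0ℚ ≤ V → 0ℚ ≤ η → η ≤ 1ℚ → η * ((2 // 1) + U + V) ≤ ε → t ≤ ε
    arith {t} {t₁} {t₂} {t₃} {t₄} {m₁} {m₂} {U} {V} {η} {ε} p₁ p₂ p₃ p₄ p₅ p₆ p₇ 0≤t₄ 0≤U 0≤V 0≤η p₈ p₉ = by≤
      (δ p₁ ⊞ δ p₂ ⊞ δ p₃ ⊞ δ p₄ ⊞ δ p₅ ⊞ δ p₆ ⊠ (0≤t₄ ⊞ 0≤V) ⊞ (0≤η ⊞ 0≤U) ⊠ δ p₇ ⊞ 0≤η ⊠ δ p₈ ⊞ δ p₉)
      (solve (t ∷ t₁ ∷ t₂ ∷ t₃ ∷ t₄ ∷ m₁ ∷ m₂ ∷ U ∷ V ∷ η ∷ ε ∷ []) ring)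
    step : ∀ n ε η → 0ℚ < η → η ≤ 1ℚ → η * ((2 // 1) + norm u + norm v) ≤ ε →
      (∀ x y → ∣ x ∣ ≤ nat B → ∣ y ∣ ≤ nat B → norm (E n x *ᶜ E n y -ᶜ E n (x + y)) ≤ η) ×
      ∣ x n ∣ ≤ nat (bound a) × ∣ y n ∣ ≤ nat (bound b) × norm (E n (x n) -ᶜ u) ≤ η × norm (E n (y n) -ᶜ v) ≤ η →
      norm (E n (x n + y n) -ᶜ u *ᶜ v) ≤ ε
    step n ε η 0<η η≤1 ηM≤ε (h , x≤ , y≤ , p , q) = arith
      {t₂ = norm (E n (x n) *ᶜ E n (y n) -ᶜ u *ᶜ v)} {m₁ = norm L} {m₂ = norm R}
      {U = norm u} {V = norm v}
      (norm-tri (E n (x n + y n)) (E n (x n) *ᶜ E n (y n)) (u *ᶜ v))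
      (subst (_≤ η) (norm-swap (E n (x n) *ᶜ E n (y n)) (E n (x n + y n)))
        (h (x n) (y n) (ℚ.≤-trans x≤ (nat-mono (ℕ.m≤m+n (bound a) (bound b)))) (ℚ.≤-trans y≤ (nat-mono (ℕ.m≤n+m (bound b) (bound a))))))
      (subst (λ s → norm s ≤ norm L + norm R) (sym (diff′ (E n (x n)) (E n (y n)) u v)) (norm-+ L R))
      (ℚ.≤-trans (norm-* (E n (x n) -ᶜ u) ((E n (y n) -ᶜ v) +ᶜ v)) (ℚ.*-monoˡ-≤-nonNeg (norm (E n (x n) -ᶜ u)) {{ℚ.nonNegative (0≤norm (E n (x n) -ᶜ u))}} (norm-+ (E n (y n) -ᶜ v) v)))
      (norm-* u (E n (y n) -ᶜ v)) p q (0≤norm (E n (y n) -ᶜ v)) (0≤norm u) (0≤norm v) (<⇒≤ 0<η) η≤1 ηM≤ε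
      where
      L = (E n (x n) -ᶜ u) *ᶜ ((E n (y n) -ᶜ v) +ᶜ v)
      R = u *ᶜ (E n (y n) -ᶜ v)

  _^ᶜ_ : ℂ → ℕ → ℂ
  w ^ᶜ zero  = 1ᶜ
  w ^ᶜ suc n = w *ᶜ w ^ᶜ n

  Angle-* : ∀ {z w} n → Angle z w → Angle (λ k → nat n * z k) (w ^ᶜ n)
  Angle-* {z} zero a = Angle-≡ (λ k → sym (ℚ.*-zeroˡ (z k))) refl Angle-0
  Angle-* {z} (suc n) a = Angle-≡ (λ k → lem (z k) (nat n)) refl (Angle-+ a (Angle-* n a))
    where
    lem : ∀ z n → z + n * z ≡ (1ℚ + n) * z
    lem = solve-∀ ring

  -1ᶜ : ℂ
  -1ᶜ = cx (- 1ℚ) 0ℚ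

  -1*-1 : ∀ w → -1ᶜ *ᶜ (-1ᶜ *ᶜ w) ≡ w
  -1*-1 = lem
    where
    lem : ∀ w → (-ᶜ 1ᶜ) *ᶜ ((-ᶜ 1ᶜ) *ᶜ w) ≡ w
    lem = solve-∀ ℂ-ring

  module Circle (π : ℕ → ℚ) (Eπ : Angle π -1ᶜ) (π-range : Ev (λ n → 12 // 5 ≤ π n × π n ≤ 17 // 5)) where

    -- The sign of the exact number `im w` is deduced from the position of a single late
    -- approximation. The linear lower bound of the sine holds only up to 12/5; beyond that it is
    -- applied to `π - z`, which has the same sine. It gives at least `ε/25` against an error of
    -- `ε/50`.
    sin-pos : ∀ {z w ε} → Angle z w → 0ℚ < ε → Ev (λ n → ε ≤ z n → z n ≤ π n - ε → 0ℚ < im w)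
    sin-pos {z} {w} {ε} a 0<ε = Ev-map step (limit a 0<ε/50 & limit (Angle-+ Eπ (Angle-neg a)) 0<ε/50 & π-range & (4 , λ n h → h))
      where
      0<ε/50 : 0ℚ < (1 // 50) * ε
      0<ε/50 = #< (1 // 50) <⊠ 0<ε
      im-diff : ∀ u v → im (u -ᶜ v) ≡ im u - im v
      im-diff (cx a b) (cx c d) = refl
      close : ∀ u v {η} → norm (u -ᶜ v) ≤ η → im u - im v ≤ η
      close u v p = ℚ.≤-trans (subst (_≤ ∣ im (u -ᶜ v) ∣) (im-diff u v) (x≤∣x∣ (im (u -ᶜ v)))) (ℚ.≤-trans (im≤norm (u -ᶜ v)) p)
      im-neg-conj : ∀ w → im (-1ᶜ *ᶜ conj w) ≡ im w
      im-neg-conj (cx a b) = lem a b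
        where
        lem : ∀ a b → (- 1ℚ) * (- b) + 0ℚ * a ≡ b
        lem = solve-∀ ring
      fin : ∀ s t y → (1 // 25) * y ≤ s → s - t ≤ (1 // 50) * ε → ε ≤ y → 0ℚ < t
      fin s t y p q r = by< (#< (1 // 50) <⊠ 0<ε <⊞ (δ p ⊞ δ q ⊞ # (1 // 25) ⊠ δ r)) (lem s t y ε)
        where
        lem : ∀ s t y ε → t - 0ℚ ≡ (1 // 50) * ε + ((s - (1 // 25) * y) + (((1 // 50) * ε - (s - t)) + (1 // 25) * (y - ε)))
        lem = solve-∀ ring
      step : ∀ n → norm (E n (z n) -ᶜ w) ≤ (1 // 50) * ε × norm (E n (π n + - z n) -ᶜ -1ᶜ *ᶜ conj w) ≤ (1 // 50) * ε ×
        (12 // 5 ≤ π n × π n ≤ 17 // 5) × 4 ℕ.≤ n → ε ≤ z n → z n ≤ π n - ε → 0ℚ < im w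
      step n (p , q , (_ , π≤) , 4≤n) ε≤z z≤π = [ case₁ , case₂ ]′ (z n ≤⊎< 12 // 5)
        where
        case₁ : z n ≤ 12 // 5 → 0ℚ < im w
        case₁ h = fin (im (E n (z n))) (im w) (z n) (E-sin-lower n 4≤n (z n) (ℚ.≤-trans (<⇒≤ 0<ε) ε≤z) h) (close (E n (z n)) w p) ε≤z
        case₂ : 12 // 5 < z n → 0ℚ < im w
        case₂ h = fin (im (E n y)) (im w) y (E-sin-lower n 4≤n y (ℚ.≤-trans (<⇒≤ 0<ε) ε≤y) (lem (π n) (z n) π≤ h))
            (subst (λ t → im (E n y) - t ≤ (1 // 50) * ε) (im-neg-conj w) (close (E n y) (-1ᶜ *ᶜ conj w) q)) ε≤y
          where
          y = π n + - z n
          ε≤y : ε ≤ y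
          ε≤y = lem′ (π n) (z n) z≤π
            where
            lem′ : ∀ p z → z ≤ p - ε → ε ≤ p + - z
            lem′ p z h = by≤ (δ h) (solve (p ∷ z ∷ ε ∷ []) ring)
          lem : ∀ p z → p ≤ 17 // 5 → 12 // 5 < z → p + - z ≤ 12 // 5
          lem p z h g = by≤ (δ h ⊞ <⇒≤ (δ< g) ⊞ # (7 // 5)) (solve (p ∷ z ∷ []) ring)

-- Counting full turns by signs of sines

module Windings where

  open Basics
  open Complex
  open Angles
  open import Data.List.Base using ([]; _∷_)
  open import Data.Nat.Base using (ℕ; zero; suc)
  open import Data.Product.Base using (Σ; _×_; _,_; proj₁; proj₂)
  open import Data.Rational.Base as ℚ using (ℚ; 0ℚ; 1ℚ; ½; _+_; _*_; _-_; -_; _≤_; _<_)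
  import Data.Rational.Properties as ℚ
  open import Data.Sum.Base using (_⊎_; inj₁; inj₂; [_,_]′)
  open import Relation.Binary.PropositionalEquality using (_≡_; refl; sym; trans; cong; subst)
  open import Tactic.RingSolver using (solve; solve-∀)

  *ᶜ-comm : ∀ u v → u *ᶜ v ≡ v *ᶜ u
  *ᶜ-comm = solve-∀ ℂ-ring

  *ᶜ-identityʳ : ∀ u → u *ᶜ 1ᶜ ≡ u
  *ᶜ-identityʳ = solve-∀ ℂ-ring

  Angle-turns : ∀ {π} → Angle π -1ᶜ → ∀ j → Angle (λ k → nat j * (π k + π k)) 1ᶜ
  Angle-turns Eπ j = Angle-≡ (λ _ → refl) (1^ j) (Angle-* j (Angle-+ Eπ Eπ))
    where
    1^ : ∀ j → (-1ᶜ *ᶜ -1ᶜ) ^ᶜ j ≡ 1ᶜ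
    1^ zero = refl
    1^ (suc j) = trans (cong ((-1ᶜ *ᶜ -1ᶜ) *ᶜ_) (1^ j)) refl

  im-neg : ∀ w → im (-1ᶜ *ᶜ w) ≡ - im w
  im-neg (cx a b) = lem a b
    where
    lem : ∀ a b → (- 1ℚ) * b + 0ℚ * a ≡ - b
    lem = solve-∀ ring

  -- J n counts the passages of the angles 0, θ, …, nθ through multiples of 2π, read off the signs of the sines.
  record Winding (w : ℂ) (J : ℕ → ℕ) : Set where
    field
      start   : J 0 ≡ 0
      cross   : ∀ n → im (w ^ᶜ n) < 0ℚ → 0ℚ ≤ im (w ^ᶜ suc n) → J (suc n) ≡ suc (J n)
      stay-up : ∀ n → 0ℚ ≤ im (w ^ᶜ n) → J (suc n) ≡ J n
      stay-lo : ∀ n → im (w ^ᶜ suc n) < 0ℚ → J (suc n) ≡ J n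

  open Winding public

  module _ (π : ℕ → ℚ) (Eπ : Angle π -1ᶜ) (π-range : Ev (λ n → 12 // 5 ≤ π n × π n ≤ 17 // 5))
           {θ w J} (Eθ : Angle θ w) {ε₀} (0<ε₀ : 0ℚ < ε₀) (θ-range : Ev (λ k → ε₀ ≤ θ k × θ k ≤ π k - ε₀)) (wind : Winding w J) where

    private
      open Circle π Eπ π-range

      Φ : ℕ → ℕ → ℚ
      Φ n k = nat n * θ k - nat (J n) * (π k + π k)

      AΦ : ∀ n → Angle (Φ n) (w ^ᶜ n)
      AΦ n = Angle-≡ (λ _ → refl) (*ᶜ-identityʳ (w ^ᶜ n)) (Angle-+ (Angle-* n Eθ) (Angle-neg (Angle-turns Eπ (J n))))

      Ψ : ℕ → ℕ → ℚ
      Ψ n k = Φ n k + θ k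

      AΨ : ∀ n → Angle (Ψ n) (w ^ᶜ suc n)
      AΨ n = Angle-≡ (λ _ → refl) (*ᶜ-comm (w ^ᶜ n) w) (Angle-+ (AΦ n) Eθ)

      minus-π : ∀ {z u} → Angle z u → Angle (λ k → z k - π k) (-1ᶜ *ᶜ u)
      minus-π {u = u} a = Angle-≡ (λ _ → refl) (*ᶜ-comm u -1ᶜ) (Angle-+ a (Angle-neg Eπ))

      Φ-stay : ∀ n k → J (suc n) ≡ J n → Φ (suc n) k ≡ Ψ n k
      Φ-stay n k e = trans (cong (λ j → nat (suc n) * θ k - nat j * (π k + π k)) e) (lem (nat n) (θ k) (nat (J n)) (π k))
        where
        lem : ∀ n θ j p → (1ℚ + n) * θ - j * (p + p) ≡ n * θ - j * (p + p) + θ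
        lem = solve-∀ ring

      Φ-cross : ∀ n k → J (suc n) ≡ suc (J n) → Φ (suc n) k ≡ Ψ n k - π k - π k
      Φ-cross n k e = trans (cong (λ j → nat (suc n) * θ k - nat j * (π k + π k)) e) (lem (nat n) (θ k) (nat (J n)) (π k))
        where
        lem : ∀ n θ j p → (1ℚ + n) * θ - (1ℚ + j) * (p + p) ≡ n * θ - j * (p + p) + θ - p - p
        lem = solve-∀ ring

      Upper Lower : ℕ → Set
      Upper n = ∀ {ε} → 0ℚ < ε → Ev (λ k → - ε ≤ Φ n k × Φ n k ≤ π k + ε)
      Lower n = ∀ {ε} → 0ℚ < ε → Ev (λ k → π k - ε ≤ Φ n k × Φ n k ≤ π k + π k + ε)

      -- `θ` keeps the distance `ε₀` from 0 and from π. Adding it to a residue known up to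
      -- `η ≤ ε₀/2` therefore leaves the distance `η` from the relevant end of a half turn, as
      -- `sin-pos` demands.
      tol : ∀ {ε} → 0ℚ < ε → Σ ℚ λ η → 0ℚ < η × η ≤ ε × η ≤ ½ * ε₀
      tol 0<ε = min₂ 0<ε (#< ½ <⊠ 0<ε₀)

      not-both : ∀ {x} {A : Set} → 0ℚ < x → x < 0ℚ → A
      not-both p q = absurd p (<⇒≤ q)

      not-neg : ∀ {u} {A : Set} → 0ℚ < im (-1ᶜ *ᶜ u) → 0ℚ ≤ im u → A
      not-neg {u} p q = absurd (subst (0ℚ <_) (im-neg u) p) (ℚ.neg-antimono-≤ q)

      -- If the new residue exceeded π, its difference with π would lie inside a half turn, and the
      -- sine at `suc n` would be negative.
      up-up : ∀ n → Upper n → 0ℚ ≤ im (w ^ᶜ n) → 0ℚ ≤ im (w ^ᶜ suc n) → Upper (suc n)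
      up-up n inv p q {ε} 0<ε =
        let (η , 0<η , η≤ε , η≤ε₀) = tol 0<ε
        in Ev-map (λ { k ((a , b) , (c , d) , h) → subst (λ x → - ε ≤ x × x ≤ π k + ε) (sym (Φ-stay n k (stay-up wind n p)))
              ( l₁ (Φ n k) (θ k) η a c η≤ε (<⇒≤ 0<ε₀)
              , [ (λ r → r) , (λ r → not-neg {w ^ᶜ suc n} (h (l₂ (Ψ n k) (π k) η r η≤ε) (l₃ (Φ n k) (θ k) (π k) η b d η≤ε₀)) q) ]′ (Ψ n k ≤⊎< π k + ε)) })
            (inv 0<η & θ-range & sin-pos (minus-π (AΨ n)) 0<η)
        where
        l₁ : ∀ f t η → - η ≤ f → ε₀ ≤ t → η ≤ ε → 0ℚ ≤ ε₀ → - ε ≤ f + t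
        l₁ f t η a c e z = by≤ (δ a ⊞ δ c ⊞ δ e ⊞ z) (solve (f ∷ t ∷ η ∷ ε ∷ ε₀ ∷ []) ring)
        l₂ : ∀ x p η → p + ε < x → η ≤ ε → η ≤ x - p
        l₂ x p η r e = by≤ (<⇒≤ (δ< r) ⊞ δ e) (solve (x ∷ p ∷ η ∷ ε ∷ []) ring)
        l₃ : ∀ f t p η → f ≤ p + η → t ≤ p - ε₀ → η ≤ ½ * ε₀ → f + t - p ≤ p - η
        l₃ f t p η b d e = by≤ (δ b ⊞ δ d ⊞ # (2 // 1) ⊠ δ e) (solve (f ∷ t ∷ p ∷ η ∷ ε₀ ∷ []) ring)

      up-lo : ∀ n → Upper n → 0ℚ ≤ im (w ^ᶜ n) → im (w ^ᶜ suc n) < 0ℚ → Lower (suc n)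
      up-lo n inv p q {ε} 0<ε =
        let (η , 0<η , η≤ε , η≤ε₀) = tol 0<ε
        in Ev-map (λ { k ((a , b) , (c , d) , h) → subst (λ x → π k - ε ≤ x × x ≤ π k + π k + ε) (sym (Φ-stay n k (stay-up wind n p)))
              ( [ (λ r → r) , (λ r → not-both (h (l₁ (Φ n k) (θ k) η a c η≤ε₀) (l₂ (Ψ n k) (π k) η r η≤ε)) q) ]′ (π k - ε ≤⊎< Ψ n k)
              , l₃ (Φ n k) (θ k) (π k) η b d η≤ε (<⇒≤ 0<ε₀)) })
            (inv 0<η & θ-range & sin-pos (AΨ n) 0<η)
        where
        l₁ : ∀ f t η → - η ≤ f → ε₀ ≤ t → η ≤ ½ * ε₀ → η ≤ f + t
        l₁ f t η a c e = by≤ (δ a ⊞ δ c ⊞ # (2 // 1) ⊠ δ e) (solve (f ∷ t ∷ η ∷ ε₀ ∷ []) ring)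
        l₂ : ∀ x p η → x < p - ε → η ≤ ε → x ≤ p - η
        l₂ x p η r e = by≤ (<⇒≤ (δ< r) ⊞ δ e) (solve (x ∷ p ∷ η ∷ ε ∷ []) ring)
        l₃ : ∀ f t p η → f ≤ p + η → t ≤ p - ε₀ → η ≤ ε → 0ℚ ≤ ε₀ → f + t ≤ p + p + ε
        l₃ f t p η b d e z = by≤ (δ b ⊞ δ d ⊞ δ e ⊞ z) (solve (f ∷ t ∷ p ∷ η ∷ ε ∷ ε₀ ∷ []) ring)

      lo-lo : ∀ n → Lower n → im (w ^ᶜ suc n) < 0ℚ → Lower (suc n)
      lo-lo n inv q {ε} 0<ε =
        let (η , 0<η , η≤ε , η≤ε₀) = tol 0<ε
        in Ev-map (λ { k ((a , b) , (c , d) , h) → subst (λ x → π k - ε ≤ x × x ≤ π k + π k + ε) (sym (Φ-stay n k (stay-lo wind n q)))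
              ( l₁ (Φ n k) (θ k) (π k) η a c η≤ε (<⇒≤ 0<ε₀)
              , [ (λ r → r) , (λ r → not-both (subst (0ℚ <_) (cong im (-1*-1 (w ^ᶜ suc n)))
                  (h (l₂ (Ψ n k) (π k) η r η≤ε) (l₃ (Φ n k) (θ k) (π k) η b d η≤ε₀))) q) ]′ (Ψ n k ≤⊎< π k + π k + ε)) })
            (inv 0<η & θ-range & sin-pos (minus-π (minus-π (AΨ n))) 0<η)
        where
        l₁ : ∀ f t p η → p - η ≤ f → ε₀ ≤ t → η ≤ ε → 0ℚ ≤ ε₀ → p - ε ≤ f + t
        l₁ f t p η a c e z = by≤ (δ a ⊞ δ c ⊞ δ e ⊞ z) (solve (f ∷ t ∷ p ∷ η ∷ ε ∷ ε₀ ∷ []) ring)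
        l₂ : ∀ x p η → p + p + ε < x → η ≤ ε → η ≤ x - p - p
        l₂ x p η r e = by≤ (<⇒≤ (δ< r) ⊞ δ e) (solve (x ∷ p ∷ η ∷ ε ∷ []) ring)
        l₃ : ∀ f t p η → f ≤ p + p + η → t ≤ p - ε₀ → η ≤ ½ * ε₀ → f + t - p - p ≤ p - η
        l₃ f t p η b d e = by≤ (δ b ⊞ δ d ⊞ # (2 // 1) ⊠ δ e) (solve (f ∷ t ∷ p ∷ η ∷ ε₀ ∷ []) ring)

      -- The only case in which a turn is completed. If the residue were negative after subtracting
      -- the turn, it would still have been in the lower half before, where the sine is negative.
      lo-up : ∀ n → Lower n → im (w ^ᶜ n) < 0ℚ → 0ℚ ≤ im (w ^ᶜ suc n) → Upper (suc n)
      lo-up n inv p q {ε} 0<ε =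
        let (η , 0<η , η≤ε , η≤ε₀) = tol 0<ε
        in Ev-map (λ { k ((a , b) , (c , d) , h) → subst (λ x → - ε ≤ x × x ≤ π k + ε) (sym (Φ-cross n k (cross wind n p q)))
              ( [ (λ r → r) , (λ r → not-neg {w ^ᶜ suc n} (h (l₁ (Φ n k) (θ k) (π k) η a c η≤ε₀) (l₂ (Ψ n k) (π k) η r η≤ε)) q) ]′ (- ε ≤⊎< Ψ n k - π k - π k)
              , l₃ (Φ n k) (θ k) (π k) η b d η≤ε (<⇒≤ 0<ε₀)) })
            (inv 0<η & θ-range & sin-pos (minus-π (AΨ n)) 0<η)
        where
        l₁ : ∀ f t p η → p - η ≤ f → ε₀ ≤ t → η ≤ ½ * ε₀ → η ≤ f + t - p
        l₁ f t p η a c e = by≤ (δ a ⊞ δ c ⊞ # (2 // 1) ⊠ δ e) (solve (f ∷ t ∷ p ∷ η ∷ ε₀ ∷ []) ring)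
        l₂ : ∀ x p η → x - p - p < - ε → η ≤ ε → x - p ≤ p - η
        l₂ x p η r e = by≤ (<⇒≤ (δ< r) ⊞ δ e) (solve (x ∷ p ∷ η ∷ ε ∷ []) ring)
        l₃ : ∀ f t p η → f ≤ p + p + η → t ≤ p - ε₀ → η ≤ ε → 0ℚ ≤ ε₀ → f + t - p - p ≤ p + ε
        l₃ f t p η b d e z = by≤ (δ b ⊞ δ d ⊞ δ e ⊞ z) (solve (f ∷ t ∷ p ∷ η ∷ ε ∷ ε₀ ∷ []) ring)

      Invariant : ℕ → Set
      Invariant n = (0ℚ ≤ im (w ^ᶜ n) → Upper n) × (im (w ^ᶜ n) < 0ℚ → Lower n)

      invariant-suc : ∀ n → Invariant n → Invariant (suc n)
      invariant-suc n (up , lo) =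
          (λ q → [ (λ p → up-up n (up p) p q) , (λ p → lo-up n (lo p) p q) ]′ (0ℚ ≤⊎< im (w ^ᶜ n)))
        , (λ q → [ (λ p → up-lo n (up p) p q) , (λ p → lo-lo n (lo p) q) ]′ (0ℚ ≤⊎< im (w ^ᶜ n)))

      invariant : ∀ n → Invariant n
      invariant zero = (λ _ {ε} 0<ε → Ev-map (λ k (p , _) → subst (λ x → - ε ≤ x × x ≤ π k + ε)
          (sym (trans (cong (λ j → 0ℚ * θ k - nat j * (π k + π k)) (start wind)) (lem₀ (θ k) (π k))))
          (ℚ.neg-antimono-≤ (<⇒≤ 0<ε) , l (π k) p (<⇒≤ 0<ε))) π-range)
        , (λ p → absurd p ℚ.≤-refl)
        where
        lem₀ : ∀ t p → 0ℚ * t - 0ℚ * (p + p) ≡ 0ℚ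
        lem₀ = solve-∀ ring
        l : ∀ p {ε} → 12 // 5 ≤ p → 0ℚ ≤ ε → 0ℚ ≤ p + ε
        l p h q = ℚ.≤-trans (# (12 // 5)) h ⊞ q
      invariant (suc n) = invariant-suc n (invariant n)

      Window : ℕ → Set
      Window n = ∀ {ε} → 0ℚ < ε → Ev (λ k → - ε ≤ Φ n k × Φ n k ≤ π k + π k + ε)

      upper-window : ∀ n → Upper n → Window n
      upper-window n up {ε} 0<ε = Ev-map (λ k ((a , b) , (c , d)) → a , l (Φ n k) (π k) b c) (up 0<ε & π-range)
        where
        l : ∀ f p → f ≤ p + ε → 12 // 5 ≤ p → f ≤ p + p + ε
        l f p h g = by≤ (δ h ⊞ ℚ.≤-trans (# (12 // 5)) g) (solve (f ∷ p ∷ ε ∷ []) ring)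

      lower-window : ∀ n → Lower n → Window n
      lower-window n lo {ε} 0<ε = Ev-map (λ k ((a , b) , (c , d)) → l (Φ n k) (π k) a c , b) (lo 0<ε & π-range)
        where
        l : ∀ f p → p - ε ≤ f → 12 // 5 ≤ p → - ε ≤ f
        l f p h g = by≤ (δ h ⊞ ℚ.≤-trans (# (12 // 5)) g) (solve (f ∷ p ∷ ε ∷ []) ring)

      window : ∀ n → 0ℚ ≤ im (w ^ᶜ n) ⊎ im (w ^ᶜ n) < 0ℚ → Window n
      window n (inj₁ p) = upper-window n (proj₁ (invariant n) p)
      window n (inj₂ p) = lower-window n (proj₂ (invariant n) p)

    -- For `θ = 2π t` this makes `J n` the integer part of `n t`, up to the ambiguity at its jumps.
    winding-window : ∀ n {ε} → 0ℚ < ε →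
      Ev (λ k → - ε ≤ nat n * θ k - nat (J n) * (π k + π k) × nat n * θ k - nat (J n) * (π k + π k) ≤ π k + π k + ε)
    winding-window n = window n (0ℚ ≤⊎< im (w ^ᶜ n))

-- Constructing an argument of a rational point on the unit circle

module Argument where

  open Basics
  open Complex
  open Exponential
  open Estimates
  open Angles
  open import Data.List.Base using ([]; _∷_)
  open import Data.Nat.Base as ℕ using (ℕ; zero; suc)
  import Data.Nat.Properties as ℕ
  open import Data.Product.Base using (Σ; ∃; _×_; _,_; proj₁; proj₂)
  open import Data.Rational.Base as ℚ using (ℚ; 0ℚ; 1ℚ; ½; _+_; _*_; _-_; -_; _≤_; _<_; ∣_∣)
  import Data.Rational.Properties as ℚ
  open import Data.Sum.Base using ([_,_]′)
  open import Relation.Binary.PropositionalEquality using (_≡_; refl; sym; trans; cong; cong₂; subst; subst₂)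
  open import Tactic.RingSolver using (solve; solve-∀)

  Near : ℚ → ℂ → ℚ → Set
  Near x u δ = Ev (λ n → norm (E n x -ᶜ u) ≤ δ)

  ∣x∣²≡x² : ∀ x → ∣ x ∣ * ∣ x ∣ ≡ x * x
  ∣x∣²≡x² x = trans (sym (ℚ.∣p*q∣≡∣p∣*∣q∣ x x)) (ℚ.0≤p⇒∣p∣≡p (0≤sq x))

  -- One step x ↦ x + Im (u · conj e^{ix}): the error of e^{ix} against u is squared, up to a constant.
  module _ (u : ℂ) (u-unit : re u * re u + im u * im u ≡ 1ℚ) {δ₀ : ℚ} (0<δ₀ : 0ℚ < δ₀) (δ₀≤ : δ₀ ≤ 1 // 32) where

    norm-u : norm u ≤ 3 // 2
    norm-u = [ (λ h → h) , (λ h → absurd (l₁ _ h) (l₂ (re u) (im u) (∣ re u ∣) (∣ im u ∣) (∣x∣²≡x² (re u)) (∣x∣²≡x² (im u)) u-unit)) ]′ (norm u ≤⊎< 3 // 2)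
      where
      l₁ : ∀ x → 3 // 2 < x → 9 // 4 < x * x
      l₁ x h = by< (δ< h <⊠ (δ< h <⊞ # (3 // 1))) (solve (x ∷ []) ring)
      l₂ : ∀ a b p q → p * p ≡ a * a → q * q ≡ b * b → a * a + b * b ≡ 1ℚ → (p + q) * (p + q) ≤ 9 // 4
      l₂ a b p q e f g = by≤ (0≤sq (p - q) ⊞ # (2 // 1) ⊠ (δ (≡⇒≤ e) ⊞ δ (≡⇒≤ f) ⊞ δ (≡⇒≤ g)) ⊞ # (1 // 4)) (solve (a ∷ b ∷ p ∷ q ∷ []) ring)

    private
      re-unit : ∀ e → (re (u *ᶜ conj e) * re (u *ᶜ conj e) + im (u *ᶜ conj e) * im (u *ᶜ conj e)) ≡ re (e *ᶜ conj e)
      re-unit e = lem u e u-unit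
        where
        lem′ : ∀ a b p q → (a * p - b * - q) * (a * p - b * - q) + (a * - q + b * p) * (a * - q + b * p) ≡ (a * a + b * b) * (p * p - q * - q)
        lem′ = solve-∀ ring
        lem : ∀ u e → re u * re u + im u * im u ≡ 1ℚ →
          re (u *ᶜ conj e) * re (u *ᶜ conj e) + im (u *ᶜ conj e) * im (u *ᶜ conj e) ≡ re (e *ᶜ conj e)
        lem (cx a b) (cx p q) h = trans (lem′ a b p q) (trans (cong (_* (p * p - q * - q)) h) (ℚ.*-identityˡ (p * p - q * - q)))

      split : ∀ a f g h e v u c → v ≡ u *ᶜ c →
        a -ᶜ u ≡ (a -ᶜ f *ᶜ g) +ᶜ ((f -ᶜ e) *ᶜ g +ᶜ (e *ᶜ ((g -ᶜ h) +ᶜ (h -ᶜ v)) +ᶜ u *ᶜ (e *ᶜ c -ᶜ 1ᶜ)))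
      split a f g h e _ u c refl = trans (-ᶜ-def a u) (trans (lem a f g h e u c) (sym (cong₂ _+ᶜ_ (-ᶜ-def a (f *ᶜ g))
          (cong₂ _+ᶜ_ (cong (_*ᶜ g) (-ᶜ-def f e)) (cong₂ (λ s t → e *ᶜ s +ᶜ u *ᶜ t) (cong₂ _+ᶜ_ (-ᶜ-def g h) (-ᶜ-def h (u *ᶜ c))) (-ᶜ-def (e *ᶜ c) 1ᶜ))))))
        where
        lem : ∀ a f g h e u c → a +ᶜ -ᶜ u ≡
          (a +ᶜ -ᶜ (f *ᶜ g)) +ᶜ ((f +ᶜ -ᶜ e) *ᶜ g +ᶜ (e *ᶜ ((g +ᶜ -ᶜ h) +ᶜ (h +ᶜ -ᶜ (u *ᶜ c))) +ᶜ u *ᶜ (e *ᶜ c +ᶜ -ᶜ 1ᶜ)))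
        lem = solve-∀ ℂ-ring

      v-split : ∀ u e c → u *ᶜ c -ᶜ 1ᶜ ≡ (u -ᶜ e) *ᶜ c +ᶜ (e *ᶜ c -ᶜ 1ᶜ)
      v-split u e c = trans (-ᶜ-def (u *ᶜ c) 1ᶜ) (trans (lem u e c) (sym (cong₂ (λ s t → s *ᶜ c +ᶜ t) (-ᶜ-def u e) (-ᶜ-def (e *ᶜ c) 1ᶜ))))
        where
        lem : ∀ u e c → u *ᶜ c +ᶜ -ᶜ 1ᶜ ≡ (u +ᶜ -ᶜ e) *ᶜ c +ᶜ (e *ᶜ c +ᶜ -ᶜ 1ᶜ)
        lem = solve-∀ ℂ-ring

      tangent-diff : ∀ v → cx 1ℚ (im v) -ᶜ v ≡ real (1ℚ - re v)
      tangent-diff (cx a b) = cong (cx (1ℚ - a)) (ℚ.+-inverseʳ b)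

      norm-split : ∀ a f g h e v c → v ≡ u *ᶜ c → norm (a -ᶜ u) ≤
        norm (a -ᶜ f *ᶜ g) + (norm (f -ᶜ e) * norm g + (norm e * (norm (g -ᶜ h) + norm (h -ᶜ v)) + norm u * norm (e *ᶜ c -ᶜ 1ᶜ)))
      norm-split a f g h e v c eq = subst (λ t → norm t ≤ norm A + (norm F * norm g + (norm e * (norm G + norm H) + norm u * norm U)))
        (sym (split a f g h e v u c eq))
        (ℚ.≤-trans (norm-+ A (F *ᶜ g +ᶜ (e *ᶜ (G +ᶜ H) +ᶜ u *ᶜ U))) (ℚ.+-monoʳ-≤ (norm A)
          (ℚ.≤-trans (norm-+ (F *ᶜ g) (e *ᶜ (G +ᶜ H) +ᶜ u *ᶜ U)) (ℚ.+-mono-≤ (norm-* F g)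
            (ℚ.≤-trans (norm-+ (e *ᶜ (G +ᶜ H)) (u *ᶜ U)) (ℚ.+-mono-≤
              (ℚ.≤-trans (norm-* e (G +ᶜ H)) (ℚ.*-monoˡ-≤-nonNeg (norm e) {{ℚ.nonNegative (0≤norm e)}} (norm-+ G H)))
              (norm-* u U)))))))
        where
        A = a -ᶜ f *ᶜ g
        F = f -ᶜ e
        G = g -ᶜ h
        H = h -ᶜ v
        U = e *ᶜ c -ᶜ 1ᶜ

    module Improve {x δ} (0<δ : 0ℚ < δ) (δ≤ : δ ≤ 1 // 32) (near : Near x u δ) where

      private
        η = (1 // 64) * δ
        0<η : 0ℚ < η
        0<η = #< (1 // 64) <⊠ 0<δ
        0≤η : 0ℚ ≤ (1 // 64) * δ
        0≤η = <⇒≤ 0<η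
        B = suc (proj₁ (archimedean (∣ x ∣)))
        x≤B : ∣ x ∣ + 1ℚ ≤ nat B
        x≤B = ℚ.≤-trans (ℚ.+-monoˡ-≤ 1ℚ (proj₂ (archimedean (∣ x ∣)))) (≡⇒≤ (ℚ.+-comm (nat (proj₁ (archimedean (∣ x ∣)))) 1ℚ))
        x≤B′ : ∣ x ∣ ≤ nat B
        x≤B′ = ℚ.≤-trans (lem (∣ x ∣)) x≤B
          where
          lem : ∀ y → y ≤ y + 1ℚ
          lem y = by≤ (# 1ℚ) (solve (y ∷ []) ring)

        -- The next iterate must be a single rational number, so the correction `s` is computed from
        -- the Taylor polynomial of one fixed degree; at `x` all higher degrees differ from it by at
        -- most `η`.
        anchor : ∃ λ n → norm (E n x -ᶜ u) ≤ δ × (∀ y → ∣ y ∣ ≤ nat B → norm (E n y *ᶜ conj (E n y) -ᶜ 1ᶜ) ≤ η) ×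
          (∀ m → n ℕ.≤ m → ∀ y → ∣ y ∣ ≤ nat B → norm (E m y -ᶜ E n y) ≤ η)
        anchor = Ev⇒∃ (near & E-unit B 0<η & E-tail B 0<η)

        n₁ = proj₁ anchor
        e = E n₁ x
        c = conj e
        v = u *ᶜ c
        s = im v

        e-u : norm (e -ᶜ u) ≤ δ
        e-u = proj₁ (proj₂ anchor)
        ec-1 : norm (e *ᶜ c -ᶜ 1ᶜ) ≤ η
        ec-1 = proj₁ (proj₂ (proj₂ anchor)) x x≤B′

        norm-e : norm e ≤ 8 // 5
        norm-e = lem (norm e) (norm (e -ᶜ u)) (norm u) (subst (λ t → norm t ≤ norm (e -ᶜ u) + norm u) (trans (cong (_+ᶜ u) (-ᶜ-def e u)) (cancel e u)) (norm-+ (e -ᶜ u) u)) e-u norm-u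
          where
          cancel : ∀ e u → (e +ᶜ -ᶜ u) +ᶜ u ≡ e
          cancel = solve-∀ ℂ-ring
          lem : ∀ a b c → a ≤ b + c → b ≤ δ → c ≤ 3 // 2 → a ≤ 8 // 5
          lem a b c p q r = by≤ (Basics.δ p ⊞ Basics.δ q ⊞ Basics.δ r ⊞ Basics.δ δ≤ ⊞ # (11 // 160)) (solve (a ∷ b ∷ c ∷ δ ∷ []) ring)

        -- 13/8 exceeds `8/5 + 1/64`, the contributions of the bound for `norm e` and of `η = δ/64`.
        v-1 : norm (v -ᶜ 1ᶜ) ≤ (13 // 8) * δ
        v-1 = lem (norm (v -ᶜ 1ᶜ)) (norm (u -ᶜ e)) (norm c) (norm (e *ᶜ c -ᶜ 1ᶜ)) (norm ((u -ᶜ e) *ᶜ c))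
            (subst (λ t → norm t ≤ norm ((u -ᶜ e) *ᶜ c) + norm (e *ᶜ c -ᶜ 1ᶜ)) (sym (v-split u e c)) (norm-+ ((u -ᶜ e) *ᶜ c) (e *ᶜ c -ᶜ 1ᶜ)))
            (norm-* (u -ᶜ e) c) (subst (_≤ δ) (norm-swap e u) e-u) (subst (_≤ 8 // 5) (sym (norm-conj e)) norm-e) ec-1 (0≤norm c)
          where
          lem : ∀ a b c d m → a ≤ m + d → m ≤ b * c → b ≤ δ → c ≤ 8 // 5 → d ≤ (1 // 64) * δ → 0ℚ ≤ c → a ≤ (13 // 8) * δ
          lem a b c d m p q r t w z = by≤ (Basics.δ p ⊞ Basics.δ q ⊞ Basics.δ r ⊠ z ⊞ <⇒≤ 0<δ ⊠ Basics.δ t ⊞ Basics.δ w ⊞ # (3 // 320) ⊠ <⇒≤ 0<δ) (solve (a ∷ b ∷ c ∷ d ∷ m ∷ δ ∷ []) ring)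

        im-1 : ∀ v → im (v -ᶜ 1ᶜ) ≡ im v
        im-1 (cx a b) = lem b
          where
          lem : ∀ b → b - 0ℚ ≡ b
          lem = solve-∀ ring
        re-1 : ∀ v → re (v -ᶜ 1ᶜ) ≡ re v - 1ℚ
        re-1 (cx a b) = refl

        s≤ : ∣ s ∣ ≤ (13 // 8) * δ
        s≤ = ℚ.≤-trans (subst (λ t → ∣ t ∣ ≤ norm (v -ᶜ 1ᶜ)) (im-1 v) (im≤norm (v -ᶜ 1ᶜ))) v-1

        s²≤ : s * s ≤ (169 // 64) * (δ * δ)
        s²≤ = subst (_≤ (169 // 64) * (δ * δ)) (∣x∣²≡x² s) (lem (∣ s ∣) s≤ (ℚ.0≤∣p∣ s))
          where
          lem : ∀ t → t ≤ (13 // 8) * δ → 0ℚ ≤ t → t * t ≤ (169 // 64) * (δ * δ)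
          lem t p q = by≤ (Basics.δ p ⊠ (q ⊞ # (13 // 8) ⊠ <⇒≤ 0<δ)) (solve (t ∷ δ ∷ []) ring)

        s≤1 : ∣ s ∣ ≤ 1ℚ
        s≤1 = ℚ.≤-trans s≤ (lem δ δ≤)
          where
          lem : ∀ d → d ≤ 1 // 32 → (13 // 8) * d ≤ 1ℚ
          lem d p = by≤ (# (13 // 8) ⊠ Basics.δ p ⊞ # (243 // 256)) (solve (d ∷ []) ring)

        -- `v` has the modulus of `e`, which is nearly 1, so `(1 - re v) (1 + re v)` is `s²` up to
        -- `η`. The second factor is at least 19/10, and 10/19 is below 3/5. Thus the distance of
        -- `v` from its tangent approximation is quadratic in `s`, up to `η`.
        1-re≤ : norm (cx 1ℚ s -ᶜ v) ≤ (3 // 5) * (s * s + η)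
        1-re≤ = subst (_≤ (3 // 5) * (s * s + η)) (sym (trans (cong norm (tangent-diff v)) (ℚ.+-identityʳ (∣ 1ℚ - re v ∣))))
            (∣x∣≤ (cancel (re v) s (1ℚ - re v) (above (re v) s (re (e *ᶜ c)) (re-unit e) (proj₁ re-ec)) re-v)
                  (cancel (re v) s (- (1ℚ - re v)) (below (re v) s (re (e *ᶜ c)) (re-unit e) (proj₂ re-ec)) re-v))
          where
          re-ec : 1ℚ - re (e *ᶜ c) ≤ η × re (e *ᶜ c) - 1ℚ ≤ η
          re-ec = let h = subst (λ t → ∣ t ∣ ≤ η) (re-1 (e *ᶜ c)) (ℚ.≤-trans (re≤norm (e *ᶜ c -ᶜ 1ᶜ)) ec-1)
                  in lem (re (e *ᶜ c)) (proj₁ (∣x∣≤⇒ h)) (proj₂ (∣x∣≤⇒ h))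
            where
            lem : ∀ r → r - 1ℚ ≤ (1 // 64) * δ → - ((1 // 64) * δ) ≤ r - 1ℚ → 1ℚ - r ≤ (1 // 64) * δ × r - 1ℚ ≤ (1 // 64) * δ
            lem r p q = by≤ (Basics.δ q) (solve (r ∷ δ ∷ []) ring) , p
          re-v : 9 // 10 ≤ re v
          re-v = lem (re v) (proj₂ (∣x∣≤⇒ (subst (λ t → ∣ t ∣ ≤ (13 // 8) * δ) (re-1 v) (ℚ.≤-trans (re≤norm (v -ᶜ 1ᶜ)) v-1))))
            where
            lem : ∀ r → - ((13 // 8) * δ) ≤ r - 1ℚ → 9 // 10 ≤ r
            lem r p = by≤ (Basics.δ p ⊞ # (13 // 8) ⊠ Basics.δ δ≤ ⊞ # (63 // 1280)) (solve (r ∷ δ ∷ []) ring)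
          above : ∀ X s R → X * X + s * s ≡ R → 1ℚ - R ≤ (1 // 64) * δ → (1ℚ - X) * (1ℚ + X) ≤ s * s + (1 // 64) * δ
          above X s R e p = by≤ (Basics.δ p ⊞ Basics.δ (≡⇒≤ (sym e))) (solve (X ∷ s ∷ R ∷ δ ∷ []) ring)
          below : ∀ X s R → X * X + s * s ≡ R → R - 1ℚ ≤ (1 // 64) * δ → - (1ℚ - X) * (1ℚ + X) ≤ s * s + (1 // 64) * δ
          below X s R e p = by≤ (Basics.δ p ⊞ Basics.δ (≡⇒≤ e) ⊞ # (2 // 1) ⊠ 0≤sq s) (solve (X ∷ s ∷ R ∷ δ ∷ []) ring)
          cancel : ∀ X s D → D * (1ℚ + X) ≤ s * s + (1 // 64) * δ → 9 // 10 ≤ X → D ≤ (3 // 5) * (s * s + (1 // 64) * δ)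
          cancel X s D p q = *-cancel-≤ {c = 1ℚ + X} (#< 1ℚ <⊞ ℚ.≤-trans (# (9 // 10)) q)
            (by≤ (Basics.δ p ⊞ (0≤sq s ⊞ 0≤η) ⊠ (# (3 // 5) ⊠ Basics.δ q ⊞ # (7 // 50))) (solve (X ∷ s ∷ D ∷ δ ∷ []) ring))

      -- The linear errors cancel; what remains is of order `s² + η` with `s² ≤ (13/8)² δ²`, and
      -- `δ ≤ 1/32` turns one factor `δ` into a number. Only halving is claimed, which makes the
      -- total movement a geometric series.
      improve : Σ ℚ λ x′ → ∣ x′ - x ∣ ≤ (2 // 1) * δ × Near x′ u (½ * δ)
      improve = x + s , close (∣ s ∣) s≤ refl , Ev-map step (E-+ B 0<η & (n₁ , λ n h → h) & (4 , λ n h → h))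
        where
        x+s-x : x + s - x ≡ s
        x+s-x = lem x s
          where
          lem : ∀ x s → x + s - x ≡ s
          lem = solve-∀ ring
        close : ∀ t → t ≤ (13 // 8) * δ → ∣ s ∣ ≡ t → ∣ x + s - x ∣ ≤ (2 // 1) * δ
        close t p e = subst (_≤ (2 // 1) * δ) (sym (trans (cong ∣_∣ x+s-x) e)) (by≤ (Basics.δ p ⊞ # (3 // 8) ⊠ <⇒≤ 0<δ) (solve (t ∷ δ ∷ []) ring))
        arith : ∀ a t₁ t₂ t₃ t₄ t₅ G e U S → a ≤ t₁ + (t₂ * G + (e * (t₃ + t₄) + U * t₅)) → t₁ ≤ (1 // 64) * δ → t₂ ≤ (1 // 64) * δ → G ≤ 3 // 1 → e ≤ 8 // 5 →
          t₃ ≤ S → t₄ ≤ (3 // 5) * (S + (1 // 64) * δ) → U ≤ 3 // 2 → t₅ ≤ (1 // 64) * δ → S ≤ (169 // 64) * (δ * δ) →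
          0ℚ ≤ G → 0ℚ ≤ t₃ → 0ℚ ≤ t₄ → 0ℚ ≤ t₅ → a ≤ ½ * δ
        arith a t₁ t₂ t₃ t₄ t₅ G e U S p p₁ p₂ pG pe p₃ p₄ pU p₅ pS 0≤G 0≤t₃ 0≤t₄ 0≤t₅ = by≤
          (Basics.δ p ⊞ Basics.δ p₁ ⊞ Basics.δ p₂ ⊠ 0≤G ⊞ 0≤η ⊠ Basics.δ pG ⊞ Basics.δ pe ⊠ (0≤t₃ ⊞ 0≤t₄) ⊞ # (8 // 5) ⊠ (Basics.δ p₃ ⊞ Basics.δ p₄)
            ⊞ Basics.δ pU ⊠ 0≤t₅ ⊞ # (3 // 2) ⊠ Basics.δ p₅ ⊞ # (64 // 25) ⊠ Basics.δ pS ⊞ # (169 // 25) ⊠ (<⇒≤ 0<δ ⊠ Basics.δ δ≤) ⊞ # (601 // 3200) ⊠ <⇒≤ 0<δ)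
          (solve (a ∷ t₁ ∷ t₂ ∷ t₃ ∷ t₄ ∷ t₅ ∷ G ∷ e ∷ U ∷ S ∷ δ ∷ []) ring)
        norm-g : ∀ g → norm (g -ᶜ cx 1ℚ s) ≤ s * s → norm g ≤ 3 // 1
        norm-g g p = lem (norm g) (norm (g -ᶜ cx 1ℚ s)) (∣ s ∣) (s * s)
            (subst (λ t → norm t ≤ norm (g -ᶜ cx 1ℚ s) + norm (cx 1ℚ s)) (trans (cong (_+ᶜ cx 1ℚ s) (-ᶜ-def g (cx 1ℚ s))) (back g (cx 1ℚ s))) (norm-+ (g -ᶜ cx 1ℚ s) (cx 1ℚ s)))
            p s≤1 (subst (_≤ 1ℚ) (∣x∣²≡x² s) (sq1 (∣ s ∣) s≤1 (ℚ.0≤∣p∣ s)))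
          where
          back : ∀ e u → (e +ᶜ -ᶜ u) +ᶜ u ≡ e
          back = solve-∀ ℂ-ring
          sq1 : ∀ t → t ≤ 1ℚ → 0ℚ ≤ t → t * t ≤ 1ℚ
          sq1 t p q = by≤ (Basics.δ p ⊠ (# 1ℚ ⊞ q)) (solve (t ∷ []) ring)
          lem : ∀ g a t q → g ≤ a + (1ℚ + t) → a ≤ q → t ≤ 1ℚ → q ≤ 1ℚ → g ≤ 3 // 1
          lem g a t q h p r w = by≤ (Basics.δ h ⊞ Basics.δ p ⊞ Basics.δ r ⊞ Basics.δ w) (solve (g ∷ a ∷ t ∷ q ∷ []) ring)
        step : ∀ n → (∀ x y → ∣ x ∣ ≤ nat B → ∣ y ∣ ≤ nat B → norm (E n x *ᶜ E n y -ᶜ E n (x + y)) ≤ η) × n₁ ℕ.≤ n × 4 ℕ.≤ n → norm (E n (x + s) -ᶜ u) ≤ ½ * δ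
        step n (h , n₁≤n , 4≤n) = arith (norm (E n (x + s) -ᶜ u)) (norm (E n (x + s) -ᶜ E n x *ᶜ E n s)) (norm (E n x -ᶜ e))
            (norm (E n s -ᶜ cx 1ℚ s)) (norm (cx 1ℚ s -ᶜ v)) (norm (e *ᶜ c -ᶜ 1ᶜ)) (norm (E n s)) (norm e) (norm u) (s * s)
            (norm-split (E n (x + s)) (E n x) (E n s) (cx 1ℚ s) e v c refl)
            (subst (_≤ η) (norm-swap (E n x *ᶜ E n s) (E n (x + s))) (h x s x≤B′ s≤B))
            (proj₂ (proj₂ (proj₂ anchor)) n n₁≤n x x≤B′) (norm-g (E n s) g-h) norm-e g-h 1-re≤ norm-u ec-1 s²≤
            (0≤norm (E n s)) (0≤norm (E n s -ᶜ cx 1ℚ s)) (0≤norm (cx 1ℚ s -ᶜ v)) (0≤norm (e *ᶜ c -ᶜ 1ᶜ))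
          where
          g-h : norm (E n s -ᶜ cx 1ℚ s) ≤ s * s
          g-h = E-tangent n 4≤n s s≤1
          s≤B : ∣ s ∣ ≤ nat B
          s≤B = ℚ.≤-trans s≤1 (lem (nat (proj₁ (archimedean (∣ x ∣)))) (0≤nat (proj₁ (archimedean (∣ x ∣)))))
            where
            lem : ∀ b → 0ℚ ≤ b → 1ℚ ≤ 1ℚ + b
            lem b p = by≤ p (solve (b ∷ []) ring)

    half : ℕ → ℚ
    half zero    = 1ℚ
    half (suc k) = ½ * half k

    0<half : ∀ k → 0ℚ < half k
    0<half zero = #< 1ℚ
    0<half (suc k) = #< ½ <⊠ 0<half k

    half≤1 : ∀ k → half k ≤ 1ℚ
    half≤1 zero = ℚ.≤-refl
    half≤1 (suc k) = lem (half k) (half≤1 k)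
      where
      lem : ∀ h → h ≤ 1ℚ → ½ * h ≤ 1ℚ
      lem h p = by≤ (# ½ ⊠ δ p ⊞ # ½) (solve (h ∷ []) ring)

    half≤inv : ∀ k → half k ≤ inv k
    half≤inv k = *-cancel-≤ (0<nat k) (ℚ.≤-trans (scaled k) (≡⇒≤ (sym (trans (ℚ.*-comm (inv k) (nat (suc k))) (nat*inv k)))))
      where
      scaled : ∀ k → half k * nat (suc k) ≤ 1ℚ
      scaled zero = ℚ.≤-refl
      scaled (suc k) = lem (half k) (nat k) (<⇒≤ (0<half k)) (0≤nat k) (scaled k)
        where
        lem : ∀ h n → 0ℚ ≤ h → 0ℚ ≤ n → h * (1ℚ + n) ≤ 1ℚ → ½ * h * (1ℚ + (1ℚ + n)) ≤ 1ℚ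
        lem h n p q r = by≤ (δ r ⊞ # ½ ⊠ (p ⊠ q)) (solve (h ∷ n ∷ []) ring)

    module Limit {x₀} (near₀ : Near x₀ u δ₀) where

      private
        δₖ : ℕ → ℚ
        δₖ k = half k * δ₀

        0<δₖ : ∀ k → 0ℚ < δₖ k
        0<δₖ k = 0<half k <⊠ 0<δ₀

        δₖ≤ : ∀ k → δₖ k ≤ 1 // 32
        δₖ≤ k = lem (half k) (half≤1 k)
          where
          lem : ∀ h → h ≤ 1ℚ → h * δ₀ ≤ 1 // 32
          lem h p = by≤ (δ p ⊠ <⇒≤ 0<δ₀ ⊞ δ δ₀≤) (solve (h ∷ δ₀ ∷ []) ring)

        iterate : ∀ k → Σ ℚ λ x → Near x u (δₖ k)
        iterate zero = x₀ , Ev-map (λ n p → ℚ.≤-trans p (≡⇒≤ (sym (ℚ.*-identityˡ δ₀)))) near₀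
        iterate (suc k) = let (x , nx) = iterate k ; (x′ , _ , nx′) = Improve.improve (0<δₖ k) (δₖ≤ k) nx
          in x′ , Ev-map (λ n p → ℚ.≤-trans p (≡⇒≤ (sym (ℚ.*-assoc ½ (half k) δ₀)))) nx′

      φ : ℕ → ℚ
      φ k = proj₁ (iterate k)

      φ-step : ∀ k → ∣ φ (suc k) - φ k ∣ ≤ (2 // 1) * δₖ k
      φ-step k = proj₁ (proj₂ (Improve.improve (0<δₖ k) (δₖ≤ k) (proj₂ (iterate k))))

      φ-cauchy : ∀ k j → ∣ φ (j ℕ.+ k) - φ k ∣ ≤ (4 // 1) * δₖ k
      φ-cauchy k j = ℚ.≤-trans (strong j) (lem (δₖ k) (δₖ (j ℕ.+ k)) (<⇒≤ (0<δₖ (j ℕ.+ k))))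
        where
        lem : ∀ a b → 0ℚ ≤ b → (4 // 1) * (a - b) ≤ (4 // 1) * a
        lem a b p = by≤ (# (4 // 1) ⊠ p) (solve (a ∷ b ∷ []) ring)
        -- Keeping the subtracted term makes the geometric series telescope in the induction.
        strong : ∀ j → ∣ φ (j ℕ.+ k) - φ k ∣ ≤ (4 // 1) * (δₖ k - δₖ (j ℕ.+ k))
        strong zero = ≡⇒≤ (trans (cong ∣_∣ (ℚ.+-inverseʳ (φ k))) (sym (trans (cong ((4 // 1) *_) (ℚ.+-inverseʳ (δₖ k))) refl)))
        strong (suc j) = l (φ (suc j ℕ.+ k)) (φ (j ℕ.+ k)) (φ k) (half k * δ₀) (half (j ℕ.+ k)) (φ-step (j ℕ.+ k)) (strong j)
          where
          l : ∀ a b c d h → ∣ a - b ∣ ≤ (2 // 1) * (h * δ₀) → ∣ b - c ∣ ≤ (4 // 1) * (d - h * δ₀) → ∣ a - c ∣ ≤ (4 // 1) * (d - ½ * h * δ₀)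
          l a b c d h p q = ℚ.≤-trans (subst (λ t → ∣ t ∣ ≤ ∣ a - b ∣ + ∣ b - c ∣) (ab a b c) (ℚ.∣p+q∣≤∣p∣+∣q∣ (a - b) (b - c))) (l′ (∣ a - b ∣) (∣ b - c ∣) p q)
            where
            ab : ∀ a b c → (a - b) + (b - c) ≡ a - c
            ab = solve-∀ ring
            l′ : ∀ x y → x ≤ (2 // 1) * (h * δ₀) → y ≤ (4 // 1) * (d - h * δ₀) → x + y ≤ (4 // 1) * (d - ½ * h * δ₀)
            l′ x y p q = by≤ (δ p ⊞ δ q) (solve (x ∷ y ∷ d ∷ h ∷ δ₀ ∷ []) ring)

      φ-near : ∀ k → ∣ φ k - x₀ ∣ ≤ (4 // 1) * δ₀
      φ-near k = subst₂ (λ m d → ∣ φ m - x₀ ∣ ≤ (4 // 1) * d) (ℕ.+-identityʳ k) (ℚ.*-identityˡ δ₀) (φ-cauchy 0 k)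

      Angle-φ : Angle φ u
      Angle-φ = record
        { bound   = b
        ; bounded = 0 , λ k _ → φ≤ k
        ; limit   = λ {ε} 0<ε → Ev-map (close ε) (E-tail b (#< ½ <⊠ 0<ε) & small-inv δ₀ (#< ½ <⊠ 0<ε)) }
        where
        b = proj₁ (archimedean (∣ x₀ ∣ + (4 // 1) * δ₀))
        φ≤ : ∀ k → ∣ φ k ∣ ≤ nat b
        φ≤ k = ℚ.≤-trans (l (φ k) x₀ (φ-near k)) (proj₂ (archimedean (∣ x₀ ∣ + (4 // 1) * δ₀)))
          where
          l : ∀ a c {d} → ∣ a - c ∣ ≤ d → ∣ a ∣ ≤ ∣ c ∣ + d
          l a c {d} p = ℚ.≤-trans (subst (λ t → ∣ t ∣ ≤ ∣ c ∣ + ∣ a - c ∣) (ca a c) (ℚ.∣p+q∣≤∣p∣+∣q∣ c (a - c))) (ℚ.+-monoʳ-≤ (∣ c ∣) p)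
            where
            ca : ∀ a c → c + (a - c) ≡ a
            ca = solve-∀ ring
        close : ∀ ε n → (∀ m → n ℕ.≤ m → ∀ y → ∣ y ∣ ≤ nat b → norm (E m y -ᶜ E n y) ≤ ½ * ε) × δ₀ * inv n ≤ ½ * ε → norm (E n (φ n) -ᶜ u) ≤ ε
        close ε n (h , g) =
          let (N , near) = proj₂ (iterate n)
              -- The error of the `n`-th iterate is controlled only from its own degree `N` on. It
              -- is read off there and carried back to degree `n` by the uniform `E-tail`.
              m = n ℕ.⊔ N
          in l (norm (E n (φ n) -ᶜ u)) (norm (E m (φ n) -ᶜ E n (φ n))) (norm (E m (φ n) -ᶜ u)) (half n) (inv n)
               (subst (λ t → norm (E n (φ n) -ᶜ u) ≤ t + norm (E m (φ n) -ᶜ u)) (norm-swap (E n (φ n)) (E m (φ n))) (norm-tri (E n (φ n)) (E m (φ n)) u))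
               (h m (ℕ.m≤m⊔n n N) (φ n) (φ≤ n)) (near m (ℕ.m≤n⊔m n N)) (half≤inv n) g
          where
          l : ∀ a b c h i → a ≤ b + c → b ≤ ½ * ε → c ≤ h * δ₀ → h ≤ i → δ₀ * i ≤ ½ * ε → a ≤ ε
          l a b c h i p q r w z = by≤ (δ p ⊞ δ q ⊞ δ r ⊞ δ w ⊠ <⇒≤ 0<δ₀ ⊞ δ z) (solve (a ∷ b ∷ c ∷ h ∷ i ∷ δ₀ ∷ ε ∷ []) ring)

-- From Cauchy reals and power series to rational sequences

module Real where

  open Basics
  open Complex
  open Exponential
  open Taylor
  open Angles
  import Defs as D
  open D using (ℝ; mkℝ; fromℚ)
  open ℝ using (seq; cauchy)
  open import Data.Empty using (⊥-elim)
  open import Data.Integer.Base as ℤ using (ℤ; +_; -1ℤ)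
  import Data.Integer.Properties as ℤ
  open import Data.List.Base using ([]; _∷_)
  open import Data.Nat.Base as ℕ using (ℕ; zero; suc; _!)
  import Data.Nat.Properties as ℕ
  open import Data.Product.Base using (Σ; _×_; _,_; proj₁; proj₂)
  open import Data.Rational.Base as ℚ using (ℚ; 0ℚ; 1ℚ; ½; _+_; _*_; _-_; -_; _/_; _≤_; _<_; ∣_∣; toℚᵘ; fromℚᵘ)
  import Data.Rational.Properties as ℚ
  open import Data.Rational.Unnormalised.Base as ℚᵘ using (ℚᵘ; mkℚᵘ; 0ℚᵘ)
  import Data.Rational.Unnormalised.Properties as ℚᵘ
  open import Data.Sum.Base using ([_,_]′)
  open import Function.Base using (_∘_)
  open import Relation.Binary.PropositionalEquality using (_≡_; refl; sym; trans; cong; cong₂; subst; subst₂)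
  open import Tactic.RingSolver using (solve; solve-∀)

  fromℚᵘ-+ : ∀ p q → fromℚᵘ (p ℚᵘ.+ q) ≡ fromℚᵘ p + fromℚᵘ q
  fromℚᵘ-+ p q = ℚ.toℚᵘ-injective (ℚᵘ.≃-trans (ℚ.toℚᵘ-fromℚᵘ (p ℚᵘ.+ q)) (ℚᵘ.≃-sym (ℚᵘ.≃-trans
    (ℚ.toℚᵘ-homo-+ (fromℚᵘ p) (fromℚᵘ q)) (ℚᵘ.+-cong (ℚ.toℚᵘ-fromℚᵘ p) (ℚ.toℚᵘ-fromℚᵘ q)))))

  fromℚᵘ-* : ∀ p q → fromℚᵘ (p ℚᵘ.* q) ≡ fromℚᵘ p * fromℚᵘ q
  fromℚᵘ-* p q = ℚ.toℚᵘ-injective (ℚᵘ.≃-trans (ℚ.toℚᵘ-fromℚᵘ (p ℚᵘ.* q)) (ℚᵘ.≃-sym (ℚᵘ.≃-trans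
    (ℚ.toℚᵘ-homo-* (fromℚᵘ p) (fromℚᵘ q)) (ℚᵘ.*-cong (ℚ.toℚᵘ-fromℚᵘ p) (ℚ.toℚᵘ-fromℚᵘ q)))))

  fromℚᵘ-neg : ∀ p → fromℚᵘ (ℚᵘ.- p) ≡ - fromℚᵘ p
  fromℚᵘ-neg p = ℚ.toℚᵘ-injective (ℚᵘ.≃-trans (ℚ.toℚᵘ-fromℚᵘ (ℚᵘ.- p)) (ℚᵘ.≃-sym (ℚᵘ.≃-trans
    (ℚ.toℚᵘ-homo‿- (fromℚᵘ p)) (ℚᵘ.-‿cong (ℚ.toℚᵘ-fromℚᵘ p)))))

  fromℚᵘ-- : ∀ p q → fromℚᵘ (p ℚᵘ.- q) ≡ fromℚᵘ p - fromℚᵘ q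
  fromℚᵘ-- p q = trans (fromℚᵘ-+ p (ℚᵘ.- q)) (cong (λ v → fromℚᵘ p + v) (fromℚᵘ-neg q))

  fromℚᵘ-abs : ∀ p → fromℚᵘ (ℚᵘ.∣ p ∣) ≡ ∣ fromℚᵘ p ∣
  fromℚᵘ-abs p = ℚ.toℚᵘ-injective (ℚᵘ.≃-trans (ℚ.toℚᵘ-fromℚᵘ (ℚᵘ.∣ p ∣)) (ℚᵘ.≃-sym (ℚᵘ.≃-trans
    (ℚ.toℚᵘ-homo-∣-∣ (fromℚᵘ p)) (ℚᵘ.∣-∣-cong (ℚ.toℚᵘ-fromℚᵘ p)))))

  fromℚᵘ-mono : ∀ {p q} → p ℚᵘ.≤ q → fromℚᵘ p ≤ fromℚᵘ q
  fromℚᵘ-mono {p} {q} h = ℚ.toℚᵘ-cancel-≤ (ℚᵘ.≤-respʳ-≃ (ℚᵘ.≃-sym (ℚ.toℚᵘ-fromℚᵘ q)) (ℚᵘ.≤-respˡ-≃ (ℚᵘ.≃-sym (ℚ.toℚᵘ-fromℚᵘ p)) h))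

  fromℚᵘ-mono-< : ∀ {p q} → p ℚᵘ.< q → fromℚᵘ p < fromℚᵘ q
  fromℚᵘ-mono-< {p} {q} h = ℚ.toℚᵘ-cancel-< (ℚᵘ.<-respʳ-≃ (ℚᵘ.≃-sym (ℚ.toℚᵘ-fromℚᵘ q)) (ℚᵘ.<-respˡ-≃ (ℚᵘ.≃-sym (ℚ.toℚᵘ-fromℚᵘ p)) h))

  fromℚᵘ-cancel : ∀ {p q} → fromℚᵘ p ≤ fromℚᵘ q → p ℚᵘ.≤ q
  fromℚᵘ-cancel {p} {q} h = ℚᵘ.≤-respʳ-≃ (ℚ.toℚᵘ-fromℚᵘ q) (ℚᵘ.≤-respˡ-≃ (ℚ.toℚᵘ-fromℚᵘ p) (ℚ.toℚᵘ-mono-≤ h))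

  fromℚᵘ-cancel-< : ∀ {p q} → fromℚᵘ p < fromℚᵘ q → p ℚᵘ.< q
  fromℚᵘ-cancel-< {p} {q} h = ℚᵘ.<-respʳ-≃ (ℚ.toℚᵘ-fromℚᵘ q) (ℚᵘ.<-respˡ-≃ (ℚ.toℚᵘ-fromℚᵘ p) (ℚ.toℚᵘ-mono-< h))

  ⟦_⟧ : ℝ → ℕ → ℚ
  ⟦ x ⟧ n = fromℚᵘ (seq x n)

  0<ᵘ : ∀ {ε} → 0ℚ < ε → 0ℚᵘ ℚᵘ.< toℚᵘ ε
  0<ᵘ p = ℚ.toℚᵘ-mono-< p

  ⟦⟧-cauchy : ∀ x {ε} → 0ℚ < ε → Ev (λ n → ∀ m → n ℕ.≤ m → ∣ ⟦ x ⟧ m - ⟦ x ⟧ n ∣ ≤ ε)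
  ⟦⟧-cauchy x {ε} p = let (N , h) = cauchy x (toℚᵘ ε) (0<ᵘ p) in N , λ n N≤n m n≤m →
    subst₂ _≤_ (trans (fromℚᵘ-abs (seq x m ℚᵘ.- seq x n)) (cong ∣_∣ (fromℚᵘ-- (seq x m) (seq x n)))) (ℚ.fromℚᵘ-toℚᵘ ε)
      (fromℚᵘ-mono (ℚᵘ.<⇒≤ (h m n (ℕ.≤-trans N≤n n≤m) N≤n)))

  ⟦⟧-bounded : ∀ x → Σ ℕ λ B → Ev (λ n → ∣ ⟦ x ⟧ n ∣ ≤ nat B)
  ⟦⟧-bounded x =
    let (N , h) = ⟦⟧-cauchy x (#< 1ℚ) ; (B , g) = archimedean (∣ ⟦ x ⟧ N ∣ + 1ℚ)
    in B , N , λ n N≤n → ℚ.≤-trans (lem (⟦ x ⟧ n) (⟦ x ⟧ N) (h N ℕ.≤-refl n N≤n)) g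
    where
    lem : ∀ a b → ∣ a - b ∣ ≤ 1ℚ → ∣ a ∣ ≤ ∣ b ∣ + 1ℚ
    lem a b p = ℚ.≤-trans (subst (λ t → ∣ t ∣ ≤ ∣ b ∣ + ∣ a - b ∣) (ba a b) (ℚ.∣p+q∣≤∣p∣+∣q∣ b (a - b))) (ℚ.+-monoʳ-≤ (∣ b ∣) p)
      where
      ba : ∀ a b → b + (a - b) ≡ a
      ba = solve-∀ ring

  <⇒Ev : ∀ {x y} → x D.< y → Σ ℚ λ ε → 0ℚ < ε × Ev (λ n → ⟦ x ⟧ n + ε ≤ ⟦ y ⟧ n)
  <⇒Ev {x} (ε , p , N , h) = fromℚᵘ ε , fromℚᵘ-mono-< p , N , λ n N≤n → subst (_≤ _) (fromℚᵘ-+ (seq x n) ε) (fromℚᵘ-mono (h n N≤n))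

  Ev⇒< : ∀ {x y ε} → 0ℚ < ε → Ev (λ n → ⟦ x ⟧ n + ε ≤ ⟦ y ⟧ n) → x D.< y
  Ev⇒< {x} {y} {ε} p (N , h) = toℚᵘ ε , 0<ᵘ p , N , λ n N≤n → fromℚᵘ-cancel
    (subst (_≤ ⟦ y ⟧ n) (sym (trans (fromℚᵘ-+ (seq x n) (toℚᵘ ε)) (cong (λ v → ⟦ x ⟧ n + v) (ℚ.fromℚᵘ-toℚᵘ ε)))) (h n N≤n))

  -- `≤` is a negation. At a late `n` the rational comparison is decidable, and a violation by `ε`
  -- there persists at all later indices with at least `ε/4` by the Cauchy property, which would
  -- prove `y < x`.
  ≤⇒Ev : ∀ {x y} → x D.≤ y → ∀ {ε} → 0ℚ < ε → Ev (λ n → ⟦ x ⟧ n ≤ ⟦ y ⟧ n + ε)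
  ≤⇒Ev {x} {y} x≤y {ε} 0<ε = Ev-map step (⟦⟧-cauchy x 0<η & ⟦⟧-cauchy y 0<η)
    where
    0<η : 0ℚ < (1 // 4) * ε
    0<η = #< (1 // 4) <⊠ 0<ε
    step : ∀ n → (∀ m → n ℕ.≤ m → ∣ ⟦ x ⟧ m - ⟦ x ⟧ n ∣ ≤ (1 // 4) * ε) × (∀ m → n ℕ.≤ m → ∣ ⟦ y ⟧ m - ⟦ y ⟧ n ∣ ≤ (1 // 4) * ε) → ⟦ x ⟧ n ≤ ⟦ y ⟧ n + ε
    step n (h , g) = [ (λ r → r) , (λ r → ⊥-elim (x≤y (Ev⇒< {y} {x} 0<η (n , λ m n≤m →
        lem (⟦ x ⟧ n) (⟦ y ⟧ n) (⟦ x ⟧ m) (⟦ y ⟧ m) r (proj₂ (∣x∣≤⇒ (h m n≤m))) (proj₁ (∣x∣≤⇒ (g m n≤m))))))) ]′ (⟦ x ⟧ n ≤⊎< ⟦ y ⟧ n + ε)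
      where
      lem : ∀ a b c d → b + ε < a → - ((1 // 4) * ε) ≤ c - a → d - b ≤ (1 // 4) * ε → d + (1 // 4) * ε ≤ c
      lem a b c d p q r = by≤ (<⇒≤ (δ< p) ⊞ δ q ⊞ δ r ⊞ # (1 // 4) ⊠ <⇒≤ 0<ε) (solve (a ∷ b ∷ c ∷ d ∷ ε ∷ []) ring)

  sgn : ℕ → ℚ
  sgn zero    = 1ℚ
  sgn (suc n) = - sgn n

  alt-suc : ∀ a n → alt a (suc n) ≡ alt a n + sgn n * a n
  alt-suc a zero = lem (a 0)
    where
    lem : ∀ x → x - 0ℚ ≡ 0ℚ + 1ℚ * x
    lem = solve-∀ ring
  alt-suc a (suc n) = trans (cong (λ v → a 0 - v) (alt-suc (a ∘ suc) n)) (lem (a 0) (alt (a ∘ suc) n) (sgn n) (a (suc n)))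
    where
    lem : ∀ x y s z → x - (y + s * z) ≡ x - y + - s * z
    lem = solve-∀ ring

  private
    invFact : ℕ → ℚ
    invFact zero    = 1ℚ
    invFact (suc j) = invFact j * inv j

    pow : ℚ → ℕ → ℚ
    pow y zero    = 1ℚ
    pow y (suc j) = y * pow y j

    τ-pow : ∀ y j → τ y j ≡ invFact j * pow y j
    τ-pow y zero = refl
    τ-pow y (suc j) = trans (cong (λ t → y * t * inv j) (τ-pow y j)) (lem y (invFact j) (pow y j) (inv j))
      where
      lem : ∀ y f p i → y * (f * p) * i ≡ f * i * (y * p)
      lem = solve-∀ ring

    fact*invFact : ∀ j → nat (j !) * invFact j ≡ 1ℚ
    fact*invFact zero = refl
    fact*invFact (suc j) = trans (cong (_* (invFact j * inv j)) (nat-* (suc j) (j !)))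
      (trans (lem (nat (suc j)) (nat (j !)) (invFact j) (inv j)) (trans (cong₂ _*_ (nat*inv j) (fact*invFact j)) refl))
      where
      lem : ∀ n f i v → n * f * (i * v) ≡ (n * v) * (f * i)
      lem = solve-∀ ring

    fromℚᵘ-/ : ∀ i n .{{_ : ℕ.NonZero n}} → nat n * fromℚᵘ (i ℚᵘ./ n) ≡ int i
    fromℚᵘ-/ i (suc d) = trans (cong (_* fromℚᵘ (mkℚᵘ i d)) (sym (int-nat (suc d)))) (fromℚᵘ-scale (mkℚᵘ i d))

    int-sgn : ∀ k → int (-1ℤ ℤ.^ k) ≡ sgn k
    int-sgn zero = refl
    int-sgn (suc k) = trans (int-* -1ℤ (-1ℤ ℤ.^ k)) (trans (cong (int -1ℤ *_) (int-sgn k)) (lem (sgn k)))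
      where
      lem : ∀ s → (- 1ℚ) * s ≡ - s
      lem = solve-∀ ring

    altInvFact-value : ∀ k j → fromℚᵘ (D.altInvFact k j) ≡ sgn k * invFact j
    altInvFact-value k j = lem (nat (j !)) (invFact j) (fromℚᵘ (D.altInvFact k j)) (sgn k) (fact*invFact j)
      (trans (fromℚᵘ-/ (-1ℤ ℤ.^ k) (j !) {{j ℕ.!≢0}}) (int-sgn k))
      where
      lem : ∀ f i a s → f * i ≡ 1ℚ → f * a ≡ s → a ≡ s * i
      lem f i a _ e refl = trans (sym (ℚ.*-identityˡ a)) (trans (cong (_* a) (sym e)) (l f i a))
        where
        l : ∀ f i a → f * i * a ≡ f * a * i
        l = solve-∀ ring

    ⟦⟧-^ : ∀ x j i → ⟦ x D.^ j ⟧ i ≡ pow (⟦ x ⟧ i) j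
    ⟦⟧-^ x zero i = refl
    ⟦⟧-^ x (suc j) i = trans (fromℚᵘ-* (seq x i) (seq (x D.^ j) i)) (cong (⟦ x ⟧ i *_) (⟦⟧-^ x j i))

    term-value : ∀ x k j i → ⟦ fromℚ (D.altInvFact k j) D.* x D.^ j ⟧ i ≡ sgn k * τ (⟦ x ⟧ i) j
    term-value x k j i = trans (fromℚᵘ-* (D.altInvFact k j) (seq (x D.^ j) i)) (trans (cong₂ _*_ (altInvFact-value k j) (⟦⟧-^ x j i))
      (trans (ℚ.*-assoc (sgn k) (invFact j) (pow (⟦ x ⟧ i) j)) (cong (sgn k *_) (sym (τ-pow (⟦ x ⟧ i) j)))))

    2*≡dbl : ∀ k → 2 ℕ.* k ≡ dbl k
    2*≡dbl zero = refl
    2*≡dbl (suc k) = cong suc (trans (ℕ.+-suc k (k ℕ.+ 0)) (cong suc (2*≡dbl k)))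

    partial-value : ∀ f a i → (∀ k → ⟦ f k ⟧ i ≡ sgn k * a k) → ∀ n → ⟦ D.partialSum f n ⟧ i ≡ alt a n
    partial-value f a i h zero = refl
    partial-value f a i h (suc n) = trans (fromℚᵘ-+ (seq (D.partialSum f n) i) (seq (f n) i))
      (trans (cong₂ _+_ (partial-value f a i h n) (h n)) (sym (alt-suc a n)))

  cosTerm sinTerm : ℝ → ℕ → ℝ
  cosTerm x k = fromℚ (D.altInvFact k (2 ℕ.* k)) D.* x D.^ (2 ℕ.* k)
  sinTerm x k = fromℚ (D.altInvFact k (suc (2 ℕ.* k))) D.* x D.^ suc (2 ℕ.* k)

  cos-partial : ∀ x n i → ⟦ D.partialSum (cosTerm x) n ⟧ i ≡ re (E n (⟦ x ⟧ i))
  cos-partial x n i = trans (partial-value (cosTerm x) (λ k → τ (⟦ x ⟧ i) (dbl k)) i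
    (λ k → trans (term-value x k (2 ℕ.* k) i) (cong (λ j → sgn k * τ (⟦ x ⟧ i) j) (2*≡dbl k))) n) (cong re (sym (E-alt n (⟦ x ⟧ i))))

  sin-partial : ∀ x n i → ⟦ D.partialSum (sinTerm x) n ⟧ i ≡ im (E n (⟦ x ⟧ i))
  sin-partial x n i = trans (partial-value (sinTerm x) (λ k → τ (⟦ x ⟧ i) (suc (dbl k))) i
    (λ k → trans (term-value x k (suc (2 ℕ.* k)) i) (cong (λ j → sgn k * τ (⟦ x ⟧ i) (suc j)) (2*≡dbl k))) n) (cong im (sym (E-alt n (⟦ x ⟧ i))))

  -- Diagonal convergence of one coordinate g of e^{ix} from the convergence of its partial sums, and back.
  module _ (g : ℂ → ℚ) (g-close : ∀ u v → ∣ g u - g v ∣ ≤ norm (u -ᶜ v)) (x : ℝ) (f : ℕ → ℝ)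
           (f-partial : ∀ n i → ⟦ D.partialSum f n ⟧ i ≡ g (E n (⟦ x ⟧ i))) where

    private
      B = proj₁ (⟦⟧-bounded x)

      dist : ∀ p n i → ⟦ D.∣ D.partialSum f n D.- fromℚ p ∣ ⟧ i ≡ ∣ g (E n (⟦ x ⟧ i)) - fromℚᵘ p ∣
      dist p n i = trans (fromℚᵘ-abs (seq (D.partialSum f n) i ℚᵘ.- p)) (cong ∣_∣ (trans (fromℚᵘ-- (seq (D.partialSum f n) i) p) (cong (_- fromℚᵘ p) (f-partial n i))))

      tri : ∀ a b c {ε} → ∣ a - b ∣ ≤ ½ * ε → ∣ b - c ∣ ≤ ½ * ε → ∣ a - c ∣ ≤ ε
      tri a b c {ε} p q = ℚ.≤-trans (subst (λ t → ∣ t ∣ ≤ ∣ a - b ∣ + ∣ b - c ∣) (l a b c) (ℚ.∣p+q∣≤∣p∣+∣q∣ (a - b) (b - c))) (l′ (∣ a - b ∣) (∣ b - c ∣) p q)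
        where
        l : ∀ a b c → (a - b) + (b - c) ≡ a - c
        l = solve-∀ ring
        l′ : ∀ x y → x ≤ ½ * ε → y ≤ ½ * ε → x + y ≤ ε
        l′ x y p q = by≤ (δ p ⊞ δ q) (solve (x ∷ y ∷ ε ∷ []) ring)

    hasSum⇒limit : ∀ p → D.HasSum f (fromℚ p) → ∀ {ε} → 0ℚ < ε → Ev (λ i → ∣ g (E i (⟦ x ⟧ i)) - fromℚᵘ p ∣ ≤ ε)
    hasSum⇒limit p h {ε} 0<ε =
      let 0<½ε = #< ½ <⊠ 0<ε
          (N , t) = E-tail B 0<½ε
          (M , s) = h (toℚᵘ (½ * ε)) (0<ᵘ 0<½ε)
          n = N ℕ.⊔ M
          (e , 0<e , close) = <⇒Ev {D.∣ D.partialSum f n D.- fromℚ p ∣} {fromℚ (toℚᵘ (½ * ε))} (s n (ℕ.m≤n⊔m N M))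
      in Ev-map (λ i (n≤i , b , c) → tri (g (E i (⟦ x ⟧ i))) (g (E n (⟦ x ⟧ i))) (fromℚᵘ p)
           (ℚ.≤-trans (g-close (E i (⟦ x ⟧ i)) (E n (⟦ x ⟧ i))) (t n (ℕ.m≤m⊔n N M) i n≤i (⟦ x ⟧ i) b))
           (weaken (∣ g (E n (⟦ x ⟧ i)) - fromℚᵘ p ∣) (<⇒≤ 0<e) (subst₂ (λ a b → a + e ≤ b) (dist p n i) (ℚ.fromℚᵘ-toℚᵘ (½ * ε)) c)))
         ((n , λ i h → h) & proj₂ (⟦⟧-bounded x) & close)
      where
      weaken : ∀ a {e} → 0ℚ ≤ e → a + e ≤ ½ * ε → a ≤ ½ * ε
      weaken a {e} q r = by≤ (q ⊞ δ r) (solve (a ∷ e ∷ ε ∷ []) ring)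

    limit⇒hasSum : ∀ p → (∀ {ε} → 0ℚ < ε → Ev (λ i → ∣ g (E i (⟦ x ⟧ i)) - fromℚᵘ p ∣ ≤ ε)) → D.HasSum f (fromℚ p)
    limit⇒hasSum p h ε′ 0<ε′ =
      let ε = fromℚᵘ ε′
          0<ε = fromℚᵘ-mono-< 0<ε′
          0<½ε = #< ½ <⊠ 0<ε
          0<¼ε = #< ½ <⊠ 0<½ε
          (N , t) = E-tail B 0<¼ε
      in N , λ n N≤n → Ev⇒< {D.∣ D.partialSum f n D.- fromℚ p ∣} {fromℚ ε′} 0<½ε
           (Ev-map (λ i (n≤i , b , c) → subst (λ a → a + ½ * ε ≤ ε) (sym (dist p n i))
              (l (∣ g (E n (⟦ x ⟧ i)) - fromℚᵘ p ∣) ε (tri (g (E n (⟦ x ⟧ i))) (g (E i (⟦ x ⟧ i))) (fromℚᵘ p)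
                (ℚ.≤-trans (g-close (E n (⟦ x ⟧ i)) (E i (⟦ x ⟧ i))) (subst (_≤ ½ * (½ * ε)) (norm-swap (E i (⟦ x ⟧ i)) (E n (⟦ x ⟧ i))) (t n N≤n i n≤i (⟦ x ⟧ i) b))) c)))
            ((n , λ i h → h) & proj₂ (⟦⟧-bounded x) & h 0<¼ε))
      where
      l : ∀ a ε → a ≤ ½ * ε → a + ½ * ε ≤ ε
      l a ε q = by≤ (δ q) (solve (a ∷ ε ∷ []) ring)

  re-close : ∀ u v → ∣ re u - re v ∣ ≤ norm (u -ᶜ v)
  re-close (cx a b) (cx c d) = re≤norm (cx a b -ᶜ cx c d)

  im-close : ∀ u v → ∣ im u - im v ∣ ≤ norm (u -ᶜ v)
  im-close (cx a b) (cx c d) = im≤norm (cx a b -ᶜ cx c d)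

  norm-re-im : ∀ u v → norm (u -ᶜ v) ≡ ∣ re u - re v ∣ + ∣ im u - im v ∣
  norm-re-im (cx a b) (cx c d) = refl

  Angle-from-limits : ∀ x c s → (∀ {ε} → 0ℚ < ε → Ev (λ i → ∣ re (E i (⟦ x ⟧ i)) - c ∣ ≤ ε)) →
    (∀ {ε} → 0ℚ < ε → Ev (λ i → ∣ im (E i (⟦ x ⟧ i)) - s ∣ ≤ ε)) → Angle ⟦ x ⟧ (cx c s)
  Angle-from-limits x c s hc hs = record
    { bound   = proj₁ (⟦⟧-bounded x)
    ; bounded = proj₂ (⟦⟧-bounded x)
    ; limit   = λ {ε} 0<ε → Ev-map (λ i (p , q) → subst (_≤ ε) (sym (norm-re-im (E i (⟦ x ⟧ i)) (cx c s)))
        (l ε (∣ re (E i (⟦ x ⟧ i)) - c ∣) (∣ im (E i (⟦ x ⟧ i)) - s ∣) p q)) (hc (#< ½ <⊠ 0<ε) & hs (#< ½ <⊠ 0<ε)) }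
    where
    l : ∀ ε a b → a ≤ ½ * ε → b ≤ ½ * ε → a + b ≤ ε
    l ε a b p q = by≤ (δ p ⊞ δ q) (solve (a ∷ b ∷ ε ∷ []) ring)

  IsCosSin⇒Angle : ∀ x p q → D.IsCos x (fromℚ p) → D.IsSin x (fromℚ q) → Angle ⟦ x ⟧ (cx (fromℚᵘ p) (fromℚᵘ q))
  IsCosSin⇒Angle x p q hc hs = Angle-from-limits x (fromℚᵘ p) (fromℚᵘ q)
    (hasSum⇒limit re re-close x (cosTerm x) (cos-partial x) p hc)
    (hasSum⇒limit im im-close x (sinTerm x) (sin-partial x) q hs)

  Angle⇒IsSin : ∀ x {w} p → Angle ⟦ x ⟧ w → im w ≡ fromℚᵘ p → D.IsSin x (fromℚ p)
  Angle⇒IsSin x {w} p a e = limit⇒hasSum im im-close x (sinTerm x) (sin-partial x) p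
    (λ {ε} 0<ε → Ev-map (λ i h → subst (λ s → ∣ im (E i (⟦ x ⟧ i)) - s ∣ ≤ ε) e (ℚ.≤-trans (im-close (E i (⟦ x ⟧ i)) w) h)) (limit a 0<ε))

-- Bounds for π and the value e^{iπ} = -1

module Pi where

  open Basics
  open Complex
  open Exponential
  open Estimates
  open Angles
  open Argument
  open Real
  import Defs as D
  open D using (ℝ; mkℝ; fromℚ)
  open ℝ using (seq; cauchy)
  open import Data.List.Base using ([]; _∷_)
  open import Data.Nat.Base as ℕ using (ℕ)
  import Data.Nat.Properties as ℕ
  open import Data.Product.Base using (Σ; _×_; _,_; proj₁; proj₂)
  open import Data.Rational.Base as ℚ using (ℚ; 0ℚ; 1ℚ; ½; _+_; _*_; _-_; -_; _≤_; _<_; ∣_∣; toℚᵘ; fromℚᵘ)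
  import Data.Rational.Properties as ℚ
  open import Data.Rational.Unnormalised.Base as ℚᵘ using (ℚᵘ; 0ℚᵘ)
  open import Data.Sum.Base using ([_,_]′)
  open import Relation.Binary.PropositionalEquality using (_≡_; refl; sym; trans; cong; cong₂; subst)
  open import Tactic.RingSolver using (solve; solve-∀)

  CauchyModulus : (ℕ → ℚ) → Set
  CauchyModulus f = ∀ {ε} → 0ℚ < ε → Σ ℕ λ N → ∀ m n → N ℕ.≤ m → N ℕ.≤ n → ∣ f m - f n ∣ < ε

  fromSeq : (f : ℕ → ℚ) → CauchyModulus f → ℝ
  fromSeq f h = mkℝ (λ n → toℚᵘ (f n)) λ ε 0<ε → let (N , g) = h (fromℚᵘ-mono-< 0<ε) in N , λ m n N≤m N≤n →
    fromℚᵘ-cancel-< (subst (_< fromℚᵘ ε) (sym (trans (fromℚᵘ-abs (toℚᵘ (f m) ℚᵘ.- toℚᵘ (f n))) (cong ∣_∣ (trans (fromℚᵘ-- (toℚᵘ (f m)) (toℚᵘ (f n)))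
      (cong₂ _-_ (ℚ.fromℚᵘ-toℚᵘ (f m)) (ℚ.fromℚᵘ-toℚᵘ (f n))))))) (g m n N≤m N≤n))

  ⟦fromSeq⟧ : ∀ f (h : CauchyModulus f) n → ⟦ fromSeq f h ⟧ n ≡ f n
  ⟦fromSeq⟧ f h n = ℚ.fromℚᵘ-toℚᵘ (f n)

  private
    near-i : Near (11 // 7) iᶜ (1 // 32)
    near-i = 4 , λ n h → ℚ.≤-trans (E-11/7 n h) (#≤ (1 // 40) (1 // 32))

    module L = Limit iᶜ refl (#< (1 // 32)) ℚ.≤-refl near-i

    twice : ℕ → ℚ
    twice k = L.φ k + L.φ k

    twice-cauchy : CauchyModulus twice
    twice-cauchy {ε} 0<ε = N , λ m n N≤m N≤n → lem (L.φ m) (L.φ n) (L.φ N) (half iᶜ refl (#< (1 // 32)) ℚ.≤-refl N) (inv N) (near m N≤m) (near n N≤n) (half≤inv iᶜ refl (#< (1 // 32)) ℚ.≤-refl N) (proj₂ Ns N ℕ.≤-refl)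
      where
      Ns = small-inv 1ℚ (#< (1 // 2) <⊠ 0<ε)
      N = proj₁ Ns
      near : ∀ m → N ℕ.≤ m → ∣ L.φ m - L.φ N ∣ ≤ (4 // 1) * (half iᶜ refl (#< (1 // 32)) ℚ.≤-refl N * (1 // 32))
      near m h = subst (λ k → ∣ L.φ k - L.φ N ∣ ≤ _) (ℕ.m∸n+n≡m h) (L.φ-cauchy N (m ℕ.∸ N))
      lem : ∀ a b c h i → ∣ a - c ∣ ≤ (4 // 1) * (h * (1 // 32)) → ∣ b - c ∣ ≤ (4 // 1) * (h * (1 // 32)) → h ≤ i → 1ℚ * i ≤ (1 // 2) * ε → ∣ (a + a) - (b + b) ∣ < ε
      lem a b c h i p q r w = ℚ.≤-<-trans (∣x∣≤
          (up a b c h (proj₁ (∣x∣≤⇒ p)) (proj₂ (∣x∣≤⇒ q))) (down a b c h (proj₂ (∣x∣≤⇒ p)) (proj₁ (∣x∣≤⇒ q)))) (fin h r w)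
        where
        up : ∀ a b c h → a - c ≤ (4 // 1) * (h * (1 // 32)) → - ((4 // 1) * (h * (1 // 32))) ≤ b - c → (a + a) - (b + b) ≤ ½ * h
        up a b c h p q = by≤ (# (2 // 1) ⊠ (δ p ⊞ δ q)) (solve (a ∷ b ∷ c ∷ h ∷ []) ring)
        down : ∀ a b c h → - ((4 // 1) * (h * (1 // 32))) ≤ a - c → b - c ≤ (4 // 1) * (h * (1 // 32)) → - ((a + a) - (b + b)) ≤ ½ * h
        down a b c h p q = by≤ (# (2 // 1) ⊠ (δ p ⊞ δ q)) (solve (a ∷ b ∷ c ∷ h ∷ []) ring)
        fin : ∀ h → h ≤ i → 1ℚ * i ≤ (1 // 2) * ε → ½ * h < ε
        fin h r w = by< ((#< (3 // 4) <⊠ 0<ε) <⊞ (# ½ ⊠ (δ r ⊞ δ w))) (solve (h ∷ i ∷ ε ∷ []) ring)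

    -- A zero of the sine near 22/7, which bounds π from above.
    ρ : ℝ
    ρ = fromSeq twice twice-cauchy

    -- The iteration starts at 11/7 and moves by at most `4 · 1/32`, so the doubled iterates stay
    -- within 1/4 of 22/7. The upper bound leaves room for a tolerance of 1/300 below 17/5.
    twice-range : ∀ k → 5 // 2 ≤ twice k × twice k ≤ 339 // 100 + 1 // 300
    twice-range k = let (p , q) = ∣x∣≤⇒ (L.φ-near k) in lo (L.φ k) q , hi (L.φ k) p
      where
      lo : ∀ f → - ((4 // 1) * (1 // 32)) ≤ f - 11 // 7 → 5 // 2 ≤ f + f
      lo f h = by≤ (# (2 // 1) ⊠ δ h ⊞ # (11 // 28)) (solve (f ∷ []) ring)
      hi : ∀ f → f - 11 // 7 ≤ (4 // 1) * (1 // 32) → f + f ≤ 339 // 100 + 1 // 300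
      hi f h = by≤ (# (2 // 1) ⊠ δ h ⊞ # (1 // 2100)) (solve (f ∷ []) ring)

    sin-ρ : D.IsSin ρ (fromℚ 0ℚᵘ)
    sin-ρ = Angle⇒IsSin ρ {iᶜ *ᶜ iᶜ} 0ℚᵘ (Angle-≡ (λ n → sym (⟦fromSeq⟧ twice twice-cauchy n)) refl (Angle-+ L.Angle-φ L.Angle-φ)) refl

  module _ (π : ℝ) (isPi : D.IsPi π) where

    private
      0<π = proj₁ isPi
      first = proj₂ (proj₂ isPi)

      0<ρ : fromℚ 0ℚᵘ D.< ρ
      0<ρ = Ev⇒< {fromℚ 0ℚᵘ} {ρ} (#< (5 // 2)) (0 , λ n _ → subst (0ℚ + 5 // 2 ≤_) (sym (⟦fromSeq⟧ twice twice-cauchy n)) (proj₁ (twice-range n)))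

      -- `ρ` is a positive zero of the sine and π is the first one, so `ρ < π` is impossible.
      π≤ρ : ∀ {ε} → 0ℚ < ε → Ev (λ n → ⟦ π ⟧ n ≤ ⟦ ρ ⟧ n + ε)
      π≤ρ = ≤⇒Ev {π} {ρ} (λ ρ<π → first ρ 0<ρ ρ<π sin-ρ)

      sin→0 : ∀ {ε} → 0ℚ < ε → Ev (λ i → ∣ im (E i (⟦ π ⟧ i)) - 0ℚ ∣ ≤ ε)
      sin→0 = hasSum⇒limit im im-close π (sinTerm π) (sin-partial π) 0ℚᵘ (proj₁ (proj₂ isPi))

      π≤ : Ev (λ n → ⟦ π ⟧ n ≤ 17 // 5)
      π≤ = Ev-map (λ n p → lem (⟦ π ⟧ n) (twice n) (subst (λ r → ⟦ π ⟧ n ≤ r + 1 // 300) (⟦fromSeq⟧ twice twice-cauchy n) p) (proj₂ (twice-range n))) (π≤ρ (#< (1 // 300)))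
        where
        lem : ∀ a b → a ≤ b + 1 // 300 → b ≤ 339 // 100 + 1 // 300 → a ≤ 17 // 5
        lem a b p q = by≤ (δ p ⊞ δ q ⊞ # (1 // 300)) (solve (a ∷ b ∷ []) ring)

      -- Between a positive `ε` and 12/5 the sine is at least `ε/25`, so it cannot tend to 0 there.
      ≤π : Ev (λ n → 12 // 5 ≤ ⟦ π ⟧ n)
      ≤π = let (ε , 0<ε , pos) = <⇒Ev {fromℚ 0ℚᵘ} {π} 0<π
           in Ev-map (λ n (p , q , 4≤n) → [ (λ r → r) , (λ r → step ε 0<ε n p q 4≤n r) ]′ (12 // 5 ≤⊎< ⟦ π ⟧ n))
                (pos & sin→0 (#< (1 // 50) <⊠ 0<ε) & (4 , λ n h → h))
        where
        step : ∀ ε → 0ℚ < ε → ∀ n → 0ℚ + ε ≤ ⟦ π ⟧ n → ∣ im (E n (⟦ π ⟧ n)) - 0ℚ ∣ ≤ (1 // 50) * ε → 4 ℕ.≤ n → ⟦ π ⟧ n < 12 // 5 → 12 // 5 ≤ ⟦ π ⟧ n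
        step ε 0<ε n p q 4≤n r = absurd {0ℚ} {(1 // 50) * ε} (#< (1 // 50) <⊠ 0<ε)
            (lem (⟦ π ⟧ n) (im (E n (⟦ π ⟧ n))) p (proj₁ (∣x∣≤⇒ q)) (E-sin-lower n 4≤n (⟦ π ⟧ n) (ℚ.≤-trans (subst (0ℚ ≤_) (sym (ℚ.+-identityˡ ε)) (<⇒≤ 0<ε)) p) (<⇒≤ r)))
          where
          lem : ∀ y s → 0ℚ + ε ≤ y → s - 0ℚ ≤ (1 // 50) * ε → (1 // 25) * y ≤ s → (1 // 50) * ε ≤ 0ℚ
          lem y s a b c = by≤ (# (1 // 25) ⊠ δ a ⊞ δ b ⊞ δ c) (l ε y s)
            where
            l : ∀ ε y s → 0ℚ - (1 // 50) * ε ≡ (1 // 25) * (y - (0ℚ + ε)) + (((1 // 50) * ε - (s - 0ℚ)) + (s - (1 // 25) * y))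
            l = solve-∀ ring

    π-range : Ev (λ n → 12 // 5 ≤ ⟦ π ⟧ n × ⟦ π ⟧ n ≤ 17 // 5)
    π-range = ≤π & π≤

    private
      -- The sine tends to 0 and the modulus to 1, so `(1 + c) (1 - c)` tends to 0. From `c ≤ 4/5`
      -- the second factor is at least 1/5 and may be divided out.
      cos→-1 : ∀ {ε} → 0ℚ < ε → Ev (λ i → ∣ re (E i (⟦ π ⟧ i)) - (- 1ℚ) ∣ ≤ ε)
      cos→-1 {ε} 0<ε =
        let (η , 0<η , η≤1 , 10η≤ε) = small {ε} {10 // 1} 0<ε (# (10 // 1))
        in Ev-map (λ n (s , u , b , (lo , hi) , 4≤n) → step η 0<η η≤1 10η≤ε (E n (⟦ π ⟧ n)) s (u (⟦ π ⟧ n) b) (E-cos≤4/5 n 4≤n (⟦ π ⟧ n) lo hi))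
             (sin→0 0<η & E-unit (proj₁ (⟦⟧-bounded π)) 0<η & proj₂ (⟦⟧-bounded π) & π-range & (4 , λ n h → h))
        where
        step : ∀ η → 0ℚ < η → η ≤ 1ℚ → η * (10 // 1) ≤ ε → ∀ u → ∣ im u - 0ℚ ∣ ≤ η → norm (u *ᶜ conj u -ᶜ 1ᶜ) ≤ η → re u ≤ 4 // 5 → ∣ re u - (- 1ℚ) ∣ ≤ ε
        step η 0<η η≤1 h (cx c s) p q r =
          let (q₁ , q₂) = ∣x∣≤⇒ (ℚ.≤-trans (re≤norm (cx c s *ᶜ conj (cx c s) -ᶜ 1ᶜ)) q)
              s² = sq (∣ s - 0ℚ ∣) p (ℚ.0≤∣p∣ (s - 0ℚ)) (∣x∣²≡x² (s - 0ℚ))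
              0<1-c = #< (1 // 5) <⊞ δ r
          in ℚ.≤-trans (∣x∣≤ (*-cancel-≤ 0<1-c (up c s η r s² q₁ q₂ (<⇒≤ 0<η))) (*-cancel-≤ 0<1-c (down c s η r s² q₂ q₁ (<⇒≤ 0<η)))) h
          where
          sq : ∀ t → t ≤ η → 0ℚ ≤ t → t * t ≡ (s - 0ℚ) * (s - 0ℚ) → (s - 0ℚ) * (s - 0ℚ) ≤ η
          sq t p 0≤t e = by≤ (δ p ⊠ (0≤t ⊞ <⇒≤ 0<η) ⊞ <⇒≤ 0<η ⊠ δ η≤1 ⊞ δ (≡⇒≤ (sym e))) (solve (t ∷ s ∷ η ∷ []) ring)
          up : ∀ c s η → c ≤ 4 // 5 → (s - 0ℚ) * (s - 0ℚ) ≤ η → (c * c - s * - s) - 1ℚ ≤ η → - η ≤ (c * c - s * - s) - 1ℚ → 0ℚ ≤ η →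
               (c - (- 1ℚ)) * (1 // 5 + (4 // 5 - c)) ≤ (η * (10 // 1)) * (1 // 5 + (4 // 5 - c))
          up c s η r a b d z = by≤ (# (10 // 1) ⊠ (z ⊠ δ r) ⊞ δ a ⊞ δ d) (solve (c ∷ s ∷ η ∷ []) ring)
          down : ∀ c s η → c ≤ 4 // 5 → (s - 0ℚ) * (s - 0ℚ) ≤ η → - η ≤ (c * c - s * - s) - 1ℚ → (c * c - s * - s) - 1ℚ ≤ η → 0ℚ ≤ η →
               - (c - (- 1ℚ)) * (1 // 5 + (4 // 5 - c)) ≤ (η * (10 // 1)) * (1 // 5 + (4 // 5 - c))
          down c s η r a b d z = by≤ (# (10 // 1) ⊠ (z ⊠ δ r) ⊞ δ d ⊞ z ⊞ 0≤sq s) (solve (c ∷ s ∷ η ∷ []) ring)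

    Angle-π : Angle ⟦ π ⟧ -1ᶜ
    Angle-π = Angle-from-limits π (- 1ℚ) 0ℚ cos→-1 sin→0

-- No power of w is real: w is not a root of unity

module Irrational where

  open Basics
  open Complex
  open Angles
  open import Data.Empty using (⊥; ⊥-elim)
  open import Data.Integer.Base as ℤ using (ℤ; +_; 1ℤ; 0ℤ; -[1+_])
  import Data.Integer.Properties as ℤ
  import Data.Integer.Tactic.RingSolver as ℤ-solver
  open import Data.Nat.Base as ℕ using (ℕ; zero; suc)
  import Data.Nat.Properties as ℕ
  open import Data.Nat.Coprimality using (Coprime; coprime-divisor; sym; recompute)
  open import Data.Nat.Divisibility using (_∣_; divides; ∣1⇒≡1)
  open import Data.Nat.Primality using (Prime; prime?; euclidsLemma)
  open import Data.Product.Base using (_,_)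
  open import Data.Rational.Base as ℚ using (ℚ; 0ℚ; 1ℚ; ½; _+_; _*_; _-_; -_; _≤_; _<_; ∣_∣; toℚᵘ)
  import Data.Rational.Properties as ℚ
  open import Data.Sum.Base using (_⊎_; inj₁; inj₂; [_,_]′)
  open import Relation.Binary.PropositionalEquality as ≡ using (_≡_; _≢_; refl; trans; cong; cong₂; subst)
  open import Relation.Nullary.Decidable using (from-yes)
  open import Tactic.RingSolver using (solve; solve-∀)

  scale : ∀ q → int (ℚ.↧ q) * q ≡ int (ℚ.↥ q)
  scale q@record{} = subst (λ r → int (ℚ.↧ q) * r ≡ int (ℚ.↥ q)) (ℚ.fromℚᵘ-toℚᵘ q) (fromℚᵘ-scale (toℚᵘ q))

  numerator-coprime : ∀ q → Coprime ℤ.∣ ℚ.↥ q ∣ ℤ.∣ ℚ.↧ q ∣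
  numerator-coprime (ℚ.mkℚ n d c) = recompute c

  private
    prime-3 : Prime 3
    prime-3 = from-yes (prime? 3)

    3∣square : ∀ b → 3 ∣ b ℕ.* b → 3 ∣ b
    3∣square b h = [ (λ r → r) , (λ r → r) ]′ (euclidsLemma b b prime-3 h)

    -- 3 divides `4 b²`, hence `b`, and then `f`, against coprimality.
    no-√3 : ∀ b f → Coprime b f → 4 ℕ.* (b ℕ.* b) ≡ 3 ℕ.* (f ℕ.* f) → ⊥
    no-√3 b f cop e = absurd-1 (cop (3∣b , 3∣f 3∣b))
      where
      open import Data.Nat.Solver using (module +-*-Solver)
      open +-*-Solver
      absurd-1 : 3 ≡ 1 → ⊥
      absurd-1 ()
      3∣b : 3 ∣ b
      3∣b = [ (λ { (divides zero ()) ; (divides (suc zero) ()) ; (divides (suc (suc _)) ()) }) , 3∣square b ]′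
        (euclidsLemma 4 (b ℕ.* b) prime-3 (divides (f ℕ.* f) (trans e (ℕ.*-comm 3 (f ℕ.* f)))))
      3∣f : 3 ∣ b → 3 ∣ f
      3∣f (divides c refl) = 3∣square f (divides (4 ℕ.* (c ℕ.* c)) (ℕ.*-cancelˡ-≡ (f ℕ.* f) (4 ℕ.* (c ℕ.* c) ℕ.* 3) 3
        (trans (≡.sym e) (+-*-Solver.solve 1 (λ c → con 4 :* (c :* con 3 :* (c :* con 3)) := con 3 :* (con 4 :* (c :* c) :* con 3)) refl c))))

  -- The sines of the multiples of the angle are q U_n(2p) for a monic integer polynomial U_n,
  -- so a vanishing one forces 2p to be an integer.
  module _ (p q : ℚ) (unit : p * p + q * q ≡ 1ℚ) (p≢0 : p ≢ 0ℚ) (q≢0 : q ≢ 0ℚ) where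

    private
      w : ℂ
      w = cx p q
      g = p + p
      A = ℚ.↥ g
      D = ℚ.↧ g

      -- The Chebyshev polynomials of the second kind at `p`, shifted by one index.
      U : ℕ → ℚ
      U zero          = 0ℚ
      U (suc zero)    = 1ℚ
      U (suc (suc n)) = g * U (suc n) - U n

      -- The theorem of Cayley and Hamilton for multiplication by `w`, of trace `2p` and determinant
      -- 1.
      cayley : ∀ v → w *ᶜ (w *ᶜ v) ≡ real g *ᶜ (w *ᶜ v) -ᶜ v
      cayley (cx a b) = cong₂ cx
        (trans (l₁ p q a b) (trans (cong (λ t → g * (p * a - q * b) - 0ℚ * (p * b + q * a) - t * a) unit) (l₂ (g * (p * a - q * b) - 0ℚ * (p * b + q * a)) a)))
        (trans (l₃ p q a b) (trans (cong (λ t → g * (p * b + q * a) + 0ℚ * (p * a - q * b) - t * b) unit) (l₂ (g * (p * b + q * a) + 0ℚ * (p * a - q * b)) b)))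
        where
        l₁ : ∀ p q a b → p * (p * a - q * b) - q * (p * b + q * a) ≡ (p + p) * (p * a - q * b) - 0ℚ * (p * b + q * a) - (p * p + q * q) * a
        l₁ = solve-∀ ring
        l₂ : ∀ x a → x - 1ℚ * a ≡ x - a
        l₂ = solve-∀ ring
        l₃ : ∀ p q a b → p * (p * b + q * a) + q * (p * a - q * b) ≡ (p + p) * (p * b + q * a) + 0ℚ * (p * a - q * b) - (p * p + q * q) * b
        l₃ = solve-∀ ring

      im-recurrence : ∀ v → im (w *ᶜ (w *ᶜ v)) ≡ g * im (w *ᶜ v) - im v
      im-recurrence v = trans (cong im (cayley v)) (lem (w *ᶜ v) v)
        where
        lem : ∀ u v → im (real g *ᶜ u -ᶜ v) ≡ g * im u - im v
        lem (cx a b) (cx c d) = l g a b d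
          where
          l : ∀ g a b d → g * b + 0ℚ * a - d ≡ g * b - d
          l = solve-∀ ring

      im-U : ∀ n → im (w ^ᶜ n) ≡ q * U n
      im-U zero = ≡.sym (ℚ.*-zeroʳ q)
      im-U (suc zero) = l p q
        where
        l : ∀ p q → p * 0ℚ + q * 1ℚ ≡ q * 1ℚ
        l = solve-∀ ring
      im-U (suc (suc n)) = trans (im-recurrence (w ^ᶜ n)) (trans (cong₂ (λ a b → g * a - b) (im-U (suc n)) (im-U n)) (l g q (U (suc n)) (U n)))
        where
        l : ∀ g q a b → g * (q * a) - q * b ≡ q * (g * a - b)
        l = solve-∀ ring

      -- Clears denominators: `h n` is `Dⁿ U (n + 1)`. Modulo `D` only its leading part `Aⁿ`
      -- survives, and `k` is the quotient of the difference by `D`.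
      h k : ℕ → ℤ
      h zero          = 1ℤ
      h (suc zero)    = A
      h (suc (suc n)) = A ℤ.* h (suc n) ℤ.- D ℤ.* D ℤ.* h n
      k zero          = 0ℤ
      k (suc zero)    = 0ℤ
      k (suc (suc n)) = A ℤ.* k (suc n) ℤ.- D ℤ.* h n

      h-mod : ∀ n → h n ≡ A ℤ.^ n ℤ.+ D ℤ.* k n
      h-mod zero = l D
        where
        l : ∀ d → 1ℤ ≡ 1ℤ ℤ.+ d ℤ.* 0ℤ
        l = ℤ-solver.solve-∀
      h-mod (suc zero) = l A D
        where
        l : ∀ a d → a ≡ a ℤ.* 1ℤ ℤ.+ d ℤ.* 0ℤ
        l = ℤ-solver.solve-∀
      h-mod (suc (suc n)) = trans (cong (λ t → A ℤ.* t ℤ.- D ℤ.* D ℤ.* h n) (h-mod (suc n))) (l A D (A ℤ.^ suc n) (k (suc n)) (h n))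
        where
        l : ∀ a d x y z → a ℤ.* (x ℤ.+ d ℤ.* y) ℤ.- d ℤ.* d ℤ.* z ≡ a ℤ.* x ℤ.+ d ℤ.* (a ℤ.* y ℤ.- d ℤ.* z)
        l = ℤ-solver.solve-∀

      powℚ : ℚ → ℕ → ℚ
      powℚ x zero    = 1ℚ
      powℚ x (suc n) = x * powℚ x n

      h-U : ∀ n → int (h n) ≡ powℚ (int D) n * U (suc n)
      h-U zero = refl
      h-U (suc zero) = trans (≡.sym (scale g)) (l (int D) g)
        where
        l : ∀ d g → d * g ≡ d * 1ℚ * (g * 1ℚ - 0ℚ)
        l = solve-∀ ring
      h-U (suc (suc n)) = trans (int-+ (A ℤ.* h (suc n)) (ℤ.- (D ℤ.* D ℤ.* h n)))
        (trans (cong₂ _+_ (int-* A (h (suc n))) (trans (int-neg (D ℤ.* D ℤ.* h n)) (cong (λ t → - t) (trans (int-* (D ℤ.* D) (h n)) (cong (_* int (h n)) (int-* D D))))))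
        (trans (cong₂ (λ a b → int A * a + - (int D * int D * b)) (h-U (suc n)) (h-U n))
          (trans (cong (λ t → t * (int D * powℚ (int D) n * U (2 ℕ.+ n)) + - (int D * int D * (powℚ (int D) n * U (suc n)))) (≡.sym (scale g)))
            (l (int D) g (powℚ (int D) n) (U (2 ℕ.+ n)) (U (suc n))))))
        where
        l : ∀ d g x a b → d * g * (d * x * a) + - (d * d * (x * b)) ≡ d * (d * x) * (g * a - b)
        l = solve-∀ ring

      U≡0⇒D∣ : ∀ n → U (suc n) ≡ 0ℚ → ℤ.∣ D ∣ ∣ ℤ.∣ A ℤ.^ n ∣
      U≡0⇒D∣ n e = divides (ℤ.∣ k n ∣) (trans (cong ℤ.∣_∣ A^n) (trans (ℤ.∣-i∣≡∣i∣ (D ℤ.* k n)) (trans (ℤ.abs-* D (k n)) (ℕ.*-comm ℤ.∣ D ∣ ℤ.∣ k n ∣))))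
        where
        h≡0 : h n ≡ 0ℤ
        h≡0 = int-inj (trans (h-U n) (trans (cong (powℚ (int D) n *_) e) (ℚ.*-zeroʳ (powℚ (int D) n))))
        l : ∀ x y → x ≡ x ℤ.+ y ℤ.- y
        l = ℤ-solver.solve-∀
        A^n : A ℤ.^ n ≡ ℤ.- (D ℤ.* k n)
        A^n = trans (l (A ℤ.^ n) (D ℤ.* k n)) (trans (cong (ℤ._- D ℤ.* k n) (trans (≡.sym (h-mod n)) h≡0)) (ℤ.+-identityˡ (ℤ.- (D ℤ.* k n))))

      D∣⇒D∣1 : ∀ n → ℤ.∣ D ∣ ∣ ℤ.∣ A ℤ.^ n ∣ → ℤ.∣ D ∣ ∣ 1
      D∣⇒D∣1 zero d = d
      D∣⇒D∣1 (suc n) d = D∣⇒D∣1 n (coprime-divisor (sym (numerator-coprime g)) (subst (ℤ.∣ D ∣ ∣_) (ℤ.abs-* A (A ℤ.^ n)) d))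

      -- `D` divides `Aⁿ` and is coprime to `A`, hence is 1; this is the rational root theorem for
      -- the monic polynomial `U`.
      g-integral : ∀ n → U (suc n) ≡ 0ℚ → g ≡ int A
      g-integral n e = trans (≡.sym (ℚ.*-identityˡ g)) (trans (cong (λ d → int (+ d) * g) (≡.sym (∣1⇒≡1 (D∣⇒D∣1 n (U≡0⇒D∣ n e))))) (scale g))

      0<q² : 0ℚ < q * q
      0<q² = [ (λ r → ⊥-elim (q≢0 (zero-sq r))) , (λ r → r) ]′ (q * q ≤⊎< 0ℚ)
        where
        zero-sq : q * q ≤ 0ℚ → q ≡ 0ℚ
        zero-sq r = [ (λ a → [ (λ b → ℚ.≤-antisym b a) , (λ b → absurd (b <⊠ b) r) ]′ (q ≤⊎< 0ℚ))
                    , (λ a → absurd (δ< a <⊠ δ< a) (subst (_≤ 0ℚ) (l q) r)) ]′ (0ℚ ≤⊎< q)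
          where
          l : ∀ q → q * q ≡ (0ℚ - q) * (0ℚ - q)
          l = solve-∀ ring

      -- The first alternative, absolute value at least 2, is stated as an inequality that `q ≠ 0`
      -- refutes: `4 - g² = 4 q² > 0`.
      small-integer : ∀ a → ((2 // 1) - int a) * ((2 // 1) + int a) ≤ 0ℚ ⊎ (a ≡ -[1+ 0 ] ⊎ a ≡ 0ℤ ⊎ a ≡ + 1)
      small-integer (+ 0) = inj₂ (inj₂ (inj₁ refl))
      small-integer (+ 1) = inj₂ (inj₂ (inj₂ refl))
      small-integer (+ suc (suc n)) = inj₁ (subst (λ t → ((2 // 1) - t) * ((2 // 1) + t) ≤ 0ℚ) (≡.sym (int-nat (2 ℕ.+ n))) (l (nat n) (0≤nat n)))
        where
        l : ∀ m → 0ℚ ≤ m → ((2 // 1) - (1ℚ + (1ℚ + m))) * ((2 // 1) + (1ℚ + (1ℚ + m))) ≤ 0ℚ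
        l m z = by≤ (z ⊠ (# (4 // 1) ⊞ z)) (l′ m)
          where
          l′ : ∀ m → 0ℚ - ((2 // 1) - (1ℚ + (1ℚ + m))) * ((2 // 1) + (1ℚ + (1ℚ + m))) ≡ m * ((4 // 1) + m)
          l′ = solve-∀ ring
      small-integer -[1+ 0 ] = inj₂ (inj₁ refl)
      small-integer -[1+ suc n ] = inj₁ (subst (λ t → ((2 // 1) - t) * ((2 // 1) + t) ≤ 0ℚ) (≡.sym (trans (int-neg (+ suc (suc n))) (cong (λ t → - t) (int-nat (2 ℕ.+ n))))) (l (nat n) (0≤nat n)))
        where
        l : ∀ m → 0ℚ ≤ m → ((2 // 1) - - (1ℚ + (1ℚ + m))) * ((2 // 1) + - (1ℚ + (1ℚ + m))) ≤ 0ℚ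
        l m z = by≤ (z ⊠ (# (4 // 1) ⊞ z)) (l′ m)
          where
          l′ : ∀ m → 0ℚ - ((2 // 1) - - (1ℚ + (1ℚ + m))) * ((2 // 1) + - (1ℚ + (1ℚ + m))) ≡ m * ((4 // 1) + m)
          l′ = solve-∀ ring

      4q²≡3 : g * g ≡ 1ℚ → (4 // 1) * (q * q) ≡ 3 // 1
      4q²≡3 e = trans (l p q) (trans (cong₂ (λ u v → (4 // 1) * u - v) unit e) refl)
        where
        l : ∀ p q → (4 // 1) * (q * q) ≡ (4 // 1) * (p * p + q * q) - (p + p) * (p + p)
        l = solve-∀ ring

      no-sixth-root : g * g ≡ 1ℚ → ⊥
      no-sixth-root e = no-√3 ℤ.∣ B ∣ ℤ.∣ F ∣ (numerator-coprime q) (trans (lhs B) (trans (cong ℤ.∣_∣ eqℤ) (≡.sym (rhs F))))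
        where
        B = ℚ.↥ q
        F = ℚ.↧ q
        lhs : ∀ b → 4 ℕ.* (ℤ.∣ b ∣ ℕ.* ℤ.∣ b ∣) ≡ ℤ.∣ + 4 ℤ.* (b ℤ.* b) ∣
        lhs b = ≡.sym (trans (ℤ.abs-* (+ 4) (b ℤ.* b)) (cong (4 ℕ.*_) (ℤ.abs-* b b)))
        rhs : ∀ b → 3 ℕ.* (ℤ.∣ b ∣ ℕ.* ℤ.∣ b ∣) ≡ ℤ.∣ + 3 ℤ.* (b ℤ.* b) ∣
        rhs b = ≡.sym (trans (ℤ.abs-* (+ 3) (b ℤ.* b)) (cong (3 ℕ.*_) (ℤ.abs-* b b)))
        expand : ∀ c b → int (c ℤ.* (b ℤ.* b)) ≡ int c * (int b * int b)
        expand c b = trans (int-* c (b ℤ.* b)) (cong (int c *_) (int-* b b))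
        l : ∀ f q → (4 // 1) * ((f * q) * (f * q)) ≡ (4 // 1) * (q * q) * (f * f)
        l = solve-∀ ring
        eqℤ : + 4 ℤ.* (B ℤ.* B) ≡ + 3 ℤ.* (F ℤ.* F)
        eqℤ = int-inj (trans (expand (+ 4) B) (trans (cong (λ t → (4 // 1) * (t * t)) (≡.sym (scale q)))
          (trans (l (int F) q) (trans (cong (_* (int F * int F)) (4q²≡3 e)) (≡.sym (expand (+ 3) F))))))

      -- Once `g = 2p` is an integer, `g = 0` contradicts `p ≠ 0`, and `g = ±1` are the primitive
      -- sixth and third roots of unity, whose imaginary part `±√3/2` is irrational.
      U≢0 : ∀ n → U (suc n) ≢ 0ℚ
      U≢0 n e = [ (λ r → absurd 0<4-g² (subst (λ t → ((2 // 1) - t) * ((2 // 1) + t) ≤ 0ℚ) (≡.sym gA) r))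
                , [ (λ r → no-sixth-root (trans (cong (λ t → t * t) (trans gA (cong int r))) refl))
                  , [ (λ r → p≢0 (half-0 p (trans gA (cong int r)))) , (λ r → no-sixth-root (trans (cong (λ t → t * t) (trans gA (cong int r))) refl)) ]′ ]′ ]′
                (small-integer A)
        where
        gA : g ≡ int A
        gA = g-integral n e
        half-0 : ∀ p → p + p ≡ 0ℚ → p ≡ 0ℚ
        half-0 p e = trans (l p) (trans (cong (½ *_) e) (ℚ.*-zeroʳ ½))
          where
          l : ∀ p → p ≡ ½ * (p + p)
          l = solve-∀ ring
        0<4-g² : 0ℚ < ((2 // 1) - g) * ((2 // 1) + g)
        0<4-g² = subst (0ℚ <_) (trans (l₁ p q) (trans (cong (λ t → (4 // 1) * t - (p + p) * (p + p)) unit) (l₂ p))) (#< (4 // 1) <⊠ 0<q²)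
          where
          l₁ : ∀ p q → (4 // 1) * (q * q) ≡ (4 // 1) * (p * p + q * q) - (p + p) * (p + p)
          l₁ = solve-∀ ring
          l₂ : ∀ p → (4 // 1) * 1ℚ - (p + p) * (p + p) ≡ ((2 // 1) - (p + p)) * ((2 // 1) + (p + p))
          l₂ = solve-∀ ring

    sine≢0 : ∀ n → im (w ^ᶜ suc n) ≢ 0ℚ
    sine≢0 n e = U≢0 n (trans (≡.sym (ℚ.*-identityˡ (U (suc n)))) (trans (cong (_* U (suc n)) (≡.sym (ℚ.*-inverseˡ q)))
      (trans (ℚ.*-assoc (ℚ.1/ q) q (U (suc n))) (trans (cong ((ℚ.1/ q) *_) (trans (≡.sym (im-U (suc n))) e)) (ℚ.*-zeroʳ (ℚ.1/ q))))))
      where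
      instance _ = ℚ.≢-nonZero q≢0

-- Approximating 1/π by counting turns of a small angle

module SmallAngle where

  open Basics
  open Complex
  open Exponential
  open Estimates
  open Angles
  open Argument
  open Windings
  open import Data.List.Base using ([]; _∷_)
  open import Data.Nat.Base as ℕ using (ℕ; suc)
  import Data.Nat.Properties as ℕ
  open import Data.Product.Base using (_×_; _,_; proj₁; proj₂)
  open import Data.Rational.Base as ℚ using (ℚ; 0ℚ; 1ℚ; ½; _+_; _*_; _-_; -_; _≤_; _<_; ∣_∣)
  import Data.Rational.Properties as ℚ
  open import Relation.Binary.PropositionalEquality using (_≡_; refl; sym; trans; cong; cong₂; subst)
  open import Tactic.RingSolver using (solve; solve-∀)

  -- The square of κ + i, scaled to the unit circle; its argument is 2/κ up to O(1/κ²).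
  unitSquare : ℕ → ℂ
  unitSquare κ = cx ((nat κ * nat κ - 1ℚ) * inv (κ ℕ.* κ)) ((2 // 1) * nat κ * inv (κ ℕ.* κ))

  module _ (π : ℕ → ℚ) (Eπ : Angle π -1ᶜ) (π-range : Ev (λ n → 12 // 5 ≤ π n × π n ≤ 17 // 5))
           (κ′ : ℕ) (32≤κ : 32 ℕ.≤ suc κ′) where

    private
      x = nat (suc κ′)
      j = inv κ′
      i = inv (suc κ′ ℕ.* suc κ′)

      xj : x * j ≡ 1ℚ
      xj = nat*inv κ′

      xi : (1ℚ + x * x) * i ≡ 1ℚ
      xi = trans (cong (λ t → (1ℚ + t) * i) (sym (nat-* (suc κ′) (suc κ′)))) (nat*inv (suc κ′ ℕ.* suc κ′))

      0≤j = 0≤inv κ′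
      0≤i = 0≤inv (suc κ′ ℕ.* suc κ′)

      32j≤1 : (32 // 1) * j ≤ 1ℚ
      32j≤1 = lem x j (nat-mono 32≤κ) xj 0≤j
        where
        lem : ∀ x j → 32 // 1 ≤ x → x * j ≡ 1ℚ → 0ℚ ≤ j → (32 // 1) * j ≤ 1ℚ
        lem x j p e z = by≤ (δ p ⊠ z ⊞ δ (≡⇒≤ e)) (solve (x ∷ j ∷ []) ring)

      i≤j² : i ≤ j * j
      i≤j² = lem x j i xj xi 0≤i
        where
        lem : ∀ x j i → x * j ≡ 1ℚ → (1ℚ + x * x) * i ≡ 1ℚ → 0ℚ ≤ i → i ≤ j * j
        lem x j i e f z = subst (i ≤_) (trans (l x j i) (trans (cong (λ t → t * (j * j)) f) (ℚ.*-identityˡ (j * j))))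
            (by≤ (z ⊠ (0≤sq j) ⊞ z ⊠ (δ (≡⇒≤ (sym (trans (cong (λ t → t * t) e) refl))))) (l′ x j i))
          where
          l : ∀ x j i → (i * (j * j) + i * ((x * j) * (x * j))) ≡ (1ℚ + x * x) * i * (j * j)
          l = solve-∀ ring
          l′ : ∀ x j i → (i * (j * j) + i * ((x * j) * (x * j))) - i ≡ i * (j * j) + i * (x * j * (x * j) - 1ℚ)
          l′ = solve-∀ ring

      unit : re (unitSquare (suc κ′)) * re (unitSquare (suc κ′)) + im (unitSquare (suc κ′)) * im (unitSquare (suc κ′)) ≡ 1ℚ
      unit = trans (lem x i) (trans (cong (λ t → t * t) xi) refl)
        where
        lem : ∀ x i → (x * x - 1ℚ) * i * ((x * x - 1ℚ) * i) + (2 // 1) * x * i * ((2 // 1) * x * i) ≡ (1ℚ + x * x) * i * ((1ℚ + x * x) * i)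
        lem = solve-∀ ring

      -- The tangent at `2j` errs by at most `4 j²`, and the coordinates of `unitSquare` differ from
      -- `(1, 2j)` by `2 i` and `2 i j`, where `i ≤ j²`; the total is below `8 j²`. The condition
      -- `32 ≤ κ` makes this small enough to start the iteration.
      δ₀ = (8 // 1) * (j * j)

      0<δ₀ : 0ℚ < δ₀
      0<δ₀ = #< (8 // 1) <⊠ (0<inv κ′ <⊠ 0<inv κ′)

      δ₀≤ : δ₀ ≤ 1 // 32
      δ₀≤ = lem j 32j≤1 0≤j
        where
        lem : ∀ j → (32 // 1) * j ≤ 1ℚ → 0ℚ ≤ j → (8 // 1) * (j * j) ≤ 1 // 32
        lem j p z = by≤ (# (1 // 4) ⊠ (z ⊠ δ p) ⊞ # (1 // 128) ⊠ δ p ⊞ # (3 // 128)) (solve (j ∷ []) ring)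

      near : Near ((2 // 1) * j) (unitSquare (suc κ′)) δ₀
      near = 4 , λ n 4≤n → ℚ.≤-trans (norm-tri (E n ((2 // 1) * j)) (cx 1ℚ ((2 // 1) * j)) (unitSquare (suc κ′)))
          (lem (norm (E n ((2 // 1) * j) -ᶜ cx 1ℚ ((2 // 1) * j))) (∣ 1ℚ - (x * x - 1ℚ) * i ∣) (∣ (2 // 1) * j - (2 // 1) * x * i ∣) j i
            (E-tangent n 4≤n ((2 // 1) * j) (subst (_≤ 1ℚ) (sym (ℚ.0≤p⇒∣p∣≡p (# (2 // 1) ⊠ 0≤j))) (2j≤1 j 32j≤1 0≤j)))
            (≡⇒≤ (trans (cong ∣_∣ (re-eq x i xi)) (ℚ.0≤p⇒∣p∣≡p (# (2 // 1) ⊠ 0≤i))))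
            (≡⇒≤ (trans (cong ∣_∣ (im-eq x j i xj xi)) (ℚ.0≤p⇒∣p∣≡p (# (2 // 1) ⊠ (0≤j ⊠ 0≤i))))) i≤j² 0≤i 32j≤1 0≤j)
        where
        2j≤1 : ∀ j → (32 // 1) * j ≤ 1ℚ → 0ℚ ≤ j → (2 // 1) * j ≤ 1ℚ
        2j≤1 j p z = by≤ (δ p ⊞ # (30 // 1) ⊠ z) (solve (j ∷ []) ring)
        re-eq : ∀ x i → (1ℚ + x * x) * i ≡ 1ℚ → 1ℚ - (x * x - 1ℚ) * i ≡ (2 // 1) * i
        re-eq x i e = trans (cong (_- (x * x - 1ℚ) * i) (sym e)) (l x i)
          where
          l : ∀ x i → (1ℚ + x * x) * i - (x * x - 1ℚ) * i ≡ (2 // 1) * i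
          l = solve-∀ ring
        im-eq : ∀ x j i → x * j ≡ 1ℚ → (1ℚ + x * x) * i ≡ 1ℚ → (2 // 1) * j - (2 // 1) * x * i ≡ (2 // 1) * (j * i)
        im-eq x j i e f = trans (l₁ x j i) (trans (cong₂ (λ s t → (2 // 1) * j * s - (2 // 1) * x * i * t) (sym f) (sym e)) (l₂ x j i))
          where
          l₁ : ∀ x j i → (2 // 1) * j - (2 // 1) * x * i ≡ (2 // 1) * j * 1ℚ - (2 // 1) * x * i * 1ℚ
          l₁ = solve-∀ ring
          l₂ : ∀ x j i → (2 // 1) * j * ((1ℚ + x * x) * i) - (2 // 1) * x * i * (x * j) ≡ (2 // 1) * (j * i)
          l₂ = solve-∀ ring
        lem : ∀ a b c j i → a ≤ (2 // 1) * j * ((2 // 1) * j) → b ≤ (2 // 1) * i → c ≤ (2 // 1) * (j * i) → i ≤ j * j → 0ℚ ≤ i → (32 // 1) * j ≤ 1ℚ → 0ℚ ≤ j → a + (b + c) ≤ (8 // 1) * (j * j)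
        lem a b c j i p q r s z h w = by≤ (δ p ⊞ δ q ⊞ δ r ⊞ # (4 // 1) ⊠ δ s ⊞ # (2 // 1) ⊠ (z ⊠ (δ h ⊞ # (31 // 1) ⊠ w))) (solve (a ∷ b ∷ c ∷ j ∷ i ∷ []) ring)

      module L = Limit (unitSquare (suc κ′)) unit 0<δ₀ δ₀≤ near

      φ-bounds : ∀ k → L.φ k - (2 // 1) * j ≤ (4 // 1) * δ₀ × - ((4 // 1) * δ₀) ≤ L.φ k - (2 // 1) * j
      φ-bounds k = ∣x∣≤⇒ {L.φ k - (2 // 1) * j} {(4 // 1) * δ₀} (L.φ-near k)

      j≤φ : ∀ f j → - ((4 // 1) * ((8 // 1) * (j * j))) ≤ f - (2 // 1) * j → (32 // 1) * j ≤ 1ℚ → 0ℚ ≤ j → j ≤ f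
      j≤φ f j p q z = by≤ (δ p ⊞ z ⊠ δ q) (solve (f ∷ j ∷ []) ring)

      φ≤π-j : ∀ f j p → f - (2 // 1) * j ≤ (4 // 1) * ((8 // 1) * (j * j)) → (32 // 1) * j ≤ 1ℚ → 0ℚ ≤ j → 12 // 5 ≤ p → f ≤ p - j
      φ≤π-j f j p a q z b = by≤ (δ a ⊞ z ⊠ δ q ⊞ δ 4j≤p) (solve (f ∷ j ∷ p ∷ []) ring)
        where
        4j≤32j : (4 // 1) * j ≤ (32 // 1) * j
        4j≤32j = by≤ (# (28 // 1) ⊠ z) (solve (j ∷ []) ring)
        4j≤p : (4 // 1) * j ≤ p
        4j≤p = ℚ.≤-trans (ℚ.≤-trans 4j≤32j q) (ℚ.≤-trans (#≤ 1ℚ (12 // 5)) b)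

      range-at : ∀ k → 12 // 5 ≤ π k × π k ≤ 17 // 5 → j ≤ L.φ k × L.φ k ≤ π k - j
      range-at k (h , _) = j≤φ (L.φ k) j (proj₂ (φ-bounds k)) 32j≤1 0≤j , φ≤π-j (L.φ k) j (π k) (proj₁ (φ-bounds k)) 32j≤1 0≤j h

      range : Ev (λ k → j ≤ L.φ k × L.φ k ≤ π k - j)
      range = Ev-map range-at π-range

    -- After `κ²` steps the total angle is `2κ` up to `4 δ₀ κ² = 32`, and it equals `2π J` up to one
    -- turn and a tolerance of 1/10. Hence `π J` is `κ` up to `16 + 17/5 + 1/20 < 20`; this is the
    -- origin of the constant 20.
    π-approx : ∀ {J} → Winding (unitSquare (suc κ′)) J →
      Ev (λ k → π k * (nat (J (suc κ′ ℕ.* suc κ′)) * j) ≤ 1ℚ + (20 // 1) * j × 1ℚ - (20 // 1) * j ≤ π k * (nat (J (suc κ′ ℕ.* suc κ′)) * j))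
    π-approx {J} wind = Ev-map at (winding-window π Eπ π-range L.Angle-φ (0<inv κ′) range wind n (#< (1 // 10)) & π-range)
      where
      n = suc κ′ ℕ.* suc κ′
      -- Multiplying by x² = κ² and using x j = 1.
      sq-bound : ∀ x j f → f - (2 // 1) * j ≤ (4 // 1) * ((8 // 1) * (j * j)) → x * j ≡ 1ℚ → 0ℚ ≤ x → x * x * f ≤ (2 // 1) * x + 32 // 1
      sq-bound x j f p e z = subst (x * x * f ≤_) (trans (l x j) (cong (λ t → (2 // 1) * x * t + (32 // 1) * (t * t)) e ∙ l₂ x))
          (by≤ ((z ⊠ z) ⊠ δ p) (l₁ x j f))
        where
        _∙_ : ∀ {a b c : ℚ} → a ≡ b → b ≡ c → a ≡ c
        _∙_ = trans
        l : ∀ x j → x * x * ((2 // 1) * j + (32 // 1) * (j * j)) ≡ (2 // 1) * x * (x * j) + (32 // 1) * ((x * j) * (x * j))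
        l = solve-∀ ring
        l₂ : ∀ x → (2 // 1) * x * 1ℚ + (32 // 1) * (1ℚ * 1ℚ) ≡ (2 // 1) * x + 32 // 1
        l₂ = solve-∀ ring
        l₁ : ∀ x j f → x * x * ((2 // 1) * j + (32 // 1) * (j * j)) - x * x * f ≡ x * x * ((4 // 1) * ((8 // 1) * (j * j)) - (f - (2 // 1) * j))
        l₁ = solve-∀ ring
      sq-bound′ : ∀ x j f → - ((4 // 1) * ((8 // 1) * (j * j))) ≤ f - (2 // 1) * j → x * j ≡ 1ℚ → 0ℚ ≤ x → (2 // 1) * x - 32 // 1 ≤ x * x * f
      sq-bound′ x j f p e z = subst (_≤ x * x * f) (trans (l x j) (trans (cong (λ t → (2 // 1) * x * t - (32 // 1) * (t * t)) e) (l₂ x)))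
          (by≤ ((z ⊠ z) ⊠ δ p) (l₁ x j f))
        where
        l : ∀ x j → x * x * ((2 // 1) * j - (32 // 1) * (j * j)) ≡ (2 // 1) * x * (x * j) - (32 // 1) * ((x * j) * (x * j))
        l = solve-∀ ring
        l₂ : ∀ x → (2 // 1) * x * 1ℚ - (32 // 1) * (1ℚ * 1ℚ) ≡ (2 // 1) * x - 32 // 1
        l₂ = solve-∀ ring
        l₁ : ∀ x j f → x * x * f - x * x * ((2 // 1) * j - (32 // 1) * (j * j)) ≡ x * x * ((f - (2 // 1) * j) - - ((4 // 1) * ((8 // 1) * (j * j))))
        l₁ = solve-∀ ring
      up : ∀ x j f p J n → n ≡ x * x → - (1 // 10) ≤ n * f - J * (p + p) → f - (2 // 1) * j ≤ (4 // 1) * ((8 // 1) * (j * j)) → x * j ≡ 1ℚ → 0ℚ ≤ j → 0ℚ ≤ x →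
           p * (J * j) ≤ 1ℚ + (20 // 1) * j
      up x j f p J _ refl h a e z w = by≤ (# ½ ⊠ (z ⊠ (δ h ⊞ δ (sq-bound x j f a e w))) ⊞ δ (≡⇒≤ e) ⊞ # (79 // 20) ⊠ z) (solve (x ∷ j ∷ f ∷ p ∷ J ∷ []) ring)
      down : ∀ x j f p J n → n ≡ x * x → n * f - J * (p + p) ≤ p + p + 1 // 10 → - ((4 // 1) * ((8 // 1) * (j * j))) ≤ f - (2 // 1) * j → x * j ≡ 1ℚ → 0ℚ ≤ j → 0ℚ ≤ x → p ≤ 17 // 5 →
           1ℚ - (20 // 1) * j ≤ p * (J * j)
      down x j f p J _ refl h a e z w q = by≤ (# ½ ⊠ (z ⊠ (δ h ⊞ δ (sq-bound′ x j f a e w))) ⊞ z ⊠ δ q ⊞ δ (≡⇒≤ (sym e)) ⊞ # (11 // 20) ⊠ z) (solve (x ∷ j ∷ f ∷ p ∷ J ∷ []) ring)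
      at : ∀ k →
           (- (1 // 10) ≤ nat n * L.φ k - nat (J n) * (π k + π k) × nat n * L.φ k - nat (J n) * (π k + π k) ≤ π k + π k + 1 // 10) ×
           (12 // 5 ≤ π k × π k ≤ 17 // 5) →
           π k * (nat (J n) * j) ≤ 1ℚ + (20 // 1) * j × 1ℚ - (20 // 1) * j ≤ π k * (nat (J n) * j)
      at k ((lo , hi) , (_ , p≤)) =
          up x j (L.φ k) (π k) (nat (J n)) (nat n) (nat-* (suc κ′) (suc κ′)) lo (proj₁ (φ-bounds k)) xj 0≤j (0≤nat (suc κ′))
        , down x j (L.φ k) (π k) (nat (J n)) (nat n) (nat-* (suc κ′) (suc κ′)) hi (proj₂ (φ-bounds k)) xj 0≤j (0≤nat (suc κ′)) p≤

-- The test inequalities against lower bounds for the type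

module Criterion where

  open Basics
  open Complex
  open Exponential
  open Estimates
  open Angles
  open Windings
  open Real using (re-close; im-close)
  open import Data.Empty using (⊥; ⊥-elim)
  open import Data.Integer.Base as ℤ using (ℤ; +_; -[1+_])
  import Data.Integer.Properties as ℤ
  open import Data.List.Base using ([]; _∷_)
  open import Data.Nat.Base as ℕ using (ℕ; zero; suc)
  import Data.Nat.Properties as ℕ
  open import Data.Product.Base using (∃; _×_; _,_; proj₁; proj₂)
  open import Data.Rational.Base as ℚ using (ℚ; 0ℚ; 1ℚ; ½; _+_; _*_; _-_; -_; _≤_; _<_; ∣_∣)
  import Data.Rational.Properties as ℚ
  open import Data.Sum.Base using (_⊎_; inj₁; inj₂; [_,_]′)
  open import Relation.Binary.PropositionalEquality using (_≡_; _≢_; refl; sym; trans; cong; cong₂; subst)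
  open import Relation.Nullary using (¬_)
  open import Tactic.RingSolver using (solve; solve-∀)

  ∣a∣≤∣b∣+e : ∀ a b {e} → ∣ a - b ∣ ≤ e → ∣ a ∣ ≤ ∣ b ∣ + e
  ∣a∣≤∣b∣+e a b {e} p = ℚ.≤-trans (subst (λ t → ∣ t ∣ ≤ ∣ b ∣ + ∣ a - b ∣) (lem a b) (ℚ.∣p+q∣≤∣p∣+∣q∣ b (a - b))) (ℚ.+-monoʳ-≤ (∣ b ∣) p)
    where
    lem : ∀ a b → b + (a - b) ≡ a
    lem = solve-∀ ring

  ∣-∣-swap : ∀ a b → ∣ a - b ∣ ≡ ∣ b - a ∣
  ∣-∣-swap a b = trans (sym (ℚ.∣-p∣≡∣p∣ (a - b))) (cong ∣_∣ (lem a b))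
    where
    lem : ∀ a b → - (a - b) ≡ b - a
    lem = solve-∀ ring

  abs-scale : ∀ {a} b → 0ℚ ≤ a → ∣ a * b ∣ ≡ a * ∣ b ∣
  abs-scale {a} b 0≤a = trans (ℚ.∣p*q∣≡∣p∣*∣q∣ a b) (cong (_* ∣ b ∣) (ℚ.0≤p⇒∣p∣≡p 0≤a))

  -- V m i k approximates m ∣ m t - i ∣ , whose infimum over m ≥ 1 is the type of t.
  V : (ℕ → ℚ) → ℕ → ℤ → ℕ → ℚ
  V t m i k = nat m * ∣ nat m * t k - int i ∣

  -- Expresses that `v` is at most the type of `t`. Tolerance and tail replace an inequality of
  -- reals, so that no infimum has to exist yet.
  LowerBound : (ℕ → ℚ) → ℚ → Set
  LowerBound t v = ∀ m i {ε} → 0ℚ < ε → Ev (λ k → v - ε ≤ V t (suc m) i k)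

  LowerBound-mono : ∀ t {u v} → u ≤ v → LowerBound t v → LowerBound t u
  LowerBound-mono t {u} {v} u≤v lb m i {ε} 0<ε = Ev-map at (lb m i 0<ε)
    where
    at : ∀ k → v - ε ≤ V t (suc m) i k → u - ε ≤ V t (suc m) i k
    at k h = ℚ.≤-trans (ℚ.+-monoˡ-≤ (- ε) u≤v) h

  LowerBound-neg : ∀ {t t′} → (∀ k → t′ k ≡ - t k) → ∀ {v} → LowerBound t v → LowerBound t′ v
  LowerBound-neg {t} {t′} e {v} lb m i {ε} 0<ε = Ev-map at (lb m (ℤ.- i) 0<ε)
    where
    l : ∀ m t i → - (m * t - - i) ≡ m * - t - i
    l = solve-∀ ring
    reflect : ∀ k → ∣ nat (suc m) * t k - int (ℤ.- i) ∣ ≡ ∣ nat (suc m) * t′ k - int i ∣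
    reflect k = trans (sym (ℚ.∣-p∣≡∣p∣ (nat (suc m) * t k - int (ℤ.- i)))) (cong ∣_∣ (trans (cong (λ j → - (nat (suc m) * t k - j)) (int-neg i))
      (trans (l (nat (suc m)) (t k) (int i)) (cong (λ x → nat (suc m) * x - int i) (sym (e k))))))
    at : ∀ k → v - ε ≤ V t (suc m) (ℤ.- i) k → v - ε ≤ V t′ (suc m) i k
    at k h = subst (λ a → v - ε ≤ nat (suc m) * a) (reflect k) h

  module Tail (π θ t : ℕ → ℚ) (Eπ : Angle π -1ᶜ) (π-range : Ev (λ n → 12 // 5 ≤ π n × π n ≤ 17 // 5))
           {p q} (unit : p * p + q * q ≡ 1ℚ) (p≢0 : p ≢ 0ℚ) (q≢0 : q ≢ 0ℚ) (Eθ : Angle θ (cx p q))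
           {ε₀} (0<ε₀ : 0ℚ < ε₀) (θ-range : Ev (λ k → ε₀ ≤ θ k × θ k ≤ π k - ε₀))
           (2πt : ∀ {ε} → 0ℚ < ε → Ev (λ k → ∣ (π k + π k) * t k - θ k ∣ ≤ ε)) where

    private
      w : ℂ
      w = cx p q
      c s : ℕ → ℚ
      c m = re (w ^ᶜ m)
      s m = im (w ^ᶜ m)

      unit-^ : ∀ m → c m * c m + s m * s m ≡ 1ℚ
      unit-^ zero = refl
      unit-^ (suc m) = lem (w ^ᶜ m) (unit-^ m)
        where
        l : ∀ p q a b → (p * a - q * b) * (p * a - q * b) + (p * b + q * a) * (p * b + q * a) ≡ (p * p + q * q) * (a * a + b * b)
        l = solve-∀ ring
        lem : ∀ u → re u * re u + im u * im u ≡ 1ℚ → re (w *ᶜ u) * re (w *ᶜ u) + im (w *ᶜ u) * im (w *ᶜ u) ≡ 1ℚ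
        lem (cx a b) e = trans (l p q a b) (trans (cong₂ _*_ unit e) refl)

      ∣s∣≤1 : ∀ m → ∣ s m ∣ ≤ 1ℚ
      ∣s∣≤1 m = [ (λ h → h) , (λ h → absurd (l (∣ s m ∣) h) (l′ (c m) (s m) (unit-^ m))) ]′ (∣ s m ∣ ≤⊎< 1ℚ)
        where
        l : ∀ a → 1ℚ < a → 1ℚ < a * a
        l a h = by< (δ< h <⊠ (δ< h <⊞ # (2 // 1))) (solve (a ∷ []) ring)
        l″ : ∀ c s → c * c + s * s ≡ 1ℚ → s * s ≤ 1ℚ
        l″ c s e = by≤ (0≤sq c ⊞ δ (≡⇒≤ e)) (solve (c ∷ s ∷ []) ring)
        l′ : ∀ c s → c * c + s * s ≡ 1ℚ → ∣ s ∣ * ∣ s ∣ ≤ 1ℚ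
        l′ c s e = subst (_≤ 1ℚ) (trans (sym (ℚ.0≤p⇒∣p∣≡p (0≤sq s))) (ℚ.∣p*q∣≡∣p∣*∣q∣ s s)) (l″ c s e)

      z : ℕ → ℤ → ℕ → ℚ
      z m i k = nat m * θ k - int i * (π k + π k)

      Angle-int-turns : ∀ i → Angle (λ k → int i * (π k + π k)) 1ᶜ
      Angle-int-turns (+ n) = Angle-≡ (λ k → cong (_* (π k + π k)) (sym (int-nat n))) refl (Angle-turns Eπ n)
      Angle-int-turns -[1+ n ] = Angle-≡ (λ k → trans (lem (nat (suc n)) (π k + π k))
          (cong (_* (π k + π k)) (sym (trans (int-neg (+ suc n)) (cong (λ v → - v) (int-nat (suc n))))))) refl (Angle-neg (Angle-turns Eπ (suc n)))
        where
        lem : ∀ n p → - (n * p) ≡ (- n) * p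
        lem = solve-∀ ring

      Az : ∀ m i → Angle (z m i) (w ^ᶜ m)
      Az m i = Angle-≡ (λ _ → refl) (*ᶜ-identityʳ (w ^ᶜ m)) (Angle-+ (Angle-* m Eθ) (Angle-neg (Angle-int-turns i)))

      z-diff : ∀ m i k {η} → ∣ (π k + π k) * t k - θ k ∣ ≤ η → ∣ z m i k - (π k + π k) * (nat m * t k - int i) ∣ ≤ nat m * η
      z-diff m i k {η} h = subst (_≤ nat m * η) (sym (trans (∣-∣-swap (z m i k) ((π k + π k) * (nat m * t k - int i)))
          (trans (cong ∣_∣ (lem (nat m) (θ k) (π k) (t k) (int i))) (abs-scale ((π k + π k) * t k - θ k) (0≤nat m)))))
          (ℚ.*-monoˡ-≤-nonNeg (nat m) {{ℚ.nonNegative (0≤nat m)}} h)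
        where
        lem : ∀ m θ π t i → (π + π) * (m * t - i) - (m * θ - i * (π + π)) ≡ m * ((π + π) * t - θ)
        lem = solve-∀ ring

      Y : ℕ → ℤ → ℕ → ℚ
      Y m i k = ∣ nat m * t k - int i ∣

      z≤Y : ∀ m i k {η} → 12 // 5 ≤ π k → ∣ (π k + π k) * t k - θ k ∣ ≤ η → ∣ z m i k ∣ ≤ (π k + π k) * Y m i k + nat m * η
      z≤Y m i k {η} h g = subst (λ a → ∣ z m i k ∣ ≤ a + nat m * η) (abs-scale (nat m * t k - int i) 0≤2π)
          (∣a∣≤∣b∣+e (z m i k) ((π k + π k) * (nat m * t k - int i)) (z-diff m i k g))
        where
        0≤π = ℚ.≤-trans (# (12 // 5)) h
        0≤2π = 0≤π ⊞ 0≤π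

      Y≤z : ∀ m i k {η} → 12 // 5 ≤ π k → ∣ (π k + π k) * t k - θ k ∣ ≤ η → (π k + π k) * Y m i k ≤ ∣ z m i k ∣ + nat m * η
      Y≤z m i k {η} h g = subst (λ a → a ≤ ∣ z m i k ∣ + nat m * η) (abs-scale (nat m * t k - int i) 0≤2π)
          (∣a∣≤∣b∣+e ((π k + π k) * (nat m * t k - int i)) (z m i k) (subst (_≤ nat m * η) (∣-∣-swap (z m i k) ((π k + π k) * (nat m * t k - int i))) (z-diff m i k g)))
        where
        0≤π = ℚ.≤-trans (# (12 // 5)) h
        0≤2π = 0≤π ⊞ 0≤π

      0≤Y : ∀ m i k → 0ℚ ≤ Y m i k
      0≤Y m i k = ℚ.0≤∣p∣ (nat m * t k - int i)

      sin-close : ∀ m i k {η} → norm (E k (z m i k) -ᶜ w ^ᶜ m) ≤ η → ∣ im (E k (z m i k)) ∣ ≤ ∣ s m ∣ + η × ∣ s m ∣ ≤ ∣ im (E k (z m i k)) ∣ + η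
      sin-close m i k h =
          ∣a∣≤∣b∣+e (im (E k (z m i k))) (s m) (ℚ.≤-trans (im-close (E k (z m i k)) (w ^ᶜ m)) h)
        , ∣a∣≤∣b∣+e (s m) (im (E k (z m i k))) (subst (_≤ _) (∣-∣-swap (im (E k (z m i k))) (s m)) (ℚ.≤-trans (im-close (E k (z m i k)) (w ^ᶜ m)) h))

      cos-close : ∀ m i k {η} → norm (E k (z m i k) -ᶜ w ^ᶜ m) ≤ η → re (E k (z m i k)) - c m ≤ η × - η ≤ re (E k (z m i k)) - c m
      cos-close m i k {η} h = ∣x∣≤⇒ {re (E k (z m i k)) - c m} {η} (ℚ.≤-trans (re-close (E k (z m i k)) (w ^ᶜ m)) h)

    0≤t≤½ : Ev (λ k → 0ℚ ≤ t k × t k ≤ ½)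
    0≤t≤½ = Ev-map at (2πt 0<ε₀ & θ-range & π-range)
      where
      at : ∀ k → ∣ (π k + π k) * t k - θ k ∣ ≤ ε₀ × (ε₀ ≤ θ k × θ k ≤ π k - ε₀) × (12 // 5 ≤ π k × π k ≤ 17 // 5) → 0ℚ ≤ t k × t k ≤ ½
      at k (h , (a , b) , (d , _)) = *-cancel-≤ 0<2π (lo (π k) (t k) (θ k) (proj₂ h′) a) , *-cancel-≤ 0<2π (hi (π k) (t k) (θ k) (proj₁ h′) b)
        where
        h′ = ∣x∣≤⇒ {(π k + π k) * t k - θ k} {ε₀} h
        0<2π : 0ℚ < π k + π k
        0<2π = ℚ.<-≤-trans (#< (12 // 5)) d <⊞ ℚ.≤-trans (# (12 // 5)) d
        lo : ∀ p t θ → - ε₀ ≤ (p + p) * t - θ → ε₀ ≤ θ → 0ℚ * (p + p) ≤ t * (p + p)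
        lo p t θ h a = by≤ (δ h ⊞ δ a) (l p t θ ε₀)
          where
          l : ∀ p t θ e → t * (p + p) - 0ℚ * (p + p) ≡ (p + p) * t - θ - - e + (θ - e)
          l = solve-∀ ring
        hi : ∀ p t θ → (p + p) * t - θ ≤ ε₀ → θ ≤ p - ε₀ → t * (p + p) ≤ ½ * (p + p)
        hi p t θ h b = by≤ (δ h ⊞ δ b) (solve (p ∷ t ∷ θ ∷ ε₀ ∷ []) ring)

    -- In the application `x = K`, `j = 1/K`, `ρ` approximates `1/π`, and `r` is a multiple of
    -- `1/K`; `r ρ` is the candidate for the type.
    module Level {x j ρ r : ℚ} (xj : x * j ≡ 1ℚ) (0<j : 0ℚ < j) (32≤x : 32 // 1 ≤ x) (0≤r : 0ℚ ≤ r) (r≤2 : r ≤ 2 // 1)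
             (πρ : Ev (λ k → π k * ρ ≤ 1ℚ + (20 // 1) * j × 1ℚ - (20 // 1) * j ≤ π k * ρ)) where

      private
        0≤j = <⇒≤ 0<j

        j≤1 : j ≤ 1ℚ
        j≤1 = lem x j 32≤x xj 0≤j
          where
          lem : ∀ x j → 32 // 1 ≤ x → x * j ≡ 1ℚ → 0ℚ ≤ j → j ≤ 1ℚ
          lem x j p e z = by≤ (δ p ⊠ z ⊞ # (31 // 1) ⊠ z ⊞ δ (≡⇒≤ e)) (solve (x ∷ j ∷ []) ring)

      module _ (m : ℕ) (i : ℤ) (m≥ : (4096 // 1) * x ≤ nat m) where

        private
          M = nat m
          0≤M = 0≤nat m

          -- `Z` is about `2π Y`. After multiplication by `2π`, the error `20 j` in `π ρ` costs at
          -- most `40 r j ≤ 80 j`, while the subtracted `20 j` gains at least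
          -- `40 · (12/5) j = 96 j`; the difference pays for `2 j`.
          near-turn : ∀ M P Y Z η ε → M * Y < r * ρ - (20 // 1) * j - ε → Z ≤ (P + P) * Y + M * η → η * (M * M) ≤ ε → P * ρ ≤ 1ℚ + (20 // 1) * j →
            12 // 5 ≤ P → 0ℚ ≤ ε → 0ℚ ≤ M → M * Z ≤ (2 // 1) * r - (2 // 1) * j
          near-turn M P Y Z η ε h₁ h₂ h₃ h₄ hP 0≤ε 0≤M = by≤
            (0≤M ⊠ δ h₂ ⊞ (0≤P ⊞ 0≤P) ⊠ <⇒≤ (δ< h₁) ⊞ δ h₃ ⊞ # (2 // 1) ⊠ (0≤r ⊠ δ h₄) ⊞ # (40 // 1) ⊠ (0≤j ⊠ (δ hP ⊞ δ r≤2)) ⊞ # (14 // 1) ⊠ 0≤j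
              ⊞ # (2 // 1) ⊠ (0≤ε ⊠ δ hP) ⊞ # (19 // 5) ⊠ 0≤ε)
            (solve (M ∷ P ∷ Y ∷ Z ∷ η ∷ ε ∷ r ∷ ρ ∷ j ∷ []) ring)
            where
            0≤P : 0ℚ ≤ P
            0≤P = ℚ.≤-trans (# (12 // 5)) hP

          -- From `M Z ≤ 2 r ≤ 4` and `M ≥ 4096 K`. The cut at `4096 K` makes the angle so small
          -- that the factor `1 + Z²` of the tangent estimate is negligible against `1/K`.
          tiny : ∀ M Z x j → M * Z ≤ (2 // 1) * r - (2 // 1) * j → (4096 // 1) * x ≤ M → x * j ≡ 1ℚ → 0ℚ ≤ Z → 0ℚ ≤ j → (1024 // 1) * Z ≤ j
          tiny M Z x j h g e 0≤Z 0≤j = by≤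
            (# (1 // 4) ⊠ (0≤j ⊠ (δ h ⊞ δ g ⊠ 0≤Z ⊞ # (2 // 1) ⊠ δ r≤2 ⊞ # (2 // 1) ⊠ 0≤j)) ⊞ # (1024 // 1) ⊠ (0≤Z ⊠ δ (≡⇒≤ (sym e))))
            (solve (M ∷ Z ∷ x ∷ j ∷ r ∷ []) ring)

          1024Z≤j⇒Z≤½ : ∀ Z → 0ℚ ≤ Z → (1024 // 1) * Z ≤ j → Z ≤ ½
          1024Z≤j⇒Z≤½ Z 0≤Z h = by≤ (# (1 // 1024) ⊠ (δ h ⊞ δ j≤1) ⊞ # (511 // 1024)) (solve (Z ∷ j ∷ []) ring)

          -- The tangent estimate bounds `2 M (1 - c)` by about `(2 r - j) s`, whereas the test
          -- inequality makes it at least `2 r s`. What is left over is `j s`, up to errors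
          -- proportional to `η`.
          clash : ∀ M Z C S c s η → (2 // 1) * (1ℚ - C) ≤ S * (Z * (1ℚ + Z * Z)) → S ≤ s + η → - η ≤ C - c → C - c ≤ η → r * s ≤ M * (1ℚ - c) →
            M * Z ≤ (2 // 1) * r - (2 // 1) * j → (1024 // 1) * Z ≤ j → η * (4 // 1 + (2 // 1) * M) ≤ ½ * (j * s) → 0ℚ ≤ Z → 0ℚ ≤ M → 0ℚ ≤ s → 0ℚ ≤ η → j * s ≤ 0ℚ
          clash M Z C S c s η h₁ h₂ h₃ h₃′ h₄ h₅ h₆ h₇ 0≤Z 0≤M 0≤s 0≤η = by≤
            (# (2 // 1) ⊠ (0≤M ⊠ δ h₁) ⊞ # (4 // 1) ⊠ δ h₄ ⊞ # (2 // 1) ⊠ ((0≤M ⊠ (0≤Z ⊠ (# 1ℚ ⊞ 0≤sq Z))) ⊠ δ h₂) ⊞ # (4 // 1) ⊠ (0≤M ⊠ δ h₃′)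
              ⊞ # (2 // 1) ⊠ (δ Q≤ ⊠ (0≤s ⊞ 0≤η)) ⊞ # (2 // 1) ⊠ δ h₇ ⊞ # (2 // 1) ⊠ (0≤η ⊠ (0≤j ⊞ # (2 // 1) ⊠ δ r≤2)))
            (l M Z C S c s η r j)
            where
            Q≤ : M * (Z * (1ℚ + Z * Z)) ≤ (2 // 1) * r - j
            Q≤ = by≤ (δ h₅ ⊞ (δ h₅ ⊞ # (2 // 1) ⊠ δ r≤2 ⊞ # (2 // 1) ⊠ 0≤j) ⊠ 0≤sq Z ⊞ # (1 // 256) ⊠ δ h₆ ⊞ # (255 // 256) ⊠ 0≤j ⊞ # (4 // 1) ⊠ (0≤Z ⊠ δ Z≤1))
              (solve (M ∷ Z ∷ r ∷ j ∷ []) ring)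
              where
              Z≤1 : Z ≤ 1ℚ
              Z≤1 = ℚ.≤-trans (1024Z≤j⇒Z≤½ Z 0≤Z h₆) (#≤ ½ 1ℚ)
            l : ∀ M Z C S c s η r j → 0ℚ - j * s ≡ (2 // 1) * (M * (S * (Z * (1ℚ + Z * Z)) - (2 // 1) * (1ℚ - C))) + ((4 // 1) * (M * (1ℚ - c) - r * s)
              + ((2 // 1) * (M * (Z * (1ℚ + Z * Z)) * (s + η - S)) + ((4 // 1) * (M * (η - (C - c)))
              + ((2 // 1) * (((2 // 1) * r - j - M * (Z * (1ℚ + Z * Z))) * (s + η)) + ((2 // 1) * (½ * (j * s) - η * (4 // 1 + (2 // 1) * M)) + (2 // 1) * (η * (j + (2 // 1) * (2 // 1 - r))))))))
            l = solve-∀ ring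

        -- The nonzero sine determines the tolerance: the contradiction has the form `j ∣s∣ ≤ 0`,
        -- reached only with an `η′` that is small against `j ∣s∣`.
        tail⇒bound : s m ≢ 0ℚ → r * ∣ s m ∣ ≤ nat m * (1ℚ - c m) → ∀ {ε} → 0ℚ < ε → Ev (λ k → r * ρ - (20 // 1) * j - ε ≤ V t m i k)
        tail⇒bound s≢0 h {ε} 0<ε = Ev-map at (2πt 0<η & π-range & πρ & limit (Az m i) 0<η′ & (4 , λ k h → h))
          where
          0<∣s∣ : 0ℚ < ∣ s m ∣
          0<∣s∣ = [ (λ g → ⊥-elim (s≢0 (ℚ.∣p∣≡0⇒p≡0 (s m) (ℚ.≤-antisym g (ℚ.0≤∣p∣ (s m)))))) , (λ g → g) ]′ (∣ s m ∣ ≤⊎< 0ℚ)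
          tol = small {ε} {M * M} 0<ε (0≤M ⊠ 0≤M)
          η = proj₁ tol
          0<η = proj₁ (proj₂ tol)
          ηM²≤ε = proj₂ (proj₂ (proj₂ tol))
          tol′ = small {½ * (j * ∣ s m ∣)} {4 // 1 + (2 // 1) * M} (#< ½ <⊠ (0<j <⊠ 0<∣s∣)) (# (4 // 1) ⊞ # (2 // 1) ⊠ 0≤M)
          η′ = proj₁ tol′
          0<η′ = proj₁ (proj₂ tol′)
          at : ∀ k → ∣ (π k + π k) * t k - θ k ∣ ≤ η × (12 // 5 ≤ π k × π k ≤ 17 // 5) × (π k * ρ ≤ 1ℚ + (20 // 1) * j × 1ℚ - (20 // 1) * j ≤ π k * ρ) ×
            norm (E k (z m i k) -ᶜ w ^ᶜ m) ≤ η′ × 4 ℕ.≤ k → r * ρ - (20 // 1) * j - ε ≤ V t m i k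
          at k (a , (π≥ , _) , (ρ≤ , _) , e , 4≤k) = [ (λ g → g) , (λ g → absurd (0<j <⊠ 0<∣s∣) (contradictory g)) ]′ (r * ρ - (20 // 1) * j - ε ≤⊎< V t m i k)
            where
            Z = ∣ z m i k ∣
            0≤Z = ℚ.0≤∣p∣ (z m i k)
            contradictory : V t m i k < r * ρ - (20 // 1) * j - ε → j * ∣ s m ∣ ≤ 0ℚ
            contradictory g = clash M Z (re (E k (z m i k))) (∣ im (E k (z m i k)) ∣) (c m) (∣ s m ∣) η′
                (proj₂ (E-tan-bounds k 4≤k (z m i k) (1024Z≤j⇒Z≤½ Z 0≤Z Z≤j))) (proj₁ (sin-close m i k e)) (proj₂ (cos-close m i k e)) (proj₁ (cos-close m i k e)) h MZ Z≤j
                (proj₂ (proj₂ (proj₂ tol′))) 0≤Z 0≤M (<⇒≤ 0<∣s∣) (<⇒≤ 0<η′)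
              where
              MZ : M * Z ≤ (2 // 1) * r - (2 // 1) * j
              MZ = near-turn M (π k) (Y m i k) Z η ε g (z≤Y m i k π≥ a) ηM²≤ε ρ≤ π≥ (<⇒≤ 0<ε) 0≤M
              Z≤j : (1024 // 1) * Z ≤ j
              Z≤j = tiny M Z x j MZ m≥ xj 0≤Z 0≤j

      private
        -- The counterpart of `near-turn`: the added `20 j` outweighs the error of `ρ`, as `r ≤ 2`
        -- is below π.
        far-turn : ∀ M P Y Z η ε → r * ρ + (20 // 1) * j - ε ≤ M * Y → (P + P) * Y ≤ Z + M * η → η * (M * M) ≤ ε → 1ℚ - (20 // 1) * j ≤ P * ρ →
          12 // 5 ≤ P → P ≤ 17 // 5 → 0ℚ ≤ ε → 0ℚ ≤ M → (2 // 1) * r - (8 // 1) * ε ≤ M * Z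
        far-turn M P Y Z η ε h₁ h₂ h₃ h₄ hP hP′ 0≤ε 0≤M = by≤
          ((0≤P ⊞ 0≤P) ⊠ δ h₁ ⊞ 0≤M ⊠ δ h₂ ⊞ δ h₃ ⊞ # (2 // 1) ⊠ (0≤r ⊠ δ h₄) ⊞ # (40 // 1) ⊠ (0≤j ⊠ (δ hP ⊞ δ r≤2)) ⊞ # (16 // 1) ⊠ 0≤j
            ⊞ # (2 // 1) ⊠ (0≤ε ⊠ δ hP′) ⊞ # (1 // 5) ⊠ 0≤ε)
          (solve (M ∷ P ∷ Y ∷ Z ∷ η ∷ ε ∷ r ∷ ρ ∷ j ∷ []) ring)
          where
          0≤P : 0ℚ ≤ P
          0≤P = ℚ.≤-trans (# (12 // 5)) hP

        clash-small : ∀ M Z C S c s ε g → Z * S ≤ (2 // 1) * (1ℚ - C) → (2 // 1) * r - (8 // 1) * ε ≤ M * Z → S ≤ s + ε → s ≤ S + ε → - ε ≤ C - c →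
          s ≤ 1ℚ → ε ≤ 1ℚ → M * (1ℚ - c) + g ≤ r * s → ε * (20 // 1 + (2 // 1) * M) ≤ g → 0ℚ ≤ S → 0ℚ ≤ M → 0ℚ ≤ ε → g ≤ 0ℚ
        clash-small M Z C S c s ε g h₁ h₂ h₃ h₄ h₅ s≤1 ε≤1 h₆ h₇ 0≤S 0≤M 0≤ε = by≤
          (0≤M ⊠ δ h₁ ⊞ δ h₂ ⊠ 0≤S ⊞ # (8 // 1) ⊠ (0≤ε ⊠ (δ h₃ ⊞ δ s≤1 ⊞ δ ε≤1)) ⊞ # (2 // 1) ⊠ (0≤r ⊠ δ h₄) ⊞ # (2 // 1) ⊠ (0≤M ⊠ δ h₅) ⊞ # (2 // 1) ⊠ δ h₆ ⊞ δ h₇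
            ⊞ # (2 // 1) ⊠ (0≤ε ⊠ δ r≤2))
          (l M Z C S c s ε g r)
          where
          l : ∀ M Z C S c s ε g r → 0ℚ - g ≡ M * ((2 // 1) * (1ℚ - C) - Z * S) + ((M * Z - ((2 // 1) * r - (8 // 1) * ε)) * S
            + ((8 // 1) * (ε * (s + ε - S + (1ℚ - s + (1ℚ - ε)))) + ((2 // 1) * (r * (S + ε - s)) + ((2 // 1) * (M * (C - c - - ε))
            + ((2 // 1) * (r * s - (M * (1ℚ - c) + g)) + (g - ε * (20 // 1 + (2 // 1) * M) + (2 // 1) * (ε * (2 // 1 - r))))))))
          l = solve-∀ ring

        -- Away from full turns the test inequality has room to spare: `1 - c` is at least 1/20 and
        -- `M ≥ 100`, so `M (1 - c) ≥ 5`, while `r s ≤ 2`.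
        clash-large : ∀ M C c s ε g → 1 // 10 ≤ 1ℚ - C → C - c ≤ ε → - ε ≤ C - c → ε ≤ 1 // 20 → 100 // 1 ≤ M → s ≤ 1ℚ → M * (1ℚ - c) + g ≤ r * s → 0ℚ ≤ s → g ≤ 0ℚ
        clash-large M C c s ε g h₁ h₂ h₃ h₄ h₅ s≤1 h₆ 0≤s = by≤
          (δ h₆ ⊞ δ r≤2 ⊠ 0≤s ⊞ # (2 // 1) ⊠ δ s≤1 ⊞ (# (100 // 1) ⊞ δ h₅) ⊠ (δ h₁ ⊞ δ h₃ ⊞ δ h₄) ⊞ # (1 // 20) ⊠ δ h₅ ⊞ # (3 // 1))
          (l M C c s ε g r)
          where
          l : ∀ M C c s ε g r → 0ℚ - g ≡ r * s - (M * (1ℚ - c) + g) + ((2 // 1 - r) * s + ((2 // 1) * (1ℚ - s)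
            + ((100 // 1 + (M - 100 // 1)) * (1ℚ - C - 1 // 10 + (C - c - - ε + (1 // 20 - ε))) + ((1 // 20) * (M - 100 // 1) + 3 // 1))))
          l = solve-∀ ring

      -- The lower bound is used only at an integer nearest to `m t`, which is the number of turns
      -- or its successor. The angle is then at most about π in absolute value, and either the
      -- tangent estimate `E-tan-bounds` or the estimate `E-1-cos≥` applies.
      bound⇒tail : ∀ {J} → Winding w J → LowerBound t (r * ρ + (20 // 1) * j) → ∀ m → (4096 // 1) * x ≤ nat (suc m) →
        r * ∣ s (suc m) ∣ ≤ nat (suc m) * (1ℚ - c (suc m))
      bound⇒tail {J} wind lb m′ m≥ = [ (λ h → h) , (λ h → absurd (δ< h) (impossible h)) ]′ (r * ∣ s m ∣ ≤⊎< M * (1ℚ - c m))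
        where
        m = suc m′
        M = nat m
        0≤M = 0≤nat m
        100≤M : 100 // 1 ≤ M
        100≤M = lem M x 32≤x m≥
          where
          lem : ∀ M x → 32 // 1 ≤ x → (4096 // 1) * x ≤ M → 100 // 1 ≤ M
          lem M x p q = by≤ (δ q ⊞ # (4096 // 1) ⊠ δ p ⊞ # (130972 // 1)) (solve (M ∷ x ∷ []) ring)
        g = r * ∣ s m ∣ - M * (1ℚ - c m)
        impossible : M * (1ℚ - c m) < r * ∣ s m ∣ → g ≤ 0ℚ
        impossible h = at (proj₁ found) (proj₂ found)
          where
          tol₁ = small {g} {20 // 1 + (2 // 1) * M} (δ< h) (# (20 // 1) ⊞ # (2 // 1) ⊠ 0≤M)
          tol₂ = min₂ (proj₁ (proj₂ tol₁)) (#< (1 // 50))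
          ε = proj₁ tol₂
          0<ε : 0ℚ < ε
          0<ε = proj₁ (proj₂ tol₂)
          ε≤ : ε ≤ 1 // 50
          ε≤ = proj₂ (proj₂ (proj₂ tol₂))
          εM≤g : ε * (20 // 1 + (2 // 1) * M) ≤ g
          εM≤g = ℚ.≤-trans (ℚ.*-monoʳ-≤-nonNeg (20 // 1 + (2 // 1) * M) {{ℚ.nonNegative (# (20 // 1) ⊞ # (2 // 1) ⊠ 0≤M)}} (proj₁ (proj₂ (proj₂ tol₂)))) (proj₂ (proj₂ (proj₂ tol₁)))
          tol₃ = small {ε} {M * M} 0<ε (0≤M ⊠ 0≤M)
          η = proj₁ tol₃
          i₀ = + J m
          i₁ = + suc (J m)
          Facts : ℕ → Set
          Facts k = (∣ (π k + π k) * t k - θ k ∣ ≤ η) × (12 // 5 ≤ π k × π k ≤ 17 // 5) × (π k * ρ ≤ 1ℚ + (20 // 1) * j × 1ℚ - (20 // 1) * j ≤ π k * ρ) ×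
            (norm (E k (z m i₀ k) -ᶜ w ^ᶜ m) ≤ ε) × (norm (E k (z m i₁ k) -ᶜ w ^ᶜ m) ≤ ε) × (r * ρ + (20 // 1) * j - ε ≤ V t m i₀ k) × (r * ρ + (20 // 1) * j - ε ≤ V t m i₁ k) ×
            (- ε ≤ nat m * θ k - nat (J m) * (π k + π k) × nat m * θ k - nat (J m) * (π k + π k) ≤ π k + π k + ε) × 4 ℕ.≤ k
          found : ∃ Facts
          found = Ev⇒∃ (2πt (proj₁ (proj₂ tol₃)) & π-range & πρ & limit (Az m i₀) 0<ε & limit (Az m i₁) 0<ε & lb m′ i₀ 0<ε & lb m′ i₁ 0<ε
            & winding-window π Eπ π-range Eθ 0<ε₀ θ-range wind m 0<ε & (4 , λ k h → h))
          one : ∀ k i → ∣ (π k + π k) * t k - θ k ∣ ≤ η → 12 // 5 ≤ π k → π k ≤ 17 // 5 → 1ℚ - (20 // 1) * j ≤ π k * ρ → norm (E k (z m i k) -ᶜ w ^ᶜ m) ≤ ε →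
            r * ρ + (20 // 1) * j - ε ≤ V t m i k → 4 ℕ.≤ k → ∣ z m i k ∣ ≤ 171 // 50 → g ≤ 0ℚ
          one k i a π≥ π≤ ρ≥ e v 4≤k Z≤ = [ small-case , (λ h → large-case (<⇒≤ h)) ]′ (∣ z m i k ∣ ≤⊎< ½)
            where
            small-case : ∣ z m i k ∣ ≤ ½ → g ≤ 0ℚ
            small-case h′ = clash-small M (∣ z m i k ∣) (re (E k (z m i k))) (∣ im (E k (z m i k)) ∣) (c m) (∣ s m ∣) ε g
              (proj₁ (E-tan-bounds k 4≤k (z m i k) h′)) (far-turn M (π k) (Y m i k) (∣ z m i k ∣) η ε v (Y≤z m i k π≥ a) (proj₂ (proj₂ (proj₂ tol₃))) ρ≥ π≥ π≤ (<⇒≤ 0<ε) 0≤M)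
              (proj₁ (sin-close m i k e)) (proj₂ (sin-close m i k e)) (proj₂ (cos-close m i k e)) (∣s∣≤1 m) (ℚ.≤-trans ε≤ (#≤ (1 // 50) 1ℚ))
              (≡⇒≤ (l (M * (1ℚ - c m)) (r * ∣ s m ∣))) εM≤g (ℚ.0≤∣p∣ (im (E k (z m i k)))) 0≤M (<⇒≤ 0<ε)
              where
              l : ∀ a b → a + (b - a) ≡ b
              l = solve-∀ ring
            large-case : ½ ≤ ∣ z m i k ∣ → g ≤ 0ℚ
            large-case h′ = clash-large M (re (E k (z m i k))) (c m) (∣ s m ∣) ε g (E-1-cos≥ k 4≤k (z m i k) h′ Z≤) (proj₁ (cos-close m i k e)) (proj₂ (cos-close m i k e))
              (ℚ.≤-trans ε≤ (#≤ (1 // 50) (1 // 20))) 100≤M (∣s∣≤1 m) (≡⇒≤ (l (M * (1ℚ - c m)) (r * ∣ s m ∣))) (ℚ.0≤∣p∣ (s m))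
              where
              l : ∀ a b → a + (b - a) ≡ b
              l = solve-∀ ring
          at : ∀ k → Facts k → g ≤ 0ℚ
          at k (a , (π≥ , π≤) , (_ , ρ≥) , e₀ , e₁ , v₀ , v₁ , (lo , hi) , 4≤k) = [ first , (λ h → second (<⇒≤ h)) ]′ (Φ ≤⊎< π k)
            where
            Φ = nat m * θ k - nat (J m) * (π k + π k)
            z₀ : z m i₀ k ≡ Φ
            z₀ = cong (λ v → nat m * θ k - v * (π k + π k)) (int-nat (J m))
            z₁ : z m i₁ k ≡ Φ - (π k + π k)
            z₁ = trans (cong (λ v → nat m * θ k - v * (π k + π k)) (int-nat (suc (J m)))) (l (nat m * θ k) (nat (J m)) (π k + π k))
              where
              l : ∀ a b p → a - (1ℚ + b) * p ≡ a - b * p - p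
              l = solve-∀ ring
            l₁ : ∀ f p → f ≤ p → p ≤ 17 // 5 → f ≤ 171 // 50
            l₁ f p a b = ℚ.≤-trans a (ℚ.≤-trans b (#≤ (17 // 5) (171 // 50)))
            l₂ : ∀ f ε → - ε ≤ f → ε ≤ 1 // 50 → - f ≤ 171 // 50
            l₂ f ε a b = by≤ (δ a ⊞ δ b ⊞ # (17 // 5)) (solve (f ∷ ε ∷ []) ring)
            l₃ : ∀ f p ε → f ≤ p + p + ε → ε ≤ 1 // 50 → f - (p + p) ≤ 171 // 50
            l₃ f p ε a b = by≤ (δ a ⊞ δ b ⊞ # (17 // 5)) (solve (f ∷ p ∷ ε ∷ []) ring)
            l₄ : ∀ f p → p ≤ f → p ≤ 17 // 5 → - (f - (p + p)) ≤ 171 // 50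
            l₄ f p a b = by≤ (δ a ⊞ δ b ⊞ # (1 // 50)) (solve (f ∷ p ∷ []) ring)
            first : Φ ≤ π k → g ≤ 0ℚ
            first h′ = one k i₀ a π≥ π≤ ρ≥ e₀ v₀ 4≤k (subst (λ v → ∣ v ∣ ≤ 171 // 50) (sym z₀) (∣x∣≤ {Φ} (l₁ Φ (π k) h′ π≤) (l₂ Φ ε lo ε≤)))
            second : π k ≤ Φ → g ≤ 0ℚ
            second h′ = one k i₁ a π≥ π≤ ρ≥ e₁ v₁ 4≤k (subst (λ v → ∣ v ∣ ≤ 171 // 50) (sym z₁) (∣x∣≤ {Φ - (π k + π k)} (l₃ Φ (π k) ε hi ε≤) (l₄ Φ (π k) h′ π≤)))

      private
        -- From `r ≤ 2 < 12/5 ≤ π`; the subtracted `20 j` absorbs the error of `ρ`.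
        v≤1 : ∀ P → P * ρ ≤ 1ℚ + (20 // 1) * j → 12 // 5 ≤ P → r * ρ - (20 // 1) * j ≤ 1ℚ
        v≤1 P h hP = *-cancel-≤ (ℚ.<-≤-trans (#< (12 // 5)) hP)
          (by≤ (0≤r ⊠ δ h ⊞ δ hP ⊞ δ r≤2 ⊞ # (20 // 1) ⊠ (0≤j ⊠ (δ hP ⊞ δ r≤2)) ⊞ # (8 // 1) ⊠ 0≤j ⊞ # (2 // 5)) (solve (P ∷ r ∷ ρ ∷ j ∷ []) ring))

      module _ {J} (wind : Winding w J) (n : ℕ) (0<n : 0ℚ < nat n) where

        private
          count-close : Ev (λ k → ∣ nat n * t k - nat (J n) ∣ ≤ 2 // 1)
          count-close = Ev-map at (2πt (proj₁ (proj₂ tol)) & π-range & winding-window π Eπ π-range Eθ 0<ε₀ θ-range wind n (#< 1ℚ))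
            where
            tol = small {1ℚ} {nat n} (#< 1ℚ) (0≤nat n)
            η = proj₁ tol
            at : ∀ k → ∣ (π k + π k) * t k - θ k ∣ ≤ η × (12 // 5 ≤ π k × π k ≤ 17 // 5) ×
              (- 1ℚ ≤ nat n * θ k - nat (J n) * (π k + π k) × nat n * θ k - nat (J n) * (π k + π k) ≤ π k + π k + 1ℚ) → ∣ nat n * t k - nat (J n) ∣ ≤ 2 // 1
            at k (a , (π≥ , _) , (lo , hi)) = ∣x∣≤ {nat n * t k - nat (J n)}
                (*-cancel-≤ 0<2π (up (nat n) (t k) (nat (J n)) (π k) (θ k) η (proj₁ a′) hi (proj₂ (proj₂ (proj₂ tol))) π≥ (0≤nat n)))
                (*-cancel-≤ 0<2π (down (nat n) (t k) (nat (J n)) (π k) (θ k) η (proj₂ a′) lo (proj₂ (proj₂ (proj₂ tol))) π≥ (0≤nat n)))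
              where
              a′ = ∣x∣≤⇒ {(π k + π k) * t k - θ k} {η} a
              0<2π : 0ℚ < π k + π k
              0<2π = ℚ.<-≤-trans (#< (12 // 5)) π≥ <⊞ ℚ.≤-trans (# (12 // 5)) π≥
              up : ∀ n t J p θ η → (p + p) * t - θ ≤ η → n * θ - J * (p + p) ≤ p + p + 1ℚ → η * n ≤ 1ℚ → 12 // 5 ≤ p → 0ℚ ≤ n → (n * t - J) * (p + p) ≤ (2 // 1) * (p + p)
              up n t J p θ η a b e h z = by≤ (z ⊠ δ a ⊞ δ b ⊞ δ e ⊞ # (2 // 1) ⊠ δ h ⊞ # (14 // 5)) (solve (n ∷ t ∷ J ∷ p ∷ θ ∷ η ∷ []) ring)
              down : ∀ n t J p θ η → - η ≤ (p + p) * t - θ → - 1ℚ ≤ n * θ - J * (p + p) → η * n ≤ 1ℚ → 12 // 5 ≤ p → 0ℚ ≤ n → - (n * t - J) * (p + p) ≤ (2 // 1) * (p + p)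
              down n t J p θ η a b e h z = by≤ (z ⊠ δ a ⊞ δ b ⊞ δ e ⊞ # (4 // 1) ⊠ δ h ⊞ # (38 // 5)) (solve (n ∷ t ∷ J ∷ p ∷ θ ∷ η ∷ []) ring)

          -- The integer counterpart of `n ∣m t - i∣`, with the counter in place of `n t`; the two
          -- differ by at most `2 m`.
          D : ℕ → ℤ → ℚ
          D m i = ∣ nat m * nat (J n) - int i * nat n ∣

          nY-D : ∀ m i k → ∣ nat n * t k - nat (J n) ∣ ≤ 2 // 1 → nat n * Y m i k ≤ D m i + (2 // 1) * nat m × D m i ≤ nat n * Y m i k + (2 // 1) * nat m
          nY-D m i k h = subst (λ a → a ≤ D m i + (2 // 1) * nat m × D m i ≤ a + (2 // 1) * nat m) (abs-scale (nat m * t k - int i) (0≤nat n))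
              (∣a∣≤∣b∣+e (nat n * (nat m * t k - int i)) (nat m * nat (J n) - int i * nat n) close
              , ∣a∣≤∣b∣+e (nat m * nat (J n) - int i * nat n) (nat n * (nat m * t k - int i)) (subst (_≤ (2 // 1) * nat m) (∣-∣-swap (nat n * (nat m * t k - int i)) (nat m * nat (J n) - int i * nat n)) close))
            where
            close : ∣ nat n * (nat m * t k - int i) - (nat m * nat (J n) - int i * nat n) ∣ ≤ (2 // 1) * nat m
            close = subst (_≤ (2 // 1) * nat m) (sym (trans (cong ∣_∣ (l (nat n) (nat m) (t k) (int i) (nat (J n)))) (abs-scale (nat n * t k - nat (J n)) (0≤nat m))))
              (l′ (nat m) (∣ nat n * t k - nat (J n) ∣) (0≤nat m) h)
              where
              l : ∀ n m t i J → n * (m * t - i) - (m * J - i * n) ≡ m * (n * t - J)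
              l = solve-∀ ring
              l′ : ∀ m a → 0ℚ ≤ m → a ≤ 2 // 1 → m * a ≤ (2 // 1) * m
              l′ m a z h = by≤ (z ⊠ δ h) (solve (m ∷ a ∷ []) ring)

          -- `m D` misses `n m ∣m t - i∣` by at most `2 m²`, and division by `n` must leave at most
          -- `2 j`. This dictates `(4096 K)² K` steps of the counter.
          M²≤nj : ∀ m → nat m * nat m * x ≤ nat n → nat m * nat m ≤ nat n * j
          M²≤nj m h = lem (nat m * nat m) (nat n) x j h xj 0≤j
            where
            lem : ∀ a n x j → a * x ≤ n → x * j ≡ 1ℚ → 0ℚ ≤ j → a ≤ n * j
            lem a n x j h e z = subst (_≤ n * j) (trans (l a x j) (trans (cong (a *_) e) (ℚ.*-identityʳ a))) (ℚ.*-monoʳ-≤-nonNeg j {{ℚ.nonNegative z}} h)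
              where
              l : ∀ a x j → a * x * j ≡ a * (x * j)
              l = solve-∀ ring

        finite⇒bound : ∀ m i → nat m * nat m * x ≤ nat n → r * ρ * nat n ≤ nat m * D m i → ∀ {ε} → 0ℚ < ε → Ev (λ k → r * ρ - (20 // 1) * j - ε ≤ V t m i k)
        finite⇒bound m i h g {ε} 0<ε = Ev-map at count-close
          where
          at : ∀ k → ∣ nat n * t k - nat (J n) ∣ ≤ 2 // 1 → r * ρ - (20 // 1) * j - ε ≤ V t m i k
          at k e = ℚ.≤-trans (weaken (r * ρ) j ε 0≤j (<⇒≤ 0<ε)) (*-cancel-≤ 0<n
              (lem (r * ρ) j (nat n) (nat m) (D m i) (Y m i k) (M²≤nj m h) g (proj₂ (nY-D m i k e)) (0≤nat m)))
            where
            weaken : ∀ v j ε → 0ℚ ≤ j → 0ℚ ≤ ε → v - (20 // 1) * j - ε ≤ v - (2 // 1) * j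
            weaken v j ε a b = by≤ (# (18 // 1) ⊠ a ⊞ b) (solve (v ∷ j ∷ ε ∷ []) ring)
            lem : ∀ v j n m D Y → m * m ≤ n * j → v * n ≤ m * D → D ≤ n * Y + (2 // 1) * m → 0ℚ ≤ m → (v - (2 // 1) * j) * n ≤ m * Y * n
            lem v j n m D Y a b c z = by≤ (# (2 // 1) ⊠ δ a ⊞ δ b ⊞ z ⊠ δ c) (solve (v ∷ j ∷ n ∷ m ∷ D ∷ Y ∷ []) ring)

        ¬finite⇒¬bound : ∀ m i → nat (suc m) * nat (suc m) * x ≤ nat n → nat (suc m) * D (suc m) i < r * ρ * nat n → ¬ LowerBound t (r * ρ + (20 // 1) * j)
        ¬finite⇒¬bound m i h g lb = at (proj₁ found) (proj₂ found)
          where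
          found : ∃ λ k → (∣ nat n * t k - nat (J n) ∣ ≤ 2 // 1) × (r * ρ + (20 // 1) * j - j ≤ V t (suc m) i k)
          found = Ev⇒∃ (count-close & lb m i 0<j)
          lem : ∀ v j n m D Y → m * m ≤ n * j → m * D < v * n → n * Y ≤ D + (2 // 1) * m → 0ℚ ≤ m → 0ℚ ≤ n → 0ℚ ≤ j → m * Y * n < (v + (20 // 1) * j - j) * n
          lem v j n m D Y a b c z w u = by< (δ< b <⊞ (# (2 // 1) ⊠ δ a ⊞ z ⊠ δ c ⊞ # (17 // 1) ⊠ (w ⊠ u))) (solve (v ∷ j ∷ n ∷ m ∷ D ∷ Y ∷ []) ring)
          at : ∀ k → (∣ nat n * t k - nat (J n) ∣ ≤ 2 // 1) × (r * ρ + (20 // 1) * j - j ≤ V t (suc m) i k) → ⊥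
          at k (e , v) = absurd (lem (r * ρ) j (nat n) (nat (suc m)) (D (suc m) i) (Y (suc m) i k) (M²≤nj (suc m) h) g (proj₁ (nY-D (suc m) i k e)) (0≤nat (suc m)) (0≤nat n) 0≤j)
            (ℚ.*-monoʳ-≤-nonNeg (nat n) {{ℚ.nonNegative (0≤nat n)}} v)

      private
        1≤V : ∀ m a → 1ℚ ≤ a → 1ℚ ≤ nat (suc m) * a
        1≤V m a h = lem (nat m) a (0≤nat m) h
          where
          lem : ∀ m a → 0ℚ ≤ m → 1ℚ ≤ a → 1ℚ ≤ (1ℚ + m) * a
          lem m a z h = by≤ (δ h ⊞ z ⊠ (# 1ℚ ⊞ δ h)) (solve (m ∷ a ∷ []) ring)

        far-Y : ∀ m i k → 0ℚ ≤ t k → t k ≤ ½ → int i ≤ - 1ℚ ⊎ nat m + 1ℚ ≤ int i → 1ℚ ≤ ∣ nat m * t k - int i ∣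
        far-Y m i k a b (inj₁ h) = ℚ.≤-trans (lem (nat m) (t k) (int i) (0≤nat m) a h) (x≤∣x∣ (nat m * t k - int i))
          where
          lem : ∀ m t i → 0ℚ ≤ m → 0ℚ ≤ t → i ≤ - 1ℚ → 1ℚ ≤ m * t - i
          lem m t i z a h = by≤ (z ⊠ a ⊞ δ h) (solve (m ∷ t ∷ i ∷ []) ring)
        far-Y m i k a b (inj₂ h) = ℚ.≤-trans (lem (nat m) (t k) (int i) (0≤nat m) b h) (-x≤∣x∣ (nat m * t k - int i))
          where
          lem : ∀ m t i → 0ℚ ≤ m → t ≤ ½ → m + 1ℚ ≤ i → 1ℚ ≤ - (m * t - i)
          lem m t i z b h = by≤ (z ⊠ δ b ⊞ # ½ ⊠ z ⊞ δ h) (solve (m ∷ t ∷ i ∷ []) ring)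

      -- As `0 ≤ t ≤ 1/2`, such numerators are at distance at least 1 from the multiple of `t`,
      -- which no candidate exceeds by `v≤1`. Hence finitely many numerators remain for each
      -- denominator.
      outside⇒bound : ∀ m i → int i ≤ - 1ℚ ⊎ nat (suc m) + 1ℚ ≤ int i → ∀ {ε} → 0ℚ < ε → Ev (λ k → r * ρ - (20 // 1) * j - ε ≤ V t (suc m) i k)
      outside⇒bound m i h {ε} 0<ε = Ev-map at (0≤t≤½ & π-range & πρ)
        where
        at : ∀ k → (0ℚ ≤ t k × t k ≤ ½) × (12 // 5 ≤ π k × π k ≤ 17 // 5) × (π k * ρ ≤ 1ℚ + (20 // 1) * j × 1ℚ - (20 // 1) * j ≤ π k * ρ) → r * ρ - (20 // 1) * j - ε ≤ V t (suc m) i k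
        at k ((a , b) , (π≥ , _) , (ρ≤ , _)) = ℚ.≤-trans (weaken (r * ρ - (20 // 1) * j) ε (<⇒≤ 0<ε))
            (ℚ.≤-trans (v≤1 (π k) ρ≤ π≥) (1≤V m (∣ nat (suc m) * t k - int i ∣) (far-Y (suc m) i k a b h)))
          where
          weaken : ∀ v ε → 0ℚ ≤ ε → v - ε ≤ v
          weaken v ε z = by≤ z (solve (v ∷ ε ∷ []) ring)

    LowerBound-0 : LowerBound t 0ℚ
    LowerBound-0 m i {ε} 0<ε = 0 , λ k _ → ℚ.≤-trans (lem ε (<⇒≤ 0<ε)) (0≤nat (suc m) ⊠ 0≤Y (suc m) i k)
      where
      lem : ∀ ε → 0ℚ ≤ ε → 0ℚ - ε ≤ 0ℚ
      lem ε z = subst (0ℚ - ε ≤_) (ℚ.+-inverseʳ ε) (ℚ.+-monoˡ-≤ (- ε) z)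

    -- The fraction 0/1 gives the value `t ≤ 1/2`. The constant 14/25 leaves a margin on both sides,
    -- between 1/2 and the candidate `2/π` at the end of the search.
    ¬LowerBound-large : ∀ {v} → 14 // 25 ≤ v → ¬ LowerBound t v
    ¬LowerBound-large {v} h lb = at (proj₁ found) (proj₂ found)
      where
      found : ∃ λ k → (0ℚ ≤ t k × t k ≤ ½) × (v - 1 // 50 ≤ V t 1 (+ 0) k)
      found = Ev⇒∃ (0≤t≤½ & lb 0 (+ 0) (#< (1 // 50)))
      at : ∀ k → (0ℚ ≤ t k × t k ≤ ½) × (v - 1 // 50 ≤ V t 1 (+ 0) k) → ⊥
      at k ((a , b) , u) = absurd (ℚ.<-≤-trans (ℚ.≤-<-trans b (#< (54 // 100 - ½) ⊹)) (lem v h)) (subst (v - 1 // 50 ≤_) V≡ u)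
        where
        _⊹ : 0ℚ < 54 // 100 - ½ → ½ < 54 // 100
        _⊹ p = by< p refl
        lem : ∀ v → 14 // 25 ≤ v → 54 // 100 ≤ v - 1 // 50
        lem v h = by≤ (δ h) (solve (v ∷ []) ring)
        l : ∀ t → 1ℚ * t - 0ℚ ≡ t
        l = solve-∀ ring
        V≡ : V t 1 (+ 0) k ≡ t k
        V≡ = trans (ℚ.*-identityˡ (∣ 1ℚ * t k - 0ℚ ∣)) (trans (cong ∣_∣ (l (t k))) (ℚ.0≤p⇒∣p∣≡p a))

-- Integer recurrences of order 6 with double roots

module Recurrence where

  import Defs as D
  open import Algebra.Properties.Monoid.Sum using (sum)
  open import Data.Fin.Base using (Fin; zero; suc; toℕ; opposite)
  open import Data.Integer.Base as ℤ using (ℤ; +_; 0ℤ; 1ℤ)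
  import Data.Integer.Properties as ℤ
  open import Data.Integer.Tactic.RingSolver using (solve-∀)
  open import Data.Nat.Base as ℕ using (ℕ; zero; suc)
  import Data.Nat.Properties as ℕ
  open import Relation.Binary.PropositionalEquality using (_≡_; _≢_; refl; sym; trans; cong; cong₂)

  Σℤ : ∀ {n} → (Fin n → ℤ) → ℤ
  Σℤ = sum ℤ.+-0-monoid

  sum-cong : ∀ k {f g : Fin k → ℤ} → (∀ i → f i ≡ g i) → Σℤ f ≡ Σℤ g
  sum-cong zero h = refl
  sum-cong (suc k) h = cong₂ ℤ._+_ (h zero) (sum-cong k (λ i → h (suc i)))

  sum-linear : ∀ n k e (c f g h : Fin n → ℤ) →
    k ℤ.* (Σℤ (λ i → c i ℤ.* f i) ℤ.- Σℤ (λ i → c i ℤ.* g i)) ℤ.- e ℤ.* Σℤ (λ i → c i ℤ.* h i) ≡ Σℤ (λ i → c i ℤ.* (k ℤ.* (f i ℤ.- g i) ℤ.- e ℤ.* h i))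
  sum-linear zero k e c f g h = trans (cong₂ ℤ._-_ (ℤ.*-zeroʳ k) (ℤ.*-zeroʳ e)) refl
  sum-linear (suc n) k e c f g h = trans
      (step k e (c zero) (f zero) (g zero) (h zero) (Σℤ (λ i → c (suc i) ℤ.* f (suc i))) (Σℤ (λ i → c (suc i) ℤ.* g (suc i))) (Σℤ (λ i → c (suc i) ℤ.* h (suc i))))
      (cong (λ v → c zero ℤ.* (k ℤ.* (f zero ℤ.- g zero) ℤ.- e ℤ.* h zero) ℤ.+ v) (sum-linear n k e (λ i → c (suc i)) (λ i → f (suc i)) (λ i → g (suc i)) (λ i → h (suc i))))
    where
    step : ∀ k e c f g h F G H → k ℤ.* ((c ℤ.* f ℤ.+ F) ℤ.- (c ℤ.* g ℤ.+ G)) ℤ.- e ℤ.* (c ℤ.* h ℤ.+ H) ≡ c ℤ.* (k ℤ.* (f ℤ.- g) ℤ.- e ℤ.* h) ℤ.+ (k ℤ.* (F ℤ.- G) ℤ.- e ℤ.* H)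
    step = solve-∀

  -- Real and imaginary parts of (a⁺ - a⁻ + b i)ⁿ, each as a difference of naturals.
  module Gauss (a⁺ a⁻ b : ℕ) where

    x⁺ x⁻ y⁺ y⁻ : ℕ → ℕ
    x⁺ zero    = 1
    x⁺ (suc n) = a⁺ ℕ.* x⁺ n ℕ.+ a⁻ ℕ.* x⁻ n ℕ.+ b ℕ.* y⁻ n
    x⁻ zero    = 0
    x⁻ (suc n) = a⁺ ℕ.* x⁻ n ℕ.+ a⁻ ℕ.* x⁺ n ℕ.+ b ℕ.* y⁺ n
    y⁺ zero    = 0
    y⁺ (suc n) = b ℕ.* x⁺ n ℕ.+ a⁺ ℕ.* y⁺ n ℕ.+ a⁻ ℕ.* y⁻ n
    y⁻ zero    = 0
    y⁻ (suc n) = b ℕ.* x⁻ n ℕ.+ a⁺ ℕ.* y⁻ n ℕ.+ a⁻ ℕ.* y⁺ n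

    a : ℤ
    a = + a⁺ ℤ.- + a⁻

    X Y : ℕ → ℤ
    X n = + x⁺ n ℤ.- + x⁻ n
    Y n = + y⁺ n ℤ.- + y⁻ n

    private
      pos₃ : ∀ u v w x y z → + (u ℕ.* v ℕ.+ w ℕ.* x ℕ.+ y ℕ.* z) ≡ + u ℤ.* + v ℤ.+ + w ℤ.* + x ℤ.+ + y ℤ.* + z
      pos₃ u v w x y z = trans (ℤ.pos-+ (u ℕ.* v ℕ.+ w ℕ.* x) (y ℕ.* z)) (cong₂ ℤ._+_
        (trans (ℤ.pos-+ (u ℕ.* v) (w ℕ.* x)) (cong₂ ℤ._+_ (ℤ.pos-* u v) (ℤ.pos-* w x))) (ℤ.pos-* y z))

    X-suc : ∀ n → X (suc n) ≡ a ℤ.* X n ℤ.- + b ℤ.* Y n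
    X-suc n = trans (cong₂ ℤ._-_ (pos₃ a⁺ (x⁺ n) a⁻ (x⁻ n) b (y⁻ n)) (pos₃ a⁺ (x⁻ n) a⁻ (x⁺ n) b (y⁺ n)))
        (lem (+ a⁺) (+ a⁻) (+ b) (+ x⁺ n) (+ x⁻ n) (+ y⁺ n) (+ y⁻ n))
      where
      lem : ∀ a a′ b x x′ y y′ → (a ℤ.* x ℤ.+ a′ ℤ.* x′ ℤ.+ b ℤ.* y′) ℤ.- (a ℤ.* x′ ℤ.+ a′ ℤ.* x ℤ.+ b ℤ.* y) ≡ (a ℤ.- a′) ℤ.* (x ℤ.- x′) ℤ.- b ℤ.* (y ℤ.- y′)
      lem = solve-∀

    Y-suc : ∀ n → Y (suc n) ≡ + b ℤ.* X n ℤ.+ a ℤ.* Y n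
    Y-suc n = trans (cong₂ ℤ._-_ (pos₃ b (x⁺ n) a⁺ (y⁺ n) a⁻ (y⁻ n)) (pos₃ b (x⁻ n) a⁺ (y⁻ n) a⁻ (y⁺ n)))
        (lem (+ a⁺) (+ a⁻) (+ b) (+ x⁺ n) (+ x⁻ n) (+ y⁺ n) (+ y⁻ n))
      where
      lem : ∀ a a′ b x x′ y y′ → (b ℤ.* x ℤ.+ a ℤ.* y ℤ.+ a′ ℤ.* y′) ℤ.- (b ℤ.* x′ ℤ.+ a ℤ.* y′ ℤ.+ a′ ℤ.* y) ≡ b ℤ.* (x ℤ.- x′) ℤ.+ (a ℤ.- a′) ℤ.* (y ℤ.- y′)
      lem = solve-∀

    module Positivity (d′ : ℕ) (a²+b²≡d² : a ℤ.* a ℤ.+ + b ℤ.* + b ≡ + suc d′ ℤ.* + suc d′) where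

      d : ℤ
      d = + suc d′

      -- Expansion of T⁶ - (T - d)² (T² - 2aT + d²)².
      coefficient : Fin 6 → ℤ
      coefficient zero                                   = + 2 ℤ.* (+ 2 ℤ.* a ℤ.+ d)
      coefficient (suc zero)                             = ℤ.- ((+ 2 ℤ.* a ℤ.+ d) ℤ.* (+ 2 ℤ.* a ℤ.+ d) ℤ.+ + 2 ℤ.* (d ℤ.* d ℤ.+ + 2 ℤ.* a ℤ.* d))
      coefficient (suc (suc zero))                       = + 2 ℤ.* (d ℤ.* d ℤ.* d) ℤ.+ + 2 ℤ.* ((+ 2 ℤ.* a ℤ.+ d) ℤ.* (d ℤ.* d ℤ.+ + 2 ℤ.* a ℤ.* d))
      coefficient (suc (suc (suc zero)))                 = ℤ.- ((d ℤ.* d ℤ.+ + 2 ℤ.* a ℤ.* d) ℤ.* (d ℤ.* d ℤ.+ + 2 ℤ.* a ℤ.* d) ℤ.+ + 2 ℤ.* (d ℤ.* d ℤ.* d) ℤ.* (+ 2 ℤ.* a ℤ.+ d))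
      coefficient (suc (suc (suc (suc zero))))           = + 2 ℤ.* (d ℤ.* d ℤ.* d) ℤ.* (d ℤ.* d ℤ.+ + 2 ℤ.* a ℤ.* d)
      coefficient (suc (suc (suc (suc (suc zero)))))     = ℤ.- (d ℤ.* d ℤ.* d ℤ.* (d ℤ.* d ℤ.* d))

      -- Written as the unfolded sum of the field `recurrence`, including the final `0ℤ`, so that
      -- the two forms agree by computation.
      Recurrent : (ℕ → ℤ) → Set
      Recurrent s = ∀ n → s (6 ℕ.+ n) ≡ coefficient zero ℤ.* s (5 ℕ.+ n) ℤ.+ (coefficient (suc zero) ℤ.* s (4 ℕ.+ n) ℤ.+
        (coefficient (suc (suc zero)) ℤ.* s (3 ℕ.+ n) ℤ.+ (coefficient (suc (suc (suc zero))) ℤ.* s (2 ℕ.+ n) ℤ.+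
        (coefficient (suc (suc (suc (suc zero)))) ℤ.* s (1 ℕ.+ n) ℤ.+ (coefficient (suc (suc (suc (suc (suc zero))))) ℤ.* s n ℤ.+ 0ℤ)))))

      Recurrent-combine : ∀ {f g h} k e → Recurrent f → Recurrent g → Recurrent h → Recurrent (λ n → k ℤ.* (f n ℤ.- g n) ℤ.- e ℤ.* h n)
      Recurrent-combine {f} {g} {h} k e rf rg rh n = trans (cong₂ (λ u v → k ℤ.* u ℤ.- e ℤ.* v) (cong₂ ℤ._-_ (rf n) (rg n)) (rh n))
          (sum-linear 6 k e coefficient (λ i → f (toℕ (opposite i) ℕ.+ n)) (λ i → g (toℕ (opposite i) ℕ.+ n)) (λ i → h (toℕ (opposite i) ℕ.+ n)))

      Q : ℕ → ℤ
      Q zero    = 1ℤ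
      Q (suc n) = d ℤ.* Q n

      -- `d` is a double root of the characteristic polynomial, whence the factor `n` in front of
      -- `dⁿ`.
      Recurrent-mQ : Recurrent (λ n → + n ℤ.* Q n)
      Recurrent-mQ n = lem a d (+ n) (Q n)
        where
        lem : ∀ a d m q → (+ 6 ℤ.+ m) ℤ.* (d ℤ.* (d ℤ.* (d ℤ.* (d ℤ.* (d ℤ.* (d ℤ.* q)))))) ≡
          (+ 2 ℤ.* (+ 2 ℤ.* a ℤ.+ d)) ℤ.* ((+ 5 ℤ.+ m) ℤ.* (d ℤ.* (d ℤ.* (d ℤ.* (d ℤ.* (d ℤ.* q)))))) ℤ.+
          ((ℤ.- ((+ 2 ℤ.* a ℤ.+ d) ℤ.* (+ 2 ℤ.* a ℤ.+ d) ℤ.+ + 2 ℤ.* (d ℤ.* d ℤ.+ + 2 ℤ.* a ℤ.* d))) ℤ.* ((+ 4 ℤ.+ m) ℤ.* (d ℤ.* (d ℤ.* (d ℤ.* (d ℤ.* q))))) ℤ.+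
          ((+ 2 ℤ.* (d ℤ.* d ℤ.* d) ℤ.+ + 2 ℤ.* ((+ 2 ℤ.* a ℤ.+ d) ℤ.* (d ℤ.* d ℤ.+ + 2 ℤ.* a ℤ.* d))) ℤ.* ((+ 3 ℤ.+ m) ℤ.* (d ℤ.* (d ℤ.* (d ℤ.* q)))) ℤ.+
          ((ℤ.- ((d ℤ.* d ℤ.+ + 2 ℤ.* a ℤ.* d) ℤ.* (d ℤ.* d ℤ.+ + 2 ℤ.* a ℤ.* d) ℤ.+ + 2 ℤ.* (d ℤ.* d ℤ.* d) ℤ.* (+ 2 ℤ.* a ℤ.+ d))) ℤ.* ((+ 2 ℤ.+ m) ℤ.* (d ℤ.* (d ℤ.* q))) ℤ.+
          ((+ 2 ℤ.* (d ℤ.* d ℤ.* d) ℤ.* (d ℤ.* d ℤ.+ + 2 ℤ.* a ℤ.* d)) ℤ.* ((+ 1 ℤ.+ m) ℤ.* (d ℤ.* q)) ℤ.+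
          ((ℤ.- (d ℤ.* d ℤ.* d ℤ.* (d ℤ.* d ℤ.* d))) ℤ.* (m ℤ.* q) ℤ.+ 0ℤ)))))
        lem = solve-∀

      module _ (z : ℕ → ℤ) (z-rec : ∀ n → z (2 ℕ.+ n) ≡ + 2 ℤ.* a ℤ.* z (suc n) ℤ.- d ℤ.* d ℤ.* z n) where

        -- The two-term recurrence implies the six-term one, also after multiplication by (k + l n).
        Recurrent-m : ∀ k l → Recurrent (λ n → (k ℤ.+ l ℤ.* + n) ℤ.* z n)
        Recurrent-m k l n = lem a d (k ℤ.+ l ℤ.* + n) l (z n) (z (1 ℕ.+ n)) (z (2 ℕ.+ n)) (z (3 ℕ.+ n)) (z (4 ℕ.+ n)) (z (5 ℕ.+ n)) (z (6 ℕ.+ n))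
            (k ℤ.+ l ℤ.* + (1 ℕ.+ n)) (k ℤ.+ l ℤ.* + (2 ℕ.+ n)) (k ℤ.+ l ℤ.* + (3 ℕ.+ n)) (k ℤ.+ l ℤ.* + (4 ℕ.+ n)) (k ℤ.+ l ℤ.* + (5 ℕ.+ n)) (k ℤ.+ l ℤ.* + (6 ℕ.+ n))
            (s k l (+ n) (+ 1)) (s k l (+ n) (+ 2)) (s k l (+ n) (+ 3)) (s k l (+ n) (+ 4)) (s k l (+ n) (+ 5)) (s k l (+ n) (+ 6))
            (z-rec n) (z-rec (1 ℕ.+ n)) (z-rec (2 ℕ.+ n)) (z-rec (3 ℕ.+ n)) (z-rec (4 ℕ.+ n))
          where
          s : ∀ k l n i → k ℤ.+ l ℤ.* (i ℤ.+ n) ≡ (k ℤ.+ l ℤ.* n) ℤ.+ l ℤ.* i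
          s = solve-∀
          lem : ∀ a d m l z₀ z₁ z₂ z₃ z₄ z₅ z₆ m₁ m₂ m₃ m₄ m₅ m₆ →
            m₁ ≡ m ℤ.+ l ℤ.* + 1 → m₂ ≡ m ℤ.+ l ℤ.* + 2 → m₃ ≡ m ℤ.+ l ℤ.* + 3 → m₄ ≡ m ℤ.+ l ℤ.* + 4 → m₅ ≡ m ℤ.+ l ℤ.* + 5 → m₆ ≡ m ℤ.+ l ℤ.* + 6 →
            z₂ ≡ + 2 ℤ.* a ℤ.* z₁ ℤ.- d ℤ.* d ℤ.* z₀ → z₃ ≡ + 2 ℤ.* a ℤ.* z₂ ℤ.- d ℤ.* d ℤ.* z₁ → z₄ ≡ + 2 ℤ.* a ℤ.* z₃ ℤ.- d ℤ.* d ℤ.* z₂ →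
            z₅ ≡ + 2 ℤ.* a ℤ.* z₄ ℤ.- d ℤ.* d ℤ.* z₃ → z₆ ≡ + 2 ℤ.* a ℤ.* z₅ ℤ.- d ℤ.* d ℤ.* z₄ →
            m₆ ℤ.* z₆ ≡
            (+ 2 ℤ.* (+ 2 ℤ.* a ℤ.+ d)) ℤ.* (m₅ ℤ.* z₅) ℤ.+
            ((ℤ.- ((+ 2 ℤ.* a ℤ.+ d) ℤ.* (+ 2 ℤ.* a ℤ.+ d) ℤ.+ + 2 ℤ.* (d ℤ.* d ℤ.+ + 2 ℤ.* a ℤ.* d))) ℤ.* (m₄ ℤ.* z₄) ℤ.+
            ((+ 2 ℤ.* (d ℤ.* d ℤ.* d) ℤ.+ + 2 ℤ.* ((+ 2 ℤ.* a ℤ.+ d) ℤ.* (d ℤ.* d ℤ.+ + 2 ℤ.* a ℤ.* d))) ℤ.* (m₃ ℤ.* z₃) ℤ.+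
            ((ℤ.- ((d ℤ.* d ℤ.+ + 2 ℤ.* a ℤ.* d) ℤ.* (d ℤ.* d ℤ.+ + 2 ℤ.* a ℤ.* d) ℤ.+ + 2 ℤ.* (d ℤ.* d ℤ.* d) ℤ.* (+ 2 ℤ.* a ℤ.+ d))) ℤ.* (m₂ ℤ.* z₂) ℤ.+
            ((+ 2 ℤ.* (d ℤ.* d ℤ.* d) ℤ.* (d ℤ.* d ℤ.+ + 2 ℤ.* a ℤ.* d)) ℤ.* (m₁ ℤ.* z₁) ℤ.+
            ((ℤ.- (d ℤ.* d ℤ.* d ℤ.* (d ℤ.* d ℤ.* d))) ℤ.* (m ℤ.* z₀) ℤ.+ 0ℤ)))))
          lem a d m l z₀ z₁ _ _ _ _ _ _ _ _ _ _ _ refl refl refl refl refl refl refl refl refl refl refl = lem′ a d m l z₀ z₁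
            where
            lem′ : ∀ a d m l z₀ z₁ →
              let z₂ = + 2 ℤ.* a ℤ.* z₁ ℤ.- d ℤ.* d ℤ.* z₀ ; z₃ = + 2 ℤ.* a ℤ.* z₂ ℤ.- d ℤ.* d ℤ.* z₁ ; z₄ = + 2 ℤ.* a ℤ.* z₃ ℤ.- d ℤ.* d ℤ.* z₂
                  z₅ = + 2 ℤ.* a ℤ.* z₄ ℤ.- d ℤ.* d ℤ.* z₃ ; z₆ = + 2 ℤ.* a ℤ.* z₅ ℤ.- d ℤ.* d ℤ.* z₄ in
              (m ℤ.+ l ℤ.* + 6) ℤ.* z₆ ≡
              (+ 2 ℤ.* (+ 2 ℤ.* a ℤ.+ d)) ℤ.* ((m ℤ.+ l ℤ.* + 5) ℤ.* z₅) ℤ.+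
              ((ℤ.- ((+ 2 ℤ.* a ℤ.+ d) ℤ.* (+ 2 ℤ.* a ℤ.+ d) ℤ.+ + 2 ℤ.* (d ℤ.* d ℤ.+ + 2 ℤ.* a ℤ.* d))) ℤ.* ((m ℤ.+ l ℤ.* + 4) ℤ.* z₄) ℤ.+
              ((+ 2 ℤ.* (d ℤ.* d ℤ.* d) ℤ.+ + 2 ℤ.* ((+ 2 ℤ.* a ℤ.+ d) ℤ.* (d ℤ.* d ℤ.+ + 2 ℤ.* a ℤ.* d))) ℤ.* ((m ℤ.+ l ℤ.* + 3) ℤ.* z₃) ℤ.+
              ((ℤ.- ((d ℤ.* d ℤ.+ + 2 ℤ.* a ℤ.* d) ℤ.* (d ℤ.* d ℤ.+ + 2 ℤ.* a ℤ.* d) ℤ.+ + 2 ℤ.* (d ℤ.* d ℤ.* d) ℤ.* (+ 2 ℤ.* a ℤ.+ d))) ℤ.* ((m ℤ.+ l ℤ.* + 2) ℤ.* z₂) ℤ.+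
              ((+ 2 ℤ.* (d ℤ.* d ℤ.* d) ℤ.* (d ℤ.* d ℤ.+ + 2 ℤ.* a ℤ.* d)) ℤ.* ((m ℤ.+ l ℤ.* + 1) ℤ.* z₁) ℤ.+
              ((ℤ.- (d ℤ.* d ℤ.* d ℤ.* (d ℤ.* d ℤ.* d))) ℤ.* (m ℤ.* z₀) ℤ.+ 0ℤ)))))
            lem′ = solve-∀

      X-rec : ∀ n → X (2 ℕ.+ n) ≡ + 2 ℤ.* a ℤ.* X (suc n) ℤ.- d ℤ.* d ℤ.* X n
      X-rec n = lem a (+ b) d (X n) (Y n) (X (1 ℕ.+ n)) (Y (1 ℕ.+ n)) (X-suc n) (Y-suc n) (X-suc (suc n)) a²+b²≡d²
        where
        lem : ∀ a b d x y x₁ y₁ {x₂} → x₁ ≡ a ℤ.* x ℤ.- b ℤ.* y → y₁ ≡ b ℤ.* x ℤ.+ a ℤ.* y → x₂ ≡ a ℤ.* x₁ ℤ.- b ℤ.* y₁ → a ℤ.* a ℤ.+ b ℤ.* b ≡ d ℤ.* d →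
          x₂ ≡ + 2 ℤ.* a ℤ.* x₁ ℤ.- d ℤ.* d ℤ.* x
        lem a b d x y _ _ refl refl refl e = trans (l a b x y) (cong (λ t → + 2 ℤ.* a ℤ.* (a ℤ.* x ℤ.- b ℤ.* y) ℤ.- t ℤ.* x) e)
          where
          l : ∀ a b x y → a ℤ.* (a ℤ.* x ℤ.- b ℤ.* y) ℤ.- b ℤ.* (b ℤ.* x ℤ.+ a ℤ.* y) ≡ + 2 ℤ.* a ℤ.* (a ℤ.* x ℤ.- b ℤ.* y) ℤ.- (a ℤ.* a ℤ.+ b ℤ.* b) ℤ.* x
          l = solve-∀

      Y-rec : ∀ n → Y (2 ℕ.+ n) ≡ + 2 ℤ.* a ℤ.* Y (suc n) ℤ.- d ℤ.* d ℤ.* Y n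
      Y-rec n = lem a (+ b) d (X n) (Y n) (X (1 ℕ.+ n)) (Y (1 ℕ.+ n)) (X-suc n) (Y-suc n) (Y-suc (suc n)) a²+b²≡d²
        where
        lem : ∀ a b d x y x₁ y₁ {y₂} → x₁ ≡ a ℤ.* x ℤ.- b ℤ.* y → y₁ ≡ b ℤ.* x ℤ.+ a ℤ.* y → y₂ ≡ b ℤ.* x₁ ℤ.+ a ℤ.* y₁ → a ℤ.* a ℤ.+ b ℤ.* b ≡ d ℤ.* d →
          y₂ ≡ + 2 ℤ.* a ℤ.* y₁ ℤ.- d ℤ.* d ℤ.* y
        lem a b d x y _ _ refl refl refl e = trans (l a b x y) (cong (λ t → + 2 ℤ.* a ℤ.* (b ℤ.* x ℤ.+ a ℤ.* y) ℤ.- t ℤ.* y) e)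
          where
          l : ∀ a b x y → b ℤ.* (a ℤ.* x ℤ.- b ℤ.* y) ℤ.+ a ℤ.* (b ℤ.* x ℤ.+ a ℤ.* y) ≡ + 2 ℤ.* a ℤ.* (b ℤ.* x ℤ.+ a ℤ.* y) ℤ.- (a ℤ.* a ℤ.+ b ℤ.* b) ℤ.* y
          l = solve-∀

      -- k · (m dᵐ - m Re) - e · Im ; dividing by dᵐ gives k m (1 - cos mθ) - e sin mθ.
      U : ℤ → ℤ → ℕ → ℤ
      U k e m = k ℤ.* (+ m ℤ.* Q m ℤ.- + m ℤ.* X m) ℤ.- e ℤ.* Y m

      -- The double roots pay for the factor `m` in front of `Q` and `X`; `Y` satisfies already the
      -- recurrence of order 2.
      Recurrent-U : ∀ k e → Recurrent (U k e)
      Recurrent-U k e = Recurrent-combine {λ m → + m ℤ.* Q m} {λ m → + m ℤ.* X m} {Y} k e Recurrent-mQ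
          (Recurrent-≡ (λ m → cong (ℤ._* X m) (l₁ (+ m))) (Recurrent-m X X-rec 0ℤ 1ℤ)) (Recurrent-≡ (λ m → l₂ (+ m) (Y m)) (Recurrent-m Y Y-rec 1ℤ 0ℤ))
        where
        l₁ : ∀ m → 0ℤ ℤ.+ 1ℤ ℤ.* m ≡ m
        l₁ = solve-∀
        l₂ : ∀ m y → (1ℤ ℤ.+ 0ℤ ℤ.* m) ℤ.* y ≡ y
        l₂ m y = trans (cong (λ t → (1ℤ ℤ.+ t) ℤ.* y) (ℤ.*-zeroˡ m)) (ℤ.*-identityˡ y)
        Recurrent-≡ : ∀ {f g} → (∀ m → f m ≡ g m) → Recurrent f → Recurrent g
        Recurrent-≡ {f} {g} h rf n = trans (sym (h (6 ℕ.+ n))) (trans (rf n) (sum-cong 6 (λ i → cong (coefficient i ℤ.*_) (h (toℕ (opposite i) ℕ.+ n)))))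

      lrs : ℤ → ℤ → ℕ → D.LRS 6
      lrs k e N = record
        { coeff      = coefficient
        ; term       = λ n → U k e (n ℕ.+ N)
        ; last≢0     = last
        ; recurrence = λ n → trans (cong (U k e) (shift n 6)) (trans (Recurrent-U k e (n ℕ.+ N))
            (sum-cong 6 (λ i → cong (λ m → coefficient i ℤ.* U k e m) (sym (shift n (toℕ (opposite i)))))))
        }
        where
        shift : ∀ n i → (n ℕ.+ i) ℕ.+ N ≡ i ℕ.+ (n ℕ.+ N)
        shift n i = trans (cong (ℕ._+ N) (ℕ.+-comm n i)) (ℕ.+-assoc i n N)
        last : ∀ i → suc (toℕ i) ≡ 6 → coefficient i ≢ 0ℤ
        last zero ()
        last (suc zero) ()
        last (suc (suc zero)) ()
        last (suc (suc (suc zero))) ()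
        last (suc (suc (suc (suc zero)))) ()
        -- This coefficient is `-d⁶`, and since `d` is a successor it computes to a negative
        -- integer.
        last (suc (suc (suc (suc (suc zero))))) _ ()

-- Primitive recursive programs and their values

module Computability where

  open import Defs using (Rec; zer; succ; proj; comp; prec; _[_]⇓_; _[_]⇓*_; ⇓zer; ⇓succ; ⇓proj; ⇓comp; ⇓prec-zero; ⇓prec-suc; []; _∷_)
  open import Data.Empty using (⊥-elim)
  open import Data.Fin.Base using (Fin; zero; suc)
  open import Data.Nat.Base using (ℕ; zero; suc; pred; _+_; _*_; _∸_; _≤_; _<_; z≤n; s≤s)
  import Data.Nat.Properties as ℕ
  open import Data.Nat.Solver using (module +-*-Solver)
  open import Data.Product.Base using (_×_; _,_; proj₁; proj₂)
  open import Data.Sum.Base using (_⊎_; inj₁; inj₂; [_,_]′)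
  open import Data.Vec.Base using (Vec; []; _∷_; lookup)
  open import Relation.Binary.PropositionalEquality using (_≡_; refl; sym; trans; cong; cong₂; subst)

  record Computes {n} (f : Vec ℕ n → ℕ) : Set where
    constructor computes
    field
      program : Rec n
      correct : ∀ xs → program [ xs ]⇓ f xs

  open Computes public

  record Fun (n : ℕ) : Set where
    constructor fun
    field
      {value}    : Vec ℕ n → ℕ
      computable : Computes value

  open Fun public

  -- Recursion produces values in terms of `iterate`; they are exchanged here for the intended
  -- function.
  as : ∀ {n} (f : Vec ℕ n → ℕ) {g} → Computes g → (∀ xs → g xs ≡ f xs) → Fun n
  as f c h = fun {value = f} (computes (program c) (λ xs → subst (program c [ xs ]⇓_) (h xs) (correct c xs)))

  -- Closed under substitution only; recursion enters through called functions. Evaluation,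
  -- compilation and correctness are then structural inductions.
  data Exp (n : ℕ) : Set where
    var  : Fin n → Exp n
    lit  : ℕ → Exp n
    call : ∀ {m} → Fun m → Vec (Exp n) m → Exp n

  mutual
    eval : ∀ {n} → Exp n → Vec ℕ n → ℕ
    eval (var i)     xs = lookup xs i
    eval (lit k)     xs = k
    eval (call f es) xs = value f (evals es xs)

    evals : ∀ {n m} → Vec (Exp n) m → Vec ℕ n → Vec ℕ m
    evals []       xs = []
    evals (e ∷ es) xs = eval e xs ∷ evals es xs

  constant : ∀ {n} → ℕ → Rec n
  constant zero    = zer
  constant (suc k) = comp succ (constant k ∷ [])

  constant-correct : ∀ {n} k (xs : Vec ℕ n) → constant k [ xs ]⇓ k
  constant-correct zero    xs = ⇓zer
  constant-correct (suc k) xs = ⇓comp (constant-correct k xs ∷ []) ⇓succ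

  mutual
    compile : ∀ {n} → Exp n → Rec n
    compile (var i)     = proj i
    compile (lit k)     = constant k
    compile (call f es) = comp (program (computable f)) (compiles es)

    compiles : ∀ {n m} → Vec (Exp n) m → Vec (Rec n) m
    compiles []       = []
    compiles (e ∷ es) = compile e ∷ compiles es

  mutual
    compile-correct : ∀ {n} (e : Exp n) xs → compile e [ xs ]⇓ eval e xs
    compile-correct (var i)     xs = ⇓proj i
    compile-correct (lit k)     xs = constant-correct k xs
    compile-correct (call f es) xs = ⇓comp (compiles-correct es xs) (correct (computable f) (evals es xs))

    compiles-correct : ∀ {n m} (es : Vec (Exp n) m) xs → compiles es [ xs ]⇓* evals es xs
    compiles-correct []       xs = []
    compiles-correct (e ∷ es) xs = compile-correct e xs ∷ compiles-correct es xs

  define : ∀ {n} (f : Vec ℕ n → ℕ) (e : Exp n) → (∀ xs → eval e xs ≡ f xs) → Fun n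
  define f e h = as f (computes (compile e) (compile-correct e)) h

  iterate : ∀ {n} → (Vec ℕ n → ℕ) → (Vec ℕ (2 + n) → ℕ) → Vec ℕ n → ℕ → ℕ
  iterate f g xs zero    = f xs
  iterate f g xs (suc k) = g (k ∷ iterate f g xs k ∷ xs)

  recursion : ∀ {n} (f : Fun n) (g : Fun (2 + n)) → Computes {suc n} λ { (k ∷ xs) → iterate (value f) (value g) xs k }
  recursion {n} f g = computes (prec (program (computable f)) (program (computable g))) λ { (k ∷ xs) → go k xs }
    where
    go : ∀ k xs → prec (program (computable f)) (program (computable g)) [ k ∷ xs ]⇓ iterate (value f) (value g) xs k
    go zero    xs = ⇓prec-zero (correct (computable f) xs)
    go (suc k) xs = ⇓prec-suc (go k xs) (correct (computable g) _)

  pattern #0 = zero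
  pattern #1 = suc zero
  pattern #2 = suc (suc zero)
  pattern #3 = suc (suc (suc zero))
  pattern #4 = suc (suc (suc (suc zero)))
  pattern #5 = suc (suc (suc (suc (suc zero))))
  pattern #6 = suc (suc (suc (suc (suc (suc zero)))))

  expression : ∀ {n} → Exp n → Fun n
  expression e = fun (computes (compile e) (compile-correct e))

  sucF predF : ∀ {n} → Vec (Exp n) 1 → Exp n
  addF mulF subF : ∀ {n} → Vec (Exp n) 2 → Exp n
  sucF es = call (fun {value = λ { (x ∷ []) → suc x }} (computes succ λ { (x ∷ []) → ⇓succ })) es
  addF es = call (as (λ { (x ∷ y ∷ []) → x + y }) (recursion (expression (var #0)) (expression (sucF (var #1 ∷ []))))
      (λ { (x ∷ y ∷ []) → go x y })) es
    where
    go : ∀ x y → iterate _ _ (y ∷ []) x ≡ x + y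
    go zero    y = refl
    go (suc x) y = cong suc (go x y)
  mulF es = call (as (λ { (x ∷ y ∷ []) → x * y }) (recursion (expression (lit 0)) (expression (addF (var #2 ∷ var #1 ∷ []))))
      (λ { (x ∷ y ∷ []) → go x y })) es
    where
    go : ∀ x y → iterate _ _ (y ∷ []) x ≡ x * y
    go zero    y = refl
    go (suc x) y = cong (y +_) (go x y)
  predF es = call (as (λ { (x ∷ []) → pred x }) (recursion (expression (lit 0)) (expression (var #0))) (λ { (zero ∷ []) → refl ; (suc x ∷ []) → refl })) es
  -- Primitive recursion runs on the first argument, here the subtrahend; hence the exchanged order.
  subF es = call (as (λ { (y ∷ x ∷ []) → x ∸ y }) (recursion (expression (var #0)) (expression (predF (var #1 ∷ []))))
      (λ { (y ∷ x ∷ []) → go y x })) es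
    where
    go : ∀ y x → iterate _ _ (x ∷ []) y ≡ x ∸ y
    go zero    x = refl
    go (suc y) x = trans (cong pred (go y x)) (ℕ.pred[m∸n]≡m∸[1+n] x y)

  infixl 6 _⊕_ _⊖_
  infixl 7 _⊗_

  _⊕_ _⊗_ _⊖_ : ∀ {n} → Exp n → Exp n → Exp n
  e ⊕ e′ = addF (e ∷ e′ ∷ [])
  e ⊗ e′ = mulF (e ∷ e′ ∷ [])
  e ⊖ e′ = subF (e′ ∷ e ∷ [])

  -- The integer square root inverts the pairing ⟨ x , y ⟩ = (x + y)² + x.
  root : ℕ → ℕ
  root zero    = 0
  root (suc z) = root z + (1 ∸ (suc (root z) * suc (root z) ∸ suc z))

  private
    1∸-cases : ∀ x y → (x ≤ y × 1 ∸ (x ∸ y) ≡ 1) ⊎ (y < x × 1 ∸ (x ∸ y) ≡ 0)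
    1∸-cases zero    y       = inj₁ (z≤n , cong (1 ∸_) (ℕ.0∸n≡0 y))
    1∸-cases (suc x) zero    = inj₂ (s≤s z≤n , ℕ.0∸n≡0 x)
    1∸-cases (suc x) (suc y) = [ (λ { (p , q) → inj₁ (s≤s p , q) }) , (λ { (p , q) → inj₂ (s≤s p , q) }) ]′ (1∸-cases x y)

    root-bounds : ∀ z → root z * root z ≤ z × z < suc (root z) * suc (root z)
    root-bounds zero = z≤n , s≤s z≤n
    root-bounds (suc z) = go (root z) (proj₁ (root-bounds z)) (proj₂ (root-bounds z)) (1∸-cases (suc (root z) * suc (root z)) (suc z))
      where
      go : ∀ r → r * r ≤ z → z < suc r * suc r → (suc r * suc r ≤ suc z × 1 ∸ (suc r * suc r ∸ suc z) ≡ 1) ⊎ (suc z < suc r * suc r × 1 ∸ (suc r * suc r ∸ suc z) ≡ 0) →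
        let r′ = r + (1 ∸ (suc r * suc r ∸ suc z)) in r′ * r′ ≤ suc z × suc z < suc r′ * suc r′
      go r lo hi (inj₁ (p , q)) = subst (λ e → (r + e) * (r + e) ≤ suc z × suc z < suc (r + e) * suc (r + e)) (sym q)
        (subst (λ m → m * m ≤ suc z × suc z < suc m * suc m) (ℕ.+-comm 1 r)
          (p , ℕ.<-≤-trans (s≤s hi) (grow r)))
        where
        grow : ∀ r → suc (suc r * suc r) ≤ suc (suc r) * suc (suc r)
        grow r = ℕ.*-mono-< {suc r} {suc (suc r)} {suc r} {suc (suc r)} ℕ.≤-refl ℕ.≤-refl
      go r lo hi (inj₂ (p , q)) = subst (λ e → (r + e) * (r + e) ≤ suc z × suc z < suc (r + e) * suc (r + e)) (sym q)
        (subst (λ m → m * m ≤ suc z × suc z < suc m * suc m) (sym (ℕ.+-identityʳ r)) (ℕ.m≤n⇒m≤1+n lo , p))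

    root-unique : ∀ r z → r * r ≤ z → z < suc r * suc r → root z ≡ r
    root-unique r z lo hi = ℕ.≤-antisym (bound (root z) r (ℕ.≤-<-trans (proj₁ (root-bounds z)) hi)) (bound r (root z) (ℕ.≤-<-trans lo (proj₂ (root-bounds z))))
      where
      bound : ∀ a b → a * a < suc b * suc b → a ≤ b
      bound a b h = [ (λ p → p) , (λ p → ⊥-elim (ℕ.<-irrefl refl (ℕ.<-≤-trans h (ℕ.*-mono-≤ p p)))) ]′ (ℕ.≤-<-connex a b)

  pair : ℕ → ℕ → ℕ
  pair x y = (x + y) * (x + y) + x

  first second : ℕ → ℕ
  first z  = z ∸ root z * root z
  second z = root z ∸ first z

  private
    -- `pair x y` lies between `(x + y)²` and `(x + y + 1)²`.
    root-pair : ∀ x y → root (pair x y) ≡ x + y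
    root-pair x y = root-unique (x + y) (pair x y) (ℕ.m≤m+n ((x + y) * (x + y)) x)
      (s≤s (subst ((x + y) * (x + y) + x ≤_) (lem x y) (ℕ.m≤m+n ((x + y) * (x + y) + x) (x + y + y))))
      where
      open +-*-Solver
      lem : ∀ x y → (x + y) * (x + y) + x + (x + y + y) ≡ x + y + (x + y) * suc (x + y)
      lem = solve 2 (λ x y → (x :+ y) :* (x :+ y) :+ x :+ (x :+ y :+ y) := x :+ y :+ (x :+ y) :* (con 1 :+ (x :+ y))) refl

  first-pair : ∀ x y → first (pair x y) ≡ x
  first-pair x y = trans (cong (λ r → pair x y ∸ r * r) (root-pair x y)) (ℕ.m+n∸m≡n ((x + y) * (x + y)) x)

  second-pair : ∀ x y → second (pair x y) ≡ y
  second-pair x y = trans (cong₂ _∸_ (root-pair x y) (first-pair x y)) (ℕ.m+n∸m≡n x y)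

  rootF firstF secondF : ∀ {n} → Vec (Exp n) 1 → Exp n
  pairF : ∀ {n} → Vec (Exp n) 2 → Exp n
  rootF es = call (as (λ { (z ∷ []) → root z }) (recursion (expression {0} (lit 0))
      (expression (var #1 ⊕ (lit 1 ⊖ (sucF (var #1 ∷ []) ⊗ sucF (var #1 ∷ []) ⊖ sucF (var #0 ∷ [])))))) (λ { (z ∷ []) → go z })) es
    where
    go : ∀ z → iterate _ _ [] z ≡ root z
    go zero    = refl
    go (suc z) = cong (λ r → r + (1 ∸ (suc r * suc r ∸ suc z))) (go z)
  pairF es = call (define (λ { (x ∷ y ∷ []) → pair x y }) ((var #0 ⊕ var #1) ⊗ (var #0 ⊕ var #1) ⊕ var #0) (λ { (x ∷ y ∷ []) → refl })) es
  firstF es = call (define (λ { (z ∷ []) → first z }) (var #0 ⊖ rootF (var #0 ∷ []) ⊗ rootF (var #0 ∷ [])) (λ { (z ∷ []) → refl })) es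
  secondF es = call (define (λ { (z ∷ []) → second z }) (rootF (var #0 ∷ []) ⊖ firstF (var #0 ∷ [])) (λ { (z ∷ []) → refl })) es

-- The program: powers, turn counters, oracle calls and the search

module Program where

  open Computability
  open Recurrence
  import Defs as D
  open D using (Rec; comp; _[_]⇓_; _[_]⇓*_; ⇓comp; encodeℤ; encodeLRS; encodeBool; LRS; PositivityDecidable; Positive)
  open import Data.Bool.Base using (Bool)
  open import Data.Fin.Base using (Fin; zero; suc)
  open import Data.Integer.Base as ℤ using (ℤ; +_)
  import Data.Integer.Properties as ℤ
  open import Data.Integer.Tactic.RingSolver using (solve-∀)
  open import Data.Nat.Base using (ℕ; zero; suc; _+_; _*_; _∸_)
  import Data.Nat.Properties as ℕ
  open import Data.Product.Base using (_×_; _,_; proj₁; proj₂)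
  open import Data.Vec.Base using (Vec; []; _∷_; lookup; tabulate)
  open import Relation.Binary.PropositionalEquality using (_≡_; refl; sym; trans; cong; cong₂; subst)
  open import Relation.Nullary using (Reflects)

  vars : ∀ {n m} → (Fin m → Fin n) → Vec (Exp n) m
  vars ι = tabulate (λ i → var (ι i))

  evals-vars : ∀ {n m} (ι : Fin m → Fin n) (xs : Vec ℕ n) (ys : Vec ℕ m) → (∀ i → lookup xs (ι i) ≡ lookup ys i) → evals (vars ι) xs ≡ ys
  evals-vars ι xs [] h = refl
  evals-vars ι xs (y ∷ ys) h = cong₂ _∷_ (h zero) (evals-vars (λ i → ι (suc i)) xs ys (λ i → h (suc i)))

  all : (ℕ → ℕ) → ℕ → ℕ
  all f zero    = 1
  all f (suc b) = all f b * f b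

  allF : ∀ {n} → Exp (suc n) → Exp n → Exp n
  allF {n} e b = call (as (λ { (k ∷ xs) → all (λ i → eval e (i ∷ xs)) k }) (recursion (expression (lit 1))
      (expression (var #1 ⊗ call (expression e) (var #0 ∷ vars (λ i → suc (suc i)))))) (λ { (k ∷ xs) → go xs k })) (b ∷ vars (λ i → i))
    where
    go : ∀ xs k → iterate _ _ xs k ≡ all (λ i → eval e (i ∷ xs)) k
    go xs zero    = refl
    go xs (suc k) = cong₂ _*_ (go xs k) (cong (λ ys → eval e (k ∷ ys)) (evals-vars (λ i → suc (suc i)) _ xs (λ i → refl)))

  eval-allF : ∀ {n} (e : Exp (suc n)) b xs → eval (allF e b) xs ≡ all (λ i → eval e (i ∷ xs)) (eval b xs)
  eval-allF e b xs = cong (λ ys → all (λ i → eval e (i ∷ ys)) (eval b xs)) (evals-vars (λ i → i) xs xs (λ i → refl))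

  module _ where

    private
      H : ℕ → ℕ → ℕ → ℕ → ℕ → ℕ → ℕ → ℕ
      H a⁺ a⁻ b u u′ v v′ = pair (pair (a⁺ * u + a⁻ * u′ + b * v′) (a⁺ * u′ + a⁻ * u + b * v)) (pair (b * u + a⁺ * v + a⁻ * v′) (b * u′ + a⁺ * v′ + a⁻ * v))

      state : ℕ → ℕ → ℕ → ℕ → ℕ
      state n a⁺ a⁻ b = let open Gauss a⁺ a⁻ b in pair (pair (x⁺ n) (x⁻ n)) (pair (y⁺ n) (y⁻ n))

      -- Primitive recursion carries a single number, while the four sequences are defined
      -- simultaneously; hence the nested pairs.
      stateF : ∀ {n} → Vec (Exp n) 4 → Exp n
      stateF es = call (as (λ { (n ∷ a⁺ ∷ a⁻ ∷ b ∷ []) → state n a⁺ a⁻ b })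
          (recursion (expression (lit (pair (pair 1 0) (pair 0 0)))) (expression step)) (λ { (n ∷ a⁺ ∷ a⁻ ∷ b ∷ []) → go n a⁺ a⁻ b })) es
        where
        u = firstF (firstF (var #1 ∷ []) ∷ [])
        u′ = secondF (firstF (var #1 ∷ []) ∷ [])
        v = firstF (secondF (var #1 ∷ []) ∷ [])
        v′ = secondF (secondF (var #1 ∷ []) ∷ [])
        step : Exp 5
        step = pairF (pairF (var #2 ⊗ u ⊕ var #3 ⊗ u′ ⊕ var #4 ⊗ v′ ∷ var #2 ⊗ u′ ⊕ var #3 ⊗ u ⊕ var #4 ⊗ v ∷ [])
          ∷ pairF (var #4 ⊗ u ⊕ var #2 ⊗ v ⊕ var #3 ⊗ v′ ∷ var #4 ⊗ u′ ⊕ var #2 ⊗ v′ ⊕ var #3 ⊗ v ∷ []) ∷ [])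
        H-cong : ∀ a⁺ a⁻ b {s u u′ v v′} → s ≡ pair (pair u u′) (pair v v′) →
          H a⁺ a⁻ b (first (first s)) (second (first s)) (first (second s)) (second (second s)) ≡ H a⁺ a⁻ b u u′ v v′
        H-cong a⁺ a⁻ b {s} {u} {u′} {v} {v′} refl = trans
          (cong₂ (λ p q → H a⁺ a⁻ b (first p) (second p) (first q) (second q)) (first-pair (pair u u′) (pair v v′)) (second-pair (pair u u′) (pair v v′)))
          (trans (cong₂ (λ p q → H a⁺ a⁻ b p q (first (pair v v′)) (second (pair v v′))) (first-pair u u′) (second-pair u u′))
            (cong₂ (H a⁺ a⁻ b u u′) (first-pair v v′) (second-pair v v′)))
        go : ∀ n a⁺ a⁻ b → iterate _ _ (a⁺ ∷ a⁻ ∷ b ∷ []) n ≡ state n a⁺ a⁻ b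
        go zero    a⁺ a⁻ b = refl
        go (suc n) a⁺ a⁻ b = let open Gauss a⁺ a⁻ b in H-cong a⁺ a⁻ b {_} {x⁺ n} {x⁻ n} {y⁺ n} {y⁻ n} (go n a⁺ a⁻ b)

    x⁺F x⁻F y⁺F y⁻F : ∀ {n} → Vec (Exp n) 4 → Exp n
    x⁺F es = call (define (λ { (n ∷ a⁺ ∷ a⁻ ∷ b ∷ []) → Gauss.x⁺ a⁺ a⁻ b n }) (firstF (firstF (stateF (vars (λ i → i)) ∷ []) ∷ []))
      (λ { (n ∷ a⁺ ∷ a⁻ ∷ b ∷ []) → let open Gauss a⁺ a⁻ b in trans (cong first (first-pair (pair (x⁺ n) (x⁻ n)) (pair (y⁺ n) (y⁻ n)))) (first-pair (x⁺ n) (x⁻ n)) })) es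
    x⁻F es = call (define (λ { (n ∷ a⁺ ∷ a⁻ ∷ b ∷ []) → Gauss.x⁻ a⁺ a⁻ b n }) (secondF (firstF (stateF (vars (λ i → i)) ∷ []) ∷ []))
      (λ { (n ∷ a⁺ ∷ a⁻ ∷ b ∷ []) → let open Gauss a⁺ a⁻ b in trans (cong second (first-pair (pair (x⁺ n) (x⁻ n)) (pair (y⁺ n) (y⁻ n)))) (second-pair (x⁺ n) (x⁻ n)) })) es
    y⁺F es = call (define (λ { (n ∷ a⁺ ∷ a⁻ ∷ b ∷ []) → Gauss.y⁺ a⁺ a⁻ b n }) (firstF (secondF (stateF (vars (λ i → i)) ∷ []) ∷ []))
      (λ { (n ∷ a⁺ ∷ a⁻ ∷ b ∷ []) → let open Gauss a⁺ a⁻ b in trans (cong first (second-pair (pair (x⁺ n) (x⁻ n)) (pair (y⁺ n) (y⁻ n)))) (first-pair (y⁺ n) (y⁻ n)) })) es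
    y⁻F es = call (define (λ { (n ∷ a⁺ ∷ a⁻ ∷ b ∷ []) → Gauss.y⁻ a⁺ a⁻ b n }) (secondF (secondF (stateF (vars (λ i → i)) ∷ []) ∷ []))
      (λ { (n ∷ a⁺ ∷ a⁻ ∷ b ∷ []) → let open Gauss a⁺ a⁻ b in trans (cong second (second-pair (pair (x⁺ n) (x⁻ n)) (pair (y⁺ n) (y⁻ n)))) (second-pair (y⁺ n) (y⁻ n)) })) es

  -- The first factor of the increment is 1 if `Y k` is negative and 0 otherwise, the second is 1 if
  -- `Y (k + 1)` is nonnegative and 0 otherwise; so it counts the passages from negative to
  -- nonnegative sine.
  turnCount : ℕ → ℕ → ℕ → ℕ → ℕ
  turnCount a⁺ a⁻ b zero    = 0
  turnCount a⁺ a⁻ b (suc k) = let open Gauss a⁺ a⁻ b in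
    turnCount a⁺ a⁻ b k + (1 ∸ (1 ∸ (y⁻ k ∸ y⁺ k))) * (1 ∸ (y⁻ (suc k) ∸ y⁺ (suc k)))

  turnCountF : ∀ {n} → Vec (Exp n) 4 → Exp n
  turnCountF es = call (as (λ { (n ∷ a⁺ ∷ a⁻ ∷ b ∷ []) → turnCount a⁺ a⁻ b n }) (recursion (expression (lit 0))
      (expression (var #1 ⊕ (lit 1 ⊖ (lit 1 ⊖ (y⁻F (var #0 ∷ ps) ⊖ y⁺F (var #0 ∷ ps)))) ⊗ (lit 1 ⊖ (y⁻F (sucF (var #0 ∷ []) ∷ ps) ⊖ y⁺F (sucF (var #0 ∷ []) ∷ ps))))))
      (λ { (n ∷ a⁺ ∷ a⁻ ∷ b ∷ []) → go n a⁺ a⁻ b })) es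
    where
    ps : Vec (Exp 5) 3
    ps = var #2 ∷ var #3 ∷ var #4 ∷ []
    go : ∀ n a⁺ a⁻ b → iterate _ _ (a⁺ ∷ a⁻ ∷ b ∷ []) n ≡ turnCount a⁺ a⁻ b n
    go zero    a⁺ a⁻ b = refl
    go (suc n) a⁺ a⁻ b = let open Gauss a⁺ a⁻ b in cong (_+ (1 ∸ (1 ∸ (y⁻ n ∸ y⁺ n))) * (1 ∸ (y⁻ (suc n) ∸ y⁺ (suc n)))) (go n a⁺ a⁻ b)

  power : ℕ → ℕ → ℕ
  power d zero    = 1
  power d (suc n) = d * power d n

  powerF : ∀ {n} → Vec (Exp n) 2 → Exp n
  powerF es = call (as (λ { (n ∷ d ∷ []) → power d n }) (recursion (expression (lit 1)) (expression (var #2 ⊗ var #1))) (λ { (n ∷ d ∷ []) → go n d })) es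
    where
    go : ∀ n d → iterate _ _ (d ∷ []) n ≡ power d n
    go zero    d = refl
    go (suc n) d = cong (d *_) (go n d)

  -- At most one of the two truncated differences is nonzero, and the code of a negative integer
  -- `-n` is `2 n - 1`.
  encodeDifference : ∀ p q → 2 * (p ∸ q) + (2 * (q ∸ p) ∸ 1) ≡ encodeℤ (+ p ℤ.- + q)
  encodeDifference p q = trans (go p q) (cong encodeℤ (sym (ℤ.m-n≡m⊖n p q)))
    where
    go : ∀ p q → 2 * (p ∸ q) + (2 * (q ∸ p) ∸ 1) ≡ encodeℤ (p ℤ.⊖ q)
    go zero    zero    = refl
    go zero    (suc q) = ℕ.+-suc q (q + 0)
    go (suc p) zero    = ℕ.+-identityʳ (2 * suc p)
    go (suc p) (suc q) = trans (go p q) (cong encodeℤ (sym (ℤ.[1+m]⊖[1+n]≡m⊖n p q)))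

  differenceF : ∀ {n} → Exp n → Exp n → Exp n
  differenceF p q = lit 2 ⊗ (p ⊖ q) ⊕ (lit 2 ⊗ (q ⊖ p) ⊖ lit 1)

  module Scan (T : ℕ → ℕ) where

    -- The length of the initial run of successes: a test contributes only while `scan i = i`, that
    -- is, while all earlier ones have passed.
    scan : ℕ → ℕ
    scan zero    = 0
    scan (suc i) = scan i + T (suc i) * (1 ∸ (i ∸ scan i))

  -- The tail of the sequence starts at index K c.
  module Oracle (oracle : PositivityDecidable 6) (c a⁺ a⁻ b d′ : ℕ)
    (a²+b²≡d² : Gauss.a a⁺ a⁻ b ℤ.* Gauss.a a⁺ a⁻ b ℤ.+ + b ℤ.* + b ≡ + suc d′ ℤ.* + suc d′) where

    open Gauss a⁺ a⁻ b
    open Positivity d′ a²+b²≡d²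

    start : ℕ → ℕ
    start K = K * c

    Q-power : ∀ m → Q m ≡ + power (suc d′) m
    Q-power zero    = refl
    Q-power (suc m) = trans (cong (d ℤ.*_) (Q-power m)) (sym (ℤ.pos-* (suc d′) (power (suc d′) m)))

    U-difference : ∀ K j m → U (+ K) (+ j) m ≡ + (K * (m * power (suc d′) m + m * x⁻ m) + j * y⁻ m) ℤ.- + (K * (m * x⁺ m) + j * y⁺ m)
                                 × U (+ K) (ℤ.- + j) m ≡ + (K * (m * power (suc d′) m + m * x⁻ m) + j * y⁺ m) ℤ.- + (K * (m * x⁺ m) + j * y⁻ m)
    U-difference K j m =
        trans (cong (λ q → + K ℤ.* (+ m ℤ.* q ℤ.- + m ℤ.* X m) ℤ.- + j ℤ.* Y m) (Q-power m))
          (trans (l₁ (+ K) (+ j) (+ m) (+ power (suc d′) m) (+ x⁺ m) (+ x⁻ m) (+ y⁺ m) (+ y⁻ m)) (sym (cong₂ ℤ._-_ (pos (y⁻ m)) (pos′ (y⁺ m)))))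
      , trans (cong (λ q → + K ℤ.* (+ m ℤ.* q ℤ.- + m ℤ.* X m) ℤ.- (ℤ.- + j) ℤ.* Y m) (Q-power m))
          (trans (l₂ (+ K) (+ j) (+ m) (+ power (suc d′) m) (+ x⁺ m) (+ x⁻ m) (+ y⁺ m) (+ y⁻ m)) (sym (cong₂ ℤ._-_ (pos (y⁺ m)) (pos′ (y⁻ m)))))
      where
      l₁ : ∀ K j m q x x′ y y′ → K ℤ.* (m ℤ.* q ℤ.- m ℤ.* (x ℤ.- x′)) ℤ.- j ℤ.* (y ℤ.- y′) ≡ (K ℤ.* (m ℤ.* q ℤ.+ m ℤ.* x′) ℤ.+ j ℤ.* y′) ℤ.- (K ℤ.* (m ℤ.* x) ℤ.+ j ℤ.* y)
      l₁ = solve-∀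
      l₂ : ∀ K j m q x x′ y y′ → K ℤ.* (m ℤ.* q ℤ.- m ℤ.* (x ℤ.- x′)) ℤ.- (ℤ.- j) ℤ.* (y ℤ.- y′) ≡ (K ℤ.* (m ℤ.* q ℤ.+ m ℤ.* x′) ℤ.+ j ℤ.* y) ℤ.- (K ℤ.* (m ℤ.* x) ℤ.+ j ℤ.* y′)
      l₂ = solve-∀
      pos : ∀ y → + (K * (m * power (suc d′) m + m * x⁻ m) + j * y) ≡ + K ℤ.* (+ m ℤ.* + power (suc d′) m ℤ.+ + m ℤ.* + x⁻ m) ℤ.+ + j ℤ.* + y
      pos y = trans (ℤ.pos-+ (K * (m * power (suc d′) m + m * x⁻ m)) (j * y)) (cong₂ ℤ._+_ (trans (ℤ.pos-* K (m * power (suc d′) m + m * x⁻ m))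
        (cong (+ K ℤ.*_) (trans (ℤ.pos-+ (m * power (suc d′) m) (m * x⁻ m)) (cong₂ ℤ._+_ (ℤ.pos-* m (power (suc d′) m)) (ℤ.pos-* m (x⁻ m)))))) (ℤ.pos-* j y))
      pos′ : ∀ y → + (K * (m * x⁺ m) + j * y) ≡ + K ℤ.* (+ m ℤ.* + x⁺ m) ℤ.+ + j ℤ.* + y
      pos′ y = trans (ℤ.pos-+ (K * (m * x⁺ m)) (j * y)) (cong₂ ℤ._+_ (trans (ℤ.pos-* K (m * x⁺ m)) (cong (+ K ℤ.*_) (ℤ.pos-* m (x⁺ m)))) (ℤ.pos-* j y))

    private
      -- Expressions in the variables K and j.
      termE : (∀ {n} → Vec (Exp n) 4 → Exp n) → (∀ {n} → Vec (Exp n) 4 → Exp n) → ℕ → Exp 2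
      termE yF yF′ i = differenceF (var #0 ⊗ (m ⊗ powerF (m ∷ lit (suc d′) ∷ []) ⊕ m ⊗ x⁻F ps) ⊕ var #1 ⊗ yF′ ps) (var #0 ⊗ (m ⊗ x⁺F ps) ⊕ var #1 ⊗ yF ps)
        where
        m = lit i ⊕ var #0 ⊗ lit c
        ps = m ∷ lit a⁺ ∷ lit a⁻ ∷ lit b ∷ []

      -- The coefficients depend only on `w` and enter as constants; `K` and `j` influence just the
      -- six initial terms.
      inputs : (ℕ → Exp 2) → Vec (Exp 2) 12
      inputs t = lit (encodeℤ (coefficient #0)) ∷ lit (encodeℤ (coefficient #1)) ∷ lit (encodeℤ (coefficient #2)) ∷
                 lit (encodeℤ (coefficient #3)) ∷ lit (encodeℤ (coefficient #4)) ∷ lit (encodeℤ (coefficient #5)) ∷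
                 t 0 ∷ t 1 ∷ t 2 ∷ t 3 ∷ t 4 ∷ t 5 ∷ []

      inputs-encode : ∀ t K e xs → (∀ i → eval (t i) xs ≡ encodeℤ (U (+ K) e (i + start K))) → evals (inputs t) xs ≡ encodeLRS (lrs (+ K) e (start K))
      inputs-encode t K e xs h = cong (λ ys → encodeℤ (coefficient #0) ∷ encodeℤ (coefficient #1) ∷ encodeℤ (coefficient #2) ∷ encodeℤ (coefficient #3) ∷ encodeℤ (coefficient #4) ∷ encodeℤ (coefficient #5) ∷ ys)
        (cong₂ _∷_ (h 0) (cong₂ _∷_ (h 1) (cong₂ _∷_ (h 2) (cong₂ _∷_ (h 3) (cong₂ _∷_ (h 4) (cong₂ _∷_ (h 5) refl))))))

    opaque
      decide⁺ decide⁻ : ℕ → ℕ → Bool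
      decide⁺ K j = proj₁ (proj₂ oracle (lrs (+ K) (+ j) (start K)))
      decide⁻ K j = proj₁ (proj₂ oracle (lrs (+ K) (ℤ.- + j) (start K)))

      reflects⁺ : ∀ K j → Reflects (Positive (lrs (+ K) (+ j) (start K))) (decide⁺ K j)
      reflects⁺ K j = proj₂ (proj₂ (proj₂ oracle (lrs (+ K) (+ j) (start K))))

      reflects⁻ : ∀ K j → Reflects (Positive (lrs (+ K) (ℤ.- + j) (start K))) (decide⁻ K j)
      reflects⁻ K j = proj₂ (proj₂ (proj₂ oracle (lrs (+ K) (ℤ.- + j) (start K))))

      decide⁺-run : ∀ K j → proj₁ oracle [ encodeLRS (lrs (+ K) (+ j) (start K)) ]⇓ encodeBool (decide⁺ K j)
      decide⁺-run K j = proj₁ (proj₂ (proj₂ oracle (lrs (+ K) (+ j) (start K))))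

      decide⁻-run : ∀ K j → proj₁ oracle [ encodeLRS (lrs (+ K) (ℤ.- + j) (start K)) ]⇓ encodeBool (decide⁻ K j)
      decide⁻-run K j = proj₁ (proj₂ (proj₂ oracle (lrs (+ K) (ℤ.- + j) (start K))))

    decide⁺F decide⁻F : ∀ {n} → Vec (Exp n) 2 → Exp n
    decide⁺F es = call (fun {value = λ { (K ∷ j ∷ []) → encodeBool (decide⁺ K j) }} (computes (comp (proj₁ oracle) (compiles (inputs t)))
        λ { (K ∷ j ∷ []) → ⇓comp (compiles-correct (inputs t) (K ∷ j ∷ [])) (subst (λ v → proj₁ oracle [ v ]⇓ encodeBool (decide⁺ K j))
          (sym (inputs-encode t K (+ j) (K ∷ j ∷ []) (λ i → value-t K j i))) (decide⁺-run K j)) })) es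
      where
      t : ℕ → Exp 2
      t = termE y⁺F y⁻F
      value-t : ∀ K j i → eval (t i) (K ∷ j ∷ []) ≡ encodeℤ (U (+ K) (+ j) (i + start K))
      value-t K j i = trans (encodeDifference (K * ((i + start K) * power (suc d′) (i + start K) + (i + start K) * x⁻ (i + start K)) + j * y⁻ (i + start K)) (K * ((i + start K) * x⁺ (i + start K)) + j * y⁺ (i + start K)))
        (cong encodeℤ (sym (proj₁ (U-difference K j (i + start K)))))
    decide⁻F es = call (fun {value = λ { (K ∷ j ∷ []) → encodeBool (decide⁻ K j) }} (computes (comp (proj₁ oracle) (compiles (inputs t)))
        λ { (K ∷ j ∷ []) → ⇓comp (compiles-correct (inputs t) (K ∷ j ∷ [])) (subst (λ v → proj₁ oracle [ v ]⇓ encodeBool (decide⁻ K j))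
          (sym (inputs-encode t K (ℤ.- + j) (K ∷ j ∷ []) (λ i → value-t K j i))) (decide⁻-run K j)) })) es
      where
      t : ℕ → Exp 2
      t = termE y⁻F y⁺F
      value-t : ∀ K j i → eval (t i) (K ∷ j ∷ []) ≡ encodeℤ (U (+ K) (ℤ.- + j) (i + start K))
      value-t K j i = trans (encodeDifference (K * ((i + start K) * power (suc d′) (i + start K) + (i + start K) * x⁻ (i + start K)) + j * y⁺ (i + start K)) (K * ((i + start K) * x⁺ (i + start K)) + j * y⁻ (i + start K)))
        (cong encodeℤ (sym (proj₂ (U-difference K j (i + start K)))))

    -- The finite part of the test: j Jπ n ≤ K² m ∣ m J - i n ∣ for 1 ≤ m ≤ 4096 K and 0 ≤ i ≤ m.
    close : ℕ → ℕ → ℕ → ℕ → ℕ → ℕ → ℕ → ℕ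
    close K j Jπ n J m i = 1 ∸ (j * Jπ * n ∸ K * K * suc m * ((suc m * J ∸ i * n) + (i * n ∸ suc m * J)))

    finite : ℕ → ℕ → ℕ → ℕ → ℕ → ℕ
    finite K j Jπ n J = all (λ m → all (close K j Jπ n J m) (2 + m)) (start K)

    test : ℕ → ℕ → ℕ → ℕ → ℕ → ℕ
    test K j Jπ n J = finite K j Jπ n J * (encodeBool (decide⁺ K j) * encodeBool (decide⁻ K j))

    private
      finiteF : Fun 5
      finiteF = define (λ { (K ∷ j ∷ Jπ ∷ n ∷ J ∷ []) → finite K j Jπ n J }) (allF (allF closeE (lit 2 ⊕ var #0)) (var #0 ⊗ lit c)) (λ { (K ∷ j ∷ Jπ ∷ n ∷ J ∷ []) →
          trans (eval-allF (allF closeE (lit 2 ⊕ var #0)) (var #0 ⊗ lit c) (K ∷ j ∷ Jπ ∷ n ∷ J ∷ []))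
            (all-cong (λ m → eval-allF closeE (lit 2 ⊕ var #0) (m ∷ K ∷ j ∷ Jπ ∷ n ∷ J ∷ [])) (start K)) })
        where
        -- Variables i , m , K , j , Jπ , n , J.
        closeE : Exp 7
        closeE = lit 1 ⊖ (var #3 ⊗ var #4 ⊗ var #5 ⊖ var #2 ⊗ var #2 ⊗ sucF (var #1 ∷ []) ⊗
          ((sucF (var #1 ∷ []) ⊗ var #6 ⊖ var #0 ⊗ var #5) ⊕ (var #0 ⊗ var #5 ⊖ sucF (var #1 ∷ []) ⊗ var #6)))
        all-cong : ∀ {f g} → (∀ m → f m ≡ g m) → ∀ k → all f k ≡ all g k
        all-cong h zero    = refl
        all-cong h (suc k) = cong₂ _*_ (all-cong h k) (h k)

      testF : Fun 5
      testF = define (λ { (K ∷ j ∷ Jπ ∷ n ∷ J ∷ []) → test K j Jπ n J }) (call finiteF (vars (λ i → i)) ⊗ (decide⁺F (var #0 ∷ var #1 ∷ []) ⊗ decide⁻F (var #0 ∷ var #1 ∷ [])))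
        (λ { (K ∷ j ∷ Jπ ∷ n ∷ J ∷ []) → refl })

      -- Inputs bound , K , Jπ , n , J.
      scanF : Fun 5
      scanF = as (λ { (k ∷ K ∷ Jπ ∷ n ∷ J ∷ []) → Scan.scan (λ j → test K j Jπ n J) k }) (recursion (expression (lit 0))
          (expression (var #1 ⊕ call testF (var #2 ∷ sucF (var #0 ∷ []) ∷ var #3 ∷ var #4 ∷ var #5 ∷ []) ⊗ (lit 1 ⊖ (var #0 ⊖ var #1))))) (λ { (k ∷ K ∷ Jπ ∷ n ∷ J ∷ []) → go k K Jπ n J })
        where
        go : ∀ k K Jπ n J → iterate _ _ (K ∷ Jπ ∷ n ∷ J ∷ []) k ≡ Scan.scan (λ j → test K j Jπ n J) k
        go zero    K Jπ n J = refl
        go (suc k) K Jπ n J = cong (λ s → s + test K (suc k) Jπ n J * (1 ∸ (k ∸ s))) (go k K Jπ n J)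

    opaque
      -- `piCount K / K` approximates `1/π` and `count K / steps K` approximates `t`. The number of
      -- steps ensures `m² ≤ steps K / K` for every denominator `m` of the finite test.
      steps piCount count : ℕ → ℕ
      steps K   = start K * start K * K
      piCount K = turnCount (K * K) 1 (K * 2) (K * K)
      count K   = turnCount a⁺ a⁻ b (steps K)

      steps-def : ∀ K → steps K ≡ start K * start K * K
      steps-def K = refl

      piCount-def : ∀ K → piCount K ≡ turnCount (K * K) 1 (K * 2) (K * K)
      piCount-def K = refl

      count-def : ∀ K → count K ≡ turnCount a⁺ a⁻ b (steps K)
      count-def K = refl

    -- A numerator over `K²`: the candidate is the product of `s / K`, with `s` the result of the
    -- scan, and `piCount K / K`.
    answer : ℕ → ℕ
    answer K = Scan.scan (λ j → test K j (piCount K) (steps K) (count K)) (K * 2) * piCount K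

    opaque
      unfolding steps

      answerF : ∀ {n} → Vec (Exp n) 1 → Exp n
      answerF es = call (define (λ { (K ∷ []) → answer K }) (call scanF (K ⊗ lit 2 ∷ K ∷ πE ∷ nE ∷ turnCountF (nE ∷ lit a⁺ ∷ lit a⁻ ∷ lit b ∷ []) ∷ []) ⊗ πE) (λ { (K ∷ []) → refl })) es
        where
        K : Exp 1
        K = var #0
        nE πE : Exp 1
        nE = K ⊗ lit c ⊗ (K ⊗ lit c) ⊗ K
        πE = turnCountF (K ⊗ K ∷ K ⊗ K ∷ lit 1 ∷ K ⊗ lit 2 ∷ [])

      eval-answerF : ∀ {n} (e : Exp n) xs → eval (answerF (e ∷ [])) xs ≡ answer (eval e xs)
      eval-answerF e xs = refl

-- Bits, the end of the search, and the values of the counters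

module Approximation where

  open Basics
  open Complex
  open Angles
  open Windings
  open SmallAngle
  open Criterion
  open Recurrence
  open Program
  import Defs as D
  open import Data.Bool.Base using (true; false)
  open import Data.Empty using (⊥; ⊥-elim)
  open import Data.Integer.Base using (+_)
  open import Data.List.Base using ([]; _∷_)
  open import Data.Nat.Base as ℕ using (ℕ; zero; suc; z≤n; s≤s)
  import Data.Nat.Properties as ℕ
  open import Data.Product.Base using (∃; _×_; _,_; proj₁; proj₂)
  open import Data.Rational.Base as ℚ using (ℚ; 0ℚ; 1ℚ; _+_; _*_; _-_; -_; _≤_; _<_; ∣_∣)
  import Data.Rational.Properties as ℚ
  open import Data.Sum.Base using (_⊎_; inj₁; inj₂; [_,_]′)
  open import Relation.Binary.PropositionalEquality using (_≡_; refl; sym; trans; cong; cong₂; subst)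
  open import Tactic.RingSolver using (solve; solve-∀)

  Bit : ℕ → Set
  Bit x = x ≡ 0 ⊎ x ≡ 1

  Bit-* : ∀ {x y} → Bit x → Bit y → Bit (x ℕ.* y)
  Bit-* (inj₁ refl) _           = inj₁ refl
  Bit-* (inj₂ refl) (inj₁ refl) = inj₁ refl
  Bit-* (inj₂ refl) (inj₂ refl) = inj₂ refl

  *≡1 : ∀ {x y} → Bit x → Bit y → x ℕ.* y ≡ 1 → x ≡ 1 × y ≡ 1
  *≡1 (inj₁ refl) _           ()
  *≡1 (inj₂ refl) (inj₁ refl) ()
  *≡1 (inj₂ refl) (inj₂ refl) _ = refl , refl

  *≡0 : ∀ {x y} → Bit x → Bit y → x ℕ.* y ≡ 0 → x ≡ 0 ⊎ y ≡ 0
  *≡0 (inj₁ refl) _           _ = inj₁ refl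
  *≡0 (inj₂ refl) (inj₁ refl) _ = inj₂ refl
  *≡0 (inj₂ refl) (inj₂ refl) ()

  Bit-all : ∀ {f} → (∀ i → Bit (f i)) → ∀ b → Bit (all f b)
  Bit-all h zero    = inj₂ refl
  Bit-all h (suc b) = Bit-* (Bit-all h b) (h b)

  all≡1 : ∀ {f} → (∀ i → Bit (f i)) → ∀ b → all f b ≡ 1 → ∀ i → i ℕ.< b → f i ≡ 1
  all≡1 {f} h (suc b) e i (s≤s i≤b) = let (p , q) = *≡1 (Bit-all h b) (h b) e in
    [ (λ i<b → all≡1 h b p i i<b) , (λ i≡b → trans (cong f i≡b) q) ]′ (ℕ.m≤n⇒m<n∨m≡n i≤b)

  all≡0 : ∀ {f} → (∀ i → Bit (f i)) → ∀ b → all f b ≡ 0 → ∃ λ i → i ℕ.< b × f i ≡ 0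
  all≡0 h zero ()
  all≡0 h (suc b) e = [ (λ p → let (i , i<b , q) = all≡0 h b p in i , ℕ.m≤n⇒m≤1+n i<b , q) , (λ q → b , ℕ.≤-refl , q) ]′ (*≡0 (Bit-all h b) (h b) e)

  1∸-bit : ∀ x → Bit (1 ℕ.∸ x)
  1∸-bit zero    = inj₂ refl
  1∸-bit (suc x) = inj₁ (ℕ.0∸n≡0 x)

  1∸≡1 : ∀ x y → 1 ℕ.∸ (x ℕ.∸ y) ≡ 1 → x ℕ.≤ y
  1∸≡1 x y e = ℕ.m∸n≡0⇒m≤n (zero-of (x ℕ.∸ y) e)
    where
    zero-of : ∀ z → 1 ℕ.∸ z ≡ 1 → z ≡ 0
    zero-of zero    _ = refl
    zero-of (suc z) e with trans (sym (ℕ.0∸n≡0 z)) e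
    ... | ()

  1∸≡0 : ∀ x y → 1 ℕ.∸ (x ℕ.∸ y) ≡ 0 → y ℕ.< x
  1∸≡0 x y e = ℕ.≰⇒> (λ x≤y → contra (trans (sym (cong (1 ℕ.∸_) (ℕ.m≤n⇒m∸n≡0 x≤y))) e))
    where
    contra : 1 ≡ 0 → ⊥
    contra ()

  encodeBool-bit : ∀ b → Bit (D.encodeBool b)
  encodeBool-bit true  = inj₂ refl
  encodeBool-bit false = inj₁ refl

  module _ {T : ℕ → ℕ} (bit : ∀ i → Bit (T i)) where

    open Scan T

    scan-spec : ∀ b → scan b ℕ.≤ b × (scan b ≡ 0 ⊎ T (scan b) ≡ 1) × (scan b ≡ b ⊎ T (suc (scan b)) ≡ 0)
    scan-spec zero = z≤n , inj₁ refl , inj₁ refl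
    scan-spec (suc i) = let (p , q , r) = scan-spec i in go (scan i) p q r (bit (suc i)) (ℕ.m≤n⇒m<n∨m≡n p)
      where
      Goal : ℕ → Set
      Goal s = s ℕ.≤ suc i × (s ≡ 0 ⊎ T s ≡ 1) × (s ≡ suc i ⊎ T (suc s) ≡ 0)
      same : ∀ s x → x ≡ 0 → Goal s → Goal (s ℕ.+ x)
      same s x refl g = subst Goal (sym (ℕ.+-identityʳ s)) g
      n<n : ∀ {i} → i ℕ.< i → {A : Set} → A
      n<n h = ⊥-elim (ℕ.<-irrefl refl h)
      go : ∀ s → s ℕ.≤ i → s ≡ 0 ⊎ T s ≡ 1 → s ≡ i ⊎ T (suc s) ≡ 0 → Bit (T (suc i)) → s ℕ.< i ⊎ s ≡ i → Goal (s ℕ.+ T (suc i) ℕ.* (1 ℕ.∸ (i ℕ.∸ s)))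
      go s s≤i q r t (inj₁ s<i) = same s _ (trans (cong (T (suc i) ℕ.*_) (zero-if-pos (i ℕ.∸ s) (ℕ.m<n⇒0<n∸m s<i))) (ℕ.*-zeroʳ (T (suc i))))
          (ℕ.m≤n⇒m≤1+n s≤i , q , [ (λ { refl → n<n s<i }) , inj₂ ]′ r)
        where
        zero-if-pos : ∀ x → 0 ℕ.< x → 1 ℕ.∸ x ≡ 0
        zero-if-pos (suc x) _ = ℕ.0∸n≡0 x
      go s s≤i q r (inj₁ t) (inj₂ refl) = same s _ (cong (ℕ._* (1 ℕ.∸ (i ℕ.∸ s))) t) (ℕ.m≤n⇒m≤1+n s≤i , q , inj₂ t)
      go s s≤i q r (inj₂ t) (inj₂ refl) = subst Goal (sym eq) (ℕ.≤-refl , inj₂ t , inj₁ refl)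
        where
        eq : i ℕ.+ T (suc i) ℕ.* (1 ℕ.∸ (i ℕ.∸ i)) ≡ suc i
        eq = trans (cong₂ (λ x y → i ℕ.+ x ℕ.* (1 ℕ.∸ y)) t (ℕ.n∸n≡0 i)) (ℕ.+-comm i 1)

  nat-cancel-< : ∀ {m n} → nat m < nat n → m ℕ.< n
  nat-cancel-< h = ℕ.≰⇒> (λ n≤m → absurd h (nat-mono n≤m))

  nat-mono-< : ∀ {m n} → m ℕ.< n → nat m < nat n
  nat-mono-< {m} {n} h = ℚ.<-≤-trans (lem (nat m)) (nat-mono h)
    where
    lem : ∀ x → x < 1ℚ + x
    lem x = by< (#< 1ℚ) (solve (x ∷ []) ring)

  nat-distance : ∀ a b → nat ((a ℕ.∸ b) ℕ.+ (b ℕ.∸ a)) ≡ ∣ nat a - nat b ∣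
  nat-distance a b = [ (λ a≤b → trans (cong₂ (λ x y → nat (x ℕ.+ y)) (ℕ.m≤n⇒m∸n≡0 a≤b) refl) (trans (diff a b a≤b) (∣-∣-swap (nat b) (nat a))))
                     , (λ b≤a → trans (cong nat (trans (cong (a ℕ.∸ b ℕ.+_) (ℕ.m≤n⇒m∸n≡0 b≤a)) (ℕ.+-identityʳ (a ℕ.∸ b)))) (diff b a b≤a)) ]′ (ℕ.≤-total a b)
    where
    diff : ∀ a b → a ℕ.≤ b → nat (b ℕ.∸ a) ≡ ∣ nat b - nat a ∣
    diff a b h = trans (trans (l (nat a) (nat (b ℕ.∸ a))) (cong (_- nat a) (trans (sym (nat-+ a (b ℕ.∸ a))) (cong nat (ℕ.m+[n∸m]≡n h))))) (sym (ℚ.0≤p⇒∣p∣≡p (δ (nat-mono h))))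
      where
      l : ∀ x y → y ≡ x + y - x
      l = solve-∀ ring

  module GaussPower (a⁺ a⁻ b e : ℕ) (w : ℂ) (re-w : nat (suc e) * re w ≡ nat a⁺ - nat a⁻) (im-w : nat (suc e) * im w ≡ nat b) where

    open Gauss a⁺ a⁻ b

    private
      P : ℕ → ℚ
      P n = nat (power (suc e) n)

      nat₃ : ∀ u v w x y z → nat (u ℕ.* v ℕ.+ w ℕ.* x ℕ.+ y ℕ.* z) ≡ nat u * nat v + nat w * nat x + nat y * nat z
      nat₃ u v w x y z = trans (nat-+ (u ℕ.* v ℕ.+ w ℕ.* x) (y ℕ.* z)) (cong₂ _+_ (trans (nat-+ (u ℕ.* v) (w ℕ.* x)) (cong₂ _+_ (nat-* u v) (nat-* w x))) (nat-* y z))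

      re-* : ∀ u v → re (u *ᶜ v) ≡ re u * re v - im u * im v
      re-* (cx _ _) (cx _ _) = refl

      im-* : ∀ u v → im (u *ᶜ v) ≡ re u * im v + im u * re v
      im-* (cx _ _) (cx _ _) = refl

    powers : ∀ n → P n * re (w ^ᶜ n) ≡ nat (x⁺ n) - nat (x⁻ n) × P n * im (w ^ᶜ n) ≡ nat (y⁺ n) - nat (y⁻ n)
    powers zero = refl , refl
    powers (suc n) = let (ih₁ , ih₂) = powers n in
        trans (cong₂ _*_ (nat-* (suc e) (power (suc e) n)) (re-* w (w ^ᶜ n)))
          (trans (l₁ (nat (suc e)) (P n) (re w) (im w) (re (w ^ᶜ n)) (im (w ^ᶜ n)))
          (trans (cong₂ _-_ (cong₂ _*_ re-w ih₁) (cong₂ _*_ im-w ih₂))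
          (trans (l₂ (nat a⁺) (nat a⁻) (nat b) (nat (x⁺ n)) (nat (x⁻ n)) (nat (y⁺ n)) (nat (y⁻ n)))
            (sym (cong₂ _-_ (nat₃ a⁺ (x⁺ n) a⁻ (x⁻ n) b (y⁻ n)) (nat₃ a⁺ (x⁻ n) a⁻ (x⁺ n) b (y⁺ n)))))))
      , trans (cong₂ _*_ (nat-* (suc e) (power (suc e) n)) (im-* w (w ^ᶜ n)))
          (trans (l₃ (nat (suc e)) (P n) (re w) (im w) (re (w ^ᶜ n)) (im (w ^ᶜ n)))
          (trans (cong₂ _+_ (cong₂ _*_ re-w ih₂) (cong₂ _*_ im-w ih₁))
          (trans (l₄ (nat a⁺) (nat a⁻) (nat b) (nat (x⁺ n)) (nat (x⁻ n)) (nat (y⁺ n)) (nat (y⁻ n)))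
            (sym (cong₂ _-_ (nat₃ b (x⁺ n) a⁺ (y⁺ n) a⁻ (y⁻ n)) (nat₃ b (x⁻ n) a⁺ (y⁻ n) a⁻ (y⁺ n)))))))
      where
      l₁ : ∀ d P p q c s → d * P * (p * c - q * s) ≡ (d * p) * (P * c) - (d * q) * (P * s)
      l₁ = solve-∀ ring
      l₂ : ∀ a a′ b x x′ y y′ → (a - a′) * (x - x′) - b * (y - y′) ≡ (a * x + a′ * x′ + b * y′) - (a * x′ + a′ * x + b * y)
      l₂ = solve-∀ ring
      l₃ : ∀ d P p q c s → d * P * (p * s + q * c) ≡ (d * p) * (P * s) + (d * q) * (P * c)
      l₃ = solve-∀ ring
      l₄ : ∀ a a′ b x x′ y y′ → (a - a′) * (y - y′) + b * (x - x′) ≡ (b * x + a * y + a′ * y′) - (b * x′ + a * y′ + a′ * y)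
      l₄ = solve-∀ ring

    0<power : ∀ n → 0ℚ < nat (power (suc e) n)
    0<power zero = #< 1ℚ
    0<power (suc n) = subst (0ℚ <_) (sym (nat-* (suc e) (power (suc e) n))) (0<nat e <⊠ 0<power n)

    private
      im<0 : ∀ n → im (w ^ᶜ n) < 0ℚ → y⁺ n ℕ.< y⁻ n
      im<0 n h = nat-cancel-< (lem (P n) (im (w ^ᶜ n)) (nat (y⁺ n)) (nat (y⁻ n)) (0<power n) h (proj₂ (powers n)))
        where
        lem : ∀ P s y y′ → 0ℚ < P → s < 0ℚ → P * s ≡ y - y′ → y < y′
        lem P s y y′ p h e = by< (p <⊠ δ< h) (trans (l₁ y y′) (trans (cong (λ t → 0ℚ - t) (sym e)) (l₂ P s)))
          where
          l₁ : ∀ y y′ → y′ - y ≡ 0ℚ - (y - y′)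
          l₁ = solve-∀ ring
          l₂ : ∀ P s → 0ℚ - P * s ≡ P * (0ℚ - s)
          l₂ = solve-∀ ring

      0≤im : ∀ n → 0ℚ ≤ im (w ^ᶜ n) → y⁻ n ℕ.≤ y⁺ n
      0≤im n h = nat-cancel (by≤ (<⇒≤ (0<power n) ⊠ h) (sym (proj₂ (powers n))))

      below : ∀ u v → u ℕ.< v → 1 ℕ.∸ (1 ℕ.∸ (v ℕ.∸ u)) ≡ 1 × 1 ℕ.∸ (v ℕ.∸ u) ≡ 0
      below u v h = go (v ℕ.∸ u) (ℕ.m<n⇒0<n∸m h)
        where
        go : ∀ x → 0 ℕ.< x → 1 ℕ.∸ (1 ℕ.∸ x) ≡ 1 × 1 ℕ.∸ x ≡ 0
        go (suc x) _ = cong (1 ℕ.∸_) (ℕ.0∸n≡0 x) , ℕ.0∸n≡0 x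

      above : ∀ u v → v ℕ.≤ u → 1 ℕ.∸ (1 ℕ.∸ (v ℕ.∸ u)) ≡ 0 × 1 ℕ.∸ (v ℕ.∸ u) ≡ 1
      above u v h = cong (λ x → 1 ℕ.∸ (1 ℕ.∸ x)) (ℕ.m≤n⇒m∸n≡0 h) , cong (1 ℕ.∸_) (ℕ.m≤n⇒m∸n≡0 h)

    turnCount-winding : Winding w (turnCount a⁺ a⁻ b)
    turnCount-winding = record
      { start   = refl
      ; cross   = λ n h g → trans (cong₂ (λ x y → turnCount a⁺ a⁻ b n ℕ.+ x ℕ.* y) (proj₁ (below (y⁺ n) (y⁻ n) (im<0 n h))) (proj₂ (above (y⁺ (suc n)) (y⁻ (suc n)) (0≤im (suc n) g)))) (ℕ.+-comm _ 1)
      ; stay-up = λ n h → trans (cong (λ x → turnCount a⁺ a⁻ b n ℕ.+ x ℕ.* (1 ℕ.∸ (y⁻ (suc n) ℕ.∸ y⁺ (suc n)))) (proj₁ (above (y⁺ n) (y⁻ n) (0≤im n h)))) (ℕ.+-identityʳ _)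
      ; stay-lo = λ n h → trans (cong (λ y → turnCount a⁺ a⁻ b n ℕ.+ (1 ℕ.∸ (1 ℕ.∸ (y⁻ n ℕ.∸ y⁺ n))) ℕ.* y) (proj₂ (below (y⁺ (suc n)) (y⁻ (suc n)) (im<0 (suc n) h))))
          (trans (cong (turnCount a⁺ a⁻ b n ℕ.+_) (ℕ.*-zeroʳ (1 ℕ.∸ (1 ℕ.∸ (y⁻ n ℕ.∸ y⁺ n))))) (ℕ.+-identityʳ _))
      }

  -- The counter for π runs on (κ + i)² = κ² - 1 + 2κ i.
  piWinding : ∀ κ → Winding (unitSquare κ) (turnCount (κ ℕ.* κ) 1 (κ ℕ.* 2))
  piWinding κ = GaussPower.turnCount-winding (κ ℕ.* κ) 1 (κ ℕ.* 2) (κ ℕ.* κ) (unitSquare κ)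
      (trans (l (nat (suc (κ ℕ.* κ))) (nat κ * nat κ - 1ℚ) (inv (κ ℕ.* κ)) (nat*inv (κ ℕ.* κ))) (cong (_- 1ℚ) (sym (nat-* κ κ))))
      (trans (l (nat (suc (κ ℕ.* κ))) ((2 // 1) * nat κ) (inv (κ ℕ.* κ)) (nat*inv (κ ℕ.* κ))) (trans (ℚ.*-comm (2 // 1) (nat κ)) (sym (nat-* κ 2))))
    where
    l : ∀ n x i → n * i ≡ 1ℚ → n * (x * i) ≡ x
    l n x i e = trans (l′ n x i) (trans (cong (_* x) e) (ℚ.*-identityˡ x))
      where
      l′ : ∀ n x i → n * (x * i) ≡ n * i * x
      l′ = solve-∀ ring

-- The output of the search brackets the type

module Bracket where

  open Basics
  open Complex
  open Angles
  open Windings using (Winding)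
  open SmallAngle
  open Irrational
  open Criterion
  open Recurrence
  open Program
  open Approximation
  import Defs as D
  open import Data.Empty using (⊥)
  open import Data.Integer.Base as ℤ using (ℤ; +_; -[1+_]; 0ℤ)
  import Data.Integer.Properties as ℤ
  open import Data.List.Base using ([]; _∷_)
  open import Data.Nat.Base as ℕ using (ℕ; zero; suc; z≤n; s≤s)
  import Data.Nat.Properties as ℕ
  open import Data.Product.Base using (∃; _×_; _,_; proj₁; proj₂)
  open import Data.Rational.Base as ℚ using (ℚ; 0ℚ; 1ℚ; _+_; _*_; _-_; -_; _≤_; _<_; ∣_∣)
  import Data.Rational.Properties as ℚ
  open import Data.Sum.Base using (_⊎_; inj₁; inj₂; [_,_]′)
  open import Relation.Binary.PropositionalEquality using (_≡_; _≢_; sym; trans; cong; cong₂; subst; subst₂)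
  open import Relation.Nullary using (¬_; Reflects; ofʸ; ofⁿ)
  open import Tactic.RingSolver using (solve; solve-∀)

  reflects-true : ∀ {P : Set} {b} → Reflects P b → D.encodeBool b ≡ 1 → P
  reflects-true (ofʸ p) _ = p
  reflects-true (ofⁿ _) ()

  reflects-false : ∀ {P : Set} {b} → Reflects P b → D.encodeBool b ≡ 0 → ¬ P
  reflects-false (ofʸ _) ()
  reflects-false (ofⁿ ¬p) _ = ¬p

  int-difference : ∀ m n → int (+ m ℤ.- + n) ≡ nat m - nat n
  int-difference m n = trans (int-+ (+ m) (ℤ.- + n)) (cong₂ _+_ (int-nat m) (trans (int-neg (+ n)) (cong (λ v → - v) (int-nat n))))

  -- `cut` is a variable known only through its value in ℚ, so that `nat cut` remains a symbol
  -- instead of a sum of 4096 ones.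
  module _ (oracle : D.PositivityDecidable 6) (cut : ℕ) (cut≡4096 : nat cut ≡ 4096 // 1) (a⁺ a⁻ b d′ : ℕ)
    (a²+b²≡d² : Gauss.a a⁺ a⁻ b ℤ.* Gauss.a a⁺ a⁻ b ℤ.+ + b ℤ.* + b ≡ + suc d′ ℤ.* + suc d′)
    (π θ t : ℕ → ℚ) (Eπ : Angle π -1ᶜ) (π-range : Ev (λ n → 12 // 5 ≤ π n × π n ≤ 17 // 5))
    {p q} (unit : p * p + q * q ≡ 1ℚ) (p≢0 : p ≢ 0ℚ) (q≢0 : q ≢ 0ℚ) (Eθ : Angle θ (cx p q))
    (d*p : nat (suc d′) * p ≡ nat a⁺ - nat a⁻) (d*q : nat (suc d′) * q ≡ nat b)
    {ε₀} (0<ε₀ : 0ℚ < ε₀) (θ-range : Ev (λ k → ε₀ ≤ θ k × θ k ≤ π k - ε₀))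
    (2πt : ∀ {ε} → 0ℚ < ε → Ev (λ k → ∣ (π k + π k) * t k - θ k ∣ ≤ ε)) where

    open Oracle oracle cut a⁺ a⁻ b d′ a²+b²≡d²
    open Gauss a⁺ a⁻ b
    open Positivity d′ a²+b²≡d² using (U)
    open Tail π θ t Eπ π-range unit p≢0 q≢0 Eθ 0<ε₀ θ-range 2πt

    private
      w = cx p q

      module GP = GaussPower a⁺ a⁻ b d′ w d*p d*q

      P : ℕ → ℚ
      P m = nat (power (suc d′) m)

      versine : ℕ → ℚ
      versine m = nat m * (1ℚ - re (w ^ᶜ m))

      sine : ℕ → ℚ
      sine m = im (w ^ᶜ m)

      -- `P m` is positive, so the integer term has the sign of the trigonometric expression.
      U-value : ∀ K j m → int (U (+ K) (+ j) m) ≡ (nat K * versine m - nat j * sine m) * P m × int (U (+ K) (ℤ.- + j) m) ≡ (nat K * versine m + nat j * sine m) * P m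
      U-value K j m =
          trans (cong int (proj₁ (U-difference K j m))) (trans (int-difference (K ℕ.* (m ℕ.* power (suc d′) m ℕ.+ m ℕ.* x⁻ m) ℕ.+ j ℕ.* y⁻ m) (K ℕ.* (m ℕ.* x⁺ m) ℕ.+ j ℕ.* y⁺ m))
            (trans (cong₂ _-_ (up (y⁻ m)) (lo (y⁺ m))) (l₁ (nat K) (nat j) (nat m) (P m) (nat (x⁺ m)) (nat (x⁻ m)) (nat (y⁺ m)) (nat (y⁻ m)) (re (w ^ᶜ m)) (im (w ^ᶜ m)) (proj₁ (GP.powers m)) (proj₂ (GP.powers m)))))
        , trans (cong int (proj₂ (U-difference K j m))) (trans (int-difference (K ℕ.* (m ℕ.* power (suc d′) m ℕ.+ m ℕ.* x⁻ m) ℕ.+ j ℕ.* y⁺ m) (K ℕ.* (m ℕ.* x⁺ m) ℕ.+ j ℕ.* y⁻ m))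
            (trans (cong₂ _-_ (up (y⁺ m)) (lo (y⁻ m))) (l₂ (nat K) (nat j) (nat m) (P m) (nat (x⁺ m)) (nat (x⁻ m)) (nat (y⁺ m)) (nat (y⁻ m)) (re (w ^ᶜ m)) (im (w ^ᶜ m)) (proj₁ (GP.powers m)) (proj₂ (GP.powers m)))))
        where
        up : ∀ y → nat (K ℕ.* (m ℕ.* power (suc d′) m ℕ.+ m ℕ.* x⁻ m) ℕ.+ j ℕ.* y) ≡ nat K * (nat m * P m + nat m * nat (x⁻ m)) + nat j * nat y
        up y = trans (nat-+ (K ℕ.* (m ℕ.* power (suc d′) m ℕ.+ m ℕ.* x⁻ m)) (j ℕ.* y)) (cong₂ _+_ (trans (nat-* K (m ℕ.* power (suc d′) m ℕ.+ m ℕ.* x⁻ m))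
          (cong (nat K *_) (trans (nat-+ (m ℕ.* power (suc d′) m) (m ℕ.* x⁻ m)) (cong₂ _+_ (nat-* m (power (suc d′) m)) (nat-* m (x⁻ m)))))) (nat-* j y))
        lo : ∀ y → nat (K ℕ.* (m ℕ.* x⁺ m) ℕ.+ j ℕ.* y) ≡ nat K * (nat m * nat (x⁺ m)) + nat j * nat y
        lo y = trans (nat-+ (K ℕ.* (m ℕ.* x⁺ m)) (j ℕ.* y)) (cong₂ _+_ (trans (nat-* K (m ℕ.* x⁺ m)) (cong (nat K *_) (nat-* m (x⁺ m)))) (nat-* j y))
        l₁ : ∀ K j m P x x′ y y′ c s → P * c ≡ x - x′ → P * s ≡ y - y′ → (K * (m * P + m * x′) + j * y′) - (K * (m * x) + j * y) ≡ (K * (m * (1ℚ - c)) - j * s) * P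
        l₁ K j m P x x′ y y′ c s e f = trans (h₁ K j m P x x′ y y′) (trans (cong₂ (λ u v → K * (m * (P - u)) - j * v) (sym e) (sym f)) (h₂ K j m P c s))
          where
          h₁ : ∀ K j m P x x′ y y′ → (K * (m * P + m * x′) + j * y′) - (K * (m * x) + j * y) ≡ K * (m * (P - (x - x′))) - j * (y - y′)
          h₁ = solve-∀ ring
          h₂ : ∀ K j m P c s → K * (m * (P - P * c)) - j * (P * s) ≡ (K * (m * (1ℚ - c)) - j * s) * P
          h₂ = solve-∀ ring
        l₂ : ∀ K j m P x x′ y y′ c s → P * c ≡ x - x′ → P * s ≡ y - y′ → (K * (m * P + m * x′) + j * y) - (K * (m * x) + j * y′) ≡ (K * (m * (1ℚ - c)) + j * s) * P
        l₂ K j m P x x′ y y′ c s e f = trans (h₁ K j m P x x′ y y′) (trans (cong₂ (λ u v → K * (m * (P - u)) + j * v) (sym e) (sym f)) (h₂ K j m P c s))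
          where
          h₁ : ∀ K j m P x x′ y y′ → (K * (m * P + m * x′) + j * y) - (K * (m * x) + j * y′) ≡ K * (m * (P - (x - x′))) + j * (y - y′)
          h₁ = solve-∀ ring
          h₂ : ∀ K j m P c s → K * (m * (P - P * c)) + j * (P * s) ≡ (K * (m * (1ℚ - c)) + j * s) * P
          h₂ = solve-∀ ring

      strip : ∀ {i a m} → int i ≡ a * P m → 0ℤ ℤ.≤ i → 0ℚ ≤ a
      strip {i} {a} {m} e h = *-cancel-≤ (GP.0<power m) (subst₂ _≤_ (sym (ℚ.*-zeroˡ (P m))) e (int-mono h))

      unstrip : ∀ {i a m} → int i ≡ a * P m → 0ℚ ≤ a → 0ℤ ℤ.≤ i
      unstrip {m = m} e h = int-cancel (subst (0ℚ ≤_) (sym e) (h ⊠ <⇒≤ (GP.0<power m)))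

    module _ (K κ′ : ℕ) (K≡ : K ≡ suc κ′) (32≤K : 32 ℕ.≤ K) where

      private
        x = nat K
        j = inv κ′
        ρ = nat (piCount K) * j

        xj : x * j ≡ 1ℚ
        xj = trans (cong (λ n → nat n * j) K≡) (nat*inv κ′)

        0≤j = 0≤inv κ′

        32≤x : 32 // 1 ≤ x
        32≤x = nat-mono 32≤K

        start≡ : nat (start K) ≡ (4096 // 1) * x
        start≡ = trans (nat-* K cut) (trans (ℚ.*-comm x (nat cut)) (cong (_* x) cut≡4096))

        steps≡ : nat (steps K) ≡ nat (start K) * nat (start K) * x
        steps≡ = trans (cong nat (steps-def K)) (trans (nat-* (start K ℕ.* start K) K) (cong (_* x) (nat-* (start K) (start K))))

        0<x : 0ℚ < x
        0<x = ℚ.<-≤-trans (#< (32 // 1)) 32≤x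

        0<start : 0ℚ < nat (start K)
        0<start = subst (0ℚ <_) (sym start≡) (#< (4096 // 1) <⊠ 0<x)

        0<steps : 0ℚ < nat (steps K)
        0<steps = subst (0ℚ <_) (sym steps≡) ((0<start <⊠ 0<start) <⊠ 0<x)

        πρ : Ev (λ k → π k * ρ ≤ 1ℚ + (20 // 1) * j × 1ℚ - (20 // 1) * j ≤ π k * ρ)
        πρ = subst (λ c → Ev (λ k → π k * (nat c * j) ≤ 1ℚ + (20 // 1) * j × 1ℚ - (20 // 1) * j ≤ π k * (nat c * j)))
          (trans (cong (λ n → turnCount (n ℕ.* n) 1 (n ℕ.* 2) (n ℕ.* n)) (sym K≡)) (sym (piCount-def K)))
          (π-approx π Eπ π-range κ′ (subst (32 ℕ.≤_) K≡ 32≤K) (piWinding (suc κ′)))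

        wind : Winding w (turnCount a⁺ a⁻ b)
        wind = GP.turnCount-winding

        Test : ℕ → ℕ
        Test jj = test K jj (piCount K) (steps K) (count K)

        left : ℕ → ℕ
        left jj = jj ℕ.* piCount K ℕ.* steps K

        right : ℕ → ℕ → ℕ
        right m i = K ℕ.* K ℕ.* suc m ℕ.* ((suc m ℕ.* count K ℕ.∸ i ℕ.* steps K) ℕ.+ (i ℕ.* steps K ℕ.∸ suc m ℕ.* count K))

        close-bit : ∀ jj m i → Bit (close K jj (piCount K) (steps K) (count K) m i)
        close-bit jj m i = 1∸-bit (left jj ℕ.∸ right m i)

        finite-bit : ∀ jj → Bit (finite K jj (piCount K) (steps K) (count K))
        finite-bit jj = Bit-all (λ m → Bit-all (close-bit jj m) (2 ℕ.+ m)) (start K)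

        decide-bit : ∀ jj → Bit (D.encodeBool (decide⁺ K jj) ℕ.* D.encodeBool (decide⁻ K jj))
        decide-bit jj = Bit-* (encodeBool-bit (decide⁺ K jj)) (encodeBool-bit (decide⁻ K jj))

        Test-bit : ∀ jj → Bit (Test jj)
        Test-bit jj = Bit-* (finite-bit jj) (decide-bit jj)

      module _ (jj : ℕ) (jj≤2K : jj ℕ.≤ K ℕ.* 2) where

        private
          r = nat jj * j

          0≤r : 0ℚ ≤ r
          0≤r = 0≤nat jj ⊠ 0≤j

          r≤2 : r ≤ 2 // 1
          r≤2 = lem (nat jj) x j (subst (nat jj ≤_) (nat-* K 2) (nat-mono jj≤2K)) xj 0≤j
            where
            lem : ∀ a x j → a ≤ x * (2 // 1) → x * j ≡ 1ℚ → 0ℚ ≤ j → a * j ≤ 2 // 1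
            lem a x j h e z = by≤ (δ h ⊠ z ⊞ # (2 // 1) ⊠ δ (≡⇒≤ e)) (solve (a ∷ x ∷ j ∷ []) ring)

          module L = Level {x} {j} {ρ} {r} xj (0<inv κ′) 32≤x 0≤r r≤2 πρ

          tail-from : ∀ m → 0ℤ ℤ.≤ U (+ K) (+ jj) m → 0ℤ ℤ.≤ U (+ K) (ℤ.- + jj) m → r * ∣ sine m ∣ ≤ versine m
          tail-from m u⁺ u⁻ = [ (λ e → subst (λ s → r * s ≤ versine m) (sym e) (l (nat jj) j x (versine m) (sine m) xj 0≤j (strip {m = m} (proj₁ (U-value K jj m)) u⁺)))
                              , (λ e → subst (λ s → r * s ≤ versine m) (sym e) (l′ (nat jj) j x (versine m) (sine m) xj 0≤j (strip {m = m} (proj₂ (U-value K jj m)) u⁻))) ]′ (ℚ.∣p∣≡p∨∣p∣≡-p (sine m))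
            where
            cancel : ∀ x j v → x * j ≡ 1ℚ → j * (x * v) ≡ v
            cancel x j v e = trans (h x j v) (trans (cong (_* v) e) (ℚ.*-identityˡ v))
              where
              h : ∀ x j v → j * (x * v) ≡ x * j * v
              h = solve-∀ ring
            l : ∀ a j x v s → x * j ≡ 1ℚ → 0ℚ ≤ j → 0ℚ ≤ x * v - a * s → a * j * s ≤ v
            l a j x v s e z h = subst (a * j * s ≤_) (cancel x j v e) (by≤ (z ⊠ h) (solve (a ∷ j ∷ x ∷ v ∷ s ∷ []) ring))
            l′ : ∀ a j x v s → x * j ≡ 1ℚ → 0ℚ ≤ j → 0ℚ ≤ x * v + a * s → a * j * - s ≤ v
            l′ a j x v s e z h = subst (a * j * - s ≤_) (cancel x j v e) (by≤ (z ⊠ h) (solve (a ∷ j ∷ x ∷ v ∷ s ∷ []) ring))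

          tail-to : ∀ m → r * ∣ sine m ∣ ≤ versine m → 0ℤ ℤ.≤ U (+ K) (+ jj) m × 0ℤ ℤ.≤ U (+ K) (ℤ.- + jj) m
          tail-to m h = unstrip {m = m} (proj₁ (U-value K jj m)) (proj₁ both) , unstrip {m = m} (proj₂ (U-value K jj m)) (proj₂ both)
            where
            l : ∀ a j x v s t → x * j ≡ 1ℚ → 0ℚ ≤ x → 0ℚ ≤ a → a * j * t ≤ v → s ≤ t → - s ≤ t → 0ℚ ≤ x * v - a * s × 0ℚ ≤ x * v + a * s
            l a j x v s t e z w h p p′ = subst (0ℚ ≤_) (q₁ a j x v s t e) (z ⊠ δ h ⊞ w ⊠ δ p) , subst (0ℚ ≤_) (q₂ a j x v s t e) (z ⊠ δ h ⊞ w ⊠ δ p′)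
              where
              g₁ : ∀ a j x v s t → x * (v - a * j * t) + a * (t - s) ≡ x * v - a * s + a * t * (1ℚ - x * j)
              g₁ = solve-∀ ring
              g₂ : ∀ a j x v s t → x * (v - a * j * t) + a * (t - - s) ≡ x * v + a * s + a * t * (1ℚ - x * j)
              g₂ = solve-∀ ring
              z₀ : ∀ u v → u + v * (1ℚ - 1ℚ) ≡ u
              z₀ u v = trans (cong (λ t → u + v * t) (ℚ.+-inverseʳ 1ℚ)) (trans (cong (λ t → u + t) (ℚ.*-zeroʳ v)) (ℚ.+-identityʳ u))
              q₁ : ∀ a j x v s t → x * j ≡ 1ℚ → x * (v - a * j * t) + a * (t - s) ≡ x * v - a * s
              q₁ a j x v s t e = trans (g₁ a j x v s t) (trans (cong (λ y → x * v - a * s + a * t * (1ℚ - y)) e) (z₀ (x * v - a * s) (a * t)))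
              q₂ : ∀ a j x v s t → x * j ≡ 1ℚ → x * (v - a * j * t) + a * (t - - s) ≡ x * v + a * s
              q₂ a j x v s t e = trans (g₂ a j x v s t) (trans (cong (λ y → x * v + a * s + a * t * (1ℚ - y)) e) (z₀ (x * v + a * s) (a * t)))
            both = l (nat jj) j x (versine m) (sine m) (∣ sine m ∣) xj (0≤nat K) (0≤nat jj) h (x≤∣x∣ (sine m)) (-x≤∣x∣ (sine m))

          close-value : ∀ m i → nat (right m i)
            ≡ x * x * nat (suc m) * ∣ nat (suc m) * nat (count K) - int (+ i) * nat (steps K) ∣
          close-value m i = trans (nat-* (K ℕ.* K ℕ.* suc m) ((suc m ℕ.* count K ℕ.∸ i ℕ.* steps K) ℕ.+ (i ℕ.* steps K ℕ.∸ suc m ℕ.* count K))) (cong₂ _*_ (trans (nat-* (K ℕ.* K) (suc m)) (cong (_* nat (suc m)) (nat-* K K)))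
            (trans (nat-distance (suc m ℕ.* count K) (i ℕ.* steps K)) (cong₂ (λ u v → ∣ u - v ∣) (nat-* (suc m) (count K)) (trans (nat-* i (steps K)) (cong (_* nat (steps K)) (sym (int-nat i)))))))

          level-value : nat (left jj) ≡ nat jj * nat (piCount K) * nat (steps K)
          level-value = trans (nat-* (jj ℕ.* piCount K) (steps K)) (cong (_* nat (steps K)) (nat-* jj (piCount K)))

          -- The program compares integers; division by `K²` turns the two sides into `r ρ n` and
          -- `m D`, the form used in `finite⇒bound`.
          rescale : ∀ a c n x j M D → x * j ≡ 1ℚ → (a * j) * (c * j) * n ≡ j * j * (a * c * n) × M * D ≡ j * j * (x * x * M * D)
          rescale a c n x j M D e = h₁ a c n j , trans (sym (trans (cong (λ t → t * t * (M * D)) e) (ℚ.*-identityˡ (M * D)))) (h₂ x j M D)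
            where
            h₁ : ∀ a c n j → (a * j) * (c * j) * n ≡ j * j * (a * c * n)
            h₁ = solve-∀ ring
            h₂ : ∀ x j M D → x * j * (x * j) * (M * D) ≡ j * j * (x * x * M * D)
            h₂ = solve-∀ ring

          dist : ℕ → ℕ → ℚ
          dist m i = ∣ nat (suc m) * nat (count K) - int (+ i) * nat (steps K) ∣

          close-1 : ∀ m i → close K jj (piCount K) (steps K) (count K) m i ≡ 1 → r * ρ * nat (steps K) ≤ nat (suc m) * dist m i
          close-1 m i e = let (h₁ , h₂) = rescale (nat jj) (nat (piCount K)) (nat (steps K)) x j (nat (suc m)) (dist m i) xj in
            subst₂ _≤_ (sym h₁) (sym h₂) (ℚ.*-monoˡ-≤-nonNeg (j * j) {{ℚ.nonNegative (0≤j ⊠ 0≤j)}}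
              (subst₂ _≤_ level-value (close-value m i) (nat-mono {left jj} {right m i} (1∸≡1 (left jj) (right m i) e))))

          close-0 : ∀ m i → close K jj (piCount K) (steps K) (count K) m i ≡ 0 → nat (suc m) * dist m i < r * ρ * nat (steps K)
          close-0 m i e = let (h₁ , h₂) = rescale (nat jj) (nat (piCount K)) (nat (steps K)) x j (nat (suc m)) (dist m i) xj in
            subst₂ _<_ (sym h₂) (sym h₁) (ℚ.*-monoʳ-<-pos (j * j) {{ℚ.positive (0<inv κ′ <⊠ 0<inv κ′)}}
              (subst₂ _<_ (close-value m i) level-value (nat-mono-< {right m i} {left jj} (1∸≡0 (left jj) (right m i) e))))

          square≤ : ∀ m → suc m ℕ.≤ start K → nat (suc m) * nat (suc m) * x ≤ nat (steps K)
          square≤ m h = subst (nat (suc m) * nat (suc m) * x ≤_) (sym steps≡)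
            (lem (nat (suc m)) (nat (start K)) x (nat-mono h) (0≤nat (suc m)) (0≤nat K))
            where
            lem : ∀ a b x → a ≤ b → 0ℚ ≤ a → 0ℚ ≤ x → a * a * x ≤ b * b * x
            lem a b x h z w = by≤ ((δ h ⊠ (δ h ⊞ # (2 // 1) ⊠ z)) ⊠ w) (solve (a ∷ b ∷ x ∷ []) ring)

        -- Small denominators are covered by the finite test, with `outside⇒bound` for the
        -- numerators it omits. Large ones are covered by the two oracle answers together with
        -- `sine≢0`.
        test-true : Test jj ≡ 1 → LowerBound t (r * ρ - (20 // 1) * j)
        test-true e m i {ε} 0<ε = by-size (ℕ.≤-<-connex (suc m) (start K)) i
          where
          parts = *≡1 (finite-bit jj) (decide-bit jj) e
          decided = *≡1 (encodeBool-bit (decide⁺ K jj)) (encodeBool-bit (decide⁻ K jj)) (proj₂ parts)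
          positive⁺ = reflects-true (reflects⁺ K jj) (proj₁ decided)
          positive⁻ = reflects-true (reflects⁻ K jj) (proj₂ decided)
          by-size : suc m ℕ.≤ start K ⊎ start K ℕ.< suc m → ∀ i → Ev (λ k → r * ρ - (20 // 1) * j - ε ≤ V t (suc m) i k)
          by-size (inj₁ h) -[1+ n ] = L.outside⇒bound m -[1+ n ] (inj₁ (subst (_≤ - 1ℚ) (sym (trans (int-neg (+ suc n)) (cong (λ v → - v) (int-nat (suc n))))) (ℚ.neg-antimono-≤ (nat-mono {1} {suc n} (s≤s z≤n))))) 0<ε
          by-size (inj₁ h) (+ n) = [ (λ n≤m → L.finite⇒bound wind (steps K) 0<steps (suc m) (+ n) (square≤ m h)
                (subst (λ c → r * ρ * nat (steps K) ≤ nat (suc m) * ∣ nat (suc m) * nat c - int (+ n) * nat (steps K) ∣) (count-def K) (close-1 m n (all≡1 (close-bit jj m) (2 ℕ.+ m) (all≡1 (λ m → Bit-all (close-bit jj m) (2 ℕ.+ m)) (start K) (proj₁ parts) m h) n (s≤s n≤m)))) 0<ε)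
              , (λ m<n → L.outside⇒bound m (+ n) (inj₂ (subst₂ _≤_ (ℚ.+-comm 1ℚ (nat (suc m))) (sym (int-nat n)) (nat-mono {suc (suc m)} {n} m<n))) 0<ε) ]′ (ℕ.≤-<-connex n (suc m))
          by-size (inj₂ h) i = L.tail⇒bound (suc m) i (subst (_≤ nat (suc m)) start≡ (nat-mono (ℕ.<⇒≤ h))) (sine≢0 p q unit p≢0 q≢0 m)
            (tail-from (suc m) (subst (λ n → 0ℤ ℤ.≤ U (+ K) (+ jj) n) n≡ (positive⁺ (suc m ℕ.∸ start K))) (subst (λ n → 0ℤ ℤ.≤ U (+ K) (ℤ.- + jj) n) n≡ (positive⁻ (suc m ℕ.∸ start K)))) 0<ε
            where
            n≡ : suc m ℕ.∸ start K ℕ.+ start K ≡ suc m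
            n≡ = ℕ.m∸n+n≡m (ℕ.<⇒≤ h)

        -- A lower bound with `20 j` to spare would force each component of the test to succeed.
        test-false : Test jj ≡ 0 → ¬ LowerBound t (r * ρ + (20 // 1) * j)
        test-false e lb = [ finite-false , (λ h → [ (λ g → reflects-false (reflects⁺ K jj) g (λ n → proj₁ (positive n))) , (λ g → reflects-false (reflects⁻ K jj) g (λ n → proj₂ (positive n))) ]′
            (*≡0 (encodeBool-bit (decide⁺ K jj)) (encodeBool-bit (decide⁻ K jj)) h)) ]′ (*≡0 (finite-bit jj) (decide-bit jj) e)
          where
          positive-at : ∀ m → start K ℕ.≤ m → 0ℤ ℤ.≤ U (+ K) (+ jj) m × 0ℤ ℤ.≤ U (+ K) (ℤ.- + jj) m
          positive-at zero h = absurd 0<start (nat-mono h)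
          positive-at (suc m) h = tail-to (suc m) (L.bound⇒tail wind lb m (subst (_≤ nat (suc m)) start≡ (nat-mono h)))
          positive : ∀ n → 0ℤ ℤ.≤ U (+ K) (+ jj) (n ℕ.+ start K) × 0ℤ ℤ.≤ U (+ K) (ℤ.- + jj) (n ℕ.+ start K)
          positive n = positive-at (n ℕ.+ start K) (ℕ.m≤n+m (start K) n)
          finite-false : finite K jj (piCount K) (steps K) (count K) ≡ 0 → ⊥
          finite-false h =
            let (m , m< , h′) = all≡0 (λ m → Bit-all (close-bit jj m) (2 ℕ.+ m)) (start K) h
                (i , _ , h″) = all≡0 (close-bit jj m) (2 ℕ.+ m) h′
            in L.¬finite⇒¬bound wind (steps K) 0<steps m (+ i) (square≤ m m<)
                 (subst (λ c → nat (suc m) * ∣ nat (suc m) * nat c - int (+ i) * nat (steps K) ∣ < r * ρ * nat (steps K)) (count-def K) (close-0 m i h″)) lb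

      level : ℚ
      level = nat (answer K) * (j * j)

      private
        s = Scan.scan Test (K ℕ.* 2)

        spec : s ℕ.≤ K ℕ.* 2 × (s ≡ 0 ⊎ Test s ≡ 1) × (s ≡ K ℕ.* 2 ⊎ Test (suc s) ≡ 0)
        spec = scan-spec Test-bit (K ℕ.* 2)

        level≡ : level ≡ nat s * j * ρ
        level≡ = trans (cong (_* (j * j)) (nat-* s (piCount K))) (l (nat s) (nat (piCount K)) j)
          where
          l : ∀ s c j → s * c * (j * j) ≡ s * j * (c * j)
          l = solve-∀ ring

        sample : ∃ λ k → (12 // 5 ≤ π k × π k ≤ 17 // 5) × (π k * ρ ≤ 1ℚ + (20 // 1) * j × 1ℚ - (20 // 1) * j ≤ π k * ρ)
        sample = Ev⇒∃ (π-range & πρ)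

        32j≤1 : (32 // 1) * j ≤ 1ℚ
        32j≤1 = lem x j 32≤x xj 0≤j
          where
          lem : ∀ x j → 32 // 1 ≤ x → x * j ≡ 1ℚ → 0ℚ ≤ j → (32 // 1) * j ≤ 1ℚ
          lem x j h e z = by≤ (δ h ⊠ z ⊞ δ (≡⇒≤ e)) (solve (x ∷ j ∷ []) ring)

        0≤ρ : 0ℚ ≤ ρ
        0≤ρ = 0≤nat (piCount K) ⊠ 0≤j

        ρ≤1 : ρ ≤ 1ℚ
        ρ≤1 = let (k , (π≥ , _) , (h , _)) = sample in lem (π k) ρ j π≥ h 32j≤1 0≤ρ
          where
          lem : ∀ P ρ j → 12 // 5 ≤ P → P * ρ ≤ 1ℚ + (20 // 1) * j → (32 // 1) * j ≤ 1ℚ → 0ℚ ≤ ρ → ρ ≤ 1ℚ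
          lem P ρ j h g q z = *-cancel-≤ {c = 12 // 5} (#< (12 // 5)) (by≤ (δ g ⊞ δ h ⊠ z ⊞ # (5 // 8) ⊠ δ q ⊞ # (31 // 40)) (solve (P ∷ ρ ∷ j ∷ []) ring))

      lower : LowerBound t (level - (20 // 1) * j)
      lower = [ (λ e → LowerBound-mono t (zero-case (cong nat e)) LowerBound-0) , (λ e → subst (λ v → LowerBound t (v - (20 // 1) * j)) (sym level≡) (test-true s (proj₁ spec) e)) ]′ (proj₁ (proj₂ spec))
        where
        zero-case : nat s ≡ 0ℚ → level - (20 // 1) * j ≤ 0ℚ
        zero-case e = subst (λ v → v - (20 // 1) * j ≤ 0ℚ) (sym (trans level≡ (trans (cong (λ v → v * j * ρ) e) (l j ρ)))) (l′ j 0≤j)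
          where
          l : ∀ j ρ → 0ℚ * j * ρ ≡ 0ℚ
          l j ρ = trans (cong (_* ρ) (ℚ.*-zeroˡ j)) (ℚ.*-zeroˡ ρ)
          l′ : ∀ j → 0ℚ ≤ j → 0ℚ - (20 // 1) * j ≤ 0ℚ
          l′ j z = subst (_≤ 0ℚ) (sym (ℚ.+-identityˡ (- ((20 // 1) * j)))) (ℚ.neg-antimono-≤ (# (20 // 1) ⊠ z))

      -- 21 instead of 20: the failing test is the one at `suc s`, and one step of `r` raises the
      -- candidate by `j ρ ≤ j`. If the search reached its cap, the level is `2 ρ`, about `2/π`, and
      -- `¬LowerBound-large` applies.
      ¬upper : ¬ LowerBound t (level + (21 // 1) * j)
      ¬upper lb = [ at-cap , next ]′ (proj₂ (proj₂ spec))
        where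
        at-cap : s ≡ K ℕ.* 2 → ⊥
        at-cap e = let (k , (_ , π≤) , (_ , h)) = sample in ¬LowerBound-large {level + (21 // 1) * j}
            (subst (λ v → 14 // 25 ≤ v + (21 // 1) * j) (sym (trans level≡ (cong (_* ρ) two))) (lem (π k) ρ j π≤ h 0≤ρ 0≤j)) lb
          where
          two : nat s * j ≡ 2 // 1
          two = trans (cong (λ v → nat v * j) e) (trans (cong (_* j) (nat-* K 2)) (trans (l x j) (cong ((2 // 1) *_) xj)))
            where
            l : ∀ x j → x * (2 // 1) * j ≡ (2 // 1) * (x * j)
            l = solve-∀ ring
          lem : ∀ P ρ j → P ≤ 17 // 5 → 1ℚ - (20 // 1) * j ≤ P * ρ → 0ℚ ≤ ρ → 0ℚ ≤ j → 14 // 25 ≤ (2 // 1) * ρ + (21 // 1) * j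
          lem P ρ j h g z w = by≤ (# (10 // 17) ⊠ (δ g ⊞ δ h ⊠ z) ⊞ # (157 // 17) ⊠ w ⊞ # (12 // 425)) (solve (P ∷ ρ ∷ j ∷ []) ring)
        next : Test (suc s) ≡ 0 → ⊥
        next e = [ (λ h → test-false (suc s) h e (LowerBound-mono t step lb)) , (λ h → at-cap (ℕ.≤-antisym (proj₁ spec) (ℕ.≤-pred h))) ]′ (ℕ.≤-<-connex (suc s) (K ℕ.* 2))
          where
          lem : ∀ s j ρ → ρ ≤ 1ℚ → 0ℚ ≤ j → (1ℚ + s) * j * ρ + (20 // 1) * j ≤ s * j * ρ + (21 // 1) * j
          lem s j ρ h z = by≤ (z ⊠ δ h) (solve (s ∷ j ∷ ρ ∷ []) ring)
          step : nat (suc s) * j * ρ + (20 // 1) * j ≤ level + (21 // 1) * j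
          step = subst (λ v → nat (suc s) * j * ρ + (20 // 1) * j ≤ v + (21 // 1) * j) (sym level≡) (lem (nat s) j ρ ρ≤1 0≤j)

-- The type as the limit of the outputs

module Infimum where

  open Basics
  open Criterion
  open Real
  open Pi
  open Computability
  import Defs as D
  open D using (ℝ; fromℚ)
  open ℝ using (seq; cauchy)
  open import Data.Empty using (⊥; ⊥-elim)
  open import Data.Integer.Base as ℤ using (ℤ; +_; -[1+_]; 1ℤ)
  import Data.Integer.Properties as ℤ
  open import Data.List.Base using ([]; _∷_)
  open import Data.Nat.Base as ℕ using (ℕ; zero; suc; z≤n; s≤s)
  import Data.Nat.Properties as ℕ
  open import Data.Product.Base using (Σ; ∃; _×_; _,_)
  open import Data.Rational.Base as ℚ using (ℚ; 0ℚ; 1ℚ; _+_; _*_; _-_; -_; _≤_; _<_; ∣_∣; toℚᵘ; fromℚᵘ)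
  import Data.Rational.Properties as ℚ
  open import Data.Rational.Unnormalised.Base as ℚᵘ using (ℚᵘ; mkℚᵘ; 0ℚᵘ)
  import Data.Rational.Unnormalised.Properties as ℚᵘ
  open import Data.Sum.Base using ([_,_]′)
  open import Data.Vec.Base as Vec using (Vec)
  open import Relation.Binary.PropositionalEquality using (_≡_; refl; sym; trans; cong; cong₂; subst; subst₂)
  open import Relation.Nullary using (¬_)
  open import Tactic.RingSolver using (solve; solve-∀)

  1≤positive : ∀ i → 0ℚ < int i → 1ℚ ≤ int i
  1≤positive (+ zero)  p = absurd p ℚ.≤-refl
  1≤positive (+ suc n) p = subst (1ℚ ≤_) (sym (int-nat (suc n))) (nat-mono {1} {suc n} (s≤s z≤n))
  1≤positive -[1+ n ]  p = absurd p (subst (_≤ 0ℚ) (sym (trans (int-neg (+ suc n)) (cong (λ v → - v) (int-nat (suc n))))) (ℚ.neg-antimono-≤ (0≤nat (suc n))))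

  ÷-scale : ∀ n m .{{_ : ℤ.NonZero m}} → int m * fromℚᵘ (n D.÷ m) ≡ int n
  ÷-scale n m = trans (cong (λ v → int m * v) (fromℚᵘ-* (mkℚᵘ n 0) r)) (trans (l (int m) (int n) (fromℚᵘ r))
    (trans (cong (λ v → int n * v) (trans (sym (fromℚᵘ-* (mkℚᵘ m 0) r)) (ℚ.fromℚᵘ-cong (ℚᵘ.*-inverseʳ (mkℚᵘ m 0))))) (ℚ.*-identityʳ (int n))))
    where
    r = ℚᵘ.1/ mkℚᵘ m 0
    l : ∀ m n r → m * (n * r) ≡ n * (m * r)
    l = solve-∀ ring

  -- The type admits negative denominators; changing both signs preserves the fraction and `m²`.
  positive-denominator : ∀ n m .{{_ : ℤ.NonZero m}} → ∃ λ m′ → ∃ λ i →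
    nat (suc m′) * fromℚᵘ (n D.÷ m) ≡ int i × nat (suc m′) * nat (suc m′) ≡ int (m ℤ.* m)
  positive-denominator n (+ suc m) = m , n ,
    trans (cong (_* fromℚᵘ (n D.÷ + suc m)) (sym (int-nat (suc m)))) (÷-scale n (+ suc m)) ,
    sym (trans (int-* (+ suc m) (+ suc m)) (cong (λ v → v * v) (int-nat (suc m))))
  positive-denominator n -[1+ m ] = m , ℤ.- n ,
    trans (l (nat (suc m)) (fromℚᵘ (n D.÷ -[1+ m ]))) (trans (cong (λ v → - (v * fromℚᵘ (n D.÷ -[1+ m ]))) (sym neg)) (trans (cong (λ v → - v) (÷-scale n -[1+ m ])) (sym (int-neg n)))) ,
    sym (trans (int-* -[1+ m ] -[1+ m ]) (trans (cong (λ v → v * v) neg) (l′ (nat (suc m)))))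
    where
    neg : int -[1+ m ] ≡ - nat (suc m)
    neg = trans (int-neg (+ suc m)) (cong (λ v → - v) (int-nat (suc m)))
    l : ∀ a y → a * y ≡ - (- a * y)
    l = solve-∀ ring
    l′ : ∀ a → - a * - a ≡ a * a
    l′ = solve-∀ ring

  scaled-distance : ∀ {M y} i x → 0ℚ ≤ M → M * y ≡ i → M * M * ∣ x - y ∣ ≡ M * ∣ M * x - i ∣
  scaled-distance {M} {y} _ x 0≤M refl = trans (ℚ.*-assoc M M (∣ x - y ∣)) (cong (λ v → M * v) (trans (sym (abs-scale (x - y) 0≤M)) (cong ∣_∣ (l M x y))))
    where
    l : ∀ M x y → M * (x - y) ≡ M * x - M * y
    l = solve-∀ ring

  module _ (t : ℝ) (level : ℕ → ℚ) where

    module _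
      (lower : ∀ κ → 31 ℕ.≤ κ → LowerBound ⟦ t ⟧ (level κ - (20 // 1) * inv κ))
      (¬upper : ∀ κ → 31 ℕ.≤ κ → ¬ LowerBound ⟦ t ⟧ (level κ + (21 // 1) * inv κ)) where

      private
        -- A lower bound found at one precision stays below a non-bound found at another. The
        -- outputs are thereby compared with each other before the type is known to exist.
        cross : ∀ κ κ′ → 31 ℕ.≤ κ → 31 ℕ.≤ κ′ → level κ ≤ level κ′ + ((20 // 1) * inv κ + (21 // 1) * inv κ′)
        cross κ κ′ h h′ = [ (λ r → r) , (λ r → ⊥-elim (¬upper κ′ h′ (LowerBound-mono ⟦ t ⟧ (l (level κ) (level κ′) (inv κ) (inv κ′) r) (lower κ h)))) ]′
            (level κ ≤⊎< level κ′ + ((20 // 1) * inv κ + (21 // 1) * inv κ′))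
          where
          l : ∀ v v′ j j′ → v′ + ((20 // 1) * j + (21 // 1) * j′) < v → v′ + (21 // 1) * j′ ≤ v - (20 // 1) * j
          l v v′ j j′ r = by≤ (<⇒≤ (δ< r)) (solve (v ∷ v′ ∷ j ∷ j′ ∷ []) ring)

        31≤ : ∀ n → 31 ℕ.≤ 31 ℕ.+ n
        31≤ n = ℕ.m≤m+n 31 n

        gap : ∀ {ε} → 0ℚ < ε → Ev (λ n → (21 // 1) * inv (31 ℕ.+ n) ≤ (1 // 8) * ε)
        gap 0<ε = let (N , h) = small-inv (21 // 1) (#< (1 // 8) <⊠ 0<ε) in N , λ n N≤n → h (31 ℕ.+ n) (ℕ.≤-trans N≤n (ℕ.m≤n+m n 31))

        level-cauchy : CauchyModulus (λ n → level (31 ℕ.+ n))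
        level-cauchy {ε} 0<ε = let (N , h) = gap 0<ε in N , λ m n N≤m N≤n →
          l (level (31 ℕ.+ m)) (level (31 ℕ.+ n)) (inv (31 ℕ.+ m)) (inv (31 ℕ.+ n)) (cross (31 ℕ.+ m) (31 ℕ.+ n) (31≤ m) (31≤ n)) (cross (31 ℕ.+ n) (31 ℕ.+ m) (31≤ n) (31≤ m))
            (h m N≤m) (h n N≤n) (0≤inv (31 ℕ.+ m)) (0≤inv (31 ℕ.+ n))
          where
          up : ∀ v w i j → v ≤ w + ((20 // 1) * i + (21 // 1) * j) → (21 // 1) * i ≤ (1 // 8) * ε → (21 // 1) * j ≤ (1 // 8) * ε → 0ℚ ≤ i → v - w ≤ (1 // 4) * ε
          up v w i j a b c z = by≤ (δ a ⊞ δ b ⊞ δ c ⊞ z) (solve (v ∷ w ∷ i ∷ j ∷ ε ∷ []) ring)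
          l : ∀ v w i j → v ≤ w + ((20 // 1) * i + (21 // 1) * j) → w ≤ v + ((20 // 1) * j + (21 // 1) * i) → (21 // 1) * i ≤ (1 // 8) * ε → (21 // 1) * j ≤ (1 // 8) * ε →
              0ℚ ≤ i → 0ℚ ≤ j → ∣ v - w ∣ < ε
          l v w i j a a′ b c z z′ = ℚ.≤-<-trans (∣x∣≤ (up v w i j a b c z) (subst (_≤ (1 // 4) * ε) (s v w) (up w v j i a′ c b z′))) (by< (#< (3 // 4) <⊠ 0<ε) (solve (ε ∷ []) ring))
            where
            s : ∀ v w → w - v ≡ - (v - w)
            s = solve-∀ ring

      -- The shift by 31 gives `K ≥ 32`, from where the brackets hold.
      type : ℝ
      type = fromSeq (λ n → level (31 ℕ.+ n)) level-cauchy

      private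
        ⟦type⟧ : ∀ k → ⟦ type ⟧ k ≡ level (31 ℕ.+ k)
        ⟦type⟧ = ⟦fromSeq⟧ (λ n → level (31 ℕ.+ n)) level-cauchy

        ⟦distance⟧ : ∀ y k → ⟦ D.∣ t D.- fromℚ y ∣ ⟧ k ≡ ∣ ⟦ t ⟧ k - fromℚᵘ y ∣
        ⟦distance⟧ y k = trans (fromℚᵘ-abs (seq t k ℚᵘ.- y)) (cong ∣_∣ (fromℚᵘ-- (seq t k) y))

        square-inverse : ∀ {m} m′ .{{_ : ℤ.NonZero (m ℤ.* m)}} → nat (suc m′) * nat (suc m′) ≡ int (m ℤ.* m) →
          nat (suc m′) * nat (suc m′) * fromℚᵘ (1ℤ D.÷ (m ℤ.* m)) ≡ 1ℚ
        square-inverse {m} m′ e = trans (cong (_* fromℚᵘ (1ℤ D.÷ (m ℤ.* m))) e) (÷-scale 1ℤ (m ℤ.* m))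

      -- A fraction that puts `c` into the set, with `c` below the limit by `η`, would undercut the
      -- bound `lower` at a precision with `21/K ≤ η/8`.
      type≤ : ∀ c n m (m≢0 : ℤ.NonZero m) → (let instance _ = m≢0; _ = ℤ.i*j≢0 m m in
        D.∣ t D.- fromℚ (n D.÷ m) ∣ D.< c D.* fromℚ (1ℤ D.÷ (m ℤ.* m))) → type D.≤ c
      type≤ c n m m≢0 near c<type =
        let (e , 0<e , below) = <⇒Ev {D.∣ t D.- fromℚ (n D.÷ m) ∣} {c D.* fromℚ s} near
            (η , 0<η , above) = <⇒Ev {c} {type} c<type
            (N , fine) = gap 0<η
            κ = 31 ℕ.+ N
            (m′ , i , my , m² ) = positive-denominator n m
            (k , b , a , g , f) = Ev⇒∃ (below & above & lower κ (31≤ N) m′ i (#< (1 // 8) <⊠ 0<η) & gap 0<η)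
        in contradictory η 0<η κ (31≤ N) (fine N ℕ.≤-refl) k
             (ℚ.≤-trans g (l (⟦ c ⟧ k) (nat (suc m′) * nat (suc m′)) (fromℚᵘ s) e (scaled-distance (int i) (⟦ t ⟧ k) (0≤nat (suc m′)) my) (square-inverse {m} m′ m²) (0≤sq (nat (suc m′))) (<⇒≤ 0<e)
               (subst₂ (λ u v → u + e ≤ v) (⟦distance⟧ y k) (fromℚᵘ-* (seq c k) s) b)))
             (subst (λ v → ⟦ c ⟧ k + η ≤ v) (⟦type⟧ k) a) f
        where
        instance
          _ = m≢0
          _ = ℤ.i*j≢0 m m
        y = n D.÷ m
        s = 1ℤ D.÷ (m ℤ.* m)
        l : ∀ {x d} c M s e → M * d ≡ x → M * s ≡ 1ℚ → 0ℚ ≤ M → 0ℚ ≤ e → d + e ≤ c * s → x ≤ c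
        l {d = d} c M s e refl ms z w h = by≤ (z ⊠ (w ⊞ δ h)) (trans (cong (λ v → v - M * d) (sym (trans (cong (λ v → c * v) ms) (ℚ.*-identityʳ c)))) (l′ c M s e d))
          where
          l′ : ∀ c M s e d → c * (M * s) - M * d ≡ M * (e + (c * s - (d + e)))
          l′ = solve-∀ ring
        contradictory : ∀ η → 0ℚ < η → ∀ κ → 31 ℕ.≤ κ → (21 // 1) * inv κ ≤ (1 // 8) * η → ∀ k → level κ - (20 // 1) * inv κ - (1 // 8) * η ≤ ⟦ c ⟧ k →
          ⟦ c ⟧ k + η ≤ level (31 ℕ.+ k) → (21 // 1) * inv (31 ℕ.+ k) ≤ (1 // 8) * η → ⊥
        contradictory η 0<η κ h f k p q r = l″ (level κ) (level (31 ℕ.+ k)) (⟦ c ⟧ k) (inv κ) (inv (31 ℕ.+ k)) p q (cross (31 ℕ.+ k) κ (31≤ k) h) f r (0≤inv (31 ℕ.+ k))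
          where
          l″ : ∀ v w c i j → v - (20 // 1) * i - (1 // 8) * η ≤ c → c + η ≤ w → w ≤ v + ((20 // 1) * j + (21 // 1) * i) → (21 // 1) * i ≤ (1 // 8) * η → (21 // 1) * j ≤ (1 // 8) * η → 0ℚ ≤ j → ⊥
          l″ v w c i j p q r f g z = absurd {0ℚ} {(1 // 2) * η} (#< (1 // 2) <⊠ 0<η) (by≤ (δ p ⊞ δ q ⊞ δ r ⊞ # (41 // 21) ⊠ δ f ⊞ δ g ⊞ z ⊞ # (1 // 168) ⊠ <⇒≤ 0<η) (e v w c i j η))
            where
            e : ∀ v w c i j η → 0ℚ - (1 // 2) * η ≡ (c - (v - (20 // 1) * i - (1 // 8) * η)) + ((w - (c + η)) + ((v + ((20 // 1) * j + (21 // 1) * i) - w)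
              + ((41 // 21) * ((1 // 8) * η - (21 // 1) * i) + (((1 // 8) * η - (21 // 1) * j) + (j + (1 // 168) * η)))))
            e = solve-∀ ring

      -- If `b` exceeded the limit by `η`, then at a fine precision `level κ + 21/K` would still be
      -- below `b`. No fraction could undercut it, so it would be a lower bound, against `¬upper`.
      ≤type : ∀ b → (∀ c → (Σ ℤ λ n → Σ ℤ λ m → Σ (ℤ.NonZero m) λ m≢0 → let instance _ = m≢0; _ = ℤ.i*j≢0 m m in
        D.∣ t D.- fromℚ (n D.÷ m) ∣ D.< c D.* fromℚ (1ℤ D.÷ (m ℤ.* m))) → b D.≤ c) → b D.≤ type
      ≤type b lb type<b =
        let (η , 0<η , above) = <⇒Ev {type} {b} type<b
            (N , fine) = gap 0<η
        in ¬upper (31 ℕ.+ N) (31≤ N) (bound η 0<η (31 ℕ.+ N) (31≤ N) (fine N ℕ.≤-refl) above)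
        where
        bound : ∀ η → 0ℚ < η → ∀ κ → 31 ℕ.≤ κ → (21 // 1) * inv κ ≤ (1 // 8) * η → Ev (λ k → ⟦ type ⟧ k + η ≤ ⟦ b ⟧ k) → LowerBound ⟦ t ⟧ (level κ + (21 // 1) * inv κ)
        bound η 0<η κ h fine above m i {ε} 0<ε =
          let (ε′ , 0<ε′ , _ , M²ε′≤ε) = small {ε} {nat (suc m) * nat (suc m)} 0<ε (0≤sq (nat (suc m)))
          in Ev-map (at ε′ M²ε′≤ε) (≤⇒Ev {z} {d} far 0<ε′)
          where
          v = level κ + (21 // 1) * inv κ
          c = fromℚ (toℚᵘ v)
          y = i D.÷ + suc m
          s = 1ℤ D.÷ (+ suc m ℤ.* + suc m)
          z d : ℝ
          z = c D.* fromℚ s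
          d = D.∣ t D.- fromℚ y ∣
          my : nat (suc m) * fromℚᵘ y ≡ int i
          my = trans (cong (_* fromℚᵘ y) (sym (int-nat (suc m)))) (÷-scale i (+ suc m))
          m² : nat (suc m) * nat (suc m) ≡ int (+ suc m ℤ.* + suc m)
          m² = sym (trans (int-* (+ suc m) (+ suc m)) (cong (λ v → v * v) (int-nat (suc m))))
          far : z D.≤ d
          -- `d<z` puts `c` into the set whose infimum is sought, so `b ≤ c`; but `c` lies below `b`
          -- by at least `η/2`.
          far d<z = lb c (i , + suc m , _ , d<z) (Ev⇒< {c} {b} (#< (1 // 2) <⊠ 0<η) (Ev-map near (above & gap 0<η)))
            where
            l : ∀ v w x i j → w + η ≤ x → v ≤ w + ((20 // 1) * i + (21 // 1) * j) → (21 // 1) * i ≤ (1 // 8) * η → (21 // 1) * j ≤ (1 // 8) * η → 0ℚ ≤ i →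
              v + (21 // 1) * i + (1 // 2) * η ≤ x
            l v w x i j p q f g z = by≤ (δ p ⊞ δ q ⊞ # (2 // 1) ⊠ δ f ⊞ δ g ⊞ z ⊞ # (1 // 8) ⊠ <⇒≤ 0<η) (solve (v ∷ w ∷ x ∷ i ∷ j ∷ η ∷ []) ring)
            near : ∀ k → ⟦ type ⟧ k + η ≤ ⟦ b ⟧ k × (21 // 1) * inv (31 ℕ.+ k) ≤ (1 // 8) * η → ⟦ c ⟧ k + (1 // 2) * η ≤ ⟦ b ⟧ k
            near k (p , g) = subst (λ u → u + (1 // 2) * η ≤ ⟦ b ⟧ k) (sym (ℚ.fromℚᵘ-toℚᵘ v))
              (l (level κ) (level (31 ℕ.+ k)) (⟦ b ⟧ k) (inv κ) (inv (31 ℕ.+ k)) (subst (λ u → u + η ≤ ⟦ b ⟧ k) (⟦type⟧ k) p) (cross κ (31 ℕ.+ k) h (31≤ k)) fine g (0≤inv κ))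
          at : ∀ ε′ → ε′ * (nat (suc m) * nat (suc m)) ≤ ε → ∀ k → ⟦ z ⟧ k ≤ ⟦ d ⟧ k + ε′ → v - ε ≤ V ⟦ t ⟧ (suc m) i k
          at ε′ q k h = l v (nat (suc m) * nat (suc m)) (fromℚᵘ s) (∣ ⟦ t ⟧ k - fromℚᵘ y ∣) ε′ (scaled-distance (int i) (⟦ t ⟧ k) (0≤nat (suc m)) my) (square-inverse {+ suc m} m m²)
              (0≤sq (nat (suc m))) q (subst₂ _≤_ (trans (fromℚᵘ-* (toℚᵘ v) s) (cong (_* fromℚᵘ s) (ℚ.fromℚᵘ-toℚᵘ v))) (cong (λ u → u + ε′) (⟦distance⟧ y k)) h)
            where
            l : ∀ {x} v M s d e → M * d ≡ x → M * s ≡ 1ℚ → 0ℚ ≤ M → e * M ≤ ε → v * s ≤ d + e → v - ε ≤ x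
            l v M s d e refl ms z q h = by≤ (δ q ⊞ z ⊠ δ h) (trans (cong (λ u → M * d - (u - ε)) (sym (trans (cong (λ u → v * u) ms) (ℚ.*-identityʳ v)))) (l′ v M s d e ε))
              where
              l′ : ∀ v M s d e ε → M * d - (v * (M * s) - ε) ≡ (ε - e * M) + M * (d + e - v * s)
              l′ = solve-∀ ring

      type-isType : D.IsType t type
      type-isType = (λ { c (n , m , m≢0 , near) → type≤ c n m m≢0 near }) , ≤type

      module _ (count : ℕ → ℕ) (level≡ : ∀ κ → level κ ≡ nat (count (suc κ)) * (inv κ * inv κ)) (countF : Exp 2 → Exp 2) (eval-countF : ∀ e xs → eval (countF e) xs ≡ count (eval e xs)) where

        private
          -- Then `K = 64 (d + 1)`. A positive fraction with denominator `d + 1` is at least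
          -- `1 / (d + 1)`, so `64/K ≤ ε`: the denominator alone determines a sufficient precision.
          precision : ℕ → ℕ
          precision d = 63 ℕ.+ 64 ℕ.* d

          precisionE : Exp 2
          precisionE = lit 63 ⊕ lit 64 ⊗ var #1

          numeratorE denominatorE : Exp 2
          numeratorE = lit 2 ⊗ countF (sucF (precisionE Vec.∷ Vec.[]))
          denominatorE = precisionE ⊕ precisionE ⊗ sucF (precisionE Vec.∷ Vec.[])

          -- The second component is `K² - 1` for `K = precision d + 1`, as unnormalised rationals
          -- store the denominator minus 1.
          approximation : ℕ → ℚᵘ
          approximation d = mkℚᵘ (+ count (suc (precision d))) (precision d ℕ.+ precision d ℕ.* suc (precision d))

          encoding : ∀ n d → evals (numeratorE Vec.∷ denominatorE Vec.∷ Vec.[]) (n Vec.∷ d Vec.∷ Vec.[]) ≡ D.encodeℚ (approximation d)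
          encoding n d = cong (λ a → 2 ℕ.* a Vec.∷ precision d ℕ.+ precision d ℕ.* suc (precision d) Vec.∷ Vec.[]) (eval-countF (sucF (precisionE Vec.∷ Vec.[])) (n Vec.∷ d Vec.∷ Vec.[]))

          fraction : ∀ κ a → fromℚᵘ (mkℚᵘ (+ a) (κ ℕ.+ κ ℕ.* suc κ)) ≡ nat a * (inv κ * inv κ)
          fraction κ a = trans (sym (ℚ.*-identityˡ q)) (trans (cong (λ v → v * v * q) (sym (nat*inv κ))) (trans (l (nat (suc κ)) (inv κ) q)
              (cong (_* (inv κ * inv κ)) (trans (cong (_* q) (trans (sym (nat-* (suc κ) (suc κ))) (sym (int-nat (suc κ ℕ.* suc κ))))) (trans (fromℚᵘ-scale (mkℚᵘ (+ a) (κ ℕ.+ κ ℕ.* suc κ))) (int-nat a))))))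
            where
            q = fromℚᵘ (mkℚᵘ (+ a) (κ ℕ.+ κ ℕ.* suc κ))
            l : ∀ x j q → (x * j) * (x * j) * q ≡ x * x * q * (j * j)
            l = solve-∀ ring

          fine : ∀ ε → 0ℚᵘ ℚᵘ.< ε → (64 // 1) * inv (precision (ℚᵘ.denominator-1 ε)) ≤ fromℚᵘ ε
          fine ε 0<ε = l (nat (suc d)) (nat (suc (precision d))) (inv (precision d)) (fromℚᵘ ε) scaled (nat*inv (precision d)) 1≤ (0≤inv (precision d)) (<⇒≤ (fromℚᵘ-mono-< 0<ε))
            where
            d = ℚᵘ.denominator-1 ε
            0<ε′ : 0ℚ < fromℚᵘ ε
            0<ε′ = fromℚᵘ-mono-< 0<ε
            scale-ε : nat (suc d) * fromℚᵘ ε ≡ int (ℚᵘ.numerator ε)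
            scale-ε = trans (cong (_* fromℚᵘ ε) (sym (int-nat (suc d)))) (fromℚᵘ-scale ε)
            1≤ : 1ℚ ≤ nat (suc d) * fromℚᵘ ε
            1≤ = subst (1ℚ ≤_) (sym scale-ε) (1≤positive (ℚᵘ.numerator ε) (subst (0ℚ <_) scale-ε (0<nat d <⊠ 0<ε′)))
            scaled : nat (suc (precision d)) ≡ (64 // 1) * nat (suc d)
            scaled = trans (cong nat (sym (ℕ.*-suc 64 d))) (trans (nat-* 64 (suc d)) (cong (_* nat (suc d)) (sym (int-nat 64))))
            l : ∀ x k j e → k ≡ (64 // 1) * x → k * j ≡ 1ℚ → 1ℚ ≤ x * e → 0ℚ ≤ j → 0ℚ ≤ e → (64 // 1) * j ≤ e
            l x _ j e refl kj h z w = by≤ ((# (64 // 1) ⊠ z) ⊠ δ h) (trans (cong (λ u → u - (64 // 1) * j) (sym (trans (cong (λ u → e * u) kj) (ℚ.*-identityʳ e)))) (l′ x j e))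
              where
              l′ : ∀ x j e → e * ((64 // 1) * x * j) - (64 // 1) * j ≡ (64 // 1) * j * (x * e - 1ℚ)
              l′ = solve-∀ ring

        type-computable : D.Computable type
        type-computable = compiles (numeratorE Vec.∷ denominatorE Vec.∷ Vec.[]) , λ ε 0<ε →
          let d = ℚᵘ.denominator-1 ε
              0<ε′ = fromℚᵘ-mono-< 0<ε
          in approximation d
            , subst (compiles (numeratorE Vec.∷ denominatorE Vec.∷ Vec.[]) D.[ D.encodeℚ ε ]⇓*_) (encoding (D.encodeℤ (ℚᵘ.numerator ε)) d)
                (compiles-correct (numeratorE Vec.∷ denominatorE Vec.∷ Vec.[]) (D.encodeℚ ε))
            , Ev⇒< {D.∣ fromℚ (approximation d) D.- type ∣} {fromℚ ε} (#< (1 // 4) <⊠ 0<ε′) (Ev-map (at ε d (fine ε 0<ε) 0<ε′) (gap 0<ε′))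
          where
          31≤precision : ∀ d → 31 ℕ.≤ precision d
          31≤precision d = ℕ.≤-trans (ℕ.m≤m+n 31 32) (ℕ.m≤m+n 63 (64 ℕ.* d))
          l : ∀ v w i j e → v ≤ w + ((20 // 1) * i + (21 // 1) * j) → (64 // 1) * i ≤ e → (21 // 1) * j ≤ (1 // 8) * e → 0ℚ ≤ e → 0ℚ ≤ i → v - w ≤ (3 // 4) * e
          l v w i j e p q r z z′ = by≤ (δ p ⊞ # (1 // 2) ⊠ δ q ⊞ δ r ⊞ # (1 // 8) ⊠ z ⊞ # (12 // 1) ⊠ z′) (solve (v ∷ w ∷ i ∷ j ∷ e ∷ []) ring)
          l* : ∀ v w i j e → w ≤ v + ((20 // 1) * j + (21 // 1) * i) → (64 // 1) * i ≤ e → (21 // 1) * j ≤ (1 // 8) * e → 0ℚ ≤ e → 0ℚ ≤ i → 0ℚ ≤ j → - (v - w) ≤ (3 // 4) * e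
          l* v w i j e p q r z z′ z″ = by≤ (δ p ⊞ # (1 // 2) ⊠ δ q ⊞ δ r ⊞ # (1 // 8) ⊠ z ⊞ # (11 // 1) ⊠ z′ ⊞ z″) (solve (v ∷ w ∷ i ∷ j ∷ e ∷ []) ring)
          fin : ∀ x e → x ≤ (3 // 4) * e → x + (1 // 4) * e ≤ e
          fin x e h = by≤ (δ h) (solve (x ∷ e ∷ []) ring)
          at : ∀ ε d → (64 // 1) * inv (precision d) ≤ fromℚᵘ ε → 0ℚ < fromℚᵘ ε → ∀ k → (21 // 1) * inv (31 ℕ.+ k) ≤ (1 // 8) * fromℚᵘ ε →
            ⟦ D.∣ fromℚ (approximation d) D.- type ∣ ⟧ k + (1 // 4) * fromℚᵘ ε ≤ fromℚᵘ ε
          at ε d f 0<ε′ k g = subst (λ x → x + (1 // 4) * fromℚᵘ ε ≤ fromℚᵘ ε) (sym dist)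
            (fin (∣ v - w ∣) (fromℚᵘ ε) (∣x∣≤ (l v w (inv κ) (inv (31 ℕ.+ k)) (fromℚᵘ ε) (cross κ (31 ℕ.+ k) (31≤precision d) (31≤ k)) f g (<⇒≤ 0<ε′) (0≤inv κ))
              (l* v w (inv κ) (inv (31 ℕ.+ k)) (fromℚᵘ ε) (cross (31 ℕ.+ k) κ (31≤ k) (31≤precision d)) f g (<⇒≤ 0<ε′) (0≤inv κ) (0≤inv (31 ℕ.+ k)))))
            where
            κ = precision d
            v = level κ
            w = level (31 ℕ.+ k)
            dist : ⟦ D.∣ fromℚ (approximation d) D.- type ∣ ⟧ k ≡ ∣ v - w ∣
            dist = trans (fromℚᵘ-abs (approximation d ℚᵘ.- seq type k)) (cong ∣_∣ (trans (fromℚᵘ-- (approximation d) (seq type k)) (cong₂ _-_ (trans (fraction κ (count (suc κ))) (sym (level≡ κ))) (⟦type⟧ k))))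

-- Reduction to positive imaginary part and conclusion

module Conclusion where

  open Basics
  open Complex
  open Exponential
  open Estimates
  open Angles
  open Irrational
  open Criterion
  open Real
  open Pi
  open Recurrence
  open Program
  open Bracket using (int-difference)
  open Infimum
  import Defs as D
  open D using (ℝ; fromℚ)
  open ℝ using (seq; cauchy)
  open import Data.Empty using (⊥-elim)
  open import Data.Integer.Base as ℤ using (ℤ; +_; -[1+_])
  import Data.Integer.Properties as ℤ
  open import Data.List.Base using ([]; _∷_)
  open import Data.Nat.Base as ℕ using (ℕ; suc; s≤s)
  import Data.Nat.Properties as ℕ
  open import Data.Product.Base using (Σ; ∃; _×_; _,_; proj₁; proj₂)
  open import Data.Rational.Base as ℚ using (ℚ; 0ℚ; 1ℚ; ½; _+_; _*_; _-_; -_; _/_; _≤_; _<_; ∣_∣; toℚᵘ; fromℚᵘ)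
  import Data.Rational.Properties as ℚ
  open import Data.Rational.Unnormalised.Base as ℚᵘ using (ℚᵘ; 0ℚᵘ)
  import Data.Rational.Unnormalised.Properties as ℚᵘ
  open import Data.Sum.Base using (_⊎_; inj₁; inj₂; [_,_]′)
  open import Data.Vec.Base as Vec using (Vec)
  open import Relation.Binary.PropositionalEquality using (_≡_; _≢_; refl; sym; trans; cong; cong₂; subst)
  open import Relation.Nullary using (¬_)
  open import Tactic.RingSolver using (solve; solve-∀)

  -- Since |sin y| ≤ |y|, an angle whose sine is not small is not small.
  Angle-away : ∀ {z w c} → 0ℚ < c → c ≤ 1ℚ → c ≤ ∣ im w ∣ → Angle z w → Ev (λ k → ½ * c < ∣ z k ∣)
  Angle-away {z} {w} {c} 0<c c≤1 c≤ a = Ev-map at (limit a (#< (1 // 4) <⊠ 0<c) & (4 , λ k h → h))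
    where
    l : ∀ s y → c ≤ s → s ≤ y + (1 // 4) * c → ½ * c < y
    l s y p q = by< ((#< (1 // 4) <⊠ 0<c) <⊞ (δ p ⊞ δ q)) (e s y c)
      where
      e : ∀ s y c → y - ½ * c ≡ (1 // 4) * c + ((s - c) + (y + (1 // 4) * c - s))
      e = solve-∀ ring
    large : ∀ y → 12 // 5 < y → ½ * c < y
    large y h = by< (δ< h <⊞ (# ½ ⊠ δ c≤1 ⊞ # (19 // 10))) (solve (y ∷ c ∷ []) ring)
    at : ∀ k → norm (E k (z k) -ᶜ w) ≤ (1 // 4) * c × 4 ℕ.≤ k → ½ * c < ∣ z k ∣
    at k (p , 4≤k) = [ (λ h → l (∣ im w ∣) (∣ z k ∣) c≤ (ℚ.≤-trans (∣a∣≤∣b∣+e (im w) (im (E k (z k))) {(1 // 4) * c}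
          (subst (_≤ (1 // 4) * c) (∣-∣-swap (im (E k (z k))) (im w)) (ℚ.≤-trans (im-close (E k (z k)) w) p)))
          (ℚ.+-monoˡ-≤ ((1 // 4) * c) (E-sin≤ k 4≤k (z k) h)))) , large (∣ z k ∣) ]′ (∣ z k ∣ ≤⊎< 12 // 5)

  module _ (π θ : ℕ → ℚ) (Eπ : Angle π -1ᶜ) (π-range : Ev (λ n → 12 // 5 ≤ π n × π n ≤ 17 // 5))
    {p q} (unit : p * p + q * q ≡ 1ℚ) (0<q : 0ℚ < q) (Eθ : Angle θ (cx p q))
    (bound : ∀ {ε} → 0ℚ < ε → Ev (λ k → ∣ θ k ∣ ≤ π k + ε)) where

    private
      open Circle π Eπ π-range

      q≤1 : q ≤ 1ℚ
      q≤1 = [ (λ h → h) , (λ h → absurd {1ℚ} {p * p + q * q} (l p q h) (≡⇒≤ unit)) ]′ (q ≤⊎< 1ℚ)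
        where
        l : ∀ p q → 1ℚ < q → 1ℚ < p * p + q * q
        l p q h = by< ((δ< h <⊠ δ< h) <⊞ (# (2 // 1) ⊠ <⇒≤ (δ< h) ⊞ 0≤sq p)) (solve (p ∷ q ∷ []) ring)

      q≤∣±q∣ : ∀ {x} → x ≡ q ⊎ x ≡ - q → q ≤ ∣ x ∣
      q≤∣±q∣ (inj₁ refl) = x≤∣x∣ q
      q≤∣±q∣ (inj₂ refl) = subst (q ≤_) (sym (ℚ.∣-p∣≡∣p∣ q)) (x≤∣x∣ q)

      l₊ : ∀ p q → (- 1ℚ) * q + 0ℚ * p ≡ - q
      l₊ = solve-∀ ring
      l₋ : ∀ p q → (- 1ℚ) * (- q) + 0ℚ * p ≡ q
      l₋ = solve-∀ ring

    -- The sines at `θ`, `π - θ` and `π + θ` are `q` up to sign, so none of these angles is near 0.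
    -- With `∣θ∣` at most π this leaves one interval on each side of 0, and on the negative side
    -- `sin-pos` at `- θ` would make `- q` positive.
    θ-range : Ev (λ k → ½ * q ≤ θ k × θ k ≤ π k - ½ * q)
    θ-range = Ev-map at (Angle-away 0<q q≤1 (q≤∣±q∣ (inj₁ refl)) Eθ
      & Angle-away 0<q q≤1 (q≤∣±q∣ (inj₁ (l₋ p q))) (Angle-+ Eπ (Angle-neg Eθ))
      & Angle-away 0<q q≤1 (q≤∣±q∣ (inj₂ (l₊ p q))) (Angle-+ Eπ Eθ)
      & bound 0<½q & sin-pos (Angle-neg Eθ) 0<½q)
      where
      0<½q = #< ½ <⊠ 0<q
      e = ½ * q
      inside : ∀ a b → e < ∣ a + - b ∣ → b ≤ a + e → b ≤ a - e
      inside a b h g = [ (λ r → r) , (λ r → absurd h (∣x∣≤ (l₁ a b r) (l₂ a b g))) ]′ (b ≤⊎< a - e)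
        where
        l₁ : ∀ a b → a - e < b → a + - b ≤ e
        l₁ a b r = by≤ (<⇒≤ (δ< r)) (l a b q)
          where
          l : ∀ a b q → ½ * q - (a + - b) ≡ b - (a - ½ * q)
          l = solve-∀ ring
        l₂ : ∀ a b → b ≤ a + e → - (a + - b) ≤ e
        l₂ a b g = by≤ (δ g) (l a b q)
          where
          l : ∀ a b q → ½ * q - - (a + - b) ≡ (a + ½ * q) - b
          l = solve-∀ ring
      at : ∀ k → e < ∣ θ k ∣ × e < ∣ π k + - θ k ∣ × e < ∣ π k + θ k ∣ × ∣ θ k ∣ ≤ π k + e × (e ≤ - θ k → - θ k ≤ π k - e → 0ℚ < - q) → e ≤ θ k × θ k ≤ π k - e
      at k (f₀ , f₁ , f₂ , b , neg) = [ (λ h → h) , (λ h → absurd {0ℚ} { - q} (neg (e≤ h) (inside (π k) (- θ k) (subst (λ v → e < ∣ π k + v ∣) (sym (double (θ k))) f₂) (ℚ.≤-trans (-x≤∣x∣ (θ k)) b))) (ℚ.neg-antimono-≤ (<⇒≤ 0<q))) ]′ (e ≤⊎< θ k)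
          , inside (π k) (θ k) f₁ (ℚ.≤-trans (x≤∣x∣ (θ k)) b)
        where
        double : ∀ x → - - x ≡ x
        double = solve-∀ ring
        e≤ : θ k < e → e ≤ - θ k
        e≤ h = [ (λ r → r) , (λ r → absurd f₀ (∣x∣≤ (<⇒≤ h) (<⇒≤ r))) ]′ (e ≤⊎< - θ k)

  difference : ∀ i → ∃ λ m → ∃ λ n → + m ℤ.- + n ≡ i
  difference (+ n)    = n , 0 , ℤ.+-identityʳ (+ n)
  difference -[1+ n ] = 0 , suc n , refl

  positive-int : ∀ i → 0ℚ < int i → int i ≡ nat ℤ.∣ i ∣
  positive-int (+ n)    _ = int-nat n
  positive-int -[1+ n ] p = absurd p (subst (_≤ 0ℚ) (sym (trans (int-neg (+ suc n)) (cong (λ v → - v) (int-nat (suc n))))) (ℚ.neg-antimono-≤ (0≤nat (suc n))))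

  -- Covers `t` and `- t` at once: `t′` and `θ′` are the possibly reflected sequences, and bounds
  -- pass between `t′` and `t` through `from-t` and `to-t`.
  module Upper (oracle : D.PositivityDecidable 6) (cut : ℕ) (cut≡ : nat cut ≡ 4096 // 1) (t : ℝ) (π : ℝ) (isPi : D.IsPi π) (θ′ t′ : ℕ → ℚ)
    {p q} (unit : p * p + q * q ≡ 1ℚ) (p≢0 : p ≢ 0ℚ) (0<q : 0ℚ < q) (Eθ : Angle θ′ (cx p q))
    (bound : ∀ {ε} → 0ℚ < ε → Ev (λ k → ∣ θ′ k ∣ ≤ ⟦ π ⟧ k + ε))
    (2πt : ∀ {ε} → 0ℚ < ε → Ev (λ k → ∣ (⟦ π ⟧ k + ⟦ π ⟧ k) * t′ k - θ′ k ∣ ≤ ε))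
    (from-t : ∀ {v} → LowerBound ⟦ t ⟧ v → LowerBound t′ v) (to-t : ∀ {v} → LowerBound t′ v → LowerBound ⟦ t ⟧ v) where

    private
      split = difference (ℚ.↥ p ℤ.* ℚ.↧ q)
      a⁺ = proj₁ split
      a⁻ = proj₁ (proj₂ split)
      b = ℤ.∣ ℚ.↥ q ∣ ℕ.* ℚ.↧ₙ p
      -- `suc d′` computes to the product of the denominators of `p` and `q`.
      d′ = ℚ.denominator-1 q ℕ.+ ℚ.denominator-1 p ℕ.* ℚ.↧ₙ q

      d≡ : nat (suc d′) ≡ nat (ℚ.↧ₙ p) * nat (ℚ.↧ₙ q)
      d≡ = nat-* (ℚ.↧ₙ p) (ℚ.↧ₙ q)

      scaleₙ : ∀ r → nat (ℚ.↧ₙ r) * r ≡ int (ℚ.↥ r)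
      scaleₙ r = trans (cong (_* r) (sym (int-nat (ℚ.↧ₙ r)))) (scale r)

      d*p : nat (suc d′) * p ≡ nat a⁺ - nat a⁻
      d*p = trans (cong (_* p) d≡) (trans (l (nat (ℚ.↧ₙ p)) (nat (ℚ.↧ₙ q)) p) (trans (cong₂ _*_ (scaleₙ p) (sym (int-nat (ℚ.↧ₙ q))))
        (trans (sym (int-* (ℚ.↥ p) (ℚ.↧ q))) (trans (cong int (sym (proj₂ (proj₂ split)))) (int-difference a⁺ a⁻)))))
        where
        l : ∀ x y p → x * y * p ≡ x * p * y
        l = solve-∀ ring

      d*q : nat (suc d′) * q ≡ nat b
      d*q = trans (cong (_* q) d≡) (trans (l (nat (ℚ.↧ₙ p)) (nat (ℚ.↧ₙ q)) q) (trans (cong (_* nat (ℚ.↧ₙ p)) (trans (scaleₙ q) (positive-int (ℚ.↥ q) 0<↥q))) (sym (nat-* ℤ.∣ ℚ.↥ q ∣ (ℚ.↧ₙ p)))))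
        where
        l : ∀ x y p → x * y * p ≡ y * p * x
        l = solve-∀ ring
        0<↥q : 0ℚ < int (ℚ.↥ q)
        0<↥q = subst (0ℚ <_) (scaleₙ q) (0<nat (ℚ.denominator-1 q) <⊠ 0<q)

      a²+b²≡d² : Gauss.a a⁺ a⁻ b ℤ.* Gauss.a a⁺ a⁻ b ℤ.+ + b ℤ.* + b ≡ + suc d′ ℤ.* + suc d′
      a²+b²≡d² = int-inj (trans (int-+ (a ℤ.* a) (+ b ℤ.* + b)) (trans (cong₂ _+_ (square a (trans (int-difference a⁺ a⁻) (sym d*p))) (square (+ b) (trans (int-nat b) (sym d*q))))
        (trans (l (nat (suc d′)) p q) (trans (cong (nat (suc d′) * nat (suc d′) *_) unit) (trans (ℚ.*-identityʳ (nat (suc d′) * nat (suc d′))) (sym (square (+ suc d′) (int-nat (suc d′)))))))))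
        where
        a = Gauss.a a⁺ a⁻ b
        square : ∀ i {x} → int i ≡ x → int (i ℤ.* i) ≡ x * x
        square i refl = int-* i i
        l : ∀ d p q → d * p * (d * p) + d * q * (d * q) ≡ d * d * (p * p + q * q)
        l = solve-∀ ring

      q≢0 : q ≢ 0ℚ
      q≢0 e = ℚ.<-irrefl (sym e) 0<q

      module O = Oracle oracle cut a⁺ a⁻ b d′ a²+b²≡d²

      level : ℕ → ℚ
      level κ = nat (O.answer (suc κ)) * (inv κ * inv κ)

      lower : ∀ κ → 31 ℕ.≤ κ → LowerBound ⟦ t ⟧ (level κ - (20 // 1) * inv κ)
      lower κ h = to-t {level κ - (20 // 1) * inv κ} (Bracket.lower oracle cut cut≡ a⁺ a⁻ b d′ a²+b²≡d² ⟦ π ⟧ θ′ t′ (Angle-π π isPi) (π-range π isPi) unit p≢0 q≢0 Eθ d*p d*q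
        (#< ½ <⊠ 0<q) (θ-range ⟦ π ⟧ θ′ (Angle-π π isPi) (π-range π isPi) unit 0<q Eθ bound) 2πt (suc κ) κ refl (s≤s h))

      ¬upper : ∀ κ → 31 ℕ.≤ κ → ¬ LowerBound ⟦ t ⟧ (level κ + (21 // 1) * inv κ)
      ¬upper κ h lb = Bracket.¬upper oracle cut cut≡ a⁺ a⁻ b d′ a²+b²≡d² ⟦ π ⟧ θ′ t′ (Angle-π π isPi) (π-range π isPi) unit p≢0 q≢0 Eθ d*p d*q
        (#< ½ <⊠ 0<q) (θ-range ⟦ π ⟧ θ′ (Angle-π π isPi) (π-range π isPi) unit 0<q Eθ bound) 2πt (suc κ) κ refl (s≤s h) (from-t {level κ + (21 // 1) * inv κ} lb)

    result : Σ ℝ (λ l → D.IsType t l × D.Computable l)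
    result = type t level lower ¬upper , type-isType t level lower ¬upper ,
      type-computable t level lower ¬upper O.answer (λ κ → refl) (λ e → O.answerF (e Vec.∷ Vec.[])) O.eval-answerF

  module _ (π θ : ℝ) (-π<θ : D.- π D.< θ) (θ≤π : θ D.≤ π) where

    argument-bound : ∀ {ε} → 0ℚ < ε → Ev (λ k → ∣ ⟦ θ ⟧ k ∣ ≤ ⟦ π ⟧ k + ε)
    argument-bound {ε} 0<ε = let (η , 0<η , above) = <⇒Ev {D.- π} {θ} -π<θ in Ev-map (at η 0<η) (above & ≤⇒Ev {θ} {π} θ≤π 0<ε)
      where
      l : ∀ η p x → 0ℚ < η → - p + η ≤ x → - x ≤ p + ε
      l η p x z h = by≤ (δ h ⊞ <⇒≤ z ⊞ <⇒≤ 0<ε) (solve (η ∷ p ∷ x ∷ ε ∷ []) ring)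
      at : ∀ η → 0ℚ < η → ∀ k → ⟦ D.- π ⟧ k + η ≤ ⟦ θ ⟧ k × ⟦ θ ⟧ k ≤ ⟦ π ⟧ k + ε → ∣ ⟦ θ ⟧ k ∣ ≤ ⟦ π ⟧ k + ε
      at η 0<η k (p , r) = ∣x∣≤ r (l η (⟦ π ⟧ k) (⟦ θ ⟧ k) 0<η (subst (λ v → v + η ≤ ⟦ θ ⟧ k) (fromℚᵘ-neg (seq π k)) p))

  module _ (π θ t : ℝ) (2πt : fromℚ (+ 2 ℚᵘ./ 1) D.* π D.* t D.≈ θ) where

    turns-limit : ∀ {ε} → 0ℚ < ε → Ev (λ k → ∣ (⟦ π ⟧ k + ⟦ π ⟧ k) * ⟦ t ⟧ k - ⟦ θ ⟧ k ∣ ≤ ε)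
    turns-limit {ε} 0<ε = Ev-map at (≤⇒Ev {x} {θ} (proj₁ 2πt) 0<ε & ≤⇒Ev {θ} {x} (proj₂ 2πt) 0<ε)
      where
      x = fromℚ (+ 2 ℚᵘ./ 1) D.* π D.* t
      ⟦x⟧ : ∀ k → ⟦ x ⟧ k ≡ (⟦ π ⟧ k + ⟦ π ⟧ k) * ⟦ t ⟧ k
      ⟦x⟧ k = trans (fromℚᵘ-* (seq (fromℚ (+ 2 ℚᵘ./ 1) D.* π) k) (seq t k)) (cong (_* ⟦ t ⟧ k) (trans (fromℚᵘ-* (+ 2 ℚᵘ./ 1) (seq π k)) (l (⟦ π ⟧ k))))
        where
        l : ∀ p → (2 // 1) * p ≡ p + p
        l = solve-∀ ring
      up : ∀ a b → a ≤ b + ε → a - b ≤ ε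
      up a b h = by≤ (δ h) (solve (a ∷ b ∷ ε ∷ []) ring)
      down : ∀ a b → b ≤ a + ε → - (a - b) ≤ ε
      down a b h = by≤ (δ h) (solve (a ∷ b ∷ ε ∷ []) ring)
      at : ∀ k → ⟦ x ⟧ k ≤ ⟦ θ ⟧ k + ε × ⟦ θ ⟧ k ≤ ⟦ x ⟧ k + ε → ∣ (⟦ π ⟧ k + ⟦ π ⟧ k) * ⟦ t ⟧ k - ⟦ θ ⟧ k ∣ ≤ ε
      at k (a , b) = subst (λ v → ∣ v - ⟦ θ ⟧ k ∣ ≤ ε) (⟦x⟧ k) (∣x∣≤ (up (⟦ x ⟧ k) (⟦ θ ⟧ k) a) (down (⟦ x ⟧ k) (⟦ θ ⟧ k) b))

  typeIsComputable : D.PositivityDecidable 6 → ∀ (t : ℝ) → D.𝒯 t → Σ ℝ (λ l → D.IsType t l × D.Computable l)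
  typeIsComputable oracle t (pᵘ , qᵘ , (unitᵘ , p≢0ᵘ , q≢0ᵘ) , π , isPi , θ , (-π<θ , θ≤π , cosθ , sinθ) , 2πt) = [ nonneg , neg ]′ (0ℚ ≤⊎< q)
    where
    p = fromℚᵘ pᵘ
    q = fromℚᵘ qᵘ
    nonzero : ∀ {r} → ¬ (r ℚᵘ.≃ 0ℚᵘ) → fromℚᵘ r ≢ 0ℚ
    nonzero {r} h e = h (ℚᵘ.≃-trans (ℚᵘ.≃-sym (ℚ.toℚᵘ-fromℚᵘ r)) (ℚᵘ.≃-reflexive (cong toℚᵘ e)))
    unit : p * p + q * q ≡ 1ℚ
    unit = trans (sym (trans (fromℚᵘ-+ (pᵘ ℚᵘ.* pᵘ) (qᵘ ℚᵘ.* qᵘ)) (cong₂ _+_ (fromℚᵘ-* pᵘ pᵘ) (fromℚᵘ-* qᵘ qᵘ)))) (ℚ.fromℚᵘ-cong unitᵘ)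
    Eθ : Angle ⟦ θ ⟧ (cx p q)
    Eθ = IsCosSin⇒Angle θ pᵘ qᵘ cosθ sinθ
    double : ∀ x → x ≡ - - x
    double = solve-∀ ring
    nonneg : 0ℚ ≤ q → Σ ℝ (λ l → D.IsType t l × D.Computable l)
    nonneg 0≤q = Upper.result oracle 4096 (sym (int-nat 4096)) t π isPi ⟦ θ ⟧ ⟦ t ⟧ unit (nonzero p≢0ᵘ) ([ (λ h → ⊥-elim (nonzero q≢0ᵘ (ℚ.≤-antisym h 0≤q))) , (λ h → h) ]′ (q ≤⊎< 0ℚ)) Eθ
      (argument-bound π θ -π<θ θ≤π) (turns-limit π θ t 2πt) (λ {v} lb → lb) (λ {v} lb → lb)
    neg : q < 0ℚ → Σ ℝ (λ l → D.IsType t l × D.Computable l)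
    neg q<0 = Upper.result oracle 4096 (sym (int-nat 4096)) t π isPi (λ k → - ⟦ θ ⟧ k) (λ k → - ⟦ t ⟧ k) {p} { - q} (trans (l p q) unit) (nonzero p≢0ᵘ) (ℚ.neg-antimono-< q<0) (Angle-neg Eθ)
      (λ {ε} 0<ε → Ev-map (λ k → subst (_≤ ⟦ π ⟧ k + ε) (sym (ℚ.∣-p∣≡∣p∣ (⟦ θ ⟧ k)))) (argument-bound π θ -π<θ θ≤π 0<ε))
      (λ {ε} 0<ε → Ev-map (λ k → subst (_≤ ε) (reflect (⟦ π ⟧ k) (⟦ t ⟧ k) (⟦ θ ⟧ k))) (turns-limit π θ t 2πt 0<ε))
      (λ {v} → LowerBound-neg {⟦ t ⟧} {λ k → - ⟦ t ⟧ k} (λ k → refl) {v}) (λ {v} → LowerBound-neg {λ k → - ⟦ t ⟧ k} {⟦ t ⟧} (λ k → double (⟦ t ⟧ k)) {v})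
      where
      l : ∀ p q → p * p + - q * - q ≡ p * p + q * q
      l = solve-∀ ring
      l′ : ∀ π t θ → - ((π + π) * t - θ) ≡ (π + π) * - t - - θ
      l′ = solve-∀ ring
      reflect : ∀ π t θ → ∣ (π + π) * t - θ ∣ ≡ ∣ (π + π) * - t - - θ ∣
      reflect π t θ = trans (sym (ℚ.∣-p∣≡∣p∣ ((π + π) * t - θ))) (cong ∣_∣ (l′ π t θ))

open import Defs
open import Data.Product.Base using (Σ; _×_)

theorem5p2 : PositivityDecidable 6 → ∀ (t : ℝ) → 𝒯 t → Σ ℝ (λ l → IsType t l × Computable l)
theorem5p2 = Conclusion.typeIsComputable
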